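{- Let $k \geq 3$ be an integer. There is a function $f_k:\mathbb{N}\to\mathbb{R}$ with $f_k(n)/n \to 0$ as $n\to\infty$ such that, for any integer $n \geq 6(k+1)$ with $nk$ even, \[ \max\left\{\frac{k(5k-3)}{4(k+1)(4k-3)}n-6,\ \frac{31k}{98(k+1)}n-f_k(n)\right\} \leq \mathrm{cms}(n,k) \leq \frac{kn}{2(k+1)} \] and \[ \max\left\{\frac{5k-8}{4(4k-7)}n-6,\ \frac{31}{98}n-f_k(n)\right\} \leq \mathrm{cms}_1(n,k) \leq \frac{n-1}{2}. \]
   Context: All graphs are finite and simple. For a graph $G$ with $m$ edges, an ordering of $G$ is a bijection $\ell: E(G)\to\mathbb{Z}_m$. For distinct edges $e,e'$, the forward distance $d_\ell(e,e')$ is the smallest positive integer $d$ with $\ell(e)+d=\ell(e')$ in $\mathbb{Z}_m$, and $d_\ell\{e,e'\}=\min\{d_\ell(e,e'),d_\ell(e',e)\}$. Two edges are adjacent if they share a vertex. $\mathrm{cms}(\ell)$ is the largest $s\in\{1,\dots,m\}$ such that $d_\ell\{e,e'\}\geq s$ for every pair of adjacent edges $e,e'$; the cyclic matching sequenceability $\mathrm{cms}(G)$ is the maximum of $\mathrm{cms}(\ell)$ over all orderings $\ell$ of $G$ (equivalently, the largest $s$ such that some cyclic ordering of $E(G)$ has every $s$ cyclically consecutive edges forming a matching). A $k$-regular graph is class 1 if its edges can be properly coloured with $k$ colours. For $n>k$ with $nk$ even, $\mathrm{cms}(n,k)$ is the minimum of $\mathrm{cms}(G)$ over all $k$-regular graphs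 $G$ on $n$ vertices, and $\mathrm{cms}_1(n,k)$ is the minimum of $\mathrm{cms}(G)$ over all $k$-regular class 1 graphs $G$ on $n$ vertices (when such graphs exist). -}

module Defs where

open import Data.Nat as ℕ using (ℕ; zero; suc; _+_; _*_; _∸_; _<_)
open import Data.Fin as Fin using (Fin; toℕ)
open import Data.Fin.Properties using (_≟_)
open import Data.List using (List; length; filter)
open import Data.List using () renaming (allFin to finList)
open import Data.Product using (Σ; _×_; _,_; proj₁; proj₂; ∃)
open import Data.Sum using (_⊎_)
open import Data.Integer as ℤ using (ℤ; +_)
open import Data.Rational as ℚ using (ℚ; _/_)
open import Relation.Binary.PropositionalEquality using (_≡_; _≢_)
open import Relation.Nullary.Decidable using (_⊎-dec_)
open import Function.Definitions using (Injective; Bijective)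

record Graph (n : ℕ) : Set where
  field
    m        : ℕ
    edge     : Fin m → Fin n × Fin n
    ordered  : ∀ e → toℕ (proj₁ (edge e)) < toℕ (proj₂ (edge e))
    edgeInj  : Injective _≡_ _≡_ edge

open Graph public

Incident : ∀ {n} (G : Graph n) → Fin n → Fin (m G) → Set
Incident G v e = (proj₁ (edge G e) ≡ v) ⊎ (proj₂ (edge G e) ≡ v)

degree : ∀ {n} (G : Graph n) → Fin n → ℕ
degree G v = length (filter (λ e → (proj₁ (edge G e) ≟ v) ⊎-dec (proj₂ (edge G e) ≟ v))
                            (finList (m G)))

Regular : ∀ {n} → ℕ → Graph n → Set
Regular k G = ∀ v → degree G v ≡ k

Adjacent : ∀ {n} (G : Graph n) → Fin (m G) → Fin (m G) → Set
Adjacent G e e' = e ≢ e' × ∃ λ v → Incident G v e × Incident G v e'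

Class1 : ∀ {n} → ℕ → Graph n → Set
Class1 k G = Σ (Fin (m G) → Fin k) λ c → ∀ e e' → Adjacent G e e' → c e ≢ c e'

-- Orderings: bijections ℓ : E(G) → ℤ_m  (ℤ_m represented by Fin m).

Ordering : ∀ {n} → Graph n → Set
Ordering G = Σ (Fin (m G) → Fin (m G)) λ ℓ → Bijective _≡_ _≡_ ℓ

-- forward distance from position i to position j in ℤ_m:
-- the d ∈ {1,…,m} with i + d ≡ j (mod m)  (equals m when i = j;
-- only used for distinct edges, where it lies in {1,…,m-1}).
fwd : (M : ℕ) → ℕ → ℕ → ℕ
fwd zero    i j = 0
fwd (suc M) i j = suc ((j + suc M ∸ suc i) ℕ.% suc M)

dist : ∀ {n} (G : Graph n) → Ordering G → Fin (m G) → Fin (m G) → ℕ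
dist G (ℓ , _) e e' = fwd (m G) (toℕ (ℓ e)) (toℕ (ℓ e'))

sdist : ∀ {n} (G : Graph n) → Ordering G → Fin (m G) → Fin (m G) → ℕ
sdist G ℓ e e' = dist G ℓ e e' ℕ.⊓ dist G ℓ e' e

Good : ∀ {n} (G : Graph n) → Ordering G → ℕ → Set
Good G ℓ s = ∀ e e' → Adjacent G e e' → s ℕ.≤ sdist G ℓ e e'

IsCmsOrd : ∀ {n} (G : Graph n) → Ordering G → ℕ → Set
IsCmsOrd G ℓ s = (1 ℕ.≤ s) × (s ℕ.≤ m G) × Good G ℓ s
               × (∀ t → 1 ℕ.≤ t → t ℕ.≤ m G → Good G ℓ t → t ℕ.≤ s)

IsCmsGraph : ∀ {n} → Graph n → ℕ → Set
IsCmsGraph G c = (∃ λ ℓ → IsCmsOrd G ℓ c)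
               × (∀ ℓ s → IsCmsOrd G ℓ s → s ℕ.≤ c)

IsCmsNK : ℕ → ℕ → ℕ → Set
IsCmsNK n k c = (Σ (Graph n) λ G → Regular k G × IsCmsGraph G c)
              × (∀ (G : Graph n) c' → Regular k G → IsCmsGraph G c' → c ℕ.≤ c')

IsCms1NK : ℕ → ℕ → ℕ → Set
IsCms1NK n k c = (Σ (Graph n) λ G → Regular k G × Class1 k G × IsCmsGraph G c)
               × (∀ (G : Graph n) c' → Regular k G → Class1 k G → IsCmsGraph G c' → c ℕ.≤ c')

-- p / d as a rational (d is always positive where used; 0 if d = 0)
frac : ℤ → ℕ → ℚ
frac p zero    = ℚ.0ℚ
frac p (suc d) = p / suc d

ℕ→ℚ : ℕ → ℚ
ℕ→ℚ x = (+ x) / 1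

Sublinear : (ℕ → ℚ) → Set
Sublinear f = ∀ (ε : ℚ) → ℚ.0ℚ ℚ.< ε →
  ∃ λ N → ∀ x → N ℕ.≤ x → ℚ.∣ f x ∣ ℚ.≤ ε ℚ.* ℕ→ℚ x

{-# OPTIONS --safe #-}
-- Lower bounds: the classes of a proper edge colouring are laid out cyclically, one after another.
-- Ordering each class in three suitable blocks keeps adjacent edges of consecutive classes about two
-- thirds of a class apart.  Applied to an equitable (k + 1)-colouring (Vizing's theorem and Kempe
-- changes), or to the k perfect matchings of a class 1 graph with k ≥ 4, this beats both bounds, so f
-- can be the constant 6.  For cubic class 1 graphs two thirds is not enough: there the three matchings
-- are split along a nearly common bipartition of the vertices, chosen by averaging, which gives 7n/20.
-- Upper bounds: a part with k + 1 vertices (k even), or with k + 2 vertices one of which is the end of a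
-- bridge (k odd), has too many edges for every window of s edges to be a matching.  If s = n/2, then
-- all windows are perfect matchings, so edges s apart would coincide.
module Submission where

open import Defs
open import Data.Bool using (Bool; true; false; not; _∧_; _∨_; if_then_else_)
open import Data.Empty using (⊥; ⊥-elim)
open import Data.Unit using (⊤; tt)
open import Data.Nat hiding (_⊔_; Ordering)
open import Data.Nat.Properties hiding (_≟_)
open import Data.Nat.DivMod
open import Data.Nat.Divisibility using (_∣_; divides)
open import Data.Fin using (Fin; toℕ; fromℕ<; punchOut)
open import Data.Fin.Properties using (toℕ<n; toℕ-injective; toℕ-fromℕ<; punchOut-injective; injective⇒≤) renaming (_≟_ to _≟F_; any? to any?F; all? to all?F)
open import Data.List using (List; []; _∷_; _++_; length; map; filter; filterᵇ; reverse; allFin; take; drop)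
open import Data.List.Properties using (length-++; length-reverse; unfold-reverse; ++-assoc; length-take; length-drop; take++drop≡id; length-tabulate; map-tabulate; tabulate-lookup; reverse-++; reverse-involutive)
open import Data.List.Membership.Propositional using (_∈_)
open import Data.List.Membership.Propositional.Properties using (∈-cartesianProductWith⁺; ∈-cartesianProduct⁺; ∈-filter⁻; ∈-lookup; ∈-∃++; ∈-allFin; ∈-++⁺ˡ; ∈-++⁺ʳ; ∈-map⁺)
open import Data.List.Relation.Unary.Any using (here; there)
open import Data.List.Relation.Unary.All as All using () renaming (_∷_ to _∷ᴬ_)
open import Data.List.Relation.Unary.AllPairs using () renaming ([] to []ᵁ; _∷_ to _∷ᵁ_)
open import Data.List.Relation.Unary.Unique.Propositional using (Unique)
open import Data.List.Relation.Unary.Unique.Propositional.Properties using (allFin⁺; cartesianProduct⁺)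
open import Data.List.Relation.Binary.Permutation.Propositional using (_↭_; refl; prep; swap; ↭-sym; ↭-reflexive) renaming (trans to ptrans)
open import Data.List.Relation.Binary.Permutation.Propositional.Properties using (↭-length; ∈-resp-↭; ++⁺; ++⁺ˡ; ++⁺ʳ; shift; ↭-reverse) renaming (++-comm to ↭-++-comm)
open import Data.Maybe using (Maybe; just; nothing)
open import Data.Maybe.Properties using (just-injective)
open import Data.Product.Properties using (≡-dec)
open import Data.Product using (Σ; _×_; ∃; _,_; proj₁; proj₂)
import Data.Sum
import Data.Bool.Properties
import Data.List
open import Data.Sum using (_⊎_; inj₁; inj₂)
open import Function using (_∘_; id; case_of_)
open import Function.Definitions using (Injective; Bijective)
open import Relation.Binary.PropositionalEquality hiding (J)
open import Relation.Binary.Definitions using (Tri; tri<; tri≈; tri>)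
open import Relation.Nullary using (¬_; Dec; yes; no)
open import Relation.Nullary.Decidable using (⌊_⌋; toWitness; _×-dec_; _⊎-dec_; _→-dec_; ¬?)
open import Data.Nat.Tactic.RingSolver using (solve-∀; solve)
import Data.Integer as Z
import Data.Integer.Properties as Z
import Data.Rational as Q
import Data.Rational.Properties as Q
import Data.Rational.Unnormalised as ℚᵘ
import Data.Rational.Unnormalised.Properties as ℚᵘ

-- For classes of L edges the distance s is kept when adjacent edges at position p of one class and
-- p′ of the next satisfy p - p′ ≤ L - s. A single comparison of two classes costs almost nothing: a
-- greedy order keeps such drops bounded. The obstacle is that each class is compared with its
-- predecessor and its successor, around a closed cycle. Three blocks separate the two tasks; only
-- the middle block is in both, and the last blocks are chosen so that almost every edge of the next
-- middle block meets at most one of their edges, which makes any order of it harmless there. The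
-- price is a drop of a third of a class. The target fractions permit this: 1/3 exceeds 31/98, is at
-- least (5k - 3)/(4(4k - 3)) for k ≥ 3 and at least (5k - 8)/(4(4k - 7)) for k ≥ 4. At k = 3 the
-- last one is 7/20, which permits a drop of 3/10 only. This number comes from cutting one matching
-- into five segments: 6 of the 10 unions of two segments separate an edge between different
-- segments, so for some union about 3/5 of the third matching at most is mixed, and half of that is
-- the drop.

private
  variable
    𝒜 ℬ : Set

-- Booleans, finite sums and counting in lists

b2n : Bool → ℕ
b2n true  = 1
b2n false = 0

true≢false : ∀ {b} → b ≡ true → b ≡ false → ⊥
true≢false refl ()

∧-true : ∀ {a b} → a ∧ b ≡ true → a ≡ true × b ≡ true
∧-true {true} {true} _ = refl , refl

∨-true : ∀ {a b} → a ∨ b ≡ true → a ≡ true ⊎ b ≡ true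
∨-true {true}  _ = inj₁ refl
∨-true {false} e = inj₂ e

∧-intro : ∀ {a b} → a ≡ true → b ≡ true → a ∧ b ≡ true
∧-intro refl refl = refl

not-true : ∀ {a} → not a ≡ true → a ≡ false
not-true {false} _ = refl

not-false : ∀ {a} → a ≡ false → not a ≡ true
not-false refl = refl

≢true : ∀ {a} → ¬ a ≡ true → a ≡ false
≢true {true}  h = ⊥-elim (h refl)
≢true {false} _ = refl

⌊⌋-true : ∀ {P : Set} (d : Dec P) → ⌊ d ⌋ ≡ true → P
⌊⌋-true (yes p) _ = p

⌊⌋-intro : ∀ {P : Set} (d : Dec P) → P → ⌊ d ⌋ ≡ true
⌊⌋-intro (yes _) _ = refl
⌊⌋-intro (no ¬p) p = ⊥-elim (¬p p)

⌊⌋-false : ∀ {P : Set} (d : Dec P) → ⌊ d ⌋ ≡ false → ¬ P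
⌊⌋-false (no ¬p) _ = ¬p

⌊⌋-no : ∀ {P : Set} (d : Dec P) → ¬ P → ⌊ d ⌋ ≡ false
⌊⌋-no (yes p) n = ⊥-elim (n p)
⌊⌋-no (no _) _  = refl

b2n-mono : ∀ {a b} → (a ≡ true → b ≡ true) → b2n a ≤ b2n b
b2n-mono {true}  {b} h rewrite h refl = ≤-refl
b2n-mono {false} h = z≤n

b2n≤1 : ∀ b → b2n b ≤ 1
b2n≤1 true  = ≤-refl
b2n≤1 false = z≤n

-- Linear arithmetic: a combined hypothesis A ≤ B yields x ≤ y once x + B + d and y + A agree as polynomials.
lin : ∀ {A B x y} d → A ≤ B → x + B + d ≡ y + A → x ≤ y
lin {A} {B} {x} {y} d h e =
  +-cancelʳ-≤ B x y (≤-trans (m≤m+n (x + B) d) (≤-trans (≤-reflexive e) (+-monoʳ-≤ y h)))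

Σl : (𝒜 → ℕ) → List 𝒜 → ℕ
Σl f []       = 0
Σl f (x ∷ xs) = f x + Σl f xs

cnt : (𝒜 → Bool) → List 𝒜 → ℕ
cnt p = Σl (λ x → b2n (p x))

Σl-cong : ∀ {f g : 𝒜 → ℕ} xs → (∀ x → x ∈ xs → f x ≡ g x) → Σl f xs ≡ Σl g xs
Σl-cong []       h = refl
Σl-cong (x ∷ xs) h = cong₂ _+_ (h x (here refl)) (Σl-cong xs (λ y i → h y (there i)))

Σl-mono : ∀ {f g : 𝒜 → ℕ} xs → (∀ x → x ∈ xs → f x ≤ g x) → Σl f xs ≤ Σl g xs
Σl-mono []       h = z≤n
Σl-mono (x ∷ xs) h = +-mono-≤ (h x (here refl)) (Σl-mono xs (λ y i → h y (there i)))

Σl-+ : ∀ (f g : 𝒜 → ℕ) xs → Σl (λ x → f x + g x) xs ≡ Σl f xs + Σl g xs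
Σl-+ f g [] = refl
Σl-+ f g (x ∷ xs) rewrite Σl-+ f g xs = lem (f x) (g x) (Σl f xs) (Σl g xs)
  where
  lem : ∀ a b c d → a + b + (c + d) ≡ a + c + (b + d)
  lem = solve-∀

Σl-const : ∀ c (xs : List 𝒜) → Σl (λ _ → c) xs ≡ c * length xs
Σl-const c []       = sym (*-zeroʳ c)
Σl-const c (x ∷ xs) = trans (cong (c +_) (Σl-const c xs)) (sym (*-suc c (length xs)))

Σl-* : ∀ c (f : 𝒜 → ℕ) xs → Σl (λ x → c * f x) xs ≡ c * Σl f xs
Σl-* c f []       = sym (*-zeroʳ c)
Σl-* c f (x ∷ xs) = trans (cong (c * f x +_) (Σl-* c f xs)) (sym (*-distribˡ-+ c (f x) (Σl f xs)))

Σl-++ : ∀ (f : 𝒜 → ℕ) xs ys → Σl f (xs ++ ys) ≡ Σl f xs + Σl f ys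
Σl-++ f []       ys = refl
Σl-++ f (x ∷ xs) ys = trans (cong (f x +_) (Σl-++ f xs ys)) (sym (+-assoc (f x) _ _))

Σl-swap : ∀ (f : 𝒜 → ℬ → ℕ) xs ys → Σl (λ x → Σl (f x) ys) xs ≡ Σl (λ y → Σl (λ x → f x y) xs) ys
Σl-swap f [] ys = sym (trans (Σl-const 0 ys) refl)
Σl-swap f (x ∷ xs) ys = trans (cong (Σl (f x) ys +_) (Σl-swap f xs ys)) (sym (Σl-+ (f x) _ ys))

Σl-↭ : ∀ (f : 𝒜 → ℕ) {xs ys} → xs ↭ ys → Σl f xs ≡ Σl f ys
Σl-↭ f refl = refl
Σl-↭ f (prep x p) = cong (f x +_) (Σl-↭ f p)
Σl-↭ f (swap {xs} {ys} x y p) rewrite Σl-↭ f p = lem (f x) (f y) (Σl f ys)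
  where
  lem : ∀ a b c → a + (b + c) ≡ b + (a + c)
  lem = solve-∀
Σl-↭ f (ptrans p q) = trans (Σl-↭ f p) (Σl-↭ f q)

Σl-< : ∀ (f g : 𝒜 → ℕ) xs → Σl f xs < Σl g xs → ∃ λ x → x ∈ xs × f x < g x
Σl-< f g (x ∷ xs) h with f x <? g x
... | yes l = x , here refl , l
... | no ¬l with Σl-< f g xs (+-cancelˡ-< (g x) _ _ (≤-trans (s≤s (+-monoˡ-≤ (Σl f xs) (≮⇒≥ ¬l))) h))
...   | y , i , l = y , there i , l

Σl-bound : ∀ (f : 𝒜 → ℕ) c xs → (∀ x → x ∈ xs → f x ≤ c) → Σl f xs ≤ c * length xs
Σl-bound f c xs h = ≤-trans (Σl-mono xs h) (≤-reflexive (Σl-const c xs))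

Σl-∈ : ∀ (f : 𝒜 → ℕ) {x} {xs : List 𝒜} → x ∈ xs → f x ≤ Σl f xs
Σl-∈ f {xs = y ∷ xs} (here refl) = m≤m+n (f y) _
Σl-∈ f {xs = y ∷ xs} (there i)   = ≤-trans (Σl-∈ f i) (m≤n+m _ (f y))

cnt≤length : ∀ (p : 𝒜 → Bool) xs → cnt p xs ≤ length xs
cnt≤length p xs = ≤-trans (Σl-bound _ 1 xs (λ x _ → b2n≤1 (p x))) (≤-reflexive (*-identityˡ _))

cnt-split : ∀ (p : 𝒜 → Bool) xs → cnt p xs + cnt (not ∘ p) xs ≡ length xs
cnt-split p [] = refl
cnt-split p (x ∷ xs) with p x
... | true  = cong suc (cnt-split p xs)
... | false = trans (+-suc _ _) (cong suc (cnt-split p xs))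

cnt-mono : ∀ (p q : 𝒜 → Bool) xs → (∀ x → x ∈ xs → p x ≡ true → q x ≡ true) → cnt p xs ≤ cnt q xs
cnt-mono p q xs h = Σl-mono xs (λ x i → b2n-mono (h x i))

cnt-pos : ∀ (p : 𝒜 → Bool) {x xs} → x ∈ xs → p x ≡ true → 1 ≤ cnt p xs
cnt-pos p {x} i e = ≤-trans (≤-reflexive (sym (cong b2n e))) (Σl-∈ (λ z → b2n (p z)) i)

cnt-zero : ∀ (p : 𝒜 → Bool) xs → (∀ x → x ∈ xs → p x ≡ false) → cnt p xs ≡ 0
cnt-zero p [] h = refl
cnt-zero p (x ∷ xs) h rewrite h x (here refl) = cnt-zero p xs (λ y i → h y (there i))

cnt-zero⁻ : ∀ (p : 𝒜 → Bool) {x xs} → cnt p xs ≡ 0 → x ∈ xs → p x ≡ false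
cnt-zero⁻ p e i = ≢true (λ t → case subst (1 ≤_) e (cnt-pos p i t) of λ ())

cnt-witness : ∀ (p : 𝒜 → Bool) xs → 1 ≤ cnt p xs → ∃ λ x → x ∈ xs × p x ≡ true
cnt-witness p (x ∷ xs) h with p x in eq
... | true  = x , here refl , eq
... | false with cnt-witness p xs h
...   | y , i , e = y , there i , e

cnt-∨ : ∀ (p q r : 𝒜 → Bool) xs → (∀ x → x ∈ xs → p x ≡ true → q x ≡ true ⊎ r x ≡ true) →
        cnt p xs ≤ cnt q xs + cnt r xs
cnt-∨ p q r xs h = ≤-trans (Σl-mono xs aux) (≤-reflexive (Σl-+ _ _ xs))
  where
  aux : ∀ x → x ∈ xs → b2n (p x) ≤ b2n (q x) + b2n (r x)
  aux x i with p x in eq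
  ... | false = z≤n
  ... | true with h x i eq
  ...   | inj₁ e rewrite e = s≤s z≤n
  ...   | inj₂ e rewrite e = m≤n+m 1 _

cnt≤1 : ∀ (p : 𝒜 → Bool) {xs} → Unique xs →
        (∀ x y → x ∈ xs → y ∈ xs → p x ≡ true → p y ≡ true → x ≡ y) → cnt p xs ≤ 1
cnt≤1 p []ᵁ h = z≤n
cnt≤1 p {x ∷ xs} (a ∷ᵁ u) h with p x in eq
... | false = cnt≤1 p u (λ y z i j → h y z (there i) (there j))
... | true  = s≤s (≤-reflexive (cnt-zero p xs (λ y i → ≢true (λ e →
                All.lookup a i (h x y (here refl) (there i) eq e)))))

cnt≡1 : ∀ (p : 𝒜 → Bool) {x xs} → Unique xs → x ∈ xs → p x ≡ true →
        (∀ y → y ∈ xs → p y ≡ true → y ≡ x) → cnt p xs ≡ 1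
cnt≡1 p {x} u i e h = ≤-antisym (cnt≤1 p u (λ y z i j a b → trans (h y i a) (sym (h z j b)))) (cnt-pos p i e)

∈-fil⁺ : ∀ (p : 𝒜 → Bool) {x xs} → x ∈ xs → p x ≡ true → x ∈ filterᵇ p xs
∈-fil⁺ p {xs = y ∷ xs} (here refl) e rewrite e = here refl
∈-fil⁺ p {xs = y ∷ xs} (there i) e with p y
... | true  = there (∈-fil⁺ p i e)
... | false = ∈-fil⁺ p i e

∈-fil⁻ : ∀ (p : 𝒜 → Bool) {x} xs → x ∈ filterᵇ p xs → x ∈ xs × p x ≡ true
∈-fil⁻ p (y ∷ xs) i with p y in eq
∈-fil⁻ p (y ∷ xs) (here refl) | true = here refl , eq
∈-fil⁻ p (y ∷ xs) (there i)   | true with ∈-fil⁻ p xs i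
... | j , e = there j , e
∈-fil⁻ p (y ∷ xs) i | false with ∈-fil⁻ p xs i
... | j , e = there j , e

length-fil : ∀ (p : 𝒜 → Bool) xs → length (filterᵇ p xs) ≡ cnt p xs
length-fil p [] = refl
length-fil p (x ∷ xs) with p x
... | true  = cong suc (length-fil p xs)
... | false = length-fil p xs

Σl-fil : ∀ (f : 𝒜 → ℕ) (p : 𝒜 → Bool) xs → Σl f (filterᵇ p xs) ≡ Σl (λ x → if p x then f x else 0) xs
Σl-fil f p [] = refl
Σl-fil f p (x ∷ xs) with p x
... | true  = cong (f x +_) (Σl-fil f p xs)
... | false = Σl-fil f p xs

cnt-fil : ∀ (p q : 𝒜 → Bool) xs → cnt p (filterᵇ q xs) ≡ cnt (λ x → q x ∧ p x) xs
cnt-fil p q xs = trans (Σl-fil _ q xs) (Σl-cong xs (λ x _ → aux (q x) (p x)))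
  where
  aux : ∀ a b → (if a then b2n b else 0) ≡ b2n (a ∧ b)
  aux true  b = refl
  aux false b = refl

cnt-fil≤ : ∀ (p q : 𝒜 → Bool) xs → cnt p (filterᵇ q xs) ≤ cnt p xs
cnt-fil≤ p q xs = ≤-trans (≤-reflexive (cnt-fil p q xs)) (cnt-mono _ _ xs (λ x _ e → proj₂ (∧-true e)))

fil-all : ∀ (p : 𝒜 → Bool) xs → (∀ x → x ∈ xs → p x ≡ true) → filterᵇ p xs ≡ xs
fil-all p [] h = refl
fil-all p (x ∷ xs) h rewrite h x (here refl) = cong (x ∷_) (fil-all p xs (λ y i → h y (there i)))

unique-fil : ∀ (p : 𝒜 → Bool) {xs} → Unique xs → Unique (filterᵇ p xs)
unique-fil p []ᵁ = []ᵁ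
unique-fil p {x ∷ xs} (a ∷ᵁ u) with p x
... | true  = All.tabulate (λ i → All.lookup a (proj₁ (∈-fil⁻ p xs i))) ∷ᵁ unique-fil p u
... | false = unique-fil p u

fil-↭ : ∀ (p : 𝒜 → Bool) xs → filterᵇ p xs ++ filterᵇ (not ∘ p) xs ↭ xs
fil-↭ p [] = refl
fil-↭ p (x ∷ xs) with p x
... | true  = prep x (fil-↭ p xs)
... | false = ptrans (shift x (filterᵇ p xs) _) (prep x (fil-↭ p xs))

∈-extract : ∀ {x : 𝒜} {xs} → x ∈ xs → ∃ λ ys → xs ↭ x ∷ ys
∈-extract {x = x} i with ∈-∃++ i
... | as , bs , refl = as ++ bs , shift x as bs

∈-take : ∀ n {x : 𝒜} xs → x ∈ take n xs → x ∈ xs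
∈-take n xs i = subst (_ ∈_) (take++drop≡id n xs) (∈-++⁺ˡ i)

∈-drop : ∀ n {x : 𝒜} xs → x ∈ drop n xs → x ∈ xs
∈-drop n xs i = subst (_ ∈_) (take++drop≡id n xs) (∈-++⁺ʳ (take n xs) i)

length-take≤ : ∀ n (xs : List 𝒜) → n ≤ length xs → length (take n xs) ≡ n
length-take≤ n xs h = trans (length-take n xs) (m≤n⇒m⊓n≡m h)

-- Positions in lists and slow orders

data At {𝒜 : Set} : List 𝒜 → ℕ → 𝒜 → Set where
  here  : ∀ {x xs} → At (x ∷ xs) 0 x
  there : ∀ {x y xs p} → At xs p x → At (y ∷ xs) (suc p) x

At-< : ∀ {xs : List 𝒜} {p x} → At xs p x → p < length xs
At-< here      = s≤s z≤n
At-< (there a) = s≤s (At-< a)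

At-fun : ∀ {xs : List 𝒜} {p x y} → At xs p x → At xs p y → x ≡ y
At-fun here      here      = refl
At-fun (there a) (there b) = At-fun a b

At-∈ : ∀ {xs : List 𝒜} {p x} → At xs p x → x ∈ xs
At-∈ here      = here refl
At-∈ (there a) = there (At-∈ a)

∈-At : ∀ {xs : List 𝒜} {x} → x ∈ xs → ∃ λ p → At xs p x
∈-At (here refl) = 0 , here
∈-At (there i) with ∈-At i
... | p , a = suc p , there a

At-++⁻ : ∀ (xs : List 𝒜) {ys p x} → At (xs ++ ys) p x →
         At xs p x ⊎ ∃ λ q → p ≡ length xs + q × At ys q x
At-++⁻ [] a = inj₂ (_ , refl , a)
At-++⁻ (x ∷ xs) here = inj₁ here
At-++⁻ (x ∷ xs) (there a) with At-++⁻ xs a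
... | inj₁ b = inj₁ (there b)
... | inj₂ (q , e , b) = inj₂ (q , cong suc e , b)

At-reverse : ∀ (xs : List 𝒜) {p x} → At (reverse xs) p x → ∃ λ q → At xs q x × suc (p + q) ≡ length xs
At-reverse [] ()
At-reverse (y ∷ xs) a rewrite unfold-reverse y xs with At-++⁻ (reverse xs) a
... | inj₁ b with At-reverse xs b
...   | q , c , e = suc q , there c , cong suc (trans (+-suc _ q) e)
At-reverse (y ∷ xs) a | inj₂ (zero , refl , here) =
  0 , here , cong suc (trans (+-identityʳ _) (trans (+-identityʳ _) (length-reverse xs)))
At-reverse (y ∷ xs) a | inj₂ (suc q , e , there ())

-- The elements of Y in the order in which W first meets them along R; the unmet ones come last.
touch : (𝒜 → ℬ → Bool) → List 𝒜 → List ℬ → List ℬ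
touch R []      Y = Y
touch R (x ∷ W) Y = filterᵇ (R x) Y ++ touch R W (filterᵇ (not ∘ R x) Y)

touch-↭ : ∀ (R : 𝒜 → ℬ → Bool) W Y → touch R W Y ↭ Y
touch-↭ R []      Y = refl
touch-↭ R (x ∷ W) Y = ptrans (++⁺ˡ (filterᵇ (R x) Y) (touch-↭ R W _)) (fil-↭ (R x) Y)

-- Every prefix of W of length p meets at most p + c elements of Y.
Slow : (𝒜 → ℬ → Bool) → ℕ → List 𝒜 → List ℬ → Set
Slow R c []      Y = ⊤
Slow R c (x ∷ W) Y = cnt (R x) Y ≤ suc c × Slow R (suc c ∸ cnt (R x) Y) W (filterᵇ (not ∘ R x) Y)

-- The first p + 1 entries of W meet at most p + 1 + c elements, and these open the list
-- `touch R W Y`. In the recursion the budget `suc c ∸ cnt (R x) Y` carries the count past the head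
-- x: one unit earned by x, one paid for each element that x meets.
touch-late : ∀ (R : 𝒜 → ℬ → Bool) c W Y {p q x y} → Slow R c W Y →
             At W p x → At (touch R W Y) q y → R x y ≡ true → q ≤ p + c
touch-late R c (x ∷ W) Y (h , s) a b e with At-++⁻ (filterᵇ (R x) Y) b
touch-late R c (x ∷ W) Y (h , s) here b e | inj₁ b' =
  ≤-pred (≤-trans (At-< b') (≤-trans (≤-reflexive (length-fil (R x) Y)) h))
touch-late R c (x ∷ W) Y (h , s) here b e | inj₂ (q , _ , b') =
  ⊥-elim (true≢false e (not-true (proj₂ (∈-fil⁻ (not ∘ R x) Y (∈-resp-↭ (touch-↭ R W _) (At-∈ b'))))))
touch-late R c (x ∷ W) Y (h , s) (there {p = p} a) b e | inj₁ b' =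
  ≤-trans (≤-pred (≤-trans (At-< b') (≤-trans (≤-reflexive (length-fil (R x) Y)) h))) (m≤n+m c (suc p))
touch-late R c (x ∷ W) Y (h , s) (there {p = p} a) b e | inj₂ (q , refl , b')
  with touch-late R _ W _ s a b' e
... | l = ≤-trans (+-monoʳ-≤ (length (filterᵇ (R x) Y)) l) (≤-reflexive (begin
    length (filterᵇ (R x) Y) + (p + (suc c ∸ cnt (R x) Y)) ≡⟨ cong (_+ (p + (suc c ∸ cnt (R x) Y))) (length-fil (R x) Y) ⟩
    cnt (R x) Y + (p + (suc c ∸ cnt (R x) Y)) ≡⟨ lem (cnt (R x) Y) p _ ⟩
    p + (cnt (R x) Y + (suc c ∸ cnt (R x) Y)) ≡⟨ cong (p +_) (m+[n∸m]≡n h) ⟩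
    p + suc c ≡⟨ +-suc p c ⟩
    suc p + c ∎))
  where
  open ≡-Reasoning
  lem : ∀ a b c → a + (b + c) ≡ b + (a + c)
  lem = solve-∀

-- Every entry earns one unit of budget, so only its meetings beyond the first are charged to c, and
-- dropping elements met earlier can only lower them. The condition does not see the order of W, so
-- any order is slow.
slow-Σ : ∀ (R : 𝒜 → ℬ → Bool) c W Y → Σl (λ x → cnt (R x) Y ∸ 1) W ≤ c → Slow R c W Y
slow-Σ R c [] Y h = tt
slow-Σ R c (x ∷ W) Y h =
  ≤-trans (m≤n+m∸n (cnt (R x) Y) 1) (s≤s (≤-trans (m≤m+n _ _) h)) ,
  slow-Σ R _ W _ (≤-trans (Σl-mono W (λ z _ → ∸-monoˡ-≤ 1 (cnt-fil≤ (R z) (not ∘ R x) Y))) (lem (cnt (R x) Y) h))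
  where
  lem : ∀ d {s} → (d ∸ 1) + s ≤ c → s ≤ suc c ∸ d
  lem zero    h = ≤-trans h (n≤1+n c)
  lem (suc d) h = m+n≤o⇒n≤o∸m d h
    where
    m+n≤o⇒n≤o∸m : ∀ m {n o} → m + n ≤ o → n ≤ o ∸ m
    m+n≤o⇒n≤o∸m m {n} {o} h = ≤-trans (≤-reflexive (sym (m+n∸m≡n m n))) (∸-monoˡ-≤ m h)

-- Entries that meet nothing earn one unit each and pay nothing; placed in front, they finance later
-- entries with two neighbours.
slow-free : ∀ (R : 𝒜 → ℬ → Bool) c W₀ W Y → (∀ x → x ∈ W₀ → cnt (R x) Y ≡ 0) →
            Slow R (length W₀ + c) W Y → Slow R c (W₀ ++ W) Y
slow-free R c [] W Y h s = s
slow-free R c (x ∷ W₀) W Y h s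
  rewrite fil-all (not ∘ R x) Y (λ y i → not-false (cnt-zero⁻ (R x) (h x (here refl)) i)) | h x (here refl) =
  z≤n , slow-free R (suc c) W₀ W Y (λ z i → h z (there i)) (subst (λ k → Slow R k W Y) (sym (+-suc (length W₀) c)) s)

-- While the budget c is positive any element may come next; when it is exhausted, double counting
-- leaves an element that meets at most one unmet element of Y.
abstract
  greedy : ∀ (R : 𝒜 → ℬ → Bool) c (X : List 𝒜) (Y : List ℬ) →
           (∀ x → x ∈ X → cnt (R x) Y ≤ 2) → (∀ y → y ∈ Y → cnt (λ x → R x y) X ≤ 2) →
           suc (length Y) ≤ length X + c → ∃ λ W → W ↭ X × Slow R c W Y
  greedy {𝒜 = 𝒜} {ℬ = ℬ} R c X Y = go (length X) c X Y refl
    where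
    go : ∀ n c (X : List 𝒜) (Y : List ℬ) → length X ≡ n →
         (∀ x → x ∈ X → cnt (R x) Y ≤ 2) → (∀ y → y ∈ Y → cnt (λ x → R x y) X ≤ 2) →
         suc (length Y) ≤ length X + c → ∃ λ W → W ↭ X × Slow R c W Y
    step : ∀ n c (X : List 𝒜) (Y : List ℬ) → length X ≡ suc n →
         (∀ x → x ∈ X → cnt (R x) Y ≤ 2) → (∀ y → y ∈ Y → cnt (λ x → R x y) X ≤ 2) →
         suc (length Y) ≤ length X + c → ∀ x → x ∈ X → cnt (R x) Y ≤ suc c →
         ∃ λ W → W ↭ X × Slow R c W Y
    step n c X Y e dx dy h x i l with ∈-extract i
    ... | X' , p with go n (suc c ∸ cnt (R x) Y) X' (filterᵇ (not ∘ R x) Y)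
           (suc-injective (trans (sym (↭-length p)) e))
           (λ z j → ≤-trans (cnt-fil≤ (R z) _ Y) (dx z (∈-resp-↭ (↭-sym p) (there j))))
           (λ y j → ≤-trans (m≤n+m _ (b2n (R x y)))
              (≤-trans (≤-reflexive (sym (Σl-↭ _ p))) (dy y (proj₁ (∈-fil⁻ _ Y j)))))
           (lem (subst₂ (λ a b → suc a ≤ b + c) (sym (cnt-split (R x) Y)) (↭-length p) h))
      where
      lem : suc (cnt (R x) Y + cnt (not ∘ R x) Y) ≤ suc (length X') + c →
            suc (length (filterᵇ (not ∘ R x) Y)) ≤ length X' + (suc c ∸ cnt (R x) Y)
      lem h rewrite length-fil (not ∘ R x) Y = +-cancelˡ-≤ (cnt (R x) Y) _ _ (begin
        cnt (R x) Y + suc (cnt (not ∘ R x) Y) ≡⟨ +-suc _ _ ⟩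
        suc (cnt (R x) Y + cnt (not ∘ R x) Y) ≤⟨ h ⟩
        suc (length X') + c ≡⟨ sym (+-suc (length X') c) ⟩
        length X' + suc c ≡⟨ cong (length X' +_) (sym (m+[n∸m]≡n l)) ⟩
        length X' + (cnt (R x) Y + (suc c ∸ cnt (R x) Y)) ≡⟨ aux (length X') (cnt (R x) Y) _ ⟩
        cnt (R x) Y + (length X' + (suc c ∸ cnt (R x) Y)) ∎)
        where
        open ≤-Reasoning
        aux : ∀ a b c → a + (b + c) ≡ b + (a + c)
        aux = solve-∀
    ...   | W , q , s = x ∷ W , ptrans (prep x q) (↭-sym p) , l , s
    go zero c [] Y e dx dy h = [] , refl , tt
    go (suc n) (suc c) (x ∷ X) Y e dx dy h =
      step n (suc c) (x ∷ X) Y e dx dy h x (here refl) (≤-trans (dx x (here refl)) (s≤s (s≤s z≤n)))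
    go (suc n) zero X Y e dx dy h with Σl-< (λ x → cnt (R x) Y) (λ _ → 2) X (begin-strict
        Σl (λ x → cnt (R x) Y) X ≡⟨ Σl-swap (λ x y → b2n (R x y)) X Y ⟩
        Σl (λ y → cnt (λ x → R x y) X) Y ≤⟨ Σl-bound _ 2 Y dy ⟩
        2 * length Y <⟨ *-monoʳ-< 2 (subst (length Y <_) (+-identityʳ _) h) ⟩
        2 * length X ≡⟨ sym (Σl-const 2 X) ⟩
        Σl (λ _ → 2) X ∎)
      where open ≤-Reasoning
    ... | x , i , l = step n zero X Y e dx dy h x i (≤-pred l)

-- From cyclic sequences of matchings to orderings

inj⇒surj : ∀ {n} (f : Fin n → Fin n) → Injective _≡_ _≡_ f → Bijective _≡_ _≡_ f
inj⇒surj {n} f inj = inj , sur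
  where
  hit : ∀ {n} (f : Fin n → Fin n) → Injective _≡_ _≡_ f → ∀ y → ∃ λ x → f x ≡ y
  hit {suc n} f inj y with any?F (λ x → f x ≟F y)
  ... | yes h = h
  ... | no ¬h = ⊥-elim (1+n≰n (injective⇒≤ {f = λ x → punchOut (ne x)} (λ {x} {z} e → inj (punchOut-injective (ne x) (ne z) e))))
    where
    ne : ∀ x → y ≢ f x
    ne x e = ¬h (x , sym e)
  sur : ∀ y → ∃ λ x → ∀ {z} → z ≡ x → f z ≡ y
  sur y with hit f inj y
  ... | x , e = x , λ { refl → e }

-- Removes the remainder from `fwd`: the distance is j - i for i < j and M + j - i for j < i, and
-- each premise is the bound in one of these cases.
fwd≥ : ∀ M s i j → i < M → j < M → i ≢ j → (i < j → s + i ≤ j) → (j < i → s + i ≤ M + j) → s ≤ fwd M i j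
fwd≥ (suc M) s i j i<M j<M ne h₁ h₂ with <-cmp i j
... | tri< l _ _ = ≤-trans (m+n≤o⇒m≤o∸n s (h₁ l)) (≤-reflexive (begin
    j ∸ i                             ≡⟨ sym (trans (sym (+-∸-assoc 1 l)) refl) ⟩
    suc (j ∸ suc i)                   ≡⟨ cong suc (sym (m<n⇒m%n≡m (≤-trans (s≤s (m∸n≤m j (suc i))) j<M))) ⟩
    suc ((j ∸ suc i) % suc M)         ≡⟨ cong suc (sym ([m+n]%n≡m%n (j ∸ suc i) (suc M))) ⟩
    suc ((j ∸ suc i + suc M) % suc M) ≡⟨ cong (λ k → suc (k % suc M)) (sym (+-∸-comm (suc M) l)) ⟩
    suc ((j + suc M ∸ suc i) % suc M) ∎))
  where open ≡-Reasoning
... | tri≈ _ e _ = ⊥-elim (ne e)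
... | tri> _ _ l = ≤-trans (m+n≤o⇒m≤o∸n s (h₂ l)) (≤-reflexive (begin
    suc M + j ∸ i                      ≡⟨ cong (_∸ i) (+-comm (suc M) j) ⟩
    j + suc M ∸ i                      ≡⟨ +-∸-assoc 1 (≤-trans i<M (m≤n+m (suc M) j)) ⟩
    suc (j + suc M ∸ suc i)            ≡⟨ cong suc (sym (m<n⇒m%n≡m small)) ⟩
    suc ((j + suc M ∸ suc i) % suc M)  ∎))
  where
  open ≡-Reasoning
  small : j + suc M ∸ suc i < suc M
  small = ≤-trans (≤-reflexive (sym (+-∸-assoc 1 (≤-trans i<M (m≤n+m (suc M) j)))))
            (≤-trans (∸-monoˡ-≤ i (+-monoˡ-≤ (suc M) (<⇒≤ l))) (≤-reflexive (m+n∸m≡n i (suc M))))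

offset : ∀ {A : Set} → (ℕ → List A) → ℕ → ℕ
offset W zero    = 0
offset W (suc i) = offset W i + length (W i)

module _ {A : Set} (W : ℕ → List A) where

  offset-mono : ∀ {i j} → i ≤ j → offset W i ≤ offset W j
  offset-mono {i} {zero}  z≤n = z≤n
  offset-mono {i} {suc j} h with m≤n⇒m<n∨m≡n h
  ... | inj₁ l    = ≤-trans (offset-mono (≤-pred l)) (m≤m+n _ _)
  ... | inj₂ refl = ≤-refl

  offset-per : ∀ K → (∀ i → W (K + i) ≡ W i) → ∀ i → offset W (K + i) ≡ offset W K + offset W i
  offset-per K per zero    = trans (cong (offset W) (+-identityʳ K)) (sym (+-identityʳ _))
  offset-per K per (suc i) = begin
    offset W (K + suc i)                           ≡⟨ cong (offset W) (+-suc K i) ⟩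
    offset W (K + i) + length (W (K + i))          ≡⟨ cong₂ _+_ (offset-per K per i) (cong length (per i)) ⟩
    offset W K + offset W i + length (W i)            ≡⟨ +-assoc (offset W K) _ _ ⟩
    offset W K + (offset W i + length (W i))          ∎
    where open ≡-Reasoning

  offset-sep : ∀ {i j p q} → i < j → p < length (W i) → offset W i + p < offset W j + q
  offset-sep {i} {j} {p} {q} l h = ≤-trans (+-monoʳ-< (offset W i) h) (≤-trans (offset-mono l) (m≤m+n _ q))

-- A periodic sequence of matchings in which e and f, adjacent and in consecutive
-- matchings, always lie at least s apart, read off as a cyclic ordering of the edges.
layout : ∀ {n} (G : Graph n) (s K : ℕ) (W : ℕ → List (Fin (m G))) (cls : Fin (m G) → ℕ) →
  (∀ i → W (K + i) ≡ W i) →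
  (∀ e → cls e < K × e ∈ W (cls e)) →
  offset W K ≡ m G →
  (∀ i {e e'} → e ∈ W i → e' ∈ W i → ¬ Adjacent G e e') →
  (∀ i → s ≤ length (W i)) →
  (∀ i {p p' e e'} → At (W i) p e → At (W (suc i)) p' e' → Adjacent G e e' → p + s ≤ length (W i) + p') →
  Σ (Ordering G) λ ℓ → Good G ℓ s
layout G s K W cls per mem tot indep long link = (ℓ , inj⇒surj ℓ ℓ-inj) , good
  where
  idx : Fin (m G) → ℕ
  idx e = proj₁ (∈-At (proj₂ (mem e)))

  at : ∀ e → At (W (cls e)) (idx e) e
  at e = proj₂ (∈-At (proj₂ (mem e)))

  pos : Fin (m G) → ℕ
  pos e = offset W (cls e) + idx e

  pos<m : ∀ e → pos e < m G
  pos<m e = subst (pos e <_) tot (≤-trans (offset-sep W {q = 0} (proj₁ (mem e)) (At-< (at e))) (≤-reflexive (+-identityʳ _)))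

  ℓ : Fin (m G) → Fin (m G)
  ℓ e = fromℕ< (pos<m e)

  toℓ : ∀ e → toℕ (ℓ e) ≡ pos e
  toℓ e = toℕ-fromℕ< (pos<m e)

  pos-inj : ∀ e e' → pos e ≡ pos e' → e ≡ e'
  pos-inj e e' h with <-cmp (cls e) (cls e')
  ... | tri< l _ _ = ⊥-elim (<-irrefl h (offset-sep W l (At-< (at e))))
  ... | tri> _ _ l = ⊥-elim (<-irrefl (sym h) (offset-sep W l (At-< (at e'))))
  ... | tri≈ _ c _ = At-fun (at e) (subst₂ (λ i p → At (W i) p e') (sym c)
          (sym (+-cancelˡ-≡ (offset W (cls e)) _ _ (trans h (cong (λ i → offset W i + idx e') (sym c))))) (at e'))

  ℓ-inj : Injective _≡_ _≡_ ℓ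
  ℓ-inj {e} {e'} h = pos-inj e e' (trans (sym (toℓ e)) (trans (cong toℕ h) (toℓ e')))

  apart : ∀ {i j p q e e'} → i < j → At (W i) p e → At (W j) q e' → Adjacent G e e' →
          s + (offset W i + p) ≤ offset W j + q
  apart {i} {j} {p} {q} l a b adj with m≤n⇒m<n∨m≡n l
  ... | inj₂ refl = begin
      s + (offset W i + p)            ≡⟨ lem s (offset W i) p ⟩
      offset W i + (p + s)            ≤⟨ +-monoʳ-≤ (offset W i) (link i a b adj) ⟩
      offset W i + (length (W i) + q) ≡⟨ sym (+-assoc (offset W i) _ q) ⟩
      offset W i + length (W i) + q   ∎
    where
    open ≤-Reasoning
    lem : ∀ a b c → a + (b + c) ≡ b + (c + a)
    lem = solve-∀
  -- A whole class, of at least s edges, lies between the two.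
  ... | inj₁ l' = begin
      s + (offset W i + p)                               ≡⟨ +-comm s _ ⟩
      offset W i + p + s                                 ≤⟨ +-mono-≤ (+-monoʳ-≤ (offset W i) (<⇒≤ (At-< a))) (long (suc i)) ⟩
      offset W i + length (W i) + length (W (suc i))     ≤⟨ offset-mono W l' ⟩
      offset W j                                         ≤⟨ m≤m+n _ q ⟩
      offset W j + q                                     ∎
    where open ≤-Reasoning

  adj-sym : ∀ {e e'} → Adjacent G e e' → Adjacent G e' e
  adj-sym (ne , v , i , j) = (λ h → ne (sym h)) , v , j , i

  before : ∀ {e e'} → Adjacent G e e' → pos e < pos e' → s + pos e ≤ pos e' × s + pos e' ≤ m G + pos e
  before {e} {e'} adj l with <-cmp (cls e) (cls e')
  ... | tri> _ _ c = ⊥-elim (<-asym l (offset-sep W c (At-< (at e'))))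
  ... | tri≈ _ c _ = ⊥-elim (indep (cls e') (subst (λ i → e ∈ W i) c (proj₂ (mem e))) (proj₂ (mem e')) adj)
  ... | tri< c _ _ = apart c (at e) (at e') adj , (begin
      -- The way on from e′ around to e: in the periodic sequence e recurs in class K + cls e, where
      -- its position has grown by m G.
      s + pos e'                        ≤⟨ apart (≤-trans (proj₁ (mem e')) (m≤m+n K (cls e))) (at e')
                                             (subst (λ w → At w (idx e) e) (sym (per (cls e))) (at e)) (adj-sym adj) ⟩
      offset W (K + cls e) + idx e         ≡⟨ cong (_+ idx e) (offset-per W K per (cls e)) ⟩
      offset W K + offset W (cls e) + idx e   ≡⟨ +-assoc (offset W K) _ _ ⟩
      offset W K + pos e                   ≡⟨ cong (_+ pos e) tot ⟩
      m G + pos e                       ∎)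
    where open ≤-Reasoning

  far : ∀ e e' → Adjacent G e e' → s ≤ fwd (m G) (toℕ (ℓ e)) (toℕ (ℓ e'))
  far e e' adj rewrite toℓ e | toℓ e' =
    fwd≥ (m G) s (pos e) (pos e') (pos<m e) (pos<m e') (λ h → proj₁ adj (pos-inj e e' h))
      (λ l → proj₁ (before adj l)) (λ l → proj₂ (before (adj-sym adj) l))

  good : Good G (ℓ , inj⇒surj ℓ ℓ-inj) s
  good e e' adj = ⊓-glb (far e e' adj) (far e' e (adj-sym adj))

-- Two-colouring the union of two matchings

Involution : ∀ {n} → (Fin n → Fin n) → Set
Involution a = ∀ v → a (a v) ≡ v

moved : ∀ {n} → (Fin n → Fin n) → Fin n → Bool
moved a v = not ⌊ a v ≟F v ⌋

moved-true : ∀ {n} (a : Fin n → Fin n) {v} → moved a v ≡ true → a v ≢ v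
moved-true a {v} h = ⌊⌋-false (a v ≟F v) (not-true h)

moved-intro : ∀ {n} (a : Fin n → Fin n) {v} → a v ≢ v → moved a v ≡ true
moved-intro a {v} h = not-false (⌊⌋-no (a v ≟F v) h)

not-≢ : ∀ {a b : Bool} → not a ≢ b → a ≡ b
not-≢ {true}  {true}  h = refl
not-≢ {true}  {false} h = ⊥-elim (h refl)
not-≢ {false} {true}  h = ⊥-elim (h refl)
not-≢ {false} {false} h = refl

≢-not : ∀ {a : Bool} → a ≢ not a
≢-not {true} ()
≢-not {false} ()

bool-≢ : ∀ {a b : Bool} → a ≢ b → not a ≡ b
bool-≢ {true}  {true}  h = ⊥-elim (h refl)
bool-≢ {true}  {false} h = refl
bool-≢ {false} {true}  h = refl
bool-≢ {false} {false} h = ⊥-elim (h refl)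

-- Contracting an edge vw of the first matching: x—v—w—y becomes x—y.
module Contract {n} (a b : Fin n → Fin n) (ia : Involution a) (ib : Involution b)
                (v : Fin n) (av≢v : a v ≢ v) where
  w = a v

  off? : ∀ u → (u ≡ v ⊎ u ≡ w) ⊎ (u ≢ v × u ≢ w)
  off? u with u ≟F v | u ≟F w
  ... | yes p | _     = inj₁ (inj₁ p)
  ... | no p  | yes q = inj₁ (inj₂ q)
  ... | no p  | no q  = inj₂ (p , q)

  a' : Fin n → Fin n
  a' u with off? u
  ... | inj₁ _ = u
  ... | inj₂ _ = a u

  b'' : Fin n → Fin n
  b'' u with b u ≟F v | b u ≟F w | b w ≟F w | b v ≟F v
  ... | yes _ | _     | yes _ | _     = u
  ... | yes _ | _     | no _  | _     = b w
  ... | no _  | yes _ | _     | yes _ = u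
  ... | no _  | yes _ | _     | no _  = b v
  ... | no _  | no _  | _     | _     = b u

  b' : Fin n → Fin n
  b' u with off? u
  ... | inj₁ _ = u
  ... | inj₂ _ = b'' u

  aw≡v : a w ≡ v
  aw≡v = ia v

  a'-in : ∀ {u} → u ≡ v ⊎ u ≡ w → a' u ≡ u
  a'-in {u} h with off? u
  ... | inj₁ _ = refl
  a'-in (inj₁ e) | inj₂ (p , q) = ⊥-elim (p e)
  a'-in (inj₂ e) | inj₂ (p , q) = ⊥-elim (q e)

  a'-out : ∀ {u} → u ≢ v → u ≢ w → a' u ≡ a u
  a'-out {u} p q with off? u
  ... | inj₁ (inj₁ e) = ⊥-elim (p e)
  ... | inj₁ (inj₂ e) = ⊥-elim (q e)
  ... | inj₂ _ = refl

  b'-in : ∀ {u} → u ≡ v ⊎ u ≡ w → b' u ≡ u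
  b'-in {u} h with off? u
  ... | inj₁ _ = refl
  b'-in (inj₁ e) | inj₂ (p , q) = ⊥-elim (p e)
  b'-in (inj₂ e) | inj₂ (p , q) = ⊥-elim (q e)

  b'-out : ∀ {u} → u ≢ v → u ≢ w → b' u ≡ b'' u
  b'-out {u} p q with off? u
  ... | inj₁ (inj₁ e) = ⊥-elim (p e)
  ... | inj₁ (inj₂ e) = ⊥-elim (q e)
  ... | inj₂ _ = refl

  w≢v : w ≢ v
  w≢v = av≢v

  b''-vy : ∀ {u} → b u ≡ v → b w ≢ w → b'' u ≡ b w
  b''-vy {u} e k with b u ≟F v | b u ≟F w | b w ≟F w | b v ≟F v
  ... | yes _ | _ | yes k' | _ = ⊥-elim (k k')
  ... | yes _ | _ | no _   | _ = refl
  ... | no p  | _ | _      | _ = ⊥-elim (p e)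

  b''-v : ∀ {u} → b u ≡ v → b w ≡ w → b'' u ≡ u
  b''-v {u} e k with b u ≟F v | b u ≟F w | b w ≟F w | b v ≟F v
  ... | yes _ | _ | yes _ | _ = refl
  ... | yes _ | _ | no k' | _ = ⊥-elim (k' k)
  ... | no p  | _ | _     | _ = ⊥-elim (p e)

  b''-wx : ∀ {u} → b u ≡ w → b v ≢ v → b'' u ≡ b v
  b''-wx {u} e k with b u ≟F v | b u ≟F w | b w ≟F w | b v ≟F v
  ... | yes p | _     | _ | _      = ⊥-elim (w≢v (trans (sym e) p))
  ... | no _  | yes _ | _ | yes k' = ⊥-elim (k k')
  ... | no _  | yes _ | _ | no _   = refl
  ... | no _  | no p  | _ | _      = ⊥-elim (p e)

  b''-w : ∀ {u} → b u ≡ w → b v ≡ v → b'' u ≡ u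
  b''-w {u} e k with b u ≟F v | b u ≟F w | b w ≟F w | b v ≟F v
  ... | yes p | _     | _ | _     = ⊥-elim (w≢v (trans (sym e) p))
  ... | no _  | yes _ | _ | yes _ = refl
  ... | no _  | yes _ | _ | no k' = ⊥-elim (k' k)
  ... | no _  | no p  | _ | _     = ⊥-elim (p e)

  b''-no : ∀ {u} → b u ≢ v → b u ≢ w → b'' u ≡ b u
  b''-no {u} p q with b u ≟F v | b u ≟F w | b w ≟F w | b v ≟F v
  ... | yes e | _     | _ | _ = ⊥-elim (p e)
  ... | no _  | yes e | _ | _ = ⊥-elim (q e)
  ... | no _  | no _  | _ | _ = refl

  flip : ∀ {s t} → b s ≡ t → s ≡ b t
  flip {s} e = trans (sym (ib s)) (cong b e)

  ia' : Involution a'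
  ia' u with off? u
  ... | inj₁ h = a'-in h
  ... | inj₂ (p , q) = trans (a'-out (λ e → q (trans (sym (ia u)) (cong a e))) (λ e → p (trans (sym (ia u)) (trans (cong a e) aw≡v)))) (ia u)

  ib' : Involution b'
  ib' u with off? u
  ... | inj₁ h = b'-in h
  ... | inj₂ (p , q) with b u ≟F v | b u ≟F w | b w ≟F w | b v ≟F v
  ...   | yes e | _ | yes k | _ = trans (b'-out p q) (b''-v e k)
  ...   | yes e | _ | no k | _ = trans (b'-out (λ h → q (trans (flip e) (sym (flip h)))) k)
            (trans (b''-wx (ib w) (λ h → p (trans (flip e) h))) (sym (flip e)))
  ...   | no _ | yes e | _ | yes k = trans (b'-out p q) (b''-w e k)
  ...   | no _ | yes e | _ | no k = trans (b'-out k (λ h → p (trans (flip e) (sym (flip h)))))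
            (trans (b''-vy (ib v) (λ h → q (trans (flip e) h))) (sym (flip e)))
  ...   | no r | no s | _ | _ = trans (b'-out r s) (trans (b''-no (λ h → p (trans (sym (ib u)) h)) (λ h → q (trans (sym (ib u)) h))) (ib u))

  fewer : cnt (moved a') (allFin n) < cnt (moved a) (allFin n)
  fewer with ∈-extract (∈-allFin v)
  ... | ys , p rewrite Σl-↭ (λ u → b2n (moved a' u)) p | Σl-↭ (λ u → b2n (moved a u)) p
      | moved-intro a av≢v | ⌊⌋-intro (a' v ≟F v) (a'-in (inj₁ refl)) =
    s≤s (cnt-mono (moved a') (moved a) ys (λ u _ h → moved-intro a (λ e → moved-true a' h (fixed u e))))
    where
    fixed : ∀ u → a u ≡ u → a' u ≡ u
    fixed u e with off? u
    ... | inj₁ _ = refl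
    ... | inj₂ _ = e

  module _ (σ : Fin n → Bool) (ha : ∀ u → a' u ≢ u → σ (a' u) ≢ σ u) (hb : ∀ u → b' u ≢ u → σ (b' u) ≢ σ u) where
    -- In the path x, v, w, y the vertex v gets the sign opposite to x. If x does not exist, v gets
    -- the sign of y, since w must differ from both. If x and y both exist, they are matched after
    -- the contraction, so their signs differ and w, opposite to v, also differs from y.
    sv : Bool
    sv with b v ≟F v
    ... | no _  = not (σ (b v))
    ... | yes _ = σ (b w)

    τ : Fin n → Bool
    τ u with off? u
    ... | inj₁ (inj₁ _) = sv
    ... | inj₁ (inj₂ _) = not sv
    ... | inj₂ _        = σ u

    τv : τ v ≡ sv
    τv with off? v
    ... | inj₁ (inj₁ _) = refl
    ... | inj₁ (inj₂ e) = ⊥-elim (w≢v (sym e))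
    ... | inj₂ (p , _)  = ⊥-elim (p refl)

    τw : τ w ≡ not sv
    τw with off? w
    ... | inj₁ (inj₁ e) = ⊥-elim (w≢v e)
    ... | inj₁ (inj₂ _) = refl
    ... | inj₂ (_ , q)  = ⊥-elim (q refl)

    τo : ∀ {u} → u ≢ v → u ≢ w → τ u ≡ σ u
    τo {u} p q with off? u
    ... | inj₁ (inj₁ e) = ⊥-elim (p e)
    ... | inj₁ (inj₂ e) = ⊥-elim (q e)
    ... | inj₂ _ = refl

    τa : ∀ u → a u ≢ u → τ (a u) ≢ τ u
    τa u h e with off? u
    ... | inj₁ (inj₁ refl) = ≢-not (trans (sym e) τw)
    ... | inj₁ (inj₂ refl) = ≢-not (trans (sym (trans (cong τ aw≡v) τv)) e)
    ... | inj₂ (p , q) = ha u (λ k → h (trans (sym (a'-out p q)) k))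
            (trans (cong σ (a'-out p q)) (trans (sym (τo (λ k → q (trans (sym (ia u)) (cong a k)))
              (λ k → p (trans (sym (ia u)) (trans (cong a k) aw≡v))))) e))

    sv-no : b v ≢ v → sv ≡ not (σ (b v))
    sv-no h with b v ≟F v
    ... | no _  = refl
    ... | yes e = ⊥-elim (h e)

    sv-yes : b v ≡ v → sv ≡ σ (b w)
    sv-yes h with b v ≟F v
    ... | no e  = ⊥-elim (e h)
    ... | yes _ = refl

    τbv : b v ≢ v → τ (b v) ≢ τ v
    τbv h e = split (b v ≟F w)
      where
      split : Dec (b v ≡ w) → ⊥
      split (yes k) = ≢-not (trans (sym τv) (trans (sym e) (trans (cong τ k) τw)))
      split (no k)  = ≢-not (trans (sym (τo h k)) (trans e (trans τv (sv-no h))))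

    τbw : b w ≢ w → τ (b w) ≢ τ w
    τbw h e = split (b w ≟F v) (b v ≟F v)
      where
      split : Dec (b w ≡ v) → Dec (b v ≡ v) → ⊥
      split (yes k) _ = ≢-not (trans (sym τv) (trans (cong τ (sym k)) (trans e τw)))
      split (no k) (yes l) = ≢-not (trans (sym (τo k h)) (trans e (trans τw (cong not (sv-yes l)))))
      split (no k) (no l) = hb (b v) (λ r → b≢ (trans (sym by) r)) (trans (cong σ by) (sym (not-≢ {σ (b v)} aux)))
        where
        bv≢w : b v ≢ w
        bv≢w r = k (sym (flip r))
        by : b' (b v) ≡ b w
        by = trans (b'-out l bv≢w) (b''-vy (ib v) h)
        b≢ : b w ≢ b v
        b≢ r = w≢v (trans (flip r) (ib v))
        aux : not (σ (b v)) ≢ σ (b w)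
        aux r = ≢-not {σ (b w)} (trans (trans (sym (τo k h)) (trans e τw)) (cong not (trans (sv-no l) r)))

    τb : ∀ u → b u ≢ u → τ (b u) ≢ τ u
    τb u h e = split (off? u) (off? (b u))
      where
      split : (u ≡ v ⊎ u ≡ w) ⊎ (u ≢ v × u ≢ w) → (b u ≡ v ⊎ b u ≡ w) ⊎ (b u ≢ v × b u ≢ w) → ⊥
      split (inj₁ (inj₁ refl)) _ = τbv h e
      split (inj₁ (inj₂ refl)) _ = τbw h e
      split (inj₂ (p , q)) (inj₁ (inj₁ k)) =
        τbv (λ r → p (trans (flip k) r)) (trans (cong τ (sym (flip k))) (trans (sym e) (cong τ k)))
      split (inj₂ (p , q)) (inj₁ (inj₂ k)) =
        τbw (λ r → q (trans (flip k) r)) (trans (cong τ (sym (flip k))) (trans (sym e) (cong τ k)))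
      split (inj₂ (p , q)) (inj₂ (r , s)) = hb u (λ k → h (trans (sym bb) k)) (trans (cong σ bb) (trans (sym (τo r s)) (trans e (τo p q))))
        where
        bb : b' u ≡ b u
        bb = trans (b'-out p q) (b''-no r s)

abstract
  -- Cycles that alternate between two matchings are even. A matching is an involution whose fixed
  -- points are the uncovered vertices; the induction contracts the edges of a, and once a is the
  -- identity the order of the two ends of each edge of b supplies the signs.
  twoColour : ∀ {n} (a b : Fin n → Fin n) → Involution a → Involution b →
    ∃ λ (σ : Fin n → Bool) → (∀ v → a v ≢ v → σ (a v) ≢ σ v) × (∀ v → b v ≢ v → σ (b v) ≢ σ v)
  twoColour {n} a b ia ib = go _ a b ia ib ≤-refl
    where
    go : ∀ k (a b : Fin n → Fin n) → Involution a → Involution b → cnt (moved a) (allFin n) ≤ k →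
      ∃ λ (σ : Fin n → Bool) → (∀ v → a v ≢ v → σ (a v) ≢ σ v) × (∀ v → b v ≢ v → σ (b v) ≢ σ v)
    go k a b ia ib h with any?F (λ v → ¬? (a v ≟F v))
    go zero a b ia ib h | yes (v , e) =
      ⊥-elim (1+n≰n (≤-trans (cnt-pos (moved a) (∈-allFin v) (moved-intro a e)) h))
    go (suc k) a b ia ib h | yes (v , e) with go k a' b' ia' ib' (≤-pred (≤-trans fewer h))
      where open Contract a b ia ib v e
    ... | σ , p , q = τ σ p q , τa σ p q , τb σ p q
      where open Contract a b ia ib v e
    go k a b ia ib h | no ¬e = (λ v → ⌊ toℕ v <? toℕ (b v) ⌋) , (λ v e → ⊥-elim (¬e (v , e))) , split
      where
      split : ∀ v → b v ≢ v → ⌊ toℕ (b v) <? toℕ (b (b v)) ⌋ ≢ ⌊ toℕ v <? toℕ (b v) ⌋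
      split v e q rewrite ib v with toℕ (b v) <? toℕ v | toℕ v <? toℕ (b v)
      ... | yes l | yes l' = <-asym l l'
      ... | no l  | no l'  = e (toℕ-injective (≤-antisym (≮⇒≥ l') (≮⇒≥ l)))

-- Edges, colour classes and selections

Proper : ∀ {n K} (G : Graph n) → (Fin (m G) → Fin K) → Set
Proper G c = ∀ e e' → Adjacent G e e' → c e ≢ c e'

module Edges {n} (G : Graph n) where

  E : Set
  E = Fin (m G)

  lo hi : E → Fin n
  lo e = proj₁ (edge G e)
  hi e = proj₂ (edge G e)

  lo≢hi : ∀ e → lo e ≢ hi e
  lo≢hi e h = <-irrefl (cong toℕ h) (ordered G e)

  incident? : ∀ v e → Dec (Incident G v e)
  incident? v e = (lo e ≟F v) ⊎-dec (hi e ≟F v)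

  inc : Fin n → E → Bool
  inc v e = ⌊ incident? v e ⌋

  other : E → Fin n → Fin n
  other e v = if ⌊ lo e ≟F v ⌋ then hi e else lo e

  other-lo : ∀ e → other e (lo e) ≡ hi e
  other-lo e rewrite ⌊⌋-intro (lo e ≟F lo e) refl = refl

  other-hi : ∀ e → other e (hi e) ≡ lo e
  other-hi e rewrite ⌊⌋-no (lo e ≟F hi e) (lo≢hi e) = refl

  other-inc : ∀ {e v} → Incident G v e → Incident G (other e v) e
  other-inc {e} (inj₁ refl) = inj₂ (sym (other-lo e))
  other-inc {e} (inj₂ refl) = inj₁ (sym (other-hi e))

  other-≢ : ∀ {e v} → Incident G v e → other e v ≢ v
  other-≢ {e} (inj₁ refl) h = lo≢hi e (trans (sym h) (other-lo e))
  other-≢ {e} (inj₂ refl) h = lo≢hi e (trans (sym (other-hi e)) h)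

  other-other : ∀ {e v} → Incident G v e → other e (other e v) ≡ v
  other-other {e} (inj₁ refl) rewrite other-lo e = other-hi e
  other-other {e} (inj₂ refl) rewrite other-hi e = other-lo e

  two-ends : ∀ {e v x} → Incident G v e → Incident G x e → x ≢ v → x ≡ other e v
  two-ends (inj₁ refl) (inj₁ refl) h = ⊥-elim (h refl)
  two-ends {e} (inj₁ refl) (inj₂ refl) h = sym (other-lo e)
  two-ends {e} (inj₂ refl) (inj₁ refl) h = sym (other-hi e)
  two-ends (inj₂ refl) (inj₂ refl) h = ⊥-elim (h refl)

  -- Here simplicity enters: pairs of ends are increasing, so two edges with the same ends are equal
  -- as pairs and `edgeInj` applies.
  same-ends : ∀ {e f u v} → u ≢ v → Incident G u e → Incident G v e → Incident G u f → Incident G v f → e ≡ f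
  same-ends {e} {f} ne a b c d = edgeInj G (aux {ne = ne} a b c d)
    where
    bad : ∀ {e f} → lo e ≡ hi f → hi e ≡ lo f → edge G e ≡ edge G f
    bad {e} {f} p q = ⊥-elim (<-asym (ordered G e) (subst₂ _<_ (cong toℕ (sym q)) (cong toℕ (sym p)) (ordered G f)))
    aux : ∀ {e f u v} {ne : u ≢ v} → Incident G u e → Incident G v e → Incident G u f → Incident G v f → edge G e ≡ edge G f
    aux {ne = ne} (inj₁ p) (inj₁ q) _ _ = ⊥-elim (ne (trans (sym p) q))
    aux {ne = ne} (inj₂ p) (inj₂ q) _ _ = ⊥-elim (ne (trans (sym p) q))
    aux {ne = ne} _ _ (inj₁ p) (inj₁ q) = ⊥-elim (ne (trans (sym p) q))
    aux {ne = ne} _ _ (inj₂ p) (inj₂ q) = ⊥-elim (ne (trans (sym p) q))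
    aux (inj₁ p) (inj₂ q) (inj₁ r) (inj₂ s) = cong₂ _,_ (trans p (sym r)) (trans q (sym s))
    aux (inj₂ p) (inj₁ q) (inj₂ r) (inj₁ s) = cong₂ _,_ (trans q (sym s)) (trans p (sym r))
    aux (inj₁ p) (inj₂ q) (inj₂ r) (inj₁ s) = bad (trans p (sym r)) (trans q (sym s))
    aux (inj₂ p) (inj₁ q) (inj₁ r) (inj₂ s) = bad (trans q (sym s)) (trans p (sym r))

  adjacent? : ∀ e f → Dec (Adjacent G e f)
  adjacent? e f = ¬? (e ≟F f) ×-dec any?F (λ v → incident? v e ×-dec incident? v f)

  nb : E → E → Bool
  nb e f = ⌊ adjacent? e f ⌋

  nb⁻ : ∀ {e f} → nb e f ≡ true → Adjacent G e f
  nb⁻ {e} {f} = ⌊⌋-true (adjacent? e f)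

  nb⁺ : ∀ {e f} → Adjacent G e f → nb e f ≡ true
  nb⁺ {e} {f} = ⌊⌋-intro (adjacent? e f)

  adj-sym : ∀ {e f} → Adjacent G e f → Adjacent G f e
  adj-sym (ne , v , i , j) = (λ h → ne (sym h)) , v , j , i

  nb-sym : ∀ e f → nb e f ≡ nb f e
  nb-sym e f with nb e f in p | nb f e in q
  ... | true  | true  = refl
  ... | false | false = refl
  ... | true  | false = ⊥-elim (true≢false (nb⁺ (adj-sym (nb⁻ p))) q)
  ... | false | true  = ⊥-elim (true≢false (nb⁺ (adj-sym (nb⁻ q))) p)

  module Colour {K} (c : E → Fin K) (proper : Proper G c) where

    cls : Fin K → List E
    cls i = filterᵇ (λ e → ⌊ c e ≟F i ⌋) (allFin (m G))

    cls⁻ : ∀ {i e} → e ∈ cls i → c e ≡ i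
    cls⁻ {i} {e} h = ⌊⌋-true (c e ≟F i) (proj₂ (∈-fil⁻ _ (allFin (m G)) h))

    cls⁺ : ∀ {i e} → c e ≡ i → e ∈ cls i
    cls⁺ {i} {e} h = ∈-fil⁺ _ (∈-allFin e) (⌊⌋-intro (c e ≟F i) h)

    cls-unique : ∀ i → Unique (cls i)
    cls-unique i = unique-fil _ (allFin⁺ (m G))

    one-at : ∀ {v e f} → c e ≡ c f → Incident G v e → Incident G v f → e ≡ f
    one-at {v} {e} {f} h p q with e ≟F f
    ... | yes r = r
    ... | no r  = ⊥-elim (proper e f (r , v , p , q) h)

    edgeAt? : ∀ i v → Dec (∃ λ e → c e ≡ i × Incident G v e)
    edgeAt? i v = any?F (λ e → (c e ≟F i) ×-dec incident? v e)

    edgeAt : Fin K → Fin n → Maybe E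
    edgeAt i v with edgeAt? i v
    ... | yes (e , _) = just e
    ... | no _        = nothing

    edgeAt⁻ : ∀ {i v e} → edgeAt i v ≡ just e → c e ≡ i × Incident G v e
    edgeAt⁻ {i} {v} h with edgeAt? i v
    edgeAt⁻ refl | yes (e , p) = p

    edgeAt⁺ : ∀ {i v e} → c e ≡ i → Incident G v e → edgeAt i v ≡ just e
    edgeAt⁺ {i} {v} {e} h p with edgeAt? i v
    ... | yes (f , q , r) = cong just (one-at (trans q (sym h)) r p)
    ... | no ¬x = ⊥-elim (¬x (e , h , p))

    mate : Fin K → Fin n → Fin n
    mate i v with edgeAt i v
    ... | just e  = other e v
    ... | nothing = v

    mate⁺ : ∀ {i v e} → c e ≡ i → Incident G v e → mate i v ≡ other e v
    mate⁺ {i} {v} h p rewrite edgeAt⁺ {i} {v} h p = refl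

    mate-inv : ∀ i → Involution (mate i)
    mate-inv i v with edgeAt i v in eq
    ... | just e with edgeAt⁻ {i} {v} eq
    ...   | h , p = trans (mate⁺ h (other-inc p)) (other-other p)
    mate-inv i v | nothing rewrite eq = refl

    mate-end : ∀ {e v} → Incident G v e → mate (c e) v ≢ v
    mate-end p h = other-≢ p (trans (sym (mate⁺ refl p)) h)

    degree≤2 : ∀ e j → cnt (nb e) (cls j) ≤ 2
    degree≤2 e j = ≤-trans
      (cnt-∨ (nb e) (inc (lo e)) (inc (hi e)) (cls j) (λ f _ h → case nb⁻ h of λ where
        (_ , v , inj₁ refl , q) → inj₁ (⌊⌋-intro (incident? _ f) q)
        (_ , v , inj₂ refl , q) → inj₂ (⌊⌋-intro (incident? _ f) q)))
      (+-mono-≤ (amo (lo e)) (amo (hi e)))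
      where
      amo : ∀ v → cnt (inc v) (cls j) ≤ 1
      amo v = cnt≤1 (inc v) (cls-unique j) (λ f f' p q a b → one-at (trans (cls⁻ p) (sym (cls⁻ q)))
                (⌊⌋-true (incident? v f) a) (⌊⌋-true (incident? v f') b))

    degree≤2' : ∀ e j → cnt (λ f → nb f e) (cls j) ≤ 2
    degree≤2' e j = ≤-trans (cnt-mono _ (nb e) (cls j) (λ f _ h → trans (nb-sym e f) h)) (degree≤2 e j)

    -- Orienting the paths and cycles of two colour classes: each edge of the first class selects at
    -- most one neighbour in the second, and misses at most one, in both directions.
    record Selection (i j : Fin K) : Set where
      field
        φ      : E → Maybe E
        φ-nb   : ∀ {e f} → c e ≡ i → φ e ≡ just f → c f ≡ j
        φ-out  : ∀ {e f f'} → c e ≡ i → c f ≡ j → c f' ≡ j → Adjacent G e f → Adjacent G e f' →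
                 φ e ≢ just f → φ e ≢ just f' → f ≡ f'
        φ-in   : ∀ {e e' f} → c e ≡ i → c e' ≡ i → c f ≡ j → Adjacent G e f → Adjacent G e' f →
                 φ e ≢ just f → φ e' ≢ just f → e ≡ e'
        φ-inj  : ∀ {e e' f} → c e ≡ i → c e' ≡ i → φ e ≡ just f → φ e' ≡ just f → e ≡ e'

    abstract
      -- Signs alternate along the edges of both classes, so each edge has one positive and one
      -- negative end; `φ e` is the edge of class j at the positive end of e. A meeting that is not
      -- selected happens at a negative end, and both e and f have only one. Two edges that select
      -- the same f share its positive end.
      selection : ∀ i j → Selection i j
      selection i j with twoColour (mate i) (mate j) (mate-inv i) (mate-inv j)
      ... | σ , σi , σj = record { φ = φ ; φ-nb = λ _ h → proj₁ (edgeAt⁻ h) ; φ-out = out ; φ-in = inn ; φ-inj = inj }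
        where
        plus : E → Fin n
        plus e = if σ (lo e) then lo e else hi e

        plus-inc : ∀ e → Incident G (plus e) e
        plus-inc e with σ (lo e)
        ... | true  = inj₁ refl
        ... | false = inj₂ refl

        φ : E → Maybe E
        φ e = edgeAt j (plus e)

        differ : ∀ {k} → (∀ v → mate k v ≢ v → σ (mate k v) ≢ σ v) → ∀ {e v x} → c e ≡ k →
                 Incident G v e → Incident G x e → σ v ≡ σ x → v ≡ x
        differ {k} h {e} {v} {x} refl p q s with v ≟F x
        ... | yes r = r
        ... | no r = ⊥-elim (h x (mate-end q) (trans (cong σ (trans (mate⁺ refl q) (sym (two-ends q p r)))) s))

        plus-σ : ∀ e → c e ≡ i → σ (plus e) ≡ true
        plus-σ e h with σ (lo e) in eq
        ... | true  = eq
        ... | false = sym (bool-≢ {false} (λ k → lo≢hi e (differ σi h (inj₁ refl) (inj₂ refl) (trans eq k))))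

        minus : ∀ {e f v} → c e ≡ i → c f ≡ j → Incident G v e → Incident G v f → φ e ≢ just f → σ v ≡ false
        minus {e} {f} {v} h k p q ne with σ v in eq
        ... | false = refl
        ... | true = ⊥-elim (ne (trans (cong (edgeAt j) (differ σi h (plus-inc e) p (trans (plus-σ e h) (sym eq)))) (edgeAt⁺ k q)))

        out : ∀ {e f f'} → c e ≡ i → c f ≡ j → c f' ≡ j → Adjacent G e f → Adjacent G e f' →
              φ e ≢ just f → φ e ≢ just f' → f ≡ f'
        out h k k' (_ , v , p , q) (_ , v' , p' , q') ne ne'
          with differ σi h p p' (trans (minus h k p q ne) (sym (minus h k' p' q' ne')))
        ... | refl = one-at (trans k (sym k')) q q'

        inn : ∀ {e e' f} → c e ≡ i → c e' ≡ i → c f ≡ j → Adjacent G e f → Adjacent G e' f →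
              φ e ≢ just f → φ e' ≢ just f → e ≡ e'
        inn h h' k (_ , v , p , q) (_ , v' , p' , q') ne ne'
          with differ σj k q q' (trans (minus h k p q ne) (sym (minus h' k p' q' ne')))
        ... | refl = one-at (trans h (sym h')) p p'

        inj : ∀ {e e' f} → c e ≡ i → c e' ≡ i → φ e ≡ just f → φ e' ≡ just f → e ≡ e'
        inj {e} {e'} h h' p p' with edgeAt⁻ p | edgeAt⁻ p'
        ... | k , q | _ , q' = one-at (trans h (sym h')) (plus-inc e)
              (subst (λ v → Incident G v e') (sym (differ σj k q q' (trans (plus-σ e h) (sym (plus-σ e' h'))))) (plus-inc e'))

-- Colour classes in cyclic order

col : ∀ {K} → ℕ → Fin (suc K)
col {K} i = fromℕ< (m%n<n i (suc K))

toℕ-col : ∀ {K} i → toℕ (col {K} i) ≡ i % suc K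
toℕ-col {K} i = toℕ-fromℕ< (m%n<n i (suc K))

col-toℕ : ∀ {K} (i : Fin (suc K)) → col (toℕ i) ≡ i
col-toℕ {K} i = toℕ-injective (trans (toℕ-col (toℕ i)) (m<n⇒m%n≡m (toℕ<n i)))

col-per : ∀ {K} i → col {K} (suc K + i) ≡ col i
col-per {K} i = toℕ-injective (trans (toℕ-col (suc K + i)) (trans
  (trans (cong (_% suc K) (+-comm (suc K) i)) ([m+n]%n≡m%n i (suc K))) (sym (toℕ-col i))))

%-+ : ∀ a b K → (a % suc K + b) % suc K ≡ (a + b) % suc K
%-+ a b K = sym (begin
  (a + b) % suc K                                   ≡⟨ cong (λ x → (x + b) % suc K) (m≡m%n+[m/n]*n a (suc K)) ⟩
  (a % suc K + a / suc K * suc K + b) % suc K       ≡⟨ cong (_% suc K) (lem (a % suc K) (a / suc K * suc K) b) ⟩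
  (a % suc K + b + a / suc K * suc K) % suc K       ≡⟨ [m+kn]%n≡m%n (a % suc K + b) (a / suc K) (suc K) ⟩
  (a % suc K + b) % suc K                           ∎)
  where
  open ≡-Reasoning
  lem : ∀ x y z → x + y + z ≡ x + z + y
  lem = solve-∀

nxt prv : ∀ {K} → Fin (suc K) → Fin (suc K)
nxt i = col (suc (toℕ i))
prv {K} i = col (toℕ i + K)

nxt-col : ∀ {K} i → nxt {K} (col i) ≡ col (suc i)
nxt-col {K} i = toℕ-injective (begin
  toℕ (nxt (col i))         ≡⟨ toℕ-col (suc (toℕ (col i))) ⟩
  suc (toℕ (col i)) % suc K ≡⟨ cong (λ x → suc x % suc K) (toℕ-col i) ⟩
  suc (i % suc K) % suc K   ≡⟨ cong (_% suc K) (+-comm 1 (i % suc K)) ⟩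
  (i % suc K + 1) % suc K   ≡⟨ %-+ i 1 K ⟩
  (i + 1) % suc K           ≡⟨ cong (_% suc K) (+-comm i 1) ⟩
  suc i % suc K             ≡⟨ sym (toℕ-col (suc i)) ⟩
  toℕ (col {K} (suc i))     ∎)
  where open ≡-Reasoning

prv-nxt : ∀ {K} (i : Fin (suc K)) → prv (nxt i) ≡ i
prv-nxt {K} i = toℕ-injective (begin
  toℕ (prv (nxt {K} i))               ≡⟨ toℕ-col (toℕ (nxt {K} i) + K) ⟩
  (toℕ (nxt {K} i) + K) % suc K       ≡⟨ cong (λ x → (x + K) % suc K) (toℕ-col {K} (suc (toℕ i))) ⟩
  (suc (toℕ i) % suc K + K) % suc K   ≡⟨ %-+ (suc (toℕ i)) K K ⟩
  (suc (toℕ i) + K) % suc K           ≡⟨ cong (_% suc K) (sym (+-suc (toℕ i) K)) ⟩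
  (toℕ i + suc K) % suc K             ≡⟨ [m+n]%n≡m%n (toℕ i) (suc K) ⟩
  toℕ i % suc K                       ≡⟨ m<n⇒m%n≡m (toℕ<n i) ⟩
  toℕ i                               ∎)
  where open ≡-Reasoning

cnt-insert : ∀ {n} (p : Fin n → Bool) {x xs} → Unique xs → x ∈ xs → p x ≡ false →
             cnt (λ y → p y ∨ ⌊ y ≟F x ⌋) xs ≡ suc (cnt p xs)
cnt-insert p {x} {xs} u i e = trans (Σl-cong xs (λ y _ → aux y)) (trans (Σl-+ _ _ xs)
  (trans (cong (cnt p xs +_) (cnt≡1 (λ y → ⌊ y ≟F x ⌋) u i (⌊⌋-intro (x ≟F x) refl) (λ y _ h → ⌊⌋-true (y ≟F x) h))) (+-comm _ 1)))
  where
  aux : ∀ y → b2n (p y ∨ ⌊ y ≟F x ⌋) ≡ b2n (p y) + b2n ⌊ y ≟F x ⌋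
  aux y with y ≟F x
  ... | yes refl rewrite e = refl
  ... | no _ with p y
  ...   | true  = refl
  ...   | false = refl

is : ∀ {n} → Maybe (Fin n) → Fin n → Bool
is nothing  x = false
is (just w) x = ⌊ x ≟F w ⌋

is-true : ∀ {n} (w : Maybe (Fin n)) {x} → is w x ≡ true → just x ≡ w
is-true (just w) {x} h = cong just (⌊⌋-true (x ≟F w) h)

is-false : ∀ {n} (w : Maybe (Fin n)) {x} → is w x ≡ false → just x ≢ w
is-false (just w) {x} h e = ⌊⌋-false (x ≟F w) h (just-injective e)

cnt-is : ∀ {n} (w : Maybe (Fin n)) {xs} → Unique xs → cnt (is w) xs ≤ 1
cnt-is w u = cnt≤1 (is w) u (λ x y _ _ a b → just-injective (trans (is-true w a) (sym (is-true w b))))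

module Scheme {n K} (G : Graph n) (c : Fin (m G) → Fin (suc K)) (proper : Proper G c) where
  open Edges G
  open Colour c proper public

  -- The offset of class j counts the edges of colour below j, and beyond the last class these are
  -- all edges.
  offset-total : (W : Fin (suc K) → List E) → (∀ i → W i ↭ cls i) → offset (W ∘ col) (suc K) ≡ m G
  offset-total W p = trans (upto (suc K) ≤-refl) (trans (all-true (suc K) (λ e → toℕ<n (c e))) (length-tabulate id))
    where
    below : ℕ → E → Bool
    below j e = ⌊ toℕ (c e) <? j ⌋
    all-true : ∀ j → (∀ e → toℕ (c e) < j) → cnt (below j) (allFin (m G)) ≡ length (allFin (m G))
    all-true j h = trans (Σl-cong (allFin (m G)) (λ e _ → cong b2n (⌊⌋-intro (toℕ (c e) <? j) (h e)))) (trans (Σl-const 1 (allFin (m G))) (*-identityˡ _))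
    upto : ∀ j → j ≤ suc K → offset (W ∘ col) j ≡ cnt (below j) (allFin (m G))
    upto zero    h = sym (cnt-zero (below 0) (allFin (m G)) (λ e _ → ⌊⌋-no (toℕ (c e) <? 0) (λ ())))
    upto (suc j) h = trans (cong₂ _+_ (upto j (<⇒≤ h)) (trans (↭-length (p (col j))) (length-fil _ (allFin (m G)))))
      (trans (sym (Σl-+ _ _ (allFin (m G)))) (Σl-cong (allFin (m G)) (λ e _ → aux e)))
      where
      tj : toℕ (col {K} j) ≡ j
      tj = trans (toℕ-col j) (m<n⇒m%n≡m h)
      aux : ∀ e → b2n (below j e) + b2n ⌊ c e ≟F col j ⌋ ≡ b2n (below (suc j) e)
      aux e with toℕ (c e) <? j | c e ≟F col j | toℕ (c e) <? suc j
      ... | yes l | yes q | _     = ⊥-elim (<-irrefl (trans (cong toℕ q) tj) l)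
      ... | yes l | no q  | yes _ = refl
      ... | yes l | no q  | no ¬l = ⊥-elim (¬l (m≤n⇒m≤1+n l))
      ... | no _  | yes q | yes _ = refl
      ... | no _  | yes q | no ¬l = ⊥-elim (¬l (s≤s (≤-reflexive (trans (cong toℕ q) tj))))
      ... | no ¬l | no q  | yes l = ⊥-elim (q (toℕ-injective (trans (≤-antisym (≤-pred l) (≮⇒≥ ¬l)) (sym tj))))
      ... | no _  | no _  | no _  = refl

  arrange : ∀ s (W : Fin (suc K) → List E) → (∀ i → W i ↭ cls i) → (∀ i → s ≤ length (W i)) →
    (∀ i {p p' e f} → At (W i) p e → At (W (nxt i)) p' f → Adjacent G e f → p + s ≤ length (W i) + p') →
    Σ (Ordering G) λ ℓ → Good G ℓ s
  arrange s W perm long link = layout G s (suc K) (W ∘ col) (toℕ ∘ c)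
    (λ i → cong W (col-per i))
    (λ e → toℕ<n (c e) , subst (λ i → e ∈ W i) (sym (col-toℕ (c e))) (∈-resp-↭ (↭-sym (perm (c e))) (cls⁺ refl)))
    (offset-total W perm)
    (λ i {e} {f} a b adj → proper e f adj (trans (cls⁻ (∈-resp-↭ (perm (col i)) a)) (sym (cls⁻ (∈-resp-↭ (perm (col i)) b)))))
    (λ i → long (col i))
    (λ i {p} {p'} {e} {f} a b adj → link (col i) a (subst (λ j → At (W j) p' f) (sym (nxt-col i)) b) adj)

  -- What following `φ` yields for a set z in class a whose selections stay in z′ or hit w.
  -- `near-out` limits how many edges outside z′ are met by z; `near-in` makes these edges, in any
  -- order, slow against z.
  record Near (a b : Fin (suc K)) (z z' : E → Bool) (w : Maybe E) : Set where
    field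
      near-out : ∀ {e f f'} → c e ≡ a → z e ≡ true → c f ≡ b → c f' ≡ b → z' f ≡ false → z' f' ≡ false →
                 just f ≢ w → just f' ≢ w → Adjacent G e f → Adjacent G e f' → f ≡ f'
      near-in  : ∀ {e e' f} → c f ≡ b → z' f ≡ false → just f ≢ w → c e ≡ a → c e' ≡ a → z e ≡ true → z e' ≡ true →
                 Adjacent G e f → Adjacent G e' f → e ≡ e'

  sel : ∀ i → Selection (col i) (col (suc i))
  sel i = selection (col i) (col (suc i))

  φ : ℕ → E → Maybe E
  φ i = Selection.φ (sel i)

  near : ∀ i {z z' : E → Bool} {w} →
         (∀ e → c e ≡ col i → z e ≡ true → ∀ f → φ i e ≡ just f → z' f ≡ true ⊎ just f ≡ w) →
         Near (col i) (col (suc i)) z z' w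
  near i {z} {z'} {w} h = record
    { near-out = λ {e} {f} {f'} ce ze cf cf' zf zf' wf wf' → Selection.φ-out (sel i) ce cf cf' `∘` (ce , ze , zf , wf , zf' , wf')
    ; near-in = λ cf zf wf ce ce' ze ze' A A' → Selection.φ-in (sel i) ce ce' cf A A' (avoid ce ze zf wf) (avoid ce' ze' zf wf) }
    where
    avoid : ∀ {e f} → c e ≡ col i → z e ≡ true → z' f ≡ false → just f ≢ w → φ i e ≢ just f
    avoid {e} {f} ce ze zf wf q with h e ce ze f q
    ... | inj₁ t = true≢false t zf
    ... | inj₂ t = wf t
    _`∘`_ : ∀ {e f f'} → (Adjacent G e f → Adjacent G e f' → φ i e ≢ just f → φ i e ≢ just f' → f ≡ f') →
            c e ≡ col i × z e ≡ true × z' f ≡ false × just f ≢ w × z' f' ≡ false × just f' ≢ w →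
            Adjacent G e f → Adjacent G e f' → f ≡ f'
    (k `∘` (ce , ze , zf , wf , zf' , wf')) A A' = k A A' (avoid ce ze zf wf) (avoid ce ze zf' wf')

  -- Sets Zᵢ of r edges in each class with φᵢ(Zᵢ) ⊆ Zᵢ₊₁ for all i, except that going around the cycle
  -- of classes may leave Z₀ at the single edge w.  A round adds the edge w to Z₀ and then follows φ.
  record Growth (r : ℕ) : Set where
    field
      z    : ℕ → E → Bool
      w    : Maybe E
      size : ∀ i → cnt (z i) (cls (col i)) ≡ r
      step : ∀ i e → c e ≡ col i → z i e ≡ true → ∀ f → φ i e ≡ just f → z (suc i) f ≡ true
      loop : ∀ e → c e ≡ col K → z K e ≡ true → ∀ f → φ K e ≡ just f → z 0 f ≡ true ⊎ just f ≡ w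

  abstract
    grow : ∀ r → (∀ i → r ≤ length (cls i)) → Growth r
    grow zero h = record { z = λ _ _ → false ; w = nothing ; size = λ i → cnt-zero _ (cls (col i)) (λ _ _ → refl) ; step = λ _ _ _ () ; loop = λ _ _ () }
    grow (suc r) h = record
      { z = z' ; w = φ K (e K)
      ; size = λ i → trans (cnt-insert (z i) (cls-unique (col i)) (cls⁺ (proj₁ (proj₂ (pick i)))) (proj₁ (proj₂ (proj₂ (pick i))))) (cong suc (size i))
      ; step = step' ; loop = loop' }
      where
      open Growth (grow r (λ i → <⇒≤ (h i)))
      -- The selected edge enters if it is new in its class; otherwise an arbitrary new edge does,
      -- so that all sets keep the same size.
      next : ∀ i (cand : Maybe E) → Σ E λ x → c x ≡ col i × z i x ≡ false × (∀ f → cand ≡ just f → c f ≡ col i → z i f ≡ true ⊎ x ≡ f)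
      filler : ∀ i → ∃ λ x → x ∈ cls (col i) × not (z i x) ≡ true
      filler i = cnt-witness (not ∘ z i) (cls (col i)) (+-cancelˡ-≤ r 1 _
        (≤-trans (≤-reflexive (+-comm r 1)) (≤-trans (h (col i)) (≤-reflexive
          (trans (sym (cnt-split (z i) (cls (col i)))) (cong (_+ cnt (not ∘ z i) (cls (col i))) (size i)))))))
      next i nothing with filler i
      ... | x , p , q = x , cls⁻ p , not-true q , λ f ()
      next i (just f) with z i f in eq | c f ≟F col i
      ... | false | yes p = f , p , eq , λ { g refl _ → inj₂ refl }
      ... | false | no p with filler i
      ...   | x , a , b = x , cls⁻ a , not-true b , λ { g refl q → ⊥-elim (p q) }
      next i (just f) | true | _ with filler i
      ...   | x , a , b = x , cls⁻ a , not-true b , λ { g refl q → inj₁ eq }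
      pick : ∀ i → Σ E λ x → c x ≡ col i × z i x ≡ false × ⊤
      cand : ℕ → Maybe E
      pick i = proj₁ (next i (cand i)) , proj₁ (proj₂ (next i (cand i))) , proj₁ (proj₂ (proj₂ (next i (cand i)))) , tt
      -- The round repairs the old leftover edge w first; the edge picked last creates the new
      -- leftover `φ K (e K)`.
      cand zero    = w
      cand (suc i) = φ i (proj₁ (pick i))
      e : ℕ → E
      e i = proj₁ (pick i)
      picked : ∀ i f → cand i ≡ just f → c f ≡ col i → z i f ≡ true ⊎ e i ≡ f
      picked i = proj₂ (proj₂ (proj₂ (next i (cand i))))
      z' : ℕ → E → Bool
      z' i x = z i x ∨ ⌊ x ≟F e i ⌋
      old : ∀ i {x} → z i x ≡ true → z' i x ≡ true
      old i h rewrite h = refl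
      new : ∀ i {x} → x ≡ e i → z' i x ≡ true
      new i {x} h with z i x
      ... | true  = refl
      ... | false = ⌊⌋-intro (x ≟F e i) h
      step' : ∀ i x → c x ≡ col i → z' i x ≡ true → ∀ f → φ i x ≡ just f → z' (suc i) f ≡ true
      step' i x cx zx f q with ∨-true {z i x} zx
      ... | inj₁ t = old (suc i) (step i x cx t f q)
      ... | inj₂ t with ⌊⌋-true (x ≟F e i) t
      ...   | refl with picked (suc i) f q (Selection.φ-nb (sel i) cx q)
      ...     | inj₁ s = old (suc i) s
      ...     | inj₂ s = new (suc i) (sym s)
      loop' : ∀ x → c x ≡ col K → z' K x ≡ true → ∀ f → φ K x ≡ just f → z' 0 f ≡ true ⊎ just f ≡ φ K (e K)
      loop' x cx zx f q with ∨-true {z K x} zx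
      ... | inj₂ t with ⌊⌋-true (x ≟F e K) t
      ...   | refl = inj₂ (sym q)
      loop' x cx zx f q | inj₁ t with loop x cx t f q
      ... | inj₁ s = inj₁ (old 0 s)
      ... | inj₂ s with picked 0 f (sym s) (trans (Selection.φ-nb (sel K) cx q) (trans (cong (λ k → col k) (sym (+-identityʳ (suc K)))) (col-per 0)))
      ...   | inj₁ a = inj₁ (old 0 a)
      ...   | inj₂ a = inj₁ (new 0 (sym a))

↭-unique : ∀ {A : Set} {xs ys : List A} → xs ↭ ys → Unique xs → Unique ys
↭-unique refl u = u
↭-unique (prep x p) (a ∷ᵁ u) = All.tabulate (λ i → All.lookup a (∈-resp-↭ (↭-sym p) i)) ∷ᵁ ↭-unique p u
↭-unique (swap x y p) ((a ∷ᴬ b) ∷ᵁ (b' ∷ᵁ u)) =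
  ((λ e → a (sym e)) ∷ᴬ All.tabulate (λ i → All.lookup b' (∈-resp-↭ (↭-sym p) i))) ∷ᵁ
  (All.tabulate (λ i → All.lookup b (∈-resp-↭ (↭-sym p) i)) ∷ᵁ ↭-unique p u)
↭-unique (ptrans p q) u = ↭-unique q (↭-unique p u)

-- The two-thirds layout

module ThirdsArith (Q : ℕ) where
  enough : ∀ u t c l → t + u ≡ c → l ≡ Q + c → t ≤ suc Q → suc (Q + Q + Q) ≤ l → Q ≤ u
  enough u t c l refl refl h h' = lin 0 (+-mono-≤ h h') (solve (Q ∷ u ∷ t ∷ []))
  half : ∀ b → suc (Q + Q + Q) ≤ Q + b + Q → Q ≤ b
  half b h = lin 1 h (solve (Q ∷ b ∷ []))
  -- The blocks have Q, b and Q edges, and `small` says s < 2Q. Each inequality settles one pair of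
  -- blocks of consecutive classes in `link`; the only missing pair, last block to first block, has
  -- no adjacent edges.
  module Link (s : ℕ) (small : suc s ≤ Q + Q) where
    fits : ∀ b → s ≤ Q + b + Q
    fits b = lin (suc b) small (solve (Q ∷ b ∷ s ∷ []))
    fromA : ∀ {lw p p'} b → lw ≡ Q + b + Q → Q ≤ b → p < Q → p + s ≤ lw + p'
    fromA {p = p} {p'} b refl h₁ h₂ = lin (2 + p') (+-mono-≤ (+-mono-≤ h₁ h₂) small) (solve (Q ∷ p ∷ s ∷ b ∷ p' ∷ []))
    B→A : ∀ {la lw p p' q w₁ v} b → la ≡ Q → lw ≡ Q + b + Q → p ≡ la + q → suc (q + w₁) ≡ b → suc (p' + v) ≡ Q → v ≤ w₁ + 1 → p + s ≤ lw + p'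
    B→A {p' = p'} {q} {w₁} {v} b refl refl refl refl e₂ h =
      lin 0 (+-mono-≤ (+-mono-≤ small h) (≤-reflexive (sym e₂))) (solve (Q ∷ q ∷ w₁ ∷ s ∷ p' ∷ v ∷ []))
    B→BZ : ∀ {la la' lw p p' q q'} b → la ≡ Q → la' ≡ Q → lw ≡ Q + b + Q → p ≡ la + q → p' ≡ la' + q' → q < b → p + s ≤ lw + p'
    B→BZ {q = q} {q'} b refl refl refl refl refl h = lin (2 + q') (+-mono-≤ small h) (solve (Q ∷ b ∷ s ∷ q ∷ q' ∷ []))
    Z→B : ∀ {la la' lb lw p p' q q' j} b → la ≡ Q → la' ≡ Q → lb ≡ b → lw ≡ Q + b + Q → p ≡ la + q → q ≡ lb + j → p' ≡ la' + q' → j ≤ q' + 1 → p + s ≤ lw + p'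
    Z→B {q' = q'} {j} b refl refl refl refl refl refl refl h = lin 0 (+-mono-≤ small h) (solve (Q ∷ b ∷ j ∷ s ∷ q' ∷ []))
    Z→Z : ∀ {la la' lb lb' lw p p' q q' q″ j} b b' → la ≡ Q → la' ≡ Q → lb ≡ b → lb' ≡ b' → lw ≡ Q + b + Q → p ≡ la + q → q ≡ lb + j → p' ≡ la' + q' →
          q' ≡ lb' + q″ → Q ≤ b' → j < Q → p + s ≤ lw + p'
    Z→Z {q″ = q″} {j} b b' refl refl refl refl refl refl refl refl refl h₁ h₂ =
      lin (2 + q″) (+-mono-≤ (+-mono-≤ h₁ h₂) small) (solve (Q ∷ b ∷ b' ∷ j ∷ s ∷ q″ ∷ []))

-- Each class is laid out in three blocks A B Z with |A| = |Z| = Q.  No edge of A meets the Z of the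
-- previous class, and B is ordered against the next A and against the previous Z.
module Thirds {n K} (G : Graph n) (c : Fin (m G) → Fin (suc K)) (proper : Proper G c)
              (Q : ℕ) (large : ∀ i → suc (Q + Q + Q) ≤ length (Edges.Colour.cls G c proper i)) where
  open Edges G
  open Scheme G c proper

  open Growth (grow Q (λ i → ≤-trans (≤-trans (m≤m+n Q Q) (≤-trans (m≤m+n (Q + Q) Q) (n≤1+n _))) (large i)))

  zf : Fin (suc K) → E → Bool
  zf i = z (toℕ i)

  -- Only the passage from the last class to the first can leave the grown sets.
  exc : Fin (suc K) → Maybe E
  exc i with suc (toℕ i) <? suc K
  ... | yes _ = nothing
  ... | no _  = w

  zf-near : ∀ i → Near i (nxt i) (zf i) (zf (nxt i)) (exc i)
  zf-near i = subst (λ a → Near a (nxt i) (zf i) (zf (nxt i)) (exc i)) (col-toℕ i) (near (toℕ i) follow)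
    where
    follow : ∀ e → c e ≡ col (toℕ i) → zf i e ≡ true → ∀ f → φ (toℕ i) e ≡ just f → zf (nxt i) f ≡ true ⊎ just f ≡ exc i
    follow e ce ze f q with suc (toℕ i) <? suc K
    ... | yes l = inj₁ (subst (λ t → z t f ≡ true) (sym (trans (toℕ-col (suc (toℕ i))) (m<n⇒m%n≡m l))) (step (toℕ i) e ce ze f q))
    ... | no l with toℕ i | ≤-antisym (≤-pred (toℕ<n i)) (≤-pred (≮⇒≥ l)) | toℕ-col {K} (suc (toℕ i))
    ...   | .K | refl | t = subst (λ t → z t f ≡ true ⊎ just f ≡ w) (sym (trans t (n%n≡0 (suc K)))) (loop e ce ze f q)

  Zl Cl U Tl A° B° : Fin (suc K) → List E
  Zl i = filterᵇ (zf i) (cls i)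
  Cl i = filterᵇ (not ∘ zf i) (cls i)

  meets : Fin (suc K) → E → Bool
  meets i f = ⌊ 1 ≤? cnt (λ e → nb e f) (Zl (prv i)) ⌋

  U i  = filterᵇ (not ∘ meets i) (Cl i)
  Tl i = filterᵇ (meets i) (Cl i)
  A° i = take Q (U i)
  B° i = drop Q (U i) ++ Tl i

  length-Zl : ∀ i → length (Zl i) ≡ Q
  length-Zl i = trans (length-fil (zf i) (cls i)) (trans (cong (λ j → cnt (zf i) (cls j)) (sym (col-toℕ i))) (size (toℕ i)))

  Zl⁻ : ∀ {i e} → e ∈ Zl i → c e ≡ i × zf i e ≡ true
  Zl⁻ {i} h = cls⁻ (proj₁ (∈-fil⁻ (zf i) (cls i) h)) , proj₂ (∈-fil⁻ (zf i) (cls i) h)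

  Cl⁻ : ∀ {i e} → e ∈ Cl i → c e ≡ i × zf i e ≡ false
  Cl⁻ {i} h = cls⁻ (proj₁ (∈-fil⁻ _ (cls i) h)) , not-true (proj₂ (∈-fil⁻ _ (cls i) h))

  Zl-unique : ∀ i → Unique (Zl i)
  Zl-unique i = unique-fil (zf i) (cls-unique i)

  Cl-unique : ∀ i → Unique (Cl i)
  Cl-unique i = unique-fil _ (cls-unique i)

  AB↭C : ∀ i → A° i ++ B° i ↭ Cl i
  AB↭C i = ptrans (↭-reflexive (trans (sym (++-assoc (A° i) _ _)) (cong (_++ Tl i) (take++drop≡id Q (U i)))))
             (ptrans (↭-++-comm (U i) (Tl i)) (fil-↭ (meets i) (Cl i)))

  AB⊆C : ∀ i {e} → e ∈ A° i ⊎ e ∈ B° i → e ∈ Cl i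
  AB⊆C i (inj₁ h) = ∈-resp-↭ (AB↭C i) (∈-++⁺ˡ h)
  AB⊆C i (inj₂ h) = ∈-resp-↭ (AB↭C i) (∈-++⁺ʳ (A° i) h)

  ABZ↭cls : ∀ i → A° i ++ B° i ++ Zl i ↭ cls i
  ABZ↭cls i = ptrans (↭-reflexive (sym (++-assoc (A° i) _ _)))
    (ptrans (++⁺ʳ (Zl i) (AB↭C i)) (ptrans (↭-++-comm (Cl i) (Zl i)) (fil-↭ (zf i) (cls i))))

  length-Cl : ∀ i → length (cls i) ≡ Q + length (Cl i)
  length-Cl i = trans (sym (↭-length (fil-↭ (zf i) (cls i)))) (trans (length-++ (Zl i)) (cong (_+ length (Cl i)) (length-Zl i)))

  -- By `near-out` each of the Q edges of the previous Z meets at most one edge outside the next Z,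
  -- and the exceptional edge adds one. So a class of 3Q + 1 edges, after removal of its own Z,
  -- still has Q edges that the previous Z does not meet; A is taken from these.
  few-met : ∀ i → cnt (meets (nxt i)) (Cl (nxt i)) ≤ suc Q
  few-met i = begin
    cnt (meets j) (Cl j)                                                   ≤⟨ cnt-∨ (meets j) (is x) (λ f → not (is x f) ∧ meets j f) (Cl j) split ⟩
    cnt (is x) (Cl j) + cnt (λ f → not (is x f) ∧ meets j f) (Cl j)        ≤⟨ +-mono-≤ (cnt-is x (Cl-unique j)) (Σl-mono (Cl j) pointwise) ⟩
    1 + Σl (λ f → cnt (λ e → not (is x f) ∧ nb e f) (Zl i)) (Cl j)         ≡⟨ cong suc (Σl-swap (λ f e → b2n (not (is x f) ∧ nb e f)) (Cl j) (Zl i)) ⟩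
    1 + Σl (λ e → cnt (λ f → not (is x f) ∧ nb e f) (Cl j)) (Zl i)         ≤⟨ +-monoʳ-≤ 1 (Σl-bound _ 1 (Zl i) once) ⟩
    1 + 1 * length (Zl i)                                                  ≡⟨ cong suc (trans (*-identityˡ _) (length-Zl i)) ⟩
    suc Q                                                                  ∎
    where
    open ≤-Reasoning
    open Near (zf-near i)
    j = nxt i
    x = exc i
    split : ∀ f → f ∈ Cl j → meets j f ≡ true → is x f ≡ true ⊎ not (is x f) ∧ meets j f ≡ true
    split f _ h with is x f
    ... | true  = inj₁ refl
    ... | false = inj₂ h
    pointwise : ∀ f → f ∈ Cl j → b2n (not (is x f) ∧ meets j f) ≤ cnt (λ e → not (is x f) ∧ nb e f) (Zl i)
    pointwise f _ with is x f | meets j f in eq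
    ... | true  | _     = z≤n
    ... | false | false = z≤n
    ... | false | true  = subst (λ k → 1 ≤ cnt (λ e → nb e f) (Zl k)) (prv-nxt i) (⌊⌋-true (1 ≤? _) eq)
    once : ∀ e → e ∈ Zl i → cnt (λ f → not (is x f) ∧ nb e f) (Cl j) ≤ 1
    once e h = cnt≤1 _ (Cl-unique j) (λ f f' p q a b →
      near-out (proj₁ (Zl⁻ h)) (proj₂ (Zl⁻ h)) (proj₁ (Cl⁻ p)) (proj₁ (Cl⁻ q)) (proj₂ (Cl⁻ p)) (proj₂ (Cl⁻ q))
        (is-false x (not-true (proj₁ (∧-true a)))) (is-false x (not-true (proj₁ (∧-true b))))
        (nb⁻ (proj₂ (∧-true a))) (nb⁻ (proj₂ (∧-true b))))

  nxt-prv : ∀ i → nxt (prv {K} i) ≡ i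
  nxt-prv i = trans (nxt-col (toℕ i + K)) (trans (cong col (sym (+-suc (toℕ i) K)))
    (trans (cong col (+-comm (toℕ i) (suc K))) (trans (col-per (toℕ i)) (col-toℕ i))))

  length-A : ∀ i → length (A° i) ≡ Q
  length-A i = length-take≤ Q (U i) (subst (λ j → Q ≤ length (U j)) (nxt-prv i) (enough (prv i)))
    where
    enough : ∀ k → Q ≤ length (U (nxt k))
    enough k = ThirdsArith.enough Q (length (U j)) (length (Tl j)) (length (Cl j)) (length (cls j))
        (trans (sym (length-++ (Tl j))) (↭-length (fil-↭ (meets j) (Cl j)))) (length-Cl j)
        (≤-trans (≤-reflexive (length-fil (meets j) (Cl j))) (few-met k)) (large j)
      where
      j = nxt k

  length-B : ∀ i → length (cls i) ≡ Q + length (B° i) + Q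
  length-B i = trans (sym (↭-length (ABZ↭cls i))) (trans (length-++ (A° i)) (trans (cong₂ _+_ (length-A i)
    (trans (length-++ (B° i)) (cong (length (B° i) +_) (length-Zl i)))) (sym (+-assoc Q _ Q))))

  Q≤B : ∀ i → Q ≤ length (B° i)
  Q≤B i = ThirdsArith.half Q (length (B° i)) (subst (suc (Q + Q + Q) ≤_) (length-B i) (large i))

  sub-degree : ∀ {xs ys zs : List E} (p : E → Bool) → xs ++ zs ↭ ys → cnt p xs ≤ cnt p ys
  sub-degree {xs} {zs = zs} p q = ≤-trans (m≤m+n _ _) (≤-reflexive (trans (sym (Σl-++ _ xs zs)) (Σl-↭ _ q)))

  A-degree : ∀ i p → cnt p (A° i) ≤ cnt p (cls i)
  A-degree i p = sub-degree {xs = A° i} {zs = B° i ++ Zl i} p (ABZ↭cls i)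

  B-degree : ∀ i p → cnt p (B° i) ≤ cnt p (cls i)
  B-degree i p = ≤-trans (m≤n+m _ (cnt p (A° i))) (≤-trans (≤-reflexive (sym (Σl-++ _ (A° i) (B° i))))
    (sub-degree {xs = A° i ++ B° i} {zs = Zl i} p (ptrans (↭-reflexive (++-assoc (A° i) _ _)) (ABZ↭cls i))))

  -- B has at least Q edges and the next A has Q, so a budget of 1 satisfies the size condition of
  -- `greedy`. This fixes the order of B, and the previous Z has to adapt to it.
  orderB : ∀ i → ∃ λ W → W ↭ B° i × Slow nb 1 W (A° (nxt i))
  orderB i = greedy nb 1 (B° i) (A° (nxt i))
    (λ e _ → ≤-trans (A-degree (nxt i) (nb e)) (degree≤2 e (nxt i)))
    (λ f _ → ≤-trans (B-degree i (λ e → nb e f)) (degree≤2' f i))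
    (≤-trans (≤-reflexive (cong suc (length-A (nxt i)))) (≤-trans (s≤s (Q≤B i)) (≤-reflexive (+-comm 1 _))))

  -- B and the next A are compared from their ends, which is why both are reversed; B and the
  -- previous Z are compared from their fronts.
  Wb Af Bf Zf W° : Fin (suc K) → List E
  Wb i = proj₁ (orderB i)
  Af i = reverse (touch nb (Wb (prv i)) (A° i))
  Bf i = reverse (Wb i)
  Zf i = touch nb (Bf (nxt i)) (Zl i)
  W° i = Af i ++ Bf i ++ Zf i

  Af↭ : ∀ i → Af i ↭ A° i
  Af↭ i = ptrans (↭-reverse _) (touch-↭ nb (Wb (prv i)) (A° i))

  Bf↭ : ∀ i → Bf i ↭ B° i
  Bf↭ i = ptrans (↭-reverse _) (proj₁ (proj₂ (orderB i)))

  Zf↭ : ∀ i → Zf i ↭ Zl i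
  Zf↭ i = touch-↭ nb (Bf (nxt i)) (Zl i)

  W°↭ : ∀ i → W° i ↭ cls i
  W°↭ i = ptrans (++⁺ (Af↭ i) (++⁺ (Bf↭ i) (Zf↭ i))) (ABZ↭cls i)

  -- By `near-in` an edge of B meets at most one edge of the previous Z, and the single exception at
  -- most two. By `slow-Σ` a budget of 1 is enough for every order of B, in particular for the one
  -- that `orderB` dictates.
  slowZ : ∀ i → Slow nb 1 (Bf (nxt i)) (Zl i)
  slowZ i = slow-Σ nb 1 (Bf (nxt i)) (Zl i) (≤-trans s₁ (≤-trans s₂ s₃))
    where
    open Near (zf-near i)
    s₂ : cnt (is (exc i)) (Bf (nxt i)) ≤ cnt (is (exc i)) (B° (nxt i))
    s₂ = ≤-reflexive (Σl-↭ _ (Bf↭ (nxt i)))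
    s₃ : cnt (is (exc i)) (B° (nxt i)) ≤ 1
    s₃ = ≤-trans (B-degree (nxt i) (is (exc i))) (cnt-is (exc i) (cls-unique (nxt i)))
    sub : ∀ f → cnt (nb f) (Zl i) ≤ 2
    sub f = ≤-trans (cnt-fil≤ (nb f) (zf i) (cls i)) (degree≤2 f i)
    excess : ∀ f → f ∈ Bf (nxt i) → cnt (nb f) (Zl i) ∸ 1 ≤ b2n (is (exc i) f)
    excess f h = by (is (exc i) f) refl
      where
      fC : f ∈ Cl (nxt i)
      fC = AB⊆C (nxt i) (inj₂ (∈-resp-↭ (Bf↭ (nxt i)) h))
      by : ∀ b → is (exc i) f ≡ b → cnt (nb f) (Zl i) ∸ 1 ≤ b2n b
      by true  eq = ∸-monoˡ-≤ 1 (sub f)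
      by false eq = ∸-monoˡ-≤ 1 (cnt≤1 (nb f) (Zl-unique i) (λ e e' p q a b →
        near-in (proj₁ (Cl⁻ fC)) (proj₂ (Cl⁻ fC)) (is-false (exc i) eq) (proj₁ (Zl⁻ p)) (proj₁ (Zl⁻ q)) (proj₂ (Zl⁻ p)) (proj₂ (Zl⁻ q))
          (adj-sym (nb⁻ a)) (adj-sym (nb⁻ b))))
    s₁ : Σl (λ f → cnt (nb f) (Zl i) ∸ 1) (Bf (nxt i)) ≤ cnt (is (exc i)) (Bf (nxt i))
    s₁ = Σl-mono (Bf (nxt i)) excess

  module _ (s : ℕ) (small : suc s ≤ Q + Q) where
    open ThirdsArith.Link Q s small

    lenW : ∀ i → length (W° i) ≡ Q + length (B° i) + Q
    lenW i = trans (↭-length (W°↭ i)) (length-B i)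

    lenAf : ∀ i → length (Af i) ≡ Q
    lenAf i = trans (↭-length (Af↭ i)) (length-A i)

    lenBf : ∀ i → length (Bf i) ≡ length (B° i)
    lenBf i = ↭-length (Bf↭ i)

    lenZf : ∀ i → length (Zf i) ≡ Q
    lenZf i = trans (↭-length (Zf↭ i)) (length-Zl i)

    link : ∀ i {p p' e f} → At (W° i) p e → At (W° (nxt i)) p' f → Adjacent G e f → p + s ≤ length (W° i) + p'
    link i {p} {p'} {e} {f} a b adj = split (At-++⁻ (Af i) a) (At-++⁻ (Af (nxt i)) b)
      where
      Goal = p + s ≤ length (W° i) + p'
      InBZ = λ j x r → ∃ λ q → r ≡ length (Af j) + q × At (Bf j ++ Zf j) q x
      noZA : e ∈ Zl i → f ∈ U (nxt i) → ⊥
      noZA eZ fU = true≢false (nb⁺ adj) (cnt-zero⁻ (λ e → nb e f) {x = e} none eZ)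
        where
        none : cnt (λ e → nb e f) (Zl i) ≡ 0
        none = n≤0⇒n≡0 (≤-pred (≰⇒> (⌊⌋-false (1 ≤? _) (subst (λ k → ⌊ 1 ≤? cnt (λ e → nb e f) (Zl k) ⌋ ≡ false) (prv-nxt i)
          (not-true (proj₂ (∈-fil⁻ _ (Cl (nxt i)) fU)))))))
      next = touch nb (Wb i) (A° (nxt i))
      ba : ∀ q → p ≡ length (Af i) + q → (∃ λ w₁ → At (Wb i) w₁ e × suc (q + w₁) ≡ length (Wb i)) →
           (∃ λ v → At next v f × suc (p' + v) ≡ length next) → Goal
      ba q ep (w₁ , a₄ , e₁) (v , b₂ , e₂) =
        B→A (length (B° i)) (lenAf i) (lenW i) ep (trans e₁ (↭-length (proj₁ (proj₂ (orderB i)))))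
          (trans e₂ (trans (↭-length (touch-↭ nb (Wb i) (A° (nxt i)))) (length-A (nxt i))))
          (touch-late nb 1 (Wb i) (A° (nxt i)) (proj₂ (proj₂ (orderB i))) a₄ b₂ (nb⁺ adj))
      zz : ∀ q q' j → p ≡ length (Af i) + q → q ≡ length (Bf i) + j → p' ≡ length (Af (nxt i)) + q' → At (Zf i) j e →
           At (Bf (nxt i)) q' f ⊎ (∃ λ q″ → q' ≡ length (Bf (nxt i)) + q″ × At (Zf (nxt i)) q″ f) → Goal
      zz q q' j ep eq ep' a₃ (inj₁ b₂) = Z→B (length (B° i)) (lenAf i) (lenAf (nxt i)) (lenBf i) (lenW i) ep eq ep'
        (touch-late nb 1 (Bf (nxt i)) (Zl i) (slowZ i) b₂ a₃ (nb⁺ (adj-sym adj)))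
      zz q q' j ep eq ep' a₃ (inj₂ (q″ , eq' , b₂)) =
        Z→Z (length (B° i)) (length (B° (nxt i))) (lenAf i) (lenAf (nxt i)) (lenBf i) (lenBf (nxt i)) (lenW i)
          ep eq ep' eq' (Q≤B (nxt i)) (subst (j <_) (lenZf i) (At-< a₃))
      tail : ∀ q → p ≡ length (Af i) + q → At (Bf i) q e ⊎ (∃ λ j → q ≡ length (Bf i) + j × At (Zf i) j e) →
             At (Af (nxt i)) p' f ⊎ InBZ (nxt i) f p' → Goal
      tail q ep (inj₁ a₃) (inj₁ b₁) = ba q ep (At-reverse (Wb i) a₃)
        (At-reverse next (subst (λ k → At (reverse (touch nb (Wb k) (A° (nxt i)))) p' f) (prv-nxt i) b₁))
      tail q ep (inj₁ a₃) (inj₂ (q' , ep' , b₁)) =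
        B→BZ (length (B° i)) (lenAf i) (lenAf (nxt i)) (lenW i) ep ep' (subst (q <_) (lenBf i) (At-< a₃))
      tail q ep (inj₂ (j , eq , a₃)) (inj₁ b₁) =
        ⊥-elim (noZA (∈-resp-↭ (Zf↭ i) (At-∈ a₃)) (∈-take Q (U (nxt i)) (∈-resp-↭ (Af↭ (nxt i)) (At-∈ b₁))))
      tail q ep (inj₂ (j , eq , a₃)) (inj₂ (q' , ep' , b₁)) = zz q q' j ep eq ep' a₃ (At-++⁻ (Bf (nxt i)) b₁)
      split : At (Af i) p e ⊎ InBZ i e p → At (Af (nxt i)) p' f ⊎ InBZ (nxt i) f p' → Goal
      split (inj₁ a₁) _ = fromA (length (B° i)) (lenW i) (Q≤B i) (subst (p <_) (lenAf i) (At-< a₁))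
      split (inj₂ (q , ep , a₂)) t = tail q ep (At-++⁻ (Bf i) a₂) t

    ordering : Σ (Ordering G) λ ℓ → Good G ℓ s
    ordering = arrange s W° W°↭ (λ i → subst (s ≤_) (sym (lenW i)) (fits (length (B° i)))) link

-- Alternating paths of two matchings

Σ-invol : ∀ {n} (t : Fin n → Fin n) → Involution t → ∀ (f : Fin n → ℕ) → Σl (f ∘ t) (allFin n) ≡ Σl f (allFin n)
Σ-invol {n} t it f = begin
  Σl (f ∘ t) V                                        ≡⟨ Σl-cong V (λ k _ → sym (pick k)) ⟩
  Σl (λ k → Σl (λ l → b2n ⌊ l ≟F t k ⌋ * f l) V) V    ≡⟨ Σl-swap (λ k l → b2n ⌊ l ≟F t k ⌋ * f l) V V ⟩
  Σl (λ l → Σl (λ k → b2n ⌊ l ≟F t k ⌋ * f l) V) V    ≡⟨ Σl-cong V (λ l _ → gather l) ⟩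
  Σl f V                                              ∎
  where
  open ≡-Reasoning
  V = allFin n
  pick : ∀ k → Σl (λ l → b2n ⌊ l ≟F t k ⌋ * f l) V ≡ f (t k)
  pick k = begin
    Σl (λ l → b2n ⌊ l ≟F t k ⌋ * f l) V     ≡⟨ Σl-cong V (λ l _ → aux l) ⟩
    Σl (λ l → f (t k) * b2n ⌊ l ≟F t k ⌋) V ≡⟨ Σl-* (f (t k)) _ V ⟩
    f (t k) * cnt (λ l → ⌊ l ≟F t k ⌋) V    ≡⟨ cong (f (t k) *_) (cnt≡1 _ (allFin⁺ n) (∈-allFin (t k)) (⌊⌋-intro (t k ≟F t k) refl) (λ y _ h → ⌊⌋-true (y ≟F t k) h)) ⟩
    f (t k) * 1                             ≡⟨ *-identityʳ _ ⟩
    f (t k)                                 ∎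
    where
    aux : ∀ l → b2n ⌊ l ≟F t k ⌋ * f l ≡ f (t k) * b2n ⌊ l ≟F t k ⌋
    aux l with l ≟F t k
    ... | yes refl = *-comm 1 (f (t k))
    ... | no _     = sym (*-zeroʳ (f (t k)))
  gather : ∀ l → Σl (λ k → b2n ⌊ l ≟F t k ⌋ * f l) V ≡ f l
  gather l = begin
    Σl (λ k → b2n ⌊ l ≟F t k ⌋ * f l) V ≡⟨ Σl-cong V (λ k _ → *-comm _ (f l)) ⟩
    Σl (λ k → f l * b2n ⌊ l ≟F t k ⌋) V ≡⟨ Σl-* (f l) _ V ⟩
    f l * cnt (λ k → ⌊ l ≟F t k ⌋) V    ≡⟨ cong (f l *_) (cnt≡1 _ (allFin⁺ n) (∈-allFin (t l)) (⌊⌋-intro (l ≟F t (t l)) (sym (it l)))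
                                             (λ y _ h → trans (sym (it y)) (cong t (sym (⌊⌋-true (l ≟F t y) h))))) ⟩
    f l * 1                             ≡⟨ *-identityʳ _ ⟩
    f l                                 ∎

-- A set closed under two matchings a and b that contains u, a vertex missed by b, and at most one
-- further vertex w missed by a or b: the path from u whose edges lie alternately in a and b.
record Chain {n} (a b : Fin n → Fin n) (u : Fin n) : Set where
  field
    on    : Fin n → Bool
    w     : Fin n
    on-u  : on u ≡ true
    on-a  : ∀ v → on (a v) ≡ on v
    on-b  : ∀ v → on (b v) ≡ on v
    ends  : ∀ v → on v ≡ true → a v ≡ v ⊎ b v ≡ v → v ≡ u ⊎ v ≡ w
    short : a u ≡ u → w ≡ u

module Unpair {n} (a : Fin n → Fin n) (ia : Involution a) (x : Fin n) where
  y = a x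

  in? : ∀ u → Dec (u ≡ x ⊎ u ≡ y)
  in? u = (u ≟F x) ⊎-dec (u ≟F y)

  un : Fin n → Fin n
  un u = if ⌊ in? u ⌋ then u else a u

  un-in : ∀ {u} → u ≡ x ⊎ u ≡ y → un u ≡ u
  un-in {u} h rewrite ⌊⌋-intro (in? u) h = refl

  un-out : ∀ {u} → ¬ (u ≡ x ⊎ u ≡ y) → un u ≡ a u
  un-out {u} h rewrite ⌊⌋-no (in? u) h = refl

  stays : ∀ {u} → ¬ (u ≡ x ⊎ u ≡ y) → ¬ (a u ≡ x ⊎ a u ≡ y)
  stays {u} h (inj₁ e) = h (inj₂ (trans (sym (ia u)) (cong a e)))
  stays {u} h (inj₂ e) = h (inj₁ (trans (sym (ia u)) (trans (cong a e) (ia x))))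

  un-inv : Involution un
  un-inv u = by (in? u)
    where
    by : Dec (u ≡ x ⊎ u ≡ y) → un (un u) ≡ u
    by (yes h) = trans (cong un (un-in h)) (un-in h)
    by (no h)  = trans (cong un (un-out h)) (trans (un-out (stays h)) (ia u))

  un-fixed : ∀ {u} → a u ≡ u → un u ≡ u
  un-fixed {u} e = by (in? u)
    where
    by : Dec (u ≡ x ⊎ u ≡ y) → un u ≡ u
    by (yes h) = un-in h
    by (no h)  = trans (un-out h) e

  un-fewer : y ≢ x → cnt (moved un) (allFin n) < cnt (moved a) (allFin n)
  un-fewer ne = go (∈-extract (∈-allFin x))
    where
    go : (∃ λ ys → allFin n ↭ x ∷ ys) → cnt (moved un) (allFin n) < cnt (moved a) (allFin n)
    go (ys , p) = begin-strict
      cnt (moved un) (allFin n)            ≡⟨ Σl-↭ _ p ⟩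
      b2n (moved un x) + cnt (moved un) ys ≡⟨ cong (λ b → b2n (not b) + cnt (moved un) ys) (⌊⌋-intro (un x ≟F x) (un-in (inj₁ refl))) ⟩
      cnt (moved un) ys                    ≤⟨ cnt-mono (moved un) (moved a) ys (λ u _ h → moved-intro a (λ e → moved-true un h (un-fixed e))) ⟩
      cnt (moved a) ys                     <⟨ ≤-refl ⟩
      1 + cnt (moved a) ys                 ≡⟨ cong (λ b → b2n b + cnt (moved a) ys) (sym (moved-intro a ne)) ⟩
      b2n (moved a x) + cnt (moved a) ys   ≡⟨ sym (Σl-↭ _ p) ⟩
      cnt (moved a) (allFin n)             ∎
      where open ≤-Reasoning

∨-cong-true : ∀ {a b : Bool} → (a ≡ true → b ≡ true) → (b ≡ true → a ≡ true) → a ≡ b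
∨-cong-true {true}  {b}     h k = sym (h refl)
∨-cong-true {false} {true}  h k = k refl
∨-cong-true {false} {false} h k = refl

abstract
  -- Deleting the edges u u₁ of a and u₁ u₂ of b leaves a shorter chain from u₂, which the new b
  -- misses. The field `short` is there for this induction: u₂ is an end of the shorter chain but
  -- may be an end of the longer one only as its far end, and it is that far end if a misses it.
  chain : ∀ {n} (a b : Fin n → Fin n) → Involution a → Involution b → ∀ u → b u ≡ u → Chain a b u
  chain {n} a b ia ib u bu = go _ a b ia ib u bu ≤-refl
    where
    single : ∀ (a b : Fin n → Fin n) → Involution a → Involution b → ∀ u → a u ≡ u → b u ≡ u → Chain a b u
    single a b ia ib u au bu = record
      { on = λ v → ⌊ v ≟F u ⌋ ; w = u ; on-u = ⌊⌋-intro (u ≟F u) refl ; on-a = closed a ia au ; on-b = closed b ib bu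
      ; ends = λ v h _ → inj₁ (⌊⌋-true (v ≟F u) h) ; short = λ _ → refl }
      where
      closed : ∀ (a : Fin n → Fin n) → Involution a → a u ≡ u → ∀ v → ⌊ a v ≟F u ⌋ ≡ ⌊ v ≟F u ⌋
      closed a ia au v = ∨-cong-true
        (λ h → ⌊⌋-intro (v ≟F u) (trans (sym (ia v)) (trans (cong a (⌊⌋-true (a v ≟F u) h)) au)))
        (λ h → ⌊⌋-intro (a v ≟F u) (trans (cong a (⌊⌋-true (v ≟F u) h)) au))
    go : ∀ k (a b : Fin n → Fin n) → Involution a → Involution b → ∀ u → b u ≡ u → cnt (moved a) (allFin n) ≤ k → Chain a b u
    go k a b ia ib u bu h with a u ≟F u
    ... | yes au = single a b ia ib u au bu
    go zero a b ia ib u bu h | no au = ⊥-elim (1+n≰n (≤-trans (cnt-pos (moved a) (∈-allFin u) (moved-intro a au)) h))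
    go (suc k) a b ia ib u bu h | no au with b (a u) ≟F a u
    ... | yes bu₁ = record
      { on = on ; w = a u ; on-u = ⌊⌋-intro (U.in? u) (inj₁ refl)
      ; on-a = λ v → ∨-cong-true (λ e → ⌊⌋-intro (U.in? v) (back-a v (⌊⌋-true (U.in? (a v)) e))) (λ e → ⌊⌋-intro (U.in? (a v)) (fwd-a v (⌊⌋-true (U.in? v) e)))
      ; on-b = λ v → ∨-cong-true (λ e → ⌊⌋-intro (U.in? v) (back-b v (⌊⌋-true (U.in? (b v)) e))) (λ e → ⌊⌋-intro (U.in? (b v)) (fwd-b v (⌊⌋-true (U.in? v) e)))
      ; ends = λ v e _ → ⌊⌋-true (U.in? v) e ; short = λ e → e }
      where
      module U = Unpair a ia u
      on : Fin n → Bool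
      on = λ v → ⌊ U.in? v ⌋
      fwd-a : ∀ v → v ≡ u ⊎ v ≡ a u → a v ≡ u ⊎ a v ≡ a u
      fwd-a v (inj₁ refl) = inj₂ refl
      fwd-a v (inj₂ refl) = inj₁ (ia u)
      back-a : ∀ v → a v ≡ u ⊎ a v ≡ a u → v ≡ u ⊎ v ≡ a u
      back-a v e = subst (λ z → z ≡ u ⊎ z ≡ a u) (ia v) (fwd-a (a v) e)
      fwd-b : ∀ v → v ≡ u ⊎ v ≡ a u → b v ≡ u ⊎ b v ≡ a u
      fwd-b v (inj₁ refl) = inj₁ bu
      fwd-b v (inj₂ refl) = inj₂ bu₁
      back-b : ∀ v → b v ≡ u ⊎ b v ≡ a u → v ≡ u ⊎ v ≡ a u
      back-b v e = subst (λ z → z ≡ u ⊎ z ≡ a u) (ib v) (fwd-b (b v) e)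
    ... | no bu₁ = record
      { on = on ; w = C.w ; on-u = ⌊⌋-intro (on? u) (inj₁ refl)
      ; on-a = λ v → ∨-cong-true (λ e → ⌊⌋-intro (on? v) (subst Member (ia v) (fwd-a (a v) (⌊⌋-true (on? (a v)) e)))) (λ e → ⌊⌋-intro (on? (a v)) (fwd-a v (⌊⌋-true (on? v) e)))
      ; on-b = λ v → ∨-cong-true (λ e → ⌊⌋-intro (on? v) (subst Member (ib v) (fwd-b (b v) (⌊⌋-true (on? (b v)) e)))) (λ e → ⌊⌋-intro (on? (b v)) (fwd-b v (⌊⌋-true (on? v) e)))
      ; ends = λ v e d → fin v (⌊⌋-true (on? v) e) d ; short = λ e → ⊥-elim (au e) }
      where
      u₁ u₂ : Fin n
      u₁ = a u
      u₂ = b u₁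
      module A = Unpair a ia u
      module B = Unpair b ib u₁
      module C = Chain (go k A.un B.un A.un-inv B.un-inv u₂ (B.un-in (inj₂ refl)) (≤-pred (≤-trans (A.un-fewer au) h)))
      Member : Fin n → Set
      Member v = v ≡ u ⊎ v ≡ u₁ ⊎ C.on v ≡ true
      on? : ∀ v → Dec (Member v)
      on? v = (v ≟F u) ⊎-dec ((v ≟F u₁) ⊎-dec (C.on v Data.Bool.≟ true))
      on : Fin n → Bool
      on = λ v → ⌊ on? v ⌋
      fwd-a : ∀ v → Member v → Member (a v)
      fwd-a v (inj₁ refl) = inj₂ (inj₁ refl)
      fwd-a v (inj₂ (inj₁ refl)) = inj₁ (ia u)
      fwd-a v (inj₂ (inj₂ e)) = by (A.in? v)
        where
        by : Dec (v ≡ u ⊎ v ≡ u₁) → Member (a v)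
        by (yes (inj₁ refl)) = inj₂ (inj₁ refl)
        by (yes (inj₂ refl)) = inj₁ (ia u)
        by (no o) = inj₂ (inj₂ (trans (cong C.on (sym (A.un-out o))) (trans (C.on-a v) e)))
      fwd-b : ∀ v → Member v → Member (b v)
      fwd-b v (inj₁ refl) = inj₁ bu
      fwd-b v (inj₂ (inj₁ refl)) = inj₂ (inj₂ C.on-u)
      fwd-b v (inj₂ (inj₂ e)) = by (B.in? v)
        where
        by : Dec (v ≡ u₁ ⊎ v ≡ u₂) → Member (b v)
        by (yes (inj₁ refl)) = inj₂ (inj₂ C.on-u)
        by (yes (inj₂ refl)) = inj₂ (inj₁ (ib u₁))
        by (no o) = inj₂ (inj₂ (trans (cong C.on (sym (B.un-out o))) (trans (C.on-b v) e)))
      u₂≢u₁ : u₂ ≢ u₁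
      u₂≢u₁ = bu₁
      fin : ∀ v → Member v → a v ≡ v ⊎ b v ≡ v → v ≡ u ⊎ v ≡ C.w
      fin v (inj₁ e) d = inj₁ e
      fin v (inj₂ (inj₁ refl)) (inj₁ e) = ⊥-elim (au (trans (sym e) (ia u)))
      fin v (inj₂ (inj₁ refl)) (inj₂ e) = ⊥-elim (bu₁ e)
      fin v (inj₂ (inj₂ e)) d = last d (C.ends v e (Data.Sum.map A.un-fixed B.un-fixed d))
        where
        last : a v ≡ v ⊎ b v ≡ v → v ≡ u₂ ⊎ v ≡ C.w → v ≡ u ⊎ v ≡ C.w
        last d (inj₂ q) = inj₂ q
        last (inj₁ q) (inj₁ refl) = inj₂ (sym (C.short (A.un-fixed q)))
        last (inj₂ q) (inj₁ refl) = ⊥-elim (u₂≢u₁ (trans (sym q) (ib u₁)))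

cnt-delete : ∀ {n} (p : Fin n → Bool) {x} → p x ≡ true →
             suc (cnt (λ y → p y ∧ not ⌊ y ≟F x ⌋) (allFin n)) ≡ cnt p (allFin n)
cnt-delete {n} p {x} e = trans (sym (cnt-insert _ (allFin⁺ n) (∈-allFin x) (off x)))
  (Σl-cong (allFin n) (λ y _ → cong b2n (aux y)))
  where
  off : ∀ x → p x ∧ not ⌊ x ≟F x ⌋ ≡ false
  off x rewrite ⌊⌋-intro (x ≟F x) refl with p x
  ... | true  = refl
  ... | false = refl
  aux : ∀ y → (p y ∧ not ⌊ y ≟F x ⌋) ∨ ⌊ y ≟F x ⌋ ≡ p y
  aux y with y ≟F x
  aux y | yes refl rewrite e = refl
  aux y | no _ with p y
  ... | true  = refl
  ... | false = refl

cnt-third : ∀ {n} (p : Fin n → Bool) a b → 3 ≤ cnt p (allFin n) → ∃ λ v → p v ≡ true × v ≢ a × v ≢ b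
cnt-third {n} p a b h = done (cnt-witness q V (+-cancelˡ-≤ 2 1 _ (begin
  3                                                                          ≤⟨ h ⟩
  cnt p V                                                                    ≤⟨ cnt-∨ p (λ v → ⌊ v ≟F a ⌋ ∨ ⌊ v ≟F b ⌋) q V split ⟩
  cnt (λ v → ⌊ v ≟F a ⌋ ∨ ⌊ v ≟F b ⌋) V + cnt q V                            ≤⟨ +-monoˡ-≤ (cnt q V) (cnt-∨ _ (λ v → ⌊ v ≟F a ⌋) (λ v → ⌊ v ≟F b ⌋) V (λ v _ e → ∨-true e)) ⟩
  cnt (λ v → ⌊ v ≟F a ⌋) V + cnt (λ v → ⌊ v ≟F b ⌋) V + cnt q V              ≤⟨ +-monoˡ-≤ (cnt q V) (+-mono-≤ (one a) (one b)) ⟩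
  2 + cnt q V                                                                ∎)))
  where
  open ≤-Reasoning
  V = allFin n
  q : Fin n → Bool
  q v = p v ∧ not (⌊ v ≟F a ⌋ ∨ ⌊ v ≟F b ⌋)
  one : ∀ c → cnt (λ v → ⌊ v ≟F c ⌋) V ≤ 1
  one c = cnt≤1 _ (allFin⁺ n) (λ x y _ _ e f → trans (⌊⌋-true (x ≟F c) e) (sym (⌊⌋-true (y ≟F c) f)))
  split : ∀ v → v ∈ V → p v ≡ true → ⌊ v ≟F a ⌋ ∨ ⌊ v ≟F b ⌋ ≡ true ⊎ q v ≡ true
  split v _ e with ⌊ v ≟F a ⌋ ∨ ⌊ v ≟F b ⌋
  ... | true  = inj₁ refl
  ... | false = inj₂ (∧-intro e refl)
  done : (∃ λ v → v ∈ V × q v ≡ true) → ∃ λ v → p v ≡ true × v ≢ a × v ≢ b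
  done (v , _ , e) = v , proj₁ (∧-true e) ,
    (λ h → true≢false (trans (cong (_∨ ⌊ v ≟F b ⌋) (⌊⌋-intro (v ≟F a) h)) refl ) (not-true (proj₂ (∧-true e)))) ,
    (λ h → true≢false (⌊⌋-intro (v ≟F b) h) (∨-false (⌊ v ≟F a ⌋) (not-true (proj₂ (∧-true e)))))
    where
    ∨-false : ∀ a {b} → a ∨ b ≡ false → b ≡ false
    ∨-false false h = h

-- Trims the set of colours missing at a vertex to a list of exactly one or two, as the parity
-- argument for stars requires.
subcount : ∀ {n} r (p : Fin n → Bool) → r ≤ cnt p (allFin n) →
           ∃ λ (q : Fin n → Bool) → (∀ v → q v ≡ true → p v ≡ true) × cnt q (allFin n) ≡ r
subcount {n} zero p h = (λ _ → false) , (λ _ ()) , cnt-zero _ (allFin n) (λ _ _ → refl)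
subcount {n} (suc r) p h = add (subcount r p (<⇒≤ h))
  where
  V = allFin n
  add : (∃ λ (q : Fin n → Bool) → (∀ v → q v ≡ true → p v ≡ true) × cnt q V ≡ r) →
        ∃ λ (q : Fin n → Bool) → (∀ v → q v ≡ true → p v ≡ true) × cnt q V ≡ suc r
  add (q , sub , e) = pick (Σl-< (λ v → b2n (q v)) (λ v → b2n (p v)) V (≤-trans (≤-reflexive (cong suc e)) h))
    where
    new : ∀ a b → b2n a < b2n b → a ≡ false × b ≡ true
    new false true _ = refl , refl
    new true true (s≤s ())
    pick : (∃ λ v → v ∈ V × b2n (q v) < b2n (p v)) → _
    pick (x , i , l) = (λ v → q v ∨ ⌊ v ≟F x ⌋) ,
      (λ v k → Data.Sum.[ sub v , (λ t → subst (λ z → p z ≡ true) (sym (⌊⌋-true (v ≟F x) t)) (proj₂ (new _ _ l))) ] (∨-true k)) ,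
      trans (cnt-insert q (allFin⁺ n) i (proj₁ (new _ _ l))) (cong suc e)

-- Kempe changes and Vizing's theorem

module Transpose {K} (i j : Fin K) where
  tr : Fin K → Fin K
  tr k = if ⌊ k ≟F i ⌋ then j else if ⌊ k ≟F j ⌋ then i else k

  tr-i : tr i ≡ j
  tr-i rewrite ⌊⌋-intro (i ≟F i) refl = refl

  tr-j : tr j ≡ i
  tr-j with j ≟F i
  ... | yes e = e
  ... | no _ rewrite ⌊⌋-intro (j ≟F j) refl = refl

  tr-o : ∀ {k} → k ≢ i → k ≢ j → tr k ≡ k
  tr-o {k} p q rewrite ⌊⌋-no (k ≟F i) p | ⌊⌋-no (k ≟F j) q = refl

  tr-case : ∀ k → (k ≡ i × tr k ≡ j) ⊎ (k ≡ j × tr k ≡ i) ⊎ (k ≢ i × k ≢ j × tr k ≡ k)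
  tr-case k with k ≟F i
  ... | yes e = inj₁ (e , refl)
  ... | no p with k ≟F j
  ...   | yes e = inj₂ (inj₁ (e , refl))
  ...   | no q  = inj₂ (inj₂ (p , q , refl))

  tr-inv : ∀ k → tr (tr k) ≡ k
  tr-inv k with tr-case k
  ... | inj₁ (refl , e)        = trans (cong tr e) tr-j
  ... | inj₂ (inj₁ (refl , e)) = trans (cong tr e) tr-i
  ... | inj₂ (inj₂ (_ , _ , e)) = trans (cong tr e) e

-- A proper partial edge colouring of a simple graph, as the family of its colour classes.
record Family (n K : ℕ) : Set where
  field
    μ    : Fin K → Fin n → Fin n
    inv  : ∀ k → Involution (μ k)
    disj : ∀ k l v → μ k v ≡ μ l v → μ k v ≢ v → k ≡ l

-- A Kempe change. At v the new matching k is the old matching `ix v k`. As `on` is closed under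
-- both colours, the two ends of an edge with one of these colours agree on whether to exchange, so
-- the new maps are involutions.
module Swap {n K} (F : Family n K) (i j : Fin K) (on : Fin n → Bool)
            (on-i : ∀ v → on (Family.μ F i v) ≡ on v) (on-j : ∀ v → on (Family.μ F j v) ≡ on v) where
  open Family F
  open Transpose i j public

  ix : Fin n → Fin K → Fin K
  ix v k = if on v then tr k else k

  sw : Fin K → Fin n → Fin n
  sw k v = μ (ix v k) v

  on-ix : ∀ v k → on (sw k v) ≡ on v ⊎ (k ≢ i × k ≢ j)
  on-ix v k with tr-case k
  ... | inj₂ (inj₂ (p , q , _)) = inj₂ (p , q)
  ... | inj₁ (refl , e) with on v in o
  ...   | true  rewrite e = inj₁ (trans (on-j v) o)
  ...   | false = inj₁ (trans (on-i v) o)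
  on-ix v k | inj₂ (inj₁ (refl , e)) with on v in o
  ...   | true  rewrite e = inj₁ (trans (on-i v) o)
  ...   | false = inj₁ (trans (on-j v) o)

  ix-o : ∀ v {k} → k ≢ i → k ≢ j → ix v k ≡ k
  ix-o v p q with on v
  ... | true  = tr-o p q
  ... | false = refl

  ix-on : ∀ {v v'} k → on v ≡ on v' → ix v k ≡ ix v' k
  ix-on k e rewrite e = refl

  ix-inv : ∀ v k → ix v (ix v k) ≡ k
  ix-inv v k with on v
  ... | true  = tr-inv k
  ... | false = refl

  sw-inv : ∀ k → Involution (sw k)
  sw-inv k v = by (on-ix v k)
    where
    by : on (sw k v) ≡ on v ⊎ (k ≢ i × k ≢ j) → sw k (sw k v) ≡ v
    by (inj₁ e) = trans (cong (λ l → μ l (sw k v)) (ix-on {sw k v} {v} k e)) (inv (ix v k) v)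
    by (inj₂ (p , q)) = trans (cong (λ l → μ l (sw k v)) (trans (ix-o (sw k v) p q) (sym (ix-o v p q)))) (inv (ix v k) v)

  family : Family n K
  family = record { μ = sw ; inv = sw-inv ; disj = λ k l v e ne →
    trans (sym (ix-inv v k)) (trans (cong (ix v) (disj (ix v k) (ix v l) v e ne)) (ix-inv v l)) }

  sw-edge : ∀ {a b} → (∃ λ k → μ k a ≡ b) → ∃ λ k → sw k a ≡ b
  sw-edge {a} (k , e) = ix a k , trans (cong (λ l → μ l a) (ix-inv a k)) e

-- Disjointness of the classes at x and u rests on `fresh`: the edge xu has no colour yet.
module Assign {n K} (F : Family n K) (i : Fin K) (x u : Fin n) (x≢u : x ≢ u)
              (fx : Family.μ F i x ≡ x) (fu : Family.μ F i u ≡ u) (fresh : ∀ k → Family.μ F k u ≢ x) where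
  open Family F

  data Place (k : Fin K) (v : Fin n) : Set where
    at-x : k ≡ i → v ≡ x → Place k v
    at-u : k ≡ i → v ≡ u → Place k v
    else : ¬ (k ≡ i × (v ≡ x ⊎ v ≡ u)) → Place k v

  place : ∀ k v → Place k v
  place k v with k ≟F i | v ≟F x | v ≟F u
  ... | no p  | _     | _     = else (λ h → p (proj₁ h))
  ... | yes p | yes q | _     = at-x p q
  ... | yes p | no q  | yes r = at-u p r
  ... | yes p | no q  | no r  = else (λ h → Data.Sum.[ q , r ] (proj₂ h))

  as : Fin K → Fin n → Fin n
  as k v = by (place k v)
    where
    by : Place k v → Fin n
    by (at-x _ _) = u
    by (at-u _ _) = x
    by (else _)   = μ k v

  as-x : as i x ≡ u
  as-x with place i x
  ... | at-x _ _ = refl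
  ... | at-u _ e = ⊥-elim (x≢u e)
  ... | else h   = ⊥-elim (h (refl , inj₁ refl))

  as-u : as i u ≡ x
  as-u with place i u
  ... | at-x _ e = ⊥-elim (x≢u (sym e))
  ... | at-u _ _ = refl
  ... | else h   = ⊥-elim (h (refl , inj₂ refl))

  as-o : ∀ {k v} → ¬ (k ≡ i × (v ≡ x ⊎ v ≡ u)) → as k v ≡ μ k v
  as-o {k} {v} h with place k v
  ... | at-x p q = ⊥-elim (h (p , inj₁ q))
  ... | at-u p q = ⊥-elim (h (p , inj₂ q))
  ... | else _   = refl

  as-inv : ∀ k → Involution (as k)
  as-inv k v = by (place k v)
    where
    by : Place k v → as k (as k v) ≡ v
    by (at-x refl refl) = trans (cong (as i) as-x) as-u
    by (at-u refl refl) = trans (cong (as i) as-u) as-x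
    by (else h) = trans (cong (as k) (as-o h)) (trans (as-o h') (inv k v))
      where
      h' : ¬ (k ≡ i × (μ k v ≡ x ⊎ μ k v ≡ u))
      h' (refl , inj₁ e) = h (refl , inj₁ (trans (sym (inv k v)) (trans (cong (μ k) e) fx)))
      h' (refl , inj₂ e) = h (refl , inj₂ (trans (sym (inv k v)) (trans (cong (μ k) e) fu)))

  unused : ∀ {l v} → v ≡ x ⊎ v ≡ u → ¬ (l ≡ i × (v ≡ x ⊎ v ≡ u)) → as i v ≢ as l v
  unused {l} (inj₁ refl) h e = fresh l (trans (cong (μ l) (trans (sym as-x) (trans e (as-o h)))) (inv l x))
  unused {l} (inj₂ refl) h e = fresh l (trans (sym (trans (sym as-u) (trans e (as-o h)))) refl)

  as-disj : ∀ k l v → as k v ≡ as l v → as k v ≢ v → k ≡ l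
  as-disj k l v e ne = by (place k v) (place l v)
    where
    by : Place k v → Place l v → k ≡ l
    by (at-x refl _) (at-x refl _) = refl
    by (at-x refl _) (at-u refl _) = refl
    by (at-u refl _) (at-x refl _) = refl
    by (at-u refl _) (at-u refl _) = refl
    by (at-x refl q) (else h) = ⊥-elim (unused (inj₁ q) h e)
    by (at-u refl q) (else h) = ⊥-elim (unused (inj₂ q) h e)
    by (else h) (at-x refl q) = ⊥-elim (unused (inj₁ q) h (sym e))
    by (else h) (at-u refl q) = ⊥-elim (unused (inj₂ q) h (sym e))
    by (else h) (else h') = disj k l v (trans (sym (as-o h)) (trans e (as-o h'))) (λ r → ne (trans (as-o h) r))

  family : Family n K
  family = record { μ = as ; inv = as-inv ; disj = as-disj }

  as-edge : ∀ {a b} → a ≢ b → (∃ λ k → μ k a ≡ b) → ∃ λ k → as k a ≡ b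
  as-edge {a} {b} ne (k , e) = k , trans (as-o h) e
    where
    h : ¬ (k ≡ i × (a ≡ x ⊎ a ≡ u))
    h (refl , inj₁ refl) = ne (trans (sym fx) e)
    h (refl , inj₂ refl) = ne (trans (sym fu) e)

ColouredBy : ∀ {n} K → (Fin n → Fin n → Set) → Set
ColouredBy {n} K R = Σ (Family n K) λ F → (∀ k v → Family.μ F k v ≢ v → R v (Family.μ F k v)) ×
                                          (∀ a b → R a b → ∃ λ k → Family.μ F k a ≡ b)

-- Colouring all edges from a set D of vertices to a vertex x (Ehrenfeucht, Faber and Kierstead).  Each
-- u ∈ D has a list L u of two colours missing at u, except that s has a list of one.  If some colour lies
-- in exactly one list it is used there and leaves the palette; otherwise some colour i is in no list and
-- some j is in three, and exchanging them along an alternating path makes i appear.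
module Star {n K : ℕ} (R : Fin n → Fin n → Set) (irr : ∀ a → ¬ R a a) (x : Fin n) where

  V = allFin n
  Cs = allFin K

  record State : Set where
    field
      F : Family n K
    open Family F public
    field
      D        : Fin n → Bool
      P        : Fin K → Bool
      L        : Fin n → Fin K → Bool
      s        : Fin n
      s∈D      : D s ≡ true
      sound    : ∀ k v → μ k v ≢ v → R v (μ k v)
      complete : ∀ a b → R a b → (∃ λ k → μ k a ≡ b) ⊎ (a ≡ x × D b ≡ true) ⊎ (b ≡ x × D a ≡ true)
      D-R      : ∀ u → D u ≡ true → R x u × R u x
      fresh    : ∀ u → D u ≡ true → ∀ k → μ k u ≢ x
      free     : ∀ k → P k ≡ true → μ k x ≡ x
      L-D      : ∀ u k → L u k ≡ true → D u ≡ true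
      L-P      : ∀ u k → L u k ≡ true → P k ≡ true
      L-free   : ∀ u k → L u k ≡ true → μ k u ≡ u
      sizes    : ∀ u → D u ≡ true → cnt (L u) Cs ≡ (if ⌊ u ≟F s ⌋ then 1 else 2)
      room     : cnt D V ≤ cnt P Cs

    load : Fin K → ℕ
    load k = cnt (λ u → L u k) V

    empty : Fin K → Bool
    empty k = P k ∧ ⌊ load k ≤? 0 ⌋

    -- The one list of size 1 makes the sum of the loads odd. This parity is the reason for treating
    -- s differently.
    total : Σl load Cs + 1 ≡ 2 * cnt D V
    total = begin
      Σl load Cs + 1                                                    ≡⟨ cong₂ _+_ (Σl-swap (λ k u → b2n (L u k)) Cs V)
                                                                             (sym (cnt≡1 (λ u → ⌊ u ≟F s ⌋) (allFin⁺ n) (∈-allFin s) (⌊⌋-intro (s ≟F s) refl) (λ y _ h → ⌊⌋-true (y ≟F s) h))) ⟩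
      Σl (λ u → cnt (L u) Cs) V + cnt (λ u → ⌊ u ≟F s ⌋) V              ≡⟨ sym (Σl-+ _ _ V) ⟩
      Σl (λ u → cnt (L u) Cs + b2n ⌊ u ≟F s ⌋) V                        ≡⟨ Σl-cong V (λ u _ → pointwise u (D u) refl) ⟩
      Σl (λ u → 2 * b2n (D u)) V                                        ≡⟨ Σl-* 2 _ V ⟩
      2 * cnt D V                                                       ∎
      where
      open ≡-Reasoning
      one : ∀ b → (if b then 1 else 2) + b2n b ≡ 2
      one true  = refl
      one false = refl
      pointwise : ∀ u b → D u ≡ b → cnt (L u) Cs + b2n ⌊ u ≟F s ⌋ ≡ 2 * b2n b
      pointwise u true e  = trans (cong (_+ b2n ⌊ u ≟F s ⌋) (sizes u e)) (one ⌊ u ≟F s ⌋)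
      pointwise u false e = cong₂ _+_ (cnt-zero (L u) Cs (λ k _ → ≢true (λ h → true≢false (L-D u k h) e)))
                              (cong b2n (⌊⌋-no (u ≟F s) (λ { refl → true≢false s∈D e })))

  -- Colour i lies in no list but that of u, so spending it on the edge xu and removing it from the
  -- palette leaves the other lists intact, while D and P lose one element each. If u owned the
  -- short list, another vertex t has its list cut to one colour, which keeps the total odd.
  module Single (S : State) (i : Fin K) (u : Fin n) (u∋i : State.L S u i ≡ true)
                (only : ∀ v → State.L S v i ≡ true → v ≡ u) where
    open State S
    Du = L-D u i u∋i
    x≢u : x ≢ u
    x≢u e = irr x (subst (R x) (sym e) (proj₁ (D-R u Du)))
    open Assign F i x u x≢u (free i (L-P u i u∋i)) (L-free u i u∋i) (fresh u Du)

    D' : Fin n → Bool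
    D' v = D v ∧ not ⌊ v ≟F u ⌋
    P' : Fin K → Bool
    P' k = P k ∧ not ⌊ k ≟F i ⌋

    D'-D : ∀ {v} → D' v ≡ true → D v ≡ true
    D'-D h = proj₁ (∧-true h)
    D'-u : ∀ {v} → D' v ≡ true → v ≢ u
    D'-u {v} h = ⌊⌋-false (v ≟F u) (not-true (proj₂ (∧-true h)))
    D'-intro : ∀ {v} → D v ≡ true → v ≢ u → D' v ≡ true
    D'-intro {v} h ne = ∧-intro h (not-false (⌊⌋-no (v ≟F u) ne))
    not-x : ∀ {v} → D v ≡ true → v ≢ x
    not-x {v} h e = irr x (subst (R x) e (proj₁ (D-R v h)))

    fewer : suc (cnt D' V) ≡ cnt D V
    fewer = cnt-delete D Du

    sound' : ∀ k v → as k v ≢ v → R v (as k v)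
    sound' k v ne = by (place k v)
      where
      by : Place k v → R v (as k v)
      by (at-x refl refl) = subst (R x) (sym as-x) (proj₁ (D-R u Du))
      by (at-u refl refl) = subst (R u) (sym as-u) (proj₂ (D-R u Du))
      by (else h) = subst (R v) (sym (as-o h)) (sound k v (λ e → ne (trans (as-o h) e)))

    complete' : ∀ a b → R a b → (∃ λ k → as k a ≡ b) ⊎ (a ≡ x × D' b ≡ true) ⊎ (b ≡ x × D' a ≡ true)
    complete' a b r = by (complete a b r)
      where
      by : (∃ λ k → μ k a ≡ b) ⊎ (a ≡ x × D b ≡ true) ⊎ (b ≡ x × D a ≡ true) → _
      by (inj₁ h) = inj₁ (as-edge (λ e → irr a (subst (R a) (sym e) r)) h)
      by (inj₂ (inj₁ (p , h))) = go (b ≟F u)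
        where
        go : Dec (b ≡ u) → _
        go (yes q) = inj₁ (i , trans (cong (as i) p) (trans as-x (sym q)))
        go (no ne) = inj₂ (inj₁ (p , D'-intro h ne))
      by (inj₂ (inj₂ (p , h))) = go (a ≟F u)
        where
        go : Dec (a ≡ u) → _
        go (yes q) = inj₁ (i , trans (cong (as i) q) (trans as-u (sym p)))
        go (no ne) = inj₂ (inj₂ (p , D'-intro h ne))

    finish : (∀ v → D' v ≡ false) → ColouredBy K R
    finish none = family , sound' , λ a b r → by (complete' a b r)
      where
      by : ∀ {a b} → (∃ λ k → as k a ≡ b) ⊎ (a ≡ x × D' b ≡ true) ⊎ (b ≡ x × D' a ≡ true) → ∃ λ k → as k a ≡ b
      by (inj₁ h) = h
      by (inj₂ (inj₁ (_ , h))) = ⊥-elim (true≢false h (none _))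
      by (inj₂ (inj₂ (_ , h))) = ⊥-elim (true≢false h (none _))

    other : ∀ {k v} → v ≢ u → v ≢ x → as k v ≡ μ k v
    other p q = as-o (λ h → Data.Sum.[ q , p ] (proj₂ h))

    next : ∀ t (L' : Fin n → Fin K → Bool) → D' t ≡ true → (∀ v k → L' v k ≡ true → L v k ≡ true × v ≢ u) →
           (∀ v → D' v ≡ true → cnt (L' v) Cs ≡ (if ⌊ v ≟F t ⌋ then 1 else 2)) → State
    next t L' t∈ sub size = record
      { F = family ; D = D' ; P = P' ; L = L' ; s = t ; s∈D = t∈ ; sound = sound' ; complete = complete'
      ; D-R = λ v h → D-R v (D'-D h)
      ; fresh = λ v h k e → fresh v (D'-D h) k (trans (sym (other (D'-u h) (not-x (D'-D h)))) e)
      ; free = λ k h → trans (as-o (λ q → ⌊⌋-false (k ≟F i) (not-true (proj₂ (∧-true h))) (proj₁ q))) (free k (proj₁ (∧-true h)))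
      ; L-D = λ v k h → D'-intro (L-D v k (proj₁ (sub v k h))) (proj₂ (sub v k h))
      ; L-P = λ v k h → ∧-intro (L-P v k (proj₁ (sub v k h))) (not-false (⌊⌋-no (k ≟F i) (λ { refl → proj₂ (sub v k h) (only v (proj₁ (sub v k h))) })))
      ; L-free = λ v k h → trans (other (proj₂ (sub v k h)) (not-x (L-D v k (proj₁ (sub v k h))))) (L-free v k (proj₁ (sub v k h)))
      ; sizes = size
      ; room = ≤-pred (≤-trans (≤-reflexive fewer) (≤-trans room (≤-reflexive (sym (cnt-delete P (L-P u i u∋i)))))) }

    restrict : Fin n → Fin K → Bool
    restrict v k = L v k ∧ not ⌊ v ≟F u ⌋

    restrict-sub : ∀ v k → restrict v k ≡ true → L v k ≡ true × v ≢ u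
    restrict-sub v k h = proj₁ (∧-true h) , ⌊⌋-false (v ≟F u) (not-true (proj₂ (∧-true h)))

    restrict-size : ∀ v → v ≢ u → cnt (restrict v) Cs ≡ cnt (L v) Cs
    restrict-size v ne = Σl-cong Cs (λ k _ → cong b2n (aux k))
      where
      aux : ∀ k → restrict v k ≡ L v k
      aux k rewrite ⌊⌋-no (v ≟F u) ne with L v k
      ... | true  = refl
      ... | false = refl

    keep : u ≢ s → State
    keep ne = next s restrict (D'-intro s∈D (λ e → ne (sym e))) restrict-sub
      (λ v h → trans (restrict-size v (D'-u h)) (sizes v (D'-D h)))

    module Shorten (u≡s : u ≡ s) (t : Fin n) (t∈ : D' t ≡ true) where
      size-t : cnt (restrict t) Cs ≡ 2
      size-t = trans (restrict-size t (D'-u t∈)) (trans (sizes t (D'-D t∈)) (cong (if_then 1 else 2) (⌊⌋-no (t ≟F s) (λ e → D'-u t∈ (trans e (sym u≡s))))))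
      short : ∃ λ q → (∀ k → q k ≡ true → restrict t k ≡ true) × cnt q Cs ≡ 1
      short = subcount 1 (restrict t) (≤-trans (s≤s z≤n) (≤-reflexive (sym size-t)))
      L' : Fin n → Fin K → Bool
      L' v k = if ⌊ v ≟F t ⌋ then proj₁ short k else restrict v k
      sub : ∀ v k → L' v k ≡ true → L v k ≡ true × v ≢ u
      sub v k h with v ≟F t
      ... | yes refl = restrict-sub v k (proj₁ (proj₂ short) k h)
      ... | no _     = restrict-sub v k h
      size : ∀ v → D' v ≡ true → cnt (L' v) Cs ≡ (if ⌊ v ≟F t ⌋ then 1 else 2)
      size v h with v ≟F t
      ... | yes refl = proj₂ (proj₂ short)
      ... | no _     = trans (restrict-size v (D'-u h)) (trans (sizes v (D'-D h)) (cong (if_then 1 else 2) (⌊⌋-no (v ≟F s) (λ e → D'-u h (trans e (sym u≡s))))))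
      state : State
      state = next t L' t∈ sub size

    outcome : ColouredBy K R ⊎ Σ State λ S' → suc (cnt (State.D S') V) ≡ cnt D V
    outcome with any?F (λ v → D' v Data.Bool.≟ true)
    ... | no none = inj₁ (finish (λ v → ≢true (λ h → none (v , h))))
    ... | yes (t , t∈) with u ≟F s
    ...   | yes e = inj₂ (Shorten.state e t t∈ , fewer)
    ...   | no ne = inj₂ (keep ne , fewer)

  -- The path from u brings i into the list of u. A vertex with j in its list is missed by j, so it
  -- can lie on the path only as one of the ends u and w; of three such vertices one is off the path
  -- and keeps j. Hence i is no longer empty and no other colour becomes empty.
  module Exchange (S : State) (i j : Fin K) (Pi : State.P S i ≡ true) (Li : State.load S i ≡ 0)
                  (Lj : 3 ≤ State.load S j) (u : Fin n) (u∋j : State.L S u j ≡ true) where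
    open State S
    Pj = L-P u j u∋j
    path : Chain (μ i) (μ j) u
    path = chain (μ i) (μ j) (inv i) (inv j) u (L-free u j u∋j)
    open Chain path
    open Swap F i j on on-a on-b

    L' : Fin n → Fin K → Bool
    L' v k = L v (ix v k)

    P-ix : ∀ v k → P (ix v k) ≡ true → P k ≡ true
    P-ix v k h with on v
    ... | false = h
    ... | true with tr-case k
    ...   | inj₁ (refl , _)            = Pi
    ...   | inj₂ (inj₁ (refl , _))     = Pj
    ...   | inj₂ (inj₂ (_ , _ , e))    = trans (sym (cong P e)) h

    free' : ∀ k → P k ≡ true → sw k x ≡ x
    free' k h with on x
    ... | false = free k h
    ... | true with tr-case k
    ...   | inj₁ (_ , e)            = trans (cong (λ l → μ l x) e) (free j Pj)
    ...   | inj₂ (inj₁ (_ , e))     = trans (cong (λ l → μ l x) e) (free i Pi)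
    ...   | inj₂ (inj₂ (_ , _ , e)) = trans (cong (λ l → μ l x) e) (free k h)

    size' : ∀ v → cnt (L' v) Cs ≡ cnt (L v) Cs
    size' v = Σ-invol (ix v) (ix-inv v) (λ k → b2n (L v k))

    state : State
    state = record
      { F = family ; D = D ; P = P ; L = L' ; s = s ; s∈D = s∈D
      ; sound = λ k v → sound (ix v k) v
      ; complete = λ a b r → Data.Sum.map₁ sw-edge (complete a b r)
      ; D-R = D-R ; fresh = λ v h k → fresh v h (ix v k) ; free = free'
      ; L-D = λ v k → L-D v (ix v k) ; L-P = λ v k h → P-ix v k (L-P v (ix v k) h) ; L-free = λ v k → L-free v (ix v k)
      ; sizes = λ v h → trans (size' v) (sizes v h) ; room = room }

    open State state using () renaming (load to load'; empty to empty')

    load'-i : 1 ≤ load' i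
    load'-i = cnt-pos (λ v → L' v i) (∈-allFin u) (trans (cong (L u) (trans (cong (if_then tr i else i) on-u) tr-i)) u∋j)

    load'-j : 1 ≤ load' j
    load'-j = by (cnt-third (λ v → L v j) u w Lj)
      where
      by : (∃ λ v → L v j ≡ true × v ≢ u × v ≢ w) → 1 ≤ load' j
      by (v , h , p , q) = cnt-pos (λ v → L' v j) (∈-allFin v) (trans (cong (L v) (cong (if_then tr j else j) off)) h)
        where
        off : on v ≡ false
        off = ≢true (λ o → Data.Sum.[ p , q ] (ends v o (inj₂ (L-free v j h))))

    load'-o : ∀ k → k ≢ i → k ≢ j → load' k ≡ load k
    load'-o k p q = Σl-cong V (λ v _ → cong (λ l → b2n (L v l)) (ix-o v p q))

    fewer : cnt empty' Cs < cnt empty Cs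
    fewer = ≤-trans (s≤s (cnt-mono empty' (λ k → empty k ∧ not ⌊ k ≟F i ⌋) Cs (λ k _ → still k)))
      (≤-reflexive (cnt-delete empty (∧-intro Pi (⌊⌋-intro (load i ≤? 0) (≤-reflexive Li)))))
      where
      still : ∀ k → empty' k ≡ true → empty k ∧ not ⌊ k ≟F i ⌋ ≡ true
      still k h = by (k ≟F i) (k ≟F j)
        where
        zero' : load' k ≤ 0
        zero' = ⌊⌋-true (load' k ≤? 0) (proj₂ (∧-true h))
        by : Dec (k ≡ i) → Dec (k ≡ j) → empty k ∧ not ⌊ k ≟F i ⌋ ≡ true
        by (yes refl) _ = ⊥-elim (1+n≰n (≤-trans load'-i zero'))
        by _ (yes refl) = ⊥-elim (1+n≰n (≤-trans load'-j zero'))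
        by (no p) (no q) = ∧-intro (∧-intro (proj₁ (∧-true h)) (⌊⌋-intro (load k ≤? 0) (≤-trans (≤-reflexive (sym (load'-o k p q))) zero'))) (not-false (⌊⌋-no (k ≟F i) p))

  module Search (S : State) (no-single : ∀ k → State.load S k ≢ 1) where
    open State S

    -- The loads sum to 2|D| - 1, which is less than twice the size of the palette; so some colour
    -- of the palette has load below 2, hence 0, as no load is 1.
    spare : ∃ λ i → P i ≡ true × load i ≡ 0
    spare = by (Σl-< load (λ k → 2 * b2n (P k)) Cs (begin-strict
        Σl load Cs         <⟨ ≤-reflexive (+-comm 1 _) ⟩
        Σl load Cs + 1     ≡⟨ total ⟩
        2 * cnt D V        ≤⟨ *-monoʳ-≤ 2 room ⟩
        2 * cnt P Cs       ≡⟨ sym (Σl-* 2 _ Cs) ⟩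
        Σl (λ k → 2 * b2n (P k)) Cs ∎))
      where
      open ≤-Reasoning
      low : ∀ b l → l < 2 * b2n b → l ≢ 1 → b ≡ true × l ≡ 0
      low true zero    h ne = refl , refl
      low true (suc zero) h ne = ⊥-elim (ne refl)
      low true (suc (suc l)) (s≤s (s≤s ())) ne
      by : (∃ λ k → k ∈ Cs × load k < 2 * b2n (P k)) → ∃ λ i → P i ≡ true × load i ≡ 0
      by (k , _ , h) = k , low (P k) (load k) h (no-single k)

    -- If every load were 0 or 2, the total of the loads would be even.
    crowded : ∃ λ j → 3 ≤ load j
    crowded with any?F (λ j → 3 ≤? load j)
    ... | yes h = h
    ... | no ¬h = ⊥-elim (even≢odd (cnt D V) (Σl half Cs) (trans (sym total) (trans (+-comm _ 1)
                    (cong suc (trans (Σl-cong Cs (λ k _ → halve (load k) (no-single k) (λ l → ¬h (k , l)))) (Σl-* 2 half Cs))))))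
      where
      half : Fin K → ℕ
      half k = b2n ⌊ 1 ≤? load k ⌋
      halve : ∀ l → l ≢ 1 → ¬ 3 ≤ l → l ≡ 2 * b2n ⌊ 1 ≤? l ⌋
      halve zero p q = refl
      halve (suc zero) p q = ⊥-elim (p refl)
      halve (suc (suc zero)) p q = refl
      halve (suc (suc (suc l))) p q = ⊥-elim (q (s≤s (s≤s (s≤s z≤n))))

    member : ∀ {j} → 3 ≤ load j → ∃ λ u → L u j ≡ true
    member {j} h = by (cnt-witness (λ u → L u j) V (≤-trans (s≤s z≤n) h))
      where
      by : (∃ λ u → u ∈ V × L u j ≡ true) → ∃ λ u → L u j ≡ true
      by (u , _ , e) = u , e

  -- Lexicographic induction: d bounds the number of uncoloured edges at x, and e the number of
  -- palette colours that are in no list. `Single` lowers the first and lets the second start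
  -- afresh; `Exchange` keeps the first and lowers the second.
  extend : ∀ d e (S : State) → cnt (State.D S) V ≤ d → cnt (State.empty S) Cs ≤ e → ColouredBy K R
  extend d e S hd he with any?F (λ k → State.load S k ≟ 1)
  extend zero e S hd he | yes (i , one) = ⊥-elim (1+n≰n (≤-trans (cnt-pos (State.D S) (∈-allFin (State.s S)) (State.s∈D S)) hd))
  extend (suc d) e S hd he | yes (i , one) = by (cnt-witness (λ u → State.L S u i) V (≤-reflexive (sym one)))
    where
    by : (∃ λ u → u ∈ V × State.L S u i ≡ true) → ColouredBy K R
    by (u , _ , h) = go (Single.outcome S i u h only)
      where
      only : ∀ v → State.L S v i ≡ true → v ≡ u
      only v k with v ≟F u
      ... | yes r = r
      ... | no r = ⊥-elim (1+n≰n (≤-trans (cnt-pos (λ y → State.L S y i ∧ not ⌊ y ≟F u ⌋) (∈-allFin v) (∧-intro k (not-false (⌊⌋-no (v ≟F u) r))))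
                     (≤-reflexive (suc-injective (trans (cnt-delete (λ y → State.L S y i) h) one)))))
      go : ColouredBy K R ⊎ Σ State (λ S' → suc (cnt (State.D S') V) ≡ cnt (State.D S) V) → ColouredBy K R
      go (inj₁ c) = c
      go (inj₂ (S' , e')) = extend d _ S' (≤-pred (≤-trans (≤-reflexive e') hd)) ≤-refl
  extend d e S hd he | no ¬one = by e he (Search.spare S ns) (Search.crowded S ns)
    where
    ns : ∀ k → State.load S k ≢ 1
    ns k h = ¬one (k , h)
    by : ∀ e → cnt (State.empty S) Cs ≤ e → (∃ λ i → State.P S i ≡ true × State.load S i ≡ 0) → (∃ λ j → 3 ≤ State.load S j) → ColouredBy K R
    by e he (i , Pi , Li) (j , Lj) = go e he (Search.member S ns Lj)
      where
      go : ∀ e → cnt (State.empty S) Cs ≤ e → (∃ λ u → State.L S u j ≡ true) → ColouredBy K R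
      go zero he (u , h) = ⊥-elim (n≮0 (≤-trans (Exchange.fewer S i j Pi Li Lj u h) he))
      go (suc e) he (u , h) = extend d e (Exchange.state S i j Pi Li Lj u h) hd (≤-pred (≤-trans (Exchange.fewer S i j Pi Li Lj u h) he))

-- The vertices arrive in order: R t is the graph on the vertices below t, and the next vertex is
-- the centre of a star towards its earlier neighbours.
module Vizing {n k} (adj : Fin n → Fin n → Bool) (adj-irr : ∀ a → adj a a ≡ false)
              (adj-comm : ∀ a b → adj a b ≡ true → adj b a ≡ true) (degree≤ : ∀ v → cnt (adj v) (allFin n) ≤ k) where
  V = allFin n
  K = suc k
  Cs = allFin K

  R : ℕ → Fin n → Fin n → Set
  R t a b = adj a b ≡ true × toℕ a < t × toℕ b < t

  R-irr : ∀ t a → ¬ R t a a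
  R-irr t a (h , _) = true≢false h (adj-irr a)

  module Step (t : ℕ) (t<n : t < n) (F : Family n K)
              (sound : ∀ k v → Family.μ F k v ≢ v → R t v (Family.μ F k v))
              (complete : ∀ a b → R t a b → ∃ λ k → Family.μ F k a ≡ b) where
    open Family F
    x : Fin n
    x = fromℕ< t<n

    tx : toℕ x ≡ t
    tx = toℕ-fromℕ< t<n

    D : Fin n → Bool
    D u = adj x u ∧ ⌊ toℕ u <? t ⌋

    D⁻ : ∀ {u} → D u ≡ true → adj x u ≡ true × toℕ u < t
    D⁻ {u} h = proj₁ (∧-true h) , ⌊⌋-true (toℕ u <? t) (proj₂ (∧-true h))

    D⁺ : ∀ {u} → adj x u ≡ true → toℕ u < t → D u ≡ true
    D⁺ {u} h l = ∧-intro h (⌊⌋-intro (toℕ u <? t) l)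

    sound' : ∀ k v → μ k v ≢ v → R (suc t) v (μ k v)
    sound' k v ne = proj₁ (sound k v ne) , m≤n⇒m≤1+n (proj₁ (proj₂ (sound k v ne))) , m≤n⇒m≤1+n (proj₂ (proj₂ (sound k v ne)))

    last : ∀ {a} → toℕ a < suc t → toℕ a < t ⊎ a ≡ x
    last l with m≤n⇒m<n∨m≡n (≤-pred l)
    ... | inj₁ h = inj₁ h
    ... | inj₂ h = inj₂ (toℕ-injective (trans h (sym tx)))

    complete' : ∀ a b → R (suc t) a b → (∃ λ k → μ k a ≡ b) ⊎ (a ≡ x × D b ≡ true) ⊎ (b ≡ x × D a ≡ true)
    complete' a b (h , la , lb) = by (last la) (last lb)
      where
      by : toℕ a < t ⊎ a ≡ x → toℕ b < t ⊎ b ≡ x → _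
      by (inj₁ p) (inj₁ q) = inj₁ (complete a b (h , p , q))
      by (inj₂ p) (inj₁ q) = inj₂ (inj₁ (p , D⁺ (subst (λ z → adj z b ≡ true) p h) q))
      by (inj₁ p) (inj₂ q) = inj₂ (inj₂ (q , D⁺ (adj-comm a x (subst (λ z → adj a z ≡ true) q h)) p))
      by (inj₂ p) (inj₂ q) = ⊥-elim (true≢false h (trans (cong (adj a) (trans q (sym p))) (adj-irr a)))

    missing : Fin n → Fin K → Bool
    missing u k = ⌊ μ k u ≟F u ⌋

    -- The edge from u to x has no colour yet, so u sees at most k - 1 of the k + 1 colours.
    enough : ∀ u → D u ≡ true → 2 ≤ cnt (missing u) Cs
    enough u h = lem (cnt (missing u) Cs) (cnt (not ∘ missing u) Cs) (cnt old V)
      (trans (cnt-split (missing u) Cs) (length-tabulate id)) used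
      (≤-trans (≤-reflexive (sym (cnt-insert old (allFin⁺ n) (∈-allFin x) old-x))) (≤-trans (cnt-mono _ (adj u) V (λ b _ → old-adj b)) (degree≤ u)))
      where
      old : Fin n → Bool
      old b = adj u b ∧ ⌊ toℕ b <? t ⌋
      old-x : old x ≡ false
      old-x = ≢true (λ e → <-irrefl tx (⌊⌋-true (toℕ x <? t) (proj₂ (∧-true e))))
      old-adj : ∀ b → old b ∨ ⌊ b ≟F x ⌋ ≡ true → adj u b ≡ true
      old-adj b e = by (∨-true e)
        where
        by : old b ≡ true ⊎ ⌊ b ≟F x ⌋ ≡ true → adj u b ≡ true
        by (inj₁ p) = proj₁ (∧-true p)
        by (inj₂ p) = subst (λ z → adj u z ≡ true) (sym (⌊⌋-true (b ≟F x) p)) (adj-comm x u (proj₁ (D⁻ h)))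
      lem : ∀ a b c → a + b ≡ suc k → b ≤ c → suc c ≤ k → 2 ≤ a
      lem a b c e h₁ h₂ = lin 0 (+-mono-≤ (+-mono-≤ h₁ h₂) (≤-reflexive (sym e))) (eq a b c k)
        where
        eq : ∀ a b c k → 2 + (c + k + (a + b)) + 0 ≡ a + (b + suc c + suc k)
        eq = solve-∀
      to : Fin n → Fin K → Bool
      to b k = old b ∧ ⌊ μ k u ≟F b ⌋
      used : cnt (not ∘ missing u) Cs ≤ cnt old V
      used = begin
        cnt (not ∘ missing u) Cs            ≤⟨ Σl-mono Cs (λ k _ → by k (μ k u ≟F u)) ⟩
        Σl (λ k → cnt (λ b → to b k) V) Cs  ≡⟨ Σl-swap (λ k b → b2n (to b k)) Cs V ⟩
        Σl (λ b → cnt (to b) Cs) V          ≤⟨ Σl-mono V (λ b _ → once b (old b) refl) ⟩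
        cnt old V                           ∎
        where
        open ≤-Reasoning
        by : ∀ k → Dec (μ k u ≡ u) → b2n (not (missing u k)) ≤ cnt (λ b → to b k) V
        by k (yes e) = ≤-trans (≤-reflexive (cong (b2n ∘ not) (⌊⌋-intro (μ k u ≟F u) e))) z≤n
        by k (no ne) = ≤-trans (b2n≤1 _) (cnt-pos (λ b → to b k) (∈-allFin (μ k u))
          (∧-intro (∧-intro (proj₁ (sound k u ne)) (⌊⌋-intro (toℕ (μ k u) <? t) (proj₂ (proj₂ (sound k u ne))))) (⌊⌋-intro (μ k u ≟F μ k u) refl)))
        once : ∀ b v → old b ≡ v → cnt (to b) Cs ≤ b2n v
        once b false e = ≤-reflexive (cnt-zero (to b) Cs (λ k _ → cong (_∧ ⌊ μ k u ≟F b ⌋) e))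
        once b true e = cnt≤1 (to b) (allFin⁺ K) (λ k l _ _ p q → disj k l u
          (trans (⌊⌋-true (μ k u ≟F b) (proj₂ (∧-true p))) (sym (⌊⌋-true (μ l u ≟F b) (proj₂ (∧-true q)))))
          (λ r → true≢false (proj₁ (∧-true {adj u b} e)) (trans (cong (adj u) (trans (sym (⌊⌋-true (μ k u ≟F b) (proj₂ (∧-true p)))) r)) (adj-irr u))))

    module Lists (s : Fin n) (s∈ : D s ≡ true) where
      size : Fin n → ℕ
      size u = if ⌊ u ≟F s ⌋ then 1 else 2

      size≤2 : ∀ u → size u ≤ 2
      size≤2 u with u ≟F s
      ... | yes _ = s≤s z≤n
      ... | no _  = ≤-refl

      list : ∀ u → ∃ λ (q : Fin K → Bool) → (∀ k → q k ≡ true → D u ≡ true × missing u k ≡ true) × (D u ≡ true → cnt q Cs ≡ size u)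
      list u = by (D u) refl
        where
        by : ∀ b → D u ≡ b → ∃ λ (q : Fin K → Bool) → (∀ k → q k ≡ true → D u ≡ true × missing u k ≡ true) × (D u ≡ true → cnt q Cs ≡ size u)
        by false e = (λ _ → false) , (λ _ ()) , λ h → ⊥-elim (true≢false h e)
        by true e = go (subcount (size u) (missing u) (≤-trans (size≤2 u) (enough u e)))
          where
          go : (∃ λ (q : Fin K → Bool) → (∀ k → q k ≡ true → missing u k ≡ true) × cnt q Cs ≡ size u) → _
          go (q , sub , c) = q , (λ k h → e , sub k h) , λ _ → c

      colouring : ColouredBy K (R (suc t))
      colouring = S.extend _ _ state ≤-refl ≤-refl
        where
        module S = Star (R (suc t)) (R-irr (suc t)) x
        state : S.State
        state = record
          { F = F ; D = D ; P = λ _ → true ; L = λ u → proj₁ (list u) ; s = s ; s∈D = s∈ ; sound = sound' ; complete = complete'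
          ; D-R = λ u h → (proj₁ (D⁻ h) , s≤s (≤-reflexive tx) , m≤n⇒m≤1+n (proj₂ (D⁻ h))) ,
                          (adj-comm x u (proj₁ (D⁻ h)) , m≤n⇒m≤1+n (proj₂ (D⁻ h)) , s≤s (≤-reflexive tx))
          ; fresh = λ u h k e → <-irrefl tx (subst (λ z → toℕ z < t) e (proj₂ (proj₂ (sound k u
              (λ r → <-irrefl tx (subst (λ z → toℕ z < t) (trans (sym r) e) (proj₂ (D⁻ h)))))))) 
          ; free = λ k _ → fix k (μ k x ≟F x)
          ; L-D = λ u k h → proj₁ (proj₁ (proj₂ (list u)) k h)
          ; L-P = λ _ _ _ → refl
          ; L-free = λ u k h → ⌊⌋-true (μ k u ≟F u) (proj₂ (proj₁ (proj₂ (list u)) k h))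
          ; sizes = λ u → proj₂ (proj₂ (list u))
          ; room = ≤-trans (cnt-mono D (adj x) V (λ u _ h → proj₁ (D⁻ h))) (≤-trans (degree≤ x) (≤-trans (n≤1+n k)
                     (≤-reflexive (sym (trans (Σl-const 1 Cs) (trans (*-identityˡ _) (length-tabulate id))))))) }
          where
          fix : ∀ k → Dec (μ k x ≡ x) → μ k x ≡ x
          fix k (yes e) = e
          fix k (no ne) = ⊥-elim (<-irrefl tx (proj₁ (proj₂ (sound k x ne))))

    step : ColouredBy K (R (suc t))
    step with any?F (λ u → D u Data.Bool.≟ true)
    ... | yes (s , s∈) = Lists.colouring s s∈
    ... | no none = F , sound' , λ a b r → by (complete' a b r)
      where
      by : ∀ {a b} → (∃ λ k → μ k a ≡ b) ⊎ (a ≡ x × D b ≡ true) ⊎ (b ≡ x × D a ≡ true) → ∃ λ k → μ k a ≡ b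
      by (inj₁ h) = h
      by (inj₂ (inj₁ (_ , h))) = ⊥-elim (none (_ , h))
      by (inj₂ (inj₂ (_ , h))) = ⊥-elim (none (_ , h))

  upTo-vertex : ∀ t → t ≤ n → ColouredBy K (R t)
  upTo-vertex zero h = record { μ = λ _ v → v ; inv = λ _ _ → refl ; disj = λ _ _ _ _ ne → ⊥-elim (ne refl) } ,
    (λ _ _ ne → ⊥-elim (ne refl)) , λ { a b (_ , () , _) }
  upTo-vertex (suc t) h = by (upTo-vertex t (<⇒≤ h))
    where
    by : ColouredBy K (R t) → ColouredBy K (R (suc t))
    by (F , s , c) = Step.step t h F s c

  abstract
    vizing : ColouredBy K (λ a b → adj a b ≡ true)
    vizing = by (upTo-vertex n ≤-refl)
      where
      by : ColouredBy K (R n) → ColouredBy K (λ a b → adj a b ≡ true)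
      by (F , s , c) = F , (λ k v ne → proj₁ (s k v ne)) , λ a b h → c a b (h , toℕ<n a , toℕ<n b)

-- Equitable edge colourings

weight : ∀ {n K} → Family n K → Fin K → ℕ
weight {n} F k = cnt (moved (Family.μ F k)) (allFin n)

Σ-pick : ∀ {K} (i : Fin K) c → Σl (λ k → b2n ⌊ k ≟F i ⌋ * c) (allFin K) ≡ c
Σ-pick {K} i c = trans (trans (Σl-cong (allFin K) (λ k _ → *-comm (b2n ⌊ k ≟F i ⌋) c)) (Σl-* c _ (allFin K)))
  (trans (cong (c *_) (cnt≡1 _ (allFin⁺ K) (∈-allFin i) (⌊⌋-intro (i ≟F i) refl) (λ y _ h → ⌊⌋-true (y ≟F i) h))) (*-identityʳ c))

Σ-two : ∀ {K} (i j : Fin K) → i ≢ j → (f g : Fin K → ℕ) → (∀ k → k ≢ i → k ≢ j → f k ≡ g k) →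
        Σl f (allFin K) + (g i + g j) ≡ Σl g (allFin K) + (f i + f j)
Σ-two {K} i j ne f g h = trans (sym (expand f g)) (trans (Σl-cong (allFin K) (λ k _ → aux k (k ≟F i) (k ≟F j))) (expand g f))
  where
  at : (Fin K → ℕ) → Fin K → ℕ
  at g k = b2n ⌊ k ≟F i ⌋ * g i + b2n ⌊ k ≟F j ⌋ * g j
  expand : ∀ f g → Σl (λ k → f k + at g k) (allFin K) ≡ Σl f (allFin K) + (g i + g j)
  expand f g = trans (Σl-+ f (at g) (allFin K)) (cong (Σl f (allFin K) +_)
    (trans (Σl-+ _ _ (allFin K)) (cong₂ _+_ (Σ-pick i (g i)) (Σ-pick j (g j)))))
  at-i : ∀ g → at g i ≡ g i
  at-i g rewrite ⌊⌋-intro (i ≟F i) refl | ⌊⌋-no (i ≟F j) ne = trans (+-identityʳ _) (+-identityʳ _)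
  at-j : ∀ g → at g j ≡ g j
  at-j g rewrite ⌊⌋-intro (j ≟F j) refl | ⌊⌋-no (j ≟F i) (λ e → ne (sym e)) = +-identityʳ _
  at-o : ∀ g k → k ≢ i → k ≢ j → at g k ≡ 0
  at-o g k p q rewrite ⌊⌋-no (k ≟F i) p | ⌊⌋-no (k ≟F j) q = refl
  aux : ∀ k → Dec (k ≡ i) → Dec (k ≡ j) → f k + at g k ≡ g k + at f k
  aux k (yes refl) _ = trans (cong (f i +_) (at-i g)) (trans (+-comm (f i) (g i)) (cong (g i +_) (sym (at-i f))))
  aux k (no _) (yes refl) = trans (cong (f j +_) (at-j g)) (trans (+-comm (f j) (g j)) (cong (g j +_) (sym (at-j f))))
  aux k (no p) (no q) = cong₂ _+_ (h k p q) (trans (at-o g k p q) (sym (at-o f k p q)))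

-- Moving d from x to y lowers the sum of squares by 2d(x - y - d), which is positive for 1 ≤ d ≤ 2
-- and x ≥ y + 4.
squares-drop : ∀ x y x' y' d → 1 ≤ d → d ≤ 2 → y + 4 ≤ x → x' + d ≡ x → y' ≡ y + d → x' * x' + y' * y' < x * x + y * y
squares-drop x y x' y' d h₁ h₂ h₃ refl refl = by d h₁ h₂ (m+[n∸m]≡n h₃)
  where
  lem₁ : ∀ y e → suc ((y + 3 + e) * (y + 3 + e) + (y + 1) * (y + 1)) + (5 + 2 * e) ≡ (y + 3 + e + 1) * (y + 3 + e + 1) + y * y
  lem₁ = solve-∀
  lem₂ : ∀ y e → suc ((y + 2 + e) * (y + 2 + e) + (y + 2) * (y + 2)) + (7 + 4 * e) ≡ (y + 2 + e + 2) * (y + 2 + e + 2) + y * y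
  lem₂ = solve-∀
  by : ∀ d → 1 ≤ d → d ≤ 2 → y + 4 + (x' + d ∸ (y + 4)) ≡ x' + d → x' * x' + (y + d) * (y + d) < (x' + d) * (x' + d) + y * y
  by (suc zero) _ _ e = go _ (+-cancelʳ-≡ 1 _ _ (trans (solve-eq y _) e))
    where
    solve-eq : ∀ y e → y + 3 + e + 1 ≡ y + 4 + e
    solve-eq = solve-∀
    go : ∀ e → y + 3 + e ≡ x' → x' * x' + (y + 1) * (y + 1) < (x' + 1) * (x' + 1) + y * y
    go e refl = ≤-trans (m≤m+n _ (5 + 2 * e)) (≤-reflexive (lem₁ y e))
  by (suc (suc zero)) _ _ e = go _ (+-cancelʳ-≡ 2 _ _ (trans (solve-eq y _) e))
    where
    solve-eq : ∀ y e → y + 2 + e + 2 ≡ y + 4 + e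
    solve-eq = solve-∀
    go : ∀ e → y + 2 + e ≡ x' → x' * x' + (y + 2) * (y + 2) < (x' + 2) * (x' + 2) + y * y
    go e refl = ≤-trans (m≤m+n _ (7 + 4 * e)) (≤-reflexive (lem₂ y e))
  by (suc (suc (suc d))) _ (s≤s (s≤s ()))

module Balance {n K} (F : Family n K) (i j : Fin K) where
  open Family F
  V = allFin n

  mv : Fin K → (Fin n → Bool) → ℕ
  mv k S = cnt (λ v → S v ∧ moved (μ k) v) V

  record Closed (S : Fin n → Bool) : Set where
    constructor closed
    field
      cl-i : ∀ v → S (μ i v) ≡ S v
      cl-j : ∀ v → S (μ j v) ≡ S v

  -- a union of components of the subgraph of colours i and j with one or two more vertices met by i than by j
  Surplus : Set
  Surplus = Σ (Fin n → Bool) λ S → Closed S × mv j S < mv i S × mv i S ≤ 2 + mv j S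

  mv-split : ∀ k (S T : Fin n → Bool) → mv k S ≡ mv k (λ v → S v ∧ T v) + mv k (λ v → S v ∧ not (T v))
  mv-split k S T = trans (Σl-cong V (λ v _ → aux (S v) (T v) (moved (μ k) v))) (Σl-+ _ _ V)
    where
    aux : ∀ a b c → b2n (a ∧ c) ≡ b2n ((a ∧ b) ∧ c) + b2n ((a ∧ not b) ∧ c)
    aux false b c = refl
    aux true true true = refl
    aux true true false = refl
    aux true false c = refl

  -- Some u in S is met by i but not by j. On its chain only the two ends can be missed by j, so the
  -- surplus there is at most 2. If it is not positive, removing the chain leaves a smaller closed
  -- set that still has a surplus.
  search : ∀ e (S : Fin n → Bool) → Closed S → cnt S V ≤ e → mv j S < mv i S → Surplus
  search e S (closed ci cj) he lt = by e he (Σl-< _ _ V lt)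
    where
    gap : ∀ a b c → b2n (a ∧ b) < b2n (a ∧ c) → a ≡ true × b ≡ false × c ≡ true
    gap true false true _ = refl , refl , refl
    gap true true true (s≤s ())
    by : ∀ e → cnt S V ≤ e → (∃ λ u → u ∈ V × b2n (S u ∧ moved (μ j) u) < b2n (S u ∧ moved (μ i) u)) → Surplus
    by e he (u , _ , l) = go e he (gap (S u) (moved (μ j) u) (moved (μ i) u) l)
      where
      go : ∀ e → cnt S V ≤ e → S u ≡ true × moved (μ j) u ≡ false × moved (μ i) u ≡ true → Surplus
      go zero he (Su , _ , _) = ⊥-elim (n≮0 (≤-trans (cnt-pos S (∈-allFin u) Su) he))
      go (suc e) he (Su , mj , mi) = finish (mv j S₁ <? mv i S₁)
        where
        uj : μ j u ≡ u
        uj = ⌊⌋-true (μ j u ≟F u) (trans (sym (not-not _)) (cong not mj))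
          where
          not-not : ∀ b → not (not b) ≡ b
          not-not true = refl
          not-not false = refl
        open Chain (chain (μ i) (μ j) (inv i) (inv j) u uj)
        S₁ S₂ : Fin n → Bool
        S₁ v = S v ∧ on v
        S₂ v = S v ∧ not (on v)
        both : ∀ v → b2n (S₁ v ∧ moved (μ i) v) ≤ b2n (S₁ v ∧ moved (μ j) v) + (b2n ⌊ v ≟F u ⌋ + b2n ⌊ v ≟F w ⌋)
        both v = aux (S₁ v) refl (v ≟F u) (v ≟F w)
          where
          aux : ∀ b → S₁ v ≡ b → (d : Dec (v ≡ u)) → (d' : Dec (v ≡ w)) → b2n (b ∧ moved (μ i) v) ≤ b2n (b ∧ moved (μ j) v) + (b2n ⌊ d ⌋ + b2n ⌊ d' ⌋)
          aux false _ _ _ = z≤n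
          aux true e (yes _) _ = ≤-trans (b2n≤1 _) (≤-trans (m≤m+n 1 _) (m≤n+m _ (b2n (moved (μ j) v))))
          aux true e (no _) (yes _) = ≤-trans (b2n≤1 _) (m≤n+m 1 (b2n (moved (μ j) v)))
          aux true e (no p) (no q) = ≤-trans (b2n≤1 _) (≤-trans (≤-reflexive (cong b2n (sym (moved-intro (μ j)
            (λ r → Data.Sum.[ p , q ] (ends v (proj₂ (∧-true {S v} e)) (inj₂ r))))))) (m≤m+n _ 0))
        at-most : mv i S₁ ≤ 2 + mv j S₁
        at-most = begin
          mv i S₁                                                                 ≤⟨ Σl-mono V (λ v _ → both v) ⟩
          Σl (λ v → b2n (S₁ v ∧ moved (μ j) v) + (b2n ⌊ v ≟F u ⌋ + b2n ⌊ v ≟F w ⌋)) V ≡⟨ trans (Σl-+ _ _ V) (cong (mv j S₁ +_) (Σl-+ _ _ V)) ⟩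
          mv j S₁ + (cnt (λ v → ⌊ v ≟F u ⌋) V + cnt (λ v → ⌊ v ≟F w ⌋) V)         ≤⟨ +-monoʳ-≤ (mv j S₁) (+-mono-≤ (one u) (one w)) ⟩
          mv j S₁ + 2                                                             ≡⟨ +-comm _ 2 ⟩
          2 + mv j S₁                                                             ∎
          where
          open ≤-Reasoning
          one : ∀ c → cnt (λ v → ⌊ v ≟F c ⌋) V ≤ 1
          one c = cnt≤1 _ (allFin⁺ n) (λ x y _ _ e f → trans (⌊⌋-true (x ≟F c) e) (sym (⌊⌋-true (y ≟F c) f)))
        smaller : cnt S₂ V < cnt S V
        smaller = ≤-trans (s≤s (cnt-mono S₂ (λ v → S v ∧ not ⌊ v ≟F u ⌋) V (λ v _ h → ∧-intro (proj₁ (∧-true h))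
                    (not-false (⌊⌋-no (v ≟F u) (λ { refl → true≢false on-u (not-true (proj₂ (∧-true {S v} h))) }))))))
                    (≤-reflexive (cnt-delete S Su))
        finish : Dec (mv j S₁ < mv i S₁) → Surplus
        finish (yes l) = S₁ , closed (λ v → cong₂ _∧_ (ci v) (on-a v)) (λ v → cong₂ _∧_ (cj v) (on-b v)) , l , at-most
        finish (no ¬l) = search e S₂ (closed (λ v → cong₂ (λ a b → a ∧ not b) (ci v) (on-a v)) (λ v → cong₂ (λ a b → a ∧ not b) (cj v) (on-b v)))
          (≤-pred (≤-trans smaller he))
          (+-cancelˡ-< (mv i S₁) _ _ (≤-trans (s≤s (+-monoˡ-≤ (mv j S₂) (≮⇒≥ ¬l)))
            (subst₂ (λ a b → suc a ≤ b) (mv-split j S on) (mv-split i S on) lt)))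

  surplus : weight F j < weight F i → Surplus
  surplus lt = search _ (λ _ → true) (closed (λ _ → refl) (λ _ → refl)) ≤-refl lt

  module Apply (i≢j : i ≢ j) (wide : weight F j + 4 ≤ weight F i) (S : Fin n → Bool) (cl : Closed S)
               (lt : mv j S < mv i S) (le : mv i S ≤ 2 + mv j S) where
    open Swap F i j S (Closed.cl-i cl) (Closed.cl-j cl) public

    weight-o : ∀ k → k ≢ i → k ≢ j → weight family k ≡ weight F k
    weight-o k p q = Σl-cong V (λ v _ → cong (λ l → b2n (moved (μ l) v)) (ix-o v p q) )

    shifted : ∀ k l → tr k ≡ l → weight family k + mv k S ≡ weight F k + mv l S
    shifted k l refl = trans (sym (Σl-+ _ _ V)) (trans (Σl-cong V (λ v _ → aux v (S v))) (Σl-+ _ _ V))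
      where
      aux : ∀ v b → b2n (moved (μ (if b then tr k else k)) v) + b2n (b ∧ moved (μ k) v) ≡ b2n (moved (μ k) v) + b2n (b ∧ moved (μ (tr k)) v)
      aux v true  = +-comm (b2n (moved (μ (tr k)) v)) _
      aux v false = refl

    sq : Family n K → Fin K → ℕ
    sq F k = weight F k * weight F k

    drop-sq : Σl (sq family) (allFin K) < Σl (sq F) (allFin K)
    drop-sq = lem _ _ _ _ (Σ-two i j i≢j (sq family) (sq F) (λ k p q → cong₂ _*_ (weight-o k p q) (weight-o k p q)))
        (squares-drop (weight F i) (weight F j) (weight family i) (weight family j) (mv i S ∸ mv j S) (m<n⇒0<n∸m lt) (m≤n+o⇒m∸n≤o (mv i S) (mv j S) (≤-trans le (≤-reflexive (+-comm 2 _)))) wide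
          (eq₁ (weight F i) (weight family i) (mv i S) (mv j S) (m∸n+n≡m (<⇒≤ lt)) (shifted i j tr-i))
          (eq₂ (weight F j) (weight family j) (mv i S) (mv j S) (m∸n+n≡m (<⇒≤ lt)) (shifted j i tr-j)))
      where
      lem : ∀ s' s p p' → s' + p ≡ s + p' → p' < p → s' < s
      lem s' s p p' e h = +-cancelʳ-< p s' s (≤-trans (≤-reflexive (cong suc e)) (+-monoʳ-< s h))
      eq₁ : ∀ x x' a b → (a ∸ b) + b ≡ a → x' + a ≡ x + b → x' + (a ∸ b) ≡ x
      eq₁ x x' a b e h = +-cancelʳ-≡ b _ _ (trans (+-assoc x' _ b) (trans (cong (x' +_) e) h))
      eq₂ : ∀ y y' a b → (a ∸ b) + b ≡ a → y' + b ≡ y + a → y' ≡ y + (a ∸ b)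
      eq₂ y y' a b e h = +-cancelʳ-≡ b _ _ (trans h (trans (cong (y +_) (sym e)) (sym (+-assoc y _ b))))

-- Weights count vertices, so they are twice the class sizes, and a gap below 4 means that sizes
-- differ by at most one.
Balanced : ∀ {n K} → (Fin n → Fin n → Set) → Set
Balanced {n} {K} R = Σ (ColouredBy K R) λ C → ∀ i j → weight (proj₁ C) i < weight (proj₁ C) j + 4

abstract
  -- Every Kempe change between two classes with a gap of at least 4 lowers the sum of the squared
  -- weights.
  balance : ∀ {n K} (R : Fin n → Fin n → Set) → ColouredBy K R → Balanced {n} {K} R
  balance {n} {K} R (F , s , c) = go _ F s c ≤-refl
    where
    go : ∀ e F → (∀ k v → Family.μ F k v ≢ v → R v (Family.μ F k v)) → (∀ a b → R a b → ∃ λ k → Family.μ F k a ≡ b) →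
         Σl (λ k → weight F k * weight F k) (allFin K) ≤ e → Balanced {n} {K} R
    go e F s c he with any?F (λ i → any?F (λ j → weight F j + 4 ≤? weight F i))
    ... | no ¬h = (F , s , c) , λ i j → ≰⇒> (λ h → ¬h (i , j , h))
    ... | yes (i , j , wide) = by e he (Balance.surplus F i j (≤-trans (s≤s (m≤m+n _ 3)) (≤-trans (≤-reflexive (sym (+-suc _ 3))) wide)))
      where
      i≢j : i ≢ j
      i≢j refl = 1+n≰n (≤-trans (≤-trans (s≤s (m≤m+n _ 3)) (≤-reflexive (sym (+-suc (weight F j) 3)))) wide)
      by : ∀ e → Σl (λ k → weight F k * weight F k) (allFin K) ≤ e → Balance.Surplus F i j → Balanced {n} {K} R
      by zero he (S , cl , lt , le) = ⊥-elim (n≮0 (≤-trans (Balance.Apply.drop-sq F i j i≢j wide S cl lt le) he))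
      by (suc e) he (S , cl , lt , le) = go e A.family (λ k v → s (A.ix v k) v) (λ a b r → A.sw-edge (c a b r))
          (≤-pred (≤-trans A.drop-sq he))
        where module A = Balance.Apply F i j i≢j wide S cl lt le

-- Degree counts and the two-thirds bounds

length-filter-cnt : ∀ {A : Set} {P : A → Set} (P? : ∀ x → Dec (P x)) xs → length (filter P? xs) ≡ cnt (λ x → ⌊ P? x ⌋) xs
length-filter-cnt P? [] = refl
length-filter-cnt P? (x ∷ xs) with P? x
... | yes _ = cong suc (length-filter-cnt P? xs)
... | no _  = length-filter-cnt P? xs

Σl-ones : ∀ {A : Set} (f : A → ℕ) xs → (∀ x → x ∈ xs → f x ≤ 1) → Σl f xs ≡ length xs → ∀ x → x ∈ xs → f x ≡ 1
Σl-ones f (y ∷ xs) h e x i = go i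
  where
  top : f y ≡ 1
  top = ≤-antisym (h y (here refl)) (+-cancelʳ-≤ (length xs) 1 (f y) (≤-trans (≤-reflexive (sym e))
    (+-monoʳ-≤ (f y) (≤-trans (Σl-bound f 1 xs (λ z j → h z (there j))) (≤-reflexive (*-identityˡ _))))))
  go : x ∈ y ∷ xs → f x ≡ 1
  go (here refl) = top
  go (there j) = Σl-ones f xs (λ z k → h z (there k)) (suc-injective (trans (cong (_+ Σl f xs) (sym top)) e)) x j

module Counting {n} (G : Graph n) where
  open Edges G public
  V = allFin n
  Es = allFin (m G)

  degree-cnt : ∀ v → degree G v ≡ cnt (inc v) Es
  degree-cnt v = length-filter-cnt (incident? v) Es

  ends-of : ∀ e → cnt (λ v → inc v e) V ≡ 2
  ends-of e = trans (Σl-cong V (λ v _ → aux v (lo e ≟F v) (hi e ≟F v))) (trans (Σl-+ _ _ V) (cong₂ _+_ (one (lo e)) (one (hi e))))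
    where
    aux : ∀ v (p : Dec (lo e ≡ v)) (q : Dec (hi e ≡ v)) → b2n ⌊ p ⊎-dec q ⌋ ≡ b2n ⌊ p ⌋ + b2n ⌊ q ⌋
    aux v (yes p) (yes q) = ⊥-elim (lo≢hi e (trans p (sym q)))
    aux v (yes p) (no q)  = refl
    aux v (no p)  (yes q) = refl
    aux v (no p)  (no q)  = refl
    one : ∀ a → cnt (λ v → ⌊ a ≟F v ⌋) V ≡ 1
    one a = cnt≡1 _ (allFin⁺ n) (∈-allFin a) (⌊⌋-intro (a ≟F a) refl) (λ y _ h → sym (⌊⌋-true (a ≟F y) h))

  ends-sum : ∀ es → Σl (λ v → cnt (inc v) es) V ≡ 2 * length es
  ends-sum es = trans (Σl-swap (λ v e → b2n (inc v e)) V es) (trans (Σl-cong es (λ e _ → ends-of e)) (Σl-const 2 es))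

  handshake : ∀ {k} → Regular k G → k * n ≡ 2 * m G
  handshake {k} reg = trans (trans (cong (k *_) (sym (length-tabulate id))) (sym (Σl-const k V)))
    (trans (Σl-cong V (λ v _ → trans (sym (reg v)) (degree-cnt v))) (trans (ends-sum Es) (cong (2 *_) (length-tabulate {n = m G} id))))

  joined? : ∀ a b → Dec (∃ λ e → Incident G a e × Incident G b e × a ≢ b)
  joined? a b = any?F (λ e → incident? a e ×-dec (incident? b e ×-dec ¬? (a ≟F b)))

  adjG : Fin n → Fin n → Bool
  adjG a b = ⌊ joined? a b ⌋

  adjG-irr : ∀ a → adjG a a ≡ false
  adjG-irr a = ⌊⌋-no (joined? a a) (λ h → proj₂ (proj₂ (proj₂ h)) refl)

  adjG-comm : ∀ a b → adjG a b ≡ true → adjG b a ≡ true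
  adjG-comm a b h = by (⌊⌋-true (joined? a b) h)
    where
    by : (∃ λ e → Incident G a e × Incident G b e × a ≢ b) → adjG b a ≡ true
    by (e , p , q , ne) = ⌊⌋-intro (joined? b a) (e , q , p , λ r → ne (sym r))

  adjG-degree : ∀ {k} → Regular k G → ∀ v → cnt (adjG v) V ≤ k
  adjG-degree {k} reg v = begin
    cnt (adjG v) V                  ≤⟨ Σl-mono V (λ b _ → by b (joined? v b)) ⟩
    Σl (λ b → cnt (to b) Es) V      ≡⟨ Σl-swap (λ b e → b2n (to b e)) V Es ⟩
    Σl (λ e → cnt (λ b → to b e) V) Es ≤⟨ Σl-mono Es (λ e _ → once e (inc v e) refl) ⟩
    cnt (inc v) Es                  ≡⟨ sym (degree-cnt v) ⟩
    degree G v                      ≡⟨ reg v ⟩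
    k                               ∎
    where
    open ≤-Reasoning
    to : Fin n → E → Bool
    to b e = inc v e ∧ ⌊ b ≟F other e v ⌋
    by : ∀ b (d : Dec (∃ λ e → Incident G v e × Incident G b e × v ≢ b)) → b2n ⌊ d ⌋ ≤ cnt (to b) Es
    by b (no _) = z≤n
    by b (yes (e , p , q , ne)) = cnt-pos (to b) (∈-allFin e) (∧-intro (⌊⌋-intro (incident? v e) p)
      (⌊⌋-intro (b ≟F other e v) (two-ends p q (λ r → ne (sym r)))))
    once : ∀ e b → inc v e ≡ b → cnt (λ b → to b e) V ≤ b2n b
    once e true _ = cnt≤1 _ (allFin⁺ n) (λ x y _ _ p q → trans (⌊⌋-true (x ≟F other e v) (proj₂ (∧-true p))) (sym (⌊⌋-true (y ≟F other e v) (proj₂ (∧-true q)))))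
    once e false h = ≤-reflexive (cnt-zero _ V (λ b _ → cong (_∧ ⌊ b ≟F other e v ⌋) h))

  identity : Σ (Ordering G) λ ℓ → Good G ℓ 0
  identity = (id , inj⇒surj id id) , λ _ _ _ → z≤n

  -- For q ≥ 1 take Q = ⌊(q - 1)/3⌋ and s = 2Q - 1. Then q ≤ 3Q + 3, so 2q + 9 ≤ 6Q + 15 = 3(s + 6).
  -- If q = 0 or Q = 0, then s = 0 is already enough. The spare 9 pays for roundings in the
  -- applications.
  thirds-bound : ∀ {K} (c : E → Fin (suc K)) (proper : Proper G c) q → (∀ i → q ≤ length (Colour.cls c proper i)) →
                 ∃ λ s → 2 * q + 9 ≤ 3 * (s + 6) × Σ (Ordering G) λ ℓ → Good G ℓ s
  thirds-bound c proper zero h = 0 , m≤m+n 9 9 , identity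
  thirds-bound c proper (suc q) h = by (q / 3) refl
    where
    up : q ≤ 3 * (q / 3) + 2
    up = ≤-trans (≤-reflexive (trans (m≡m%n+[m/n]*n q 3) (trans (+-comm (q % 3) _) (cong (_+ q % 3) (*-comm (q / 3) 3)))))
           (+-monoʳ-≤ (3 * (q / 3)) (≤-pred (m%n<n q 3)))
    down : 3 * (q / 3) ≤ q
    down = ≤-trans (≤-reflexive (*-comm 3 (q / 3))) (m/n*n≤m q 3)
    by : ∀ r → q / 3 ≡ r → ∃ λ s → 2 * suc q + 9 ≤ 3 * (s + 6) × Σ (Ordering G) λ ℓ → Good G ℓ s
    by zero e = 0 , ≤-trans (+-monoˡ-≤ 9 (*-monoʳ-≤ 2 (s≤s (subst (λ r → q ≤ 3 * r + 2) e up)))) (m≤m+n 15 3) , identity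
    by (suc r) e = suc (2 * r) , lem r (subst (λ r → q ≤ 3 * r + 2) e up) ,
      Thirds.ordering G c proper (suc r) (λ i → ≤-trans (s≤s (≤-trans (≤-reflexive (lem' r)) (subst (λ r → 3 * r ≤ q) e down))) (h i)) (suc (2 * r))
        (≤-reflexive (lem″ r))
      where
      eq : ∀ r q → 2 * suc q + 9 + 2 * (3 * suc r + 2) + 0 ≡ 3 * (suc (2 * r) + 6) + 2 * q
      eq = solve-∀
      lem : ∀ r → q ≤ 3 * suc r + 2 → 2 * suc q + 9 ≤ 3 * (suc (2 * r) + 6)
      lem r h = lin 0 (*-monoʳ-≤ 2 h) (eq r q)
      lem' : ∀ r → suc r + suc r + suc r ≡ 3 * suc r
      lem' = solve-∀
      lem″ : ∀ r → suc (suc (2 * r)) ≡ suc r + suc r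
      lem″ = solve-∀

  module FromFamily {K} (F : Family n K) (sound : ∀ k v → Family.μ F k v ≢ v → adjG v (Family.μ F k v) ≡ true)
                    (complete : ∀ a b → adjG a b ≡ true → ∃ λ k → Family.μ F k a ≡ b) where
    open Family F

    pick : ∀ e → ∃ λ k → μ k (lo e) ≡ hi e
    pick e = complete (lo e) (hi e) (⌊⌋-intro (joined? (lo e) (hi e)) (e , inj₁ refl , inj₂ refl , lo≢hi e))

    c : E → Fin K
    c e = proj₁ (pick e)

    c-other : ∀ e {v} → Incident G v e → μ (c e) v ≡ other e v
    c-other e (inj₁ refl) = trans (proj₂ (pick e)) (sym (other-lo e))
    c-other e (inj₂ refl) = trans (cong (μ (c e)) (sym (proj₂ (pick e)))) (trans (inv (c e) (lo e)) (sym (other-hi e)))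

    proper : Proper G c
    proper e f (ne , v , p , q) h = ne (same-ends (λ r → other-≢ p (sym r)) p (other-inc p) q
      (subst (λ x → Incident G x f) (trans (sym (c-other f q)) (trans (cong (λ k → μ k v) (sym h)) (c-other e p))) (other-inc q)))

    open Colour c proper

    weight-cls : ∀ i → weight F i ≡ 2 * length (cls i)
    weight-cls i = trans (Σl-cong V (λ v _ → sym (by v (μ i v ≟F v)))) (ends-sum (cls i))
      where
      by : ∀ v (d : Dec (μ i v ≡ v)) → cnt (inc v) (cls i) ≡ b2n (not ⌊ d ⌋)
      by v (yes e) = cnt-zero (inc v) (cls i) (λ f h → ≢true (λ p → other-≢ (⌊⌋-true (incident? v f) p)
        (trans (sym (c-other f (⌊⌋-true (incident? v f) p))) (trans (cong (λ k → μ k v) (cls⁻ h)) e))))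
      by v (no ne) = go (⌊⌋-true (joined? v (μ i v)) (sound i v ne))
        where
        go : (∃ λ e → Incident G v e × Incident G (μ i v) e × v ≢ μ i v) → cnt (inc v) (cls i) ≡ 1
        go (e , p , q , _) = cnt≡1 (inc v) (cls-unique i) (cls⁺ ce) (⌊⌋-intro (incident? v e) p)
            (λ f h r → one-at (trans (cls⁻ h) (sym ce)) (⌊⌋-true (incident? v f) r) p)
          where
          ce : c e ≡ i
          ce = disj (c e) i v (trans (c-other e p) (sym (two-ends p q ne))) (λ r → other-≢ p (trans (sym (c-other e p)) r))

  sizes-sum : ∀ {K} (c : E → Fin K) (proper : Proper G c) → Σl (λ i → length (Colour.cls c proper i)) (allFin K) ≡ m G
  sizes-sum {K} c proper = trans (Σl-cong (allFin K) (λ i _ → length-fil _ Es))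
    (trans (Σl-swap (λ i e → b2n ⌊ c e ≟F i ⌋) (allFin K) Es) (trans (Σl-cong Es (λ e _ →
      cnt≡1 _ (allFin⁺ K) (∈-allFin (c e)) (⌊⌋-intro (c e ≟F c e) refl) (λ y _ h → sym (⌊⌋-true (c e ≟F y) h))))
      (trans (Σl-const 1 Es) (trans (*-identityˡ _) (length-tabulate id)))))

  -- Sizes differ by at most one, so every class has at least q = ⌊m/(k + 1)⌋ edges: one smaller
  -- class would keep all the others at q or below and the sum below m.
  regular-bound : ∀ {k} → Regular k G → ∃ λ s → 2 * m G ≤ suc k * (3 * (s + 6)) × Σ (Ordering G) λ ℓ → Good G ℓ s
  regular-bound {k} reg = by (balance _ (Vizing.vizing adjG adjG-irr adjG-comm (adjG-degree reg)))
    where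
    by : Balanced {n} {suc k} (λ a b → adjG a b ≡ true) → ∃ λ s → 2 * m G ≤ suc k * (3 * (s + 6)) × Σ (Ordering G) λ ℓ → Good G ℓ s
    by ((F , sound , complete) , bal) = finish (thirds-bound c proper q enough)
      where
      open FromFamily F sound complete
      open Colour c proper
      size : Fin (suc k) → ℕ
      size i = length (cls i)
      q = m G / suc k
      close : ∀ i j → size i ≤ suc (size j)
      close i j = ≤-pred (*-cancelˡ-< 2 (size i) (suc (suc (size j))) (subst₂ (λ a b → a < b) (weight-cls i) (trans (cong (_+ 4) (weight-cls j)) (lem (size j))) (bal i j)))
        where
        lem : ∀ a → 2 * a + 4 ≡ 2 * suc (suc a)
        lem = solve-∀
      enough : ∀ j → q ≤ size j
      enough j = ≮⇒≥ (λ l → <-irrefl (sizes-sum c proper) (begin-strict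
          Σl size (allFin (suc k))       <⟨ small l ⟩
          Σl (λ _ → q) (allFin (suc k))  ≡⟨ trans (Σl-const q (allFin (suc k))) (cong (q *_) (length-tabulate id)) ⟩
          q * suc k                      ≤⟨ m/n*n≤m (m G) (suc k) ⟩
          m G                            ∎))
        where
        open ≤-Reasoning
        small : size j < q → Σl size (allFin (suc k)) < Σl (λ _ → q) (allFin (suc k))
        small l = go (∈-extract (∈-allFin j))
          where
          go : (∃ λ ys → allFin (suc k) ↭ j ∷ ys) → _
          go (ys , p) = subst₂ _<_ (sym (Σl-↭ _ p)) (sym (Σl-↭ _ p)) (+-mono-<-≤ l (Σl-mono ys (λ i _ → ≤-trans (close i j) l)))
      finish : (∃ λ s → 2 * q + 9 ≤ 3 * (s + 6) × Σ (Ordering G) λ ℓ → Good G ℓ s) → _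
      finish (s , h , o) = s , ≤-trans (begin
          2 * m G                     ≡⟨ cong (2 *_) (m≡m%n+[m/n]*n (m G) (suc k)) ⟩
          2 * (m G % suc k + q * suc k) ≤⟨ *-monoʳ-≤ 2 (+-monoˡ-≤ (q * suc k) (<⇒≤ (m%n<n (m G) (suc k)))) ⟩
          2 * (suc k + q * suc k)     ≡⟨ lem k q ⟩
          suc k * (2 * q + 2)         ≤⟨ *-monoʳ-≤ (suc k) (+-monoʳ-≤ (2 * q) (m≤m+n 2 7)) ⟩
          suc k * (2 * q + 9)         ∎) (*-monoʳ-≤ (suc k) h) , o
        where
        open ≤-Reasoning
        lem : ∀ k q → 2 * (suc k + q * suc k) ≡ suc k * (2 * q + 2)
        lem = solve-∀

  module ClassOne {k} (reg : Regular (suc k) G) (c : E → Fin (suc k)) (proper : Proper G c) where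
    open Colour c proper public

    -- Each of the suc k classes has at most one edge at v, and together they have suc k.
    at-every : ∀ i v → cnt (inc v) (cls i) ≡ 1
    at-every i v = Σl-ones (λ i → cnt (inc v) (cls i)) (allFin (suc k))
      (λ i _ → cnt≤1 (inc v) (cls-unique i) (λ f f' p q a b → one-at (trans (cls⁻ p) (sym (cls⁻ q))) (⌊⌋-true (incident? v f) a) (⌊⌋-true (incident? v f') b)))
      (trans (Σl-cong (allFin (suc k)) (λ i _ → cnt-fil (inc v) (λ e → ⌊ c e ≟F i ⌋) Es))
        (trans (Σl-swap (λ i e → b2n (⌊ c e ≟F i ⌋ ∧ inc v e)) (allFin (suc k)) Es)
        (trans (Σl-cong Es (λ e _ → pointwise e)) (trans (sym (degree-cnt v)) (trans (reg v) (sym (length-tabulate id)))))))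
      i (∈-allFin i)
      where
      pointwise : ∀ e → cnt (λ i → ⌊ c e ≟F i ⌋ ∧ inc v e) (allFin (suc k)) ≡ b2n (inc v e)
      pointwise e = by (inc v e) refl
        where
        by : ∀ b → inc v e ≡ b → cnt (λ i → ⌊ c e ≟F i ⌋ ∧ inc v e) (allFin (suc k)) ≡ b2n b
        by true h = cnt≡1 _ (allFin⁺ (suc k)) (∈-allFin (c e)) (∧-intro (⌊⌋-intro (c e ≟F c e) refl) h) (λ y _ r → sym (⌊⌋-true (c e ≟F y) (proj₁ (∧-true r))))
        by false h = cnt-zero _ (allFin (suc k)) (λ i _ → ≢true (λ r → true≢false (proj₂ (∧-true {⌊ c e ≟F i ⌋} r)) h))

    perfect : ∀ i → 2 * length (cls i) ≡ n
    perfect i = trans (sym (ends-sum (cls i))) (trans (Σl-cong V (λ v _ → at-every i v)) (trans (Σl-const 1 V) (trans (*-identityˡ _) (length-tabulate id))))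

    class-one-bound : ∃ λ s → n + 9 ≤ 3 * (s + 6) × Σ (Ordering G) λ ℓ → Good G ℓ s
    class-one-bound = by (thirds-bound c proper (length (cls Fin.zero)) (λ i → ≤-reflexive (*-cancelˡ-≡ _ _ 2 (trans (perfect Fin.zero) (sym (perfect i))))))
      where
      by : (∃ λ s → 2 * length (cls Fin.zero) + 9 ≤ 3 * (s + 6) × Σ (Ordering G) λ ℓ → Good G ℓ s) → _
      by (s , h , o) = s , subst (λ x → x + 9 ≤ 3 * (s + 6)) (perfect Fin.zero) h , o

-- Cubic class 1 graphs: sizes of the blocks

module CubicArith (ℓ u β c₁ H : ℕ) (β≤4 : β ≤ 4) (c₁≤ : c₁ ≤ 2 * β)
  (lo : 2 * u ≤ 3 * ℓ + 8) (hi : 3 * ℓ ≤ 2 * u + 20) (H≤ : 10 * H ≤ 3 * (ℓ + u) + 60) (≤H : 3 * (ℓ + u) + 51 ≤ 10 * H)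
  (big : 91 ≤ ℓ + u) where

  c₁≤8 : c₁ ≤ 8
  c₁≤8 = ≤-trans c₁≤ (*-monoʳ-≤ 2 β≤4)

  -- With N = ℓ + u the leading terms are ℓ = 2N/5, u = 3N/5 and H = 3N/10. So `r₁` and `r₂` are
  -- tight up to constants, which the 51 in `≤H` covers; the remaining inequalities have room
  -- proportional to N, and `big` makes it exceed their constants.
  r₁ : u + 2 * β ≤ 2 * H
  r₁ = *-cancelˡ-≤ 5 (lin 3 (+-mono-≤ (+-mono-≤ lo ≤H) (*-monoʳ-≤ 10 β≤4)) (eq ℓ u β H))
    where
    eq : ∀ ℓ u β H → 5 * (u + 2 * β) + (3 * ℓ + 8 + 10 * H + 10 * 4) + 3 ≡ 5 * (2 * H) + (2 * u + (3 * (ℓ + u) + 51) + 10 * β)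
    eq = solve-∀

  r₂ : u + 1 + β ≤ 2 * H
  r₂ = *-cancelˡ-≤ 5 (lin 18 (+-mono-≤ (+-mono-≤ lo ≤H) (*-monoʳ-≤ 5 β≤4)) (eq ℓ u β H))
    where
    eq : ∀ ℓ u β H → 5 * (u + 1 + β) + (3 * ℓ + 8 + 10 * H + 5 * 4) + 18 ≡ 5 * (2 * H) + (2 * u + (3 * (ℓ + u) + 51) + 5 * β)
    eq = solve-∀

  r₃ : H ≤ u
  r₃ = *-cancelˡ-≤ 10 (lin 173 (+-mono-≤ (+-mono-≤ H≤ (*-monoʳ-≤ 2 hi)) (*-monoʳ-≤ 3 big)) (eq ℓ u H))
    where
    eq : ∀ ℓ u H → 10 * H + (3 * (ℓ + u) + 60 + 2 * (2 * u + 20) + 3 * (ℓ + u)) + 173 ≡ 10 * u + (10 * H + 2 * (3 * ℓ) + 3 * 91)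
    eq = solve-∀

  r₄ : H ≤ ℓ + c₁ + 1
  r₄ = *-cancelˡ-≤ 10 (lin (25 + 10 * c₁) (+-mono-≤ (+-mono-≤ H≤ (*-monoʳ-≤ 2 lo)) big) (eq ℓ u H c₁))
    where
    eq : ∀ ℓ u H c₁ → 10 * H + (3 * (ℓ + u) + 60 + 2 * (3 * ℓ + 8) + (ℓ + u)) + (25 + 10 * c₁) ≡ 10 * (ℓ + c₁ + 1) + (10 * H + 2 * (2 * u) + 91)
    eq = solve-∀

  r₅ : ℓ + c₁ + β ≤ 2 * H
  r₅ = *-cancelˡ-≤ 10 (lin 124 (+-mono-≤ (+-mono-≤ (+-mono-≤ (*-monoʳ-≤ 2 ≤H) (*-monoʳ-≤ 2 hi)) (*-monoʳ-≤ 2 big)) (+-mono-≤ (*-monoʳ-≤ 10 c₁≤8) (*-monoʳ-≤ 10 β≤4))) (eq ℓ u H c₁ β))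
    where
    eq : ∀ ℓ u H c₁ β → 10 * (ℓ + c₁ + β) + (2 * (10 * H) + 2 * (2 * u + 20) + 2 * (ℓ + u) + (10 * 8 + 10 * 4)) + 124
       ≡ 10 * (2 * H) + (2 * (3 * (ℓ + u) + 51) + 2 * (3 * ℓ) + 2 * 91 + (10 * c₁ + 10 * β))
    eq = solve-∀

  r₆ : 2 * ℓ + β ≤ 3 + 3 * H
  r₆ = *-cancelˡ-≤ 10 (lin 154 (+-mono-≤ (+-mono-≤ (+-mono-≤ (*-monoʳ-≤ 3 ≤H) (*-monoʳ-≤ 4 hi)) big) (*-monoʳ-≤ 10 β≤4)) (eq ℓ u H β))
    where
    eq : ∀ ℓ u H β → 10 * (2 * ℓ + β) + (3 * (10 * H) + 4 * (2 * u + 20) + (ℓ + u) + 10 * 4) + 154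
       ≡ 10 * (3 + 3 * H) + (3 * (3 * (ℓ + u) + 51) + 4 * (3 * ℓ) + 91 + 10 * β)
    eq = solve-∀

  r₇ : c₁ + 1 + β ≤ H
  r₇ = *-cancelˡ-≤ 10 (lin 194 (+-mono-≤ (+-mono-≤ ≤H (*-monoʳ-≤ 3 big)) (+-mono-≤ (*-monoʳ-≤ 10 c₁≤8) (*-monoʳ-≤ 10 β≤4))) (eq ℓ u H c₁ β))
    where
    eq : ∀ ℓ u H c₁ β → 10 * (c₁ + 1 + β) + (10 * H + 3 * (ℓ + u) + (10 * 8 + 10 * 4)) + 194 ≡ 10 * H + (3 * (ℓ + u) + 51 + 3 * 91 + (10 * c₁ + 10 * β))
    eq = solve-∀

  r₈ : β ≤ H
  r₈ = ≤-trans (m≤n+m β (c₁ + 1)) r₇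

xor : Bool → Bool → Bool
xor true  b = not b
xor false b = b

cnt-point : ∀ {n} (p : Fin n → Bool) a → cnt (λ v → p v ∧ ⌊ a ≟F v ⌋) (allFin n) ≡ b2n (p a)
cnt-point {n} p a = by (p a) refl
  where
  by : ∀ b → p a ≡ b → cnt (λ v → p v ∧ ⌊ a ≟F v ⌋) (allFin n) ≡ b2n b
  by true e = cnt≡1 _ (allFin⁺ n) (∈-allFin a) (∧-intro e (⌊⌋-intro (a ≟F a) refl)) (λ y _ h → sym (⌊⌋-true (a ≟F y) (proj₂ (∧-true h))))
  by false e = cnt-zero _ (allFin n) (λ v _ → ≢true (λ h → true≢false (subst (λ z → p z ≡ true) (sym (⌊⌋-true (a ≟F v) (proj₂ (∧-true h)))) (proj₁ (∧-true h))) e))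

-- Reads `Slow` as a bound on what a prefix meets; `boundary` needs it in this form for initial
-- segments.
slow-touched : ∀ {A B : Set} (R : A → B → Bool) c p W Y → Slow R c W Y →
               cnt (λ y → ⌊ 1 ≤? cnt (λ x → R x y) (take p W) ⌋) Y ≤ p + c
slow-touched R c zero W Y s = ≤-trans (≤-reflexive (cnt-zero _ Y (λ _ _ → refl))) z≤n
slow-touched R c (suc p) [] Y s = ≤-trans (≤-reflexive (cnt-zero _ Y (λ _ _ → refl))) z≤n
slow-touched R c (suc p) (x ∷ W) Y (h , s) = begin
  cnt (λ y → ⌊ 1 ≤? b2n (R x y) + k y ⌋) Y                       ≤⟨ cnt-∨ _ (R x) (λ y → not (R x y) ∧ ⌊ 1 ≤? k y ⌋) Y (λ y _ → split y) ⟩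
  cnt (R x) Y + cnt (λ y → not (R x y) ∧ ⌊ 1 ≤? k y ⌋) Y         ≡⟨ cong (cnt (R x) Y +_) (sym (cnt-fil (λ y → ⌊ 1 ≤? k y ⌋) (not ∘ R x) Y)) ⟩
  cnt (R x) Y + cnt (λ y → ⌊ 1 ≤? k y ⌋) (filterᵇ (not ∘ R x) Y) ≤⟨ +-monoʳ-≤ (cnt (R x) Y) (slow-touched R _ p W _ s) ⟩
  cnt (R x) Y + (p + (suc c ∸ cnt (R x) Y))                      ≡⟨ lem (cnt (R x) Y) p _ ⟩
  p + (cnt (R x) Y + (suc c ∸ cnt (R x) Y))                      ≡⟨ cong (p +_) (m+[n∸m]≡n h) ⟩
  p + suc c                                                      ≡⟨ +-suc p c ⟩
  suc p + c                                                      ∎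
  where
  open ≤-Reasoning
  k : _ → ℕ
  k y = cnt (λ x → R x y) (take p W)
  lem : ∀ a b c → a + (b + c) ≡ b + (a + c)
  lem = solve-∀
  split : ∀ y → ⌊ 1 ≤? b2n (R x y) + k y ⌋ ≡ true → R x y ≡ true ⊎ not (R x y) ∧ ⌊ 1 ≤? k y ⌋ ≡ true
  split y h with R x y
  ... | true  = inj₁ refl
  ... | false = inj₂ h

module Perfect {n k} (G : Graph n) (reg : Regular (suc k) G) (c : Fin (m G) → Fin (suc k)) (proper : Proper G c) where
  open Counting G public
  open ClassOne reg c proper public

  abstract
    at : Fin (suc k) → Fin n → E
    at i v = proj₁ (cnt-witness (inc v) (cls i) (≤-reflexive (sym (at-every i v))))

    at-cls : ∀ i v → c (at i v) ≡ i
    at-cls i v = cls⁻ (proj₁ (proj₂ (cnt-witness (inc v) (cls i) (≤-reflexive (sym (at-every i v))))))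

    at-inc : ∀ i v → Incident G v (at i v)
    at-inc i v = ⌊⌋-true (incident? v _) (proj₂ (proj₂ (cnt-witness (inc v) (cls i) (≤-reflexive (sym (at-every i v))))))

  at-unique : ∀ {i v e} → c e ≡ i → Incident G v e → at i v ≡ e
  at-unique {i} {v} h p = one-at (trans (at-cls i v) (sym h)) (at-inc i v) p

  sumE : (Fin n → Bool) → E → ℕ
  sumE p e = b2n (p (lo e)) + b2n (p (hi e))

  -- A perfect matching covers each vertex exactly once, so a sum over both ends of its edges is a
  -- sum over all vertices.
  sumE-total : ∀ i p → Σl (sumE p) (cls i) ≡ cnt p V
  sumE-total i p = trans (Σl-cong (cls i) (λ e _ → sym (ends e)))
    (trans (Σl-swap (λ e v → b2n (p v ∧ inc v e)) (cls i) V) (Σl-cong V (λ v _ → by v (p v) refl)))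
    where
    ends : ∀ e → cnt (λ v → p v ∧ inc v e) V ≡ sumE p e
    ends e = trans (Σl-cong V (λ v _ → aux (p v) v (lo e ≟F v) (hi e ≟F v))) (trans (Σl-+ _ _ V) (cong₂ _+_ (cnt-point p (lo e)) (cnt-point p (hi e))))
      where
      aux : ∀ b v (x : Dec (lo e ≡ v)) (y : Dec (hi e ≡ v)) → b2n (b ∧ ⌊ x ⊎-dec y ⌋) ≡ b2n (b ∧ ⌊ x ⌋) + b2n (b ∧ ⌊ y ⌋)
      aux false v x y = refl
      aux true v (yes x) (yes y) = ⊥-elim (lo≢hi e (trans x (sym y)))
      aux true v (yes x) (no y)  = refl
      aux true v (no x)  (yes y) = refl
      aux true v (no x)  (no y)  = refl
    by : ∀ v b → p v ≡ b → cnt (λ e → p v ∧ inc v e) (cls i) ≡ b2n b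
    by v true e = trans (Σl-cong (cls i) (λ f _ → cong (λ z → b2n (z ∧ inc v f)) e)) (at-every i v)
    by v false e = cnt-zero _ (cls i) (λ f _ → cong (_∧ inc v f) e)

  -- A neighbour of f in class i is the edge of that class at one of the two ends of f.
  nb-count : ∀ i (p : E → Bool) f → cnt (nb f) (filterᵇ p (cls i)) ≤ sumE (p ∘ at i) f
  nb-count i p f = ≤-trans (cnt-∨ (nb f) (λ e → p e ∧ ⌊ e ≟F at i (lo f) ⌋) (λ e → p e ∧ ⌊ e ≟F at i (hi f) ⌋) (filterᵇ p (cls i)) split)
      (+-mono-≤ (one (at i (lo f))) (one (at i (hi f))))
    where
    split : ∀ e → e ∈ filterᵇ p (cls i) → nb f e ≡ true → _
    split e h r = by (∈-fil⁻ p (cls i) h) (nb⁻ r)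
      where
      by : e ∈ cls i × p e ≡ true → Adjacent G f e → p e ∧ ⌊ e ≟F at i (lo f) ⌋ ≡ true ⊎ p e ∧ ⌊ e ≟F at i (hi f) ⌋ ≡ true
      by (q , pe) (_ , v , inj₁ refl , w) = inj₁ (∧-intro pe (⌊⌋-intro (e ≟F at i (lo f)) (sym (at-unique (cls⁻ q) w))))
      by (q , pe) (_ , v , inj₂ refl , w) = inj₂ (∧-intro pe (⌊⌋-intro (e ≟F at i (hi f)) (sym (at-unique (cls⁻ q) w))))
    one : ∀ a → cnt (λ e → p e ∧ ⌊ e ≟F a ⌋) (filterᵇ p (cls i)) ≤ b2n (p a)
    one a = by (p a) refl
      where
      by : ∀ b → p a ≡ b → cnt (λ e → p e ∧ ⌊ e ≟F a ⌋) (filterᵇ p (cls i)) ≤ b2n b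
      by true _ = cnt≤1 _ (unique-fil p (cls-unique i)) (λ x y _ _ r s → trans (⌊⌋-true (x ≟F a) (proj₂ (∧-true r))) (sym (⌊⌋-true (y ≟F a) (proj₂ (∧-true s)))))
      by false e = ≤-reflexive (cnt-zero _ (filterᵇ p (cls i)) (λ x _ → ≢true (λ r →
        true≢false (subst (λ z → p z ≡ true) (⌊⌋-true (x ≟F a) (proj₂ (∧-true r))) (proj₁ (∧-true r))) e)))

  size-eq : ∀ i j → length (cls i) ≡ length (cls j)
  size-eq i j = *-cancelˡ-≡ _ _ 2 (trans (perfect i) (sym (perfect j)))

At-take : ∀ {A : Set} {xs : List A} {y f} p → At xs y f → y < p → At (take p xs) y f
At-take (suc p) here      _       = here
At-take (suc p) (there a) (s≤s l) = there (At-take p a l)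

At-drop : ∀ {A : Set} {xs : List A} {j e} k → At xs j e → k ≤ j → e ∈ drop k xs
At-drop zero    a         _       = At-∈ a
At-drop (suc k) (there a) (s≤s l) = At-drop k a l

length-drop≤ : ∀ {A : Set} k (xs : List A) {s} → length xs ≡ k + s → length (drop k xs) ≡ s
length-drop≤ k xs {s} e = trans (length-drop k xs) (trans (cong (_∸ k) e) (m+n∸m≡n k s))

-- `touch-late` counted from the back: with both lists reversed, the bound on how late y comes turns
-- into a bound on how early it comes.
rev-late : ∀ {A B : Set} (R : A → B → Bool) c W Y {p p' x y} → Slow R c W Y → At (reverse W) p x →
           At (reverse (touch R W Y)) p' y → R x y ≡ true → p + length Y ≤ length W + p' + c
rev-late R c W Y {p} {p'} s a b e = by (At-reverse W a) (At-reverse (touch R W Y) b)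
  where
  by : (∃ λ w → At W w _ × suc (p + w) ≡ length W) → (∃ λ v → At (touch R W Y) v _ × suc (p' + v) ≡ length (touch R W Y)) →
       p + length Y ≤ length W + p' + c
  by (w , a' , e₁) (v , b' , e₂) = lem _ _ w v e₁ (trans e₂ (↭-length (touch-↭ R W Y))) (touch-late R c W Y s a' b' e)
    where
    eq : ∀ p p' w v c → p + suc (p' + v) + (w + c) + 0 ≡ suc (p + w) + p' + c + v
    eq = solve-∀
    lem : ∀ lw ly w v → suc (p + w) ≡ lw → suc (p' + v) ≡ ly → v ≤ w + c → p + ly ≤ lw + p' + c
    lem _ _ w v refl refl h = lin 0 h (eq p p' w v c)

-- Two of the three perfect matchings follow the same bipartition of the vertices into V(L₁) and its
-- complement, up to the χ crossing edges of M₁; in the third, X consists mostly of mixed edges, so that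
-- U₂ can be ordered after X and L₁ before it.
module CubicLayout {n} (G : Graph n) (reg : Regular 3 G) (c : Fin (m G) → Fin 3) (proper : Proper G c) (lE : Fin (m G) → Bool) where
  open Perfect G reg c proper public

  i₀ i₁ i₂ : Fin 3
  i₀ = Fin.zero
  i₁ = Fin.suc Fin.zero
  i₂ = Fin.suc (Fin.suc Fin.zero)

  M₀ M₁ M₂ : List E
  M₀ = cls i₀
  M₁ = cls i₁
  M₂ = cls i₂

  -- l is the vertex set of L₁, and k that of U₂, the edges of M₁ that are not inside V(L₁). Every
  -- vertex is in l or in k, and χ vertices are in both: the ends in V(L₁) of crossing edges.
  l k : Fin n → Bool
  gE cross : E → Bool
  l v = lE (at i₀ v)
  gE f = l (lo f) ∧ l (hi f)
  cross f = xor (l (lo f)) (l (hi f))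
  k v = not (gE (at i₁ v))

  N ℓ u ℓ₂ u₂ χ mix : ℕ
  N = length M₀
  ℓ = cnt lE M₀
  u = cnt (not ∘ lE) M₀
  ℓ₂ = cnt gE M₁
  u₂ = cnt (not ∘ gE) M₁
  χ = cnt cross M₁
  mix = cnt cross M₂

  -- The digit is the number of ends in V(L₁) for r and in V(U₂) for t.
  r0 r2 t0 t2 : E → Bool
  r0 f = not (l (lo f)) ∧ not (l (hi f))
  r2 f = l (lo f) ∧ l (hi f)
  t0 f = not (k (lo f)) ∧ not (k (hi f))
  t2 f = k (lo f) ∧ k (hi f)

  l-at : ∀ {e v} → c e ≡ i₀ → Incident G v e → l v ≡ lE e
  l-at h p = cong lE (at-unique h p)

  k-at : ∀ {e v} → c e ≡ i₁ → Incident G v e → k v ≡ not (gE e)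
  k-at h p = cong (not ∘ gE) (at-unique h p)

  l⇒k : ∀ v → l v ≡ false → k v ≡ true
  l⇒k v h = not-false (by (at-inc i₁ v))
    where
    by : Incident G v (at i₁ v) → gE (at i₁ v) ≡ false
    by (inj₁ e) = trans (cong (λ z → l z ∧ l (hi (at i₁ v))) e) (cong (_∧ l (hi (at i₁ v))) h)
    by (inj₂ e) = ≢true (λ r → true≢false (proj₂ (∧-true {l (lo (at i₁ v))} r)) (trans (cong l e) h))

  N≡ : ℓ + u ≡ N
  N≡ = cnt-split lE M₀

  N₁ : ℓ₂ + u₂ ≡ N
  N₁ = trans (cnt-split gE M₁) (size-eq i₁ i₀)

  twice : ∀ i (p : Fin n → Bool) (q : E → Bool) → (∀ e → c e ≡ i → ∀ v → Incident G v e → p v ≡ q e) → cnt p V ≡ 2 * cnt q (cls i)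
  twice i p q h = trans (sym (sumE-total i p)) (trans (Σl-cong (cls i) (λ e r → trans
    (cong₂ (λ x y → b2n x + b2n y) (h e (cls⁻ r) _ (inj₁ refl)) (h e (cls⁻ r) _ (inj₂ refl))) (cong (b2n (q e) +_) (sym (+-identityʳ _))))) (Σl-* 2 _ (cls i)))

  sum-l : cnt l V ≡ 2 * ℓ
  sum-l = twice i₀ l lE (λ e h v → l-at h)

  sum-k : cnt k V ≡ 2 * u₂
  sum-k = twice i₁ k (not ∘ gE) (λ e h v → k-at h)

  eqχ : 2 * ℓ ≡ 2 * ℓ₂ + χ
  eqχ = trans (sym sum-l) (trans (sym (sumE-total i₁ l)) (trans (Σl-cong M₁ (λ f _ → aux (l (lo f)) (l (hi f))))
    (trans (Σl-+ _ _ M₁) (cong (_+ χ) (Σl-* 2 _ M₁)))))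
    where
    aux : ∀ a b → b2n a + b2n b ≡ 2 * b2n (a ∧ b) + b2n (xor a b)
    aux true true = refl
    aux true false = refl
    aux false true = refl
    aux false false = refl

  Σ1 : ∀ i → Σl (λ _ → 1) (cls i) ≡ N
  Σ1 i = trans (Σl-const 1 (cls i)) (trans (*-identityˡ _) (size-eq i i₀))

  eq-mix : 2 * ℓ + 2 * cnt r0 M₂ + mix ≡ 2 * N
  eq-mix = trans (cong (λ z → z + 2 * cnt r0 M₂ + mix) (trans (sym sum-l) (sym (sumE-total i₂ l))))
    (trans (sym (trans (Σl-+ _ _ M₂) (cong (_+ mix) (trans (Σl-+ _ _ M₂) (cong (Σl (sumE l) M₂ +_) (Σl-* 2 _ M₂))))))
    (trans (Σl-cong M₂ (λ f _ → aux (l (lo f)) (l (hi f)))) (trans (Σl-const 2 M₂) (cong (2 *_) (size-eq i₂ i₀)))))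
    where
    aux : ∀ a b → b2n a + b2n b + 2 * b2n (not a ∧ not b) + b2n (xor a b) ≡ 2
    aux true true = refl
    aux true false = refl
    aux false true = refl
    aux false false = refl

  eq-t : cnt t0 M₂ + 2 * u₂ ≡ N + cnt t2 M₂
  eq-t = trans (cong (cnt t0 M₂ +_) (trans (sym sum-k) (sym (sumE-total i₂ k)))) (trans (sym (Σl-+ _ _ M₂))
    (trans (Σl-cong M₂ (λ f _ → aux (k (lo f)) (k (hi f)))) (trans (Σl-+ _ _ M₂) (cong (_+ cnt t2 M₂) (Σ1 i₂)))))
    where
    aux : ∀ a b → b2n (not a ∧ not b) + (b2n a + b2n b) ≡ 1 + b2n (a ∧ b)
    aux true true = refl
    aux true false = refl
    aux false true = refl
    aux false false = refl

  c₁ c₂ : ℕ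
  c₁ = cnt (λ f → t2 f ∧ not (r0 f)) M₂
  c₂ = cnt (λ f → r2 f ∧ not (t0 f)) M₂

  r0⇒t2 : ∀ f → r0 f ≡ true → t2 f ≡ true
  r0⇒t2 f h = ∧-intro (l⇒k _ (not-true (proj₁ (∧-true h)))) (l⇒k _ (not-true (proj₂ (∧-true {not (l (lo f))} h))))

  eq-t2 : cnt t2 M₂ ≡ cnt r0 M₂ + c₁
  eq-t2 = trans (Σl-cong M₂ (λ f _ → aux (t2 f) (r0 f) (r0⇒t2 f))) (Σl-+ _ _ M₂)
    where
    aux : ∀ a b → (b ≡ true → a ≡ true) → b2n a ≡ b2n b + b2n (a ∧ not b)
    aux true true h = refl
    aux true false h = refl
    aux false true h = case h refl of λ ()
    aux false false h = refl

  -- The sizes of l and k add up to 2N + χ. Every edge of M₂ uses at least 2 of this total, as each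
  -- of its ends is in l or in k, and an edge marked by p uses a third; so there are at most χ
  -- marked edges.
  excess : ∀ (p : E → Bool) → (∀ a b x y → (a ≡ false → x ≡ true) → (b ≡ false → y ≡ true) → ∀ f → l (lo f) ≡ a → l (hi f) ≡ b → k (lo f) ≡ x → k (hi f) ≡ y →
           2 + b2n (p f) ≤ b2n a + b2n b + (b2n x + b2n y)) → cnt p M₂ ≤ χ
  excess p h = lem (cnt p M₂) (begin
      2 * N + cnt p M₂                         ≡⟨ cong (_+ cnt p M₂) (sym (trans (Σl-const 2 M₂) (cong (2 *_) (size-eq i₂ i₀)))) ⟩
      Σl (λ _ → 2) M₂ + cnt p M₂               ≡⟨ sym (Σl-+ _ _ M₂) ⟩
      Σl (λ f → 2 + b2n (p f)) M₂              ≤⟨ Σl-mono M₂ (λ f _ → h _ _ _ _ (l⇒k _) (l⇒k _) f refl refl refl refl) ⟩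
      Σl (λ f → sumE l f + sumE k f) M₂        ≡⟨ trans (Σl-+ _ _ M₂) (cong₂ _+_ (trans (sumE-total i₂ l) sum-l) (trans (sumE-total i₂ k) sum-k)) ⟩
      2 * ℓ + 2 * u₂                           ≡⟨ cong (_+ 2 * u₂) eqχ ⟩
      2 * ℓ₂ + χ + 2 * u₂                      ∎) N₁
    where
    open ≤-Reasoning
    eq : ∀ a b x χ → x + (2 * a + χ + 2 * b) + 0 ≡ χ + (2 * (a + b) + x)
    eq = solve-∀
    go : ∀ x N a b χ → 2 * N + x ≤ 2 * a + χ + 2 * b → a + b ≡ N → x ≤ χ
    go x N a b χ h refl = lin 0 h (eq a b x χ)
    lem : ∀ x → 2 * N + x ≤ 2 * ℓ₂ + χ + 2 * u₂ → ℓ₂ + u₂ ≡ N → x ≤ χ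
    lem x = go x N ℓ₂ u₂ χ

  c₁≤χ : c₁ ≤ χ
  c₁≤χ = excess _ (λ { a b x y p q f refl refl refl refl → aux (l (lo f)) (l (hi f)) (k (lo f)) (k (hi f)) p q })
    where
    aux : ∀ a b x y → (a ≡ false → x ≡ true) → (b ≡ false → y ≡ true) → 2 + b2n ((x ∧ y) ∧ not (not a ∧ not b)) ≤ b2n a + b2n b + (b2n x + b2n y)
    aux true true true true p q = s≤s (s≤s (s≤s z≤n))
    aux true true true false p q = s≤s (s≤s z≤n)
    aux true true false true p q = s≤s (s≤s z≤n)
    aux true true false false p q = s≤s (s≤s z≤n)
    aux true false true true p q = s≤s (s≤s (s≤s z≤n))
    aux true false false true p q = s≤s (s≤s z≤n)
    aux true false x false p q = case q refl of λ ()
    aux false true true true p q = s≤s (s≤s (s≤s z≤n))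
    aux false true true false p q = s≤s (s≤s z≤n)
    aux false b false y p q = case p refl of λ ()
    aux false false true true p q = s≤s (s≤s z≤n)
    aux false false true false p q = case q refl of λ ()

  c₂≤χ : c₂ ≤ χ
  c₂≤χ = excess _ (λ { a b x y p q f refl refl refl refl → aux (l (lo f)) (l (hi f)) (k (lo f)) (k (hi f)) p q })
    where
    aux : ∀ a b x y → (a ≡ false → x ≡ true) → (b ≡ false → y ≡ true) → 2 + b2n ((a ∧ b) ∧ not (not x ∧ not y)) ≤ b2n a + b2n b + (b2n x + b2n y)
    aux true true true true p q = s≤s (s≤s (s≤s z≤n))
    aux true true true false p q = s≤s (s≤s (s≤s z≤n))
    aux true true false true p q = s≤s (s≤s (s≤s z≤n))
    aux true true false false p q = s≤s (s≤s z≤n)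
    aux true false true true p q = s≤s (s≤s z≤n)
    aux true false false true p q = s≤s (s≤s z≤n)
    aux true false x false p q = case q refl of λ ()
    aux false true true true p q = s≤s (s≤s z≤n)
    aux false true true false p q = s≤s (s≤s z≤n)
    aux false b false y p q = case p refl of λ ()
    aux false false true true p q = s≤s (s≤s z≤n)
    aux false false true false p q = case q refl of λ ()

  apart₀₁ : ∀ {e f} → c e ≡ i₀ → lE e ≡ false → gE f ≡ true → ¬ Adjacent G e f
  apart₀₁ {e} {f} h p q (_ , v , a , b) = by b
    where
    by : Incident G v f → ⊥
    by (inj₁ refl) = true≢false (proj₁ (∧-true q)) (trans (l-at h a) p)
    by (inj₂ refl) = true≢false (proj₂ (∧-true {l (lo f)} q)) (trans (l-at h a) p)

  apart₁₂ : ∀ {e f} → c e ≡ i₁ → gE e ≡ false → t0 f ≡ true → ¬ Adjacent G e f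
  apart₁₂ {e} {f} h p q (_ , v , a , b) = by b
    where
    by : Incident G v f → ⊥
    by (inj₁ refl) = true≢false (trans (k-at h a) (not-false p)) (not-true (proj₁ (∧-true q)))
    by (inj₂ refl) = true≢false (trans (k-at h a) (not-false p)) (not-true (proj₂ (∧-true {not (k (lo f))} q)))

  apart₂₀ : ∀ {e f} → c f ≡ i₀ → lE f ≡ true → r0 e ≡ true → ¬ Adjacent G e f
  apart₂₀ {e} {f} h p q (_ , v , a , b) = by a
    where
    by : Incident G v e → ⊥
    by (inj₁ refl) = true≢false (trans (l-at h b) p) (not-true (proj₁ (∧-true q)))
    by (inj₂ refl) = true≢false (trans (l-at h b) p) (not-true (proj₂ (∧-true {not (l (lo e))} q)))

module CubicNumbers (ℓ u ℓ₂ u₂ χ mix r t tt c₁ c₂ N H : ℕ) (N≡ : ℓ + u ≡ N) (N₁ : ℓ₂ + u₂ ≡ N) (eqχ : 2 * ℓ ≡ 2 * ℓ₂ + χ)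
  (eq-mix : 2 * ℓ + 2 * r + mix ≡ 2 * N) (eq-t : t + 2 * u₂ ≡ N + tt) (eq-tt : tt ≡ r + c₁) (c₁≤χ : c₁ ≤ χ) (c₂≤χ : c₂ ≤ χ)
  (χ≤8 : χ ≤ 8) (mix≤ : mix + 2 * χ + 2 ≤ 2 * H) (lo : 2 * u ≤ 3 * ℓ + 8) (hi : 3 * ℓ ≤ 2 * u + 20)
  (H≤ : 10 * H ≤ 3 * N + 60) (≤H : 3 * N + 51 ≤ 10 * H) (big : 91 ≤ N) where

  -- p, κ, a and z are the sizes of C₁, A₂, A₃ and Z₃. z is chosen for the step from M₂ to M₀, which
  -- needs N + χ ≤ H + ℓ + z. g is the length of both ends D₀ and D₂ of X₃: equal, so that one end
  -- earns the budget that the other spends. This gives a + H = ℓ + c₁ + 1 (`aH`), enough for the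
  -- step from M₁ to M₂. β = χ/2 is the loss from crossing edges, and c″ the budget for ordering C₁
  -- against Z₃ when Z₃ is the larger one.
  β p κ z g a c″ : ℕ
  β = ℓ ∸ ℓ₂
  p = H ∸ β
  κ = ℓ ∸ suc H
  z = u + χ + 1 ∸ H
  g = r ∸ z
  a = t ∸ g
  c″ = suc z ∸ p

  q3 : ℓ ≡ ℓ₂ + β
  q3 = sym (m+[n∸m]≡n {ℓ₂} {ℓ} (*-cancelˡ-≤ 2 (≤-trans (m≤m+n _ χ) (≤-reflexive (sym eqχ)))))

  χ≡ : χ ≡ 2 * β
  χ≡ = +-cancelˡ-≡ (2 * ℓ₂) _ _ (trans (sym eqχ) (trans (cong (2 *_) q3) (*-distribˡ-+ 2 ℓ₂ β)))

  β≤4 : β ≤ 4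
  β≤4 = *-cancelˡ-≤ 2 (≤-trans (≤-reflexive (sym χ≡)) χ≤8)

  open CubicArith ℓ u β c₁ H β≤4 (subst (c₁ ≤_) χ≡ c₁≤χ) lo hi (subst (λ x → 10 * H ≤ 3 * x + 60) (sym N≡) H≤)
    (subst (λ x → 3 * x + 51 ≤ 10 * H) (sym N≡) ≤H) (subst (91 ≤_) (sym N≡) big) public

  q2 : p + β ≡ H
  q2 = m∸n+n≡m r₈

  zH : z + H ≡ u + χ + 1
  zH = m∸n+n≡m (≤-trans r₃ (≤-trans (m≤m+n u χ) (m≤m+n _ 1)))

  p≤u : p ≤ u
  p≤u = ≤-trans (m∸n≤m H β) r₃

  -- M₂ has u - mix/2 edges with no end in V(L₁), so this is the place where the bound on mixed
  -- edges is used, with nothing to spare.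
  z≤r : z ≤ r
  z≤r = *-cancelˡ-≤ 2 (go ℓ u χ mix r z H (+-mono-≤ (+-mono-≤ mix≤ (≤-reflexive (cong (2 *_) zH)))
          (≤-reflexive (trans (cong (2 *_) N≡) (sym eq-mix)))))
    where
    eq : ∀ ℓ u χ mix r z H → 2 * z + (2 * H + 2 * (u + χ + 1) + (2 * ℓ + 2 * r + mix)) + 0 ≡ 2 * r + (mix + 2 * χ + 2 + 2 * (z + H) + 2 * (ℓ + u))
    eq = solve-∀
    go : ∀ ℓ u χ mix r z H → mix + 2 * χ + 2 + 2 * (z + H) + 2 * (ℓ + u) ≤ 2 * H + 2 * (u + χ + 1) + (2 * ℓ + 2 * r + mix) → 2 * z ≤ 2 * r
    go ℓ u χ mix r z H h = lin 0 h (eq ℓ u χ mix r z H)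

  gz : g + z ≡ r
  gz = m∸n+n≡m z≤r

  u₂≡ : u₂ ≡ u + β
  u₂≡ = +-cancelˡ-≡ ℓ₂ _ _ (trans N₁ (trans (sym N≡) (trans (cong (_+ u) q3) (trans (+-assoc ℓ₂ β u) (cong (ℓ₂ +_) (+-comm β u))))))

  tH : t + H ≡ ℓ + c₁ + 1 + g
  tH = go ℓ u β t H g z (trans (cong (λ x → t + 2 * x) (sym u₂≡)) (trans eq-t (cong₂ _+_ (sym N≡) (trans eq-tt (cong (_+ c₁) (sym gz))))))
        (trans zH (cong (λ x → u + x + 1) χ≡))
    where
    eq₁ : ∀ u β t H z → t + H + (2 * (u + β) + z) ≡ t + 2 * (u + β) + (z + H)
    eq₁ = solve-∀
    eq₂ : ∀ ℓ u β g z c₁ → ℓ + u + (g + z + c₁) + (u + 2 * β + 1) ≡ ℓ + c₁ + 1 + g + (2 * (u + β) + z)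
    eq₂ = solve-∀
    go : ∀ ℓ u β t H g z → t + 2 * (u + β) ≡ ℓ + u + (g + z + c₁) → z + H ≡ u + 2 * β + 1 → t + H ≡ ℓ + c₁ + 1 + g
    go ℓ u β t H g z e e' = +-cancelʳ-≡ (2 * (u + β) + z) _ _ (trans (eq₁ u β t H z) (trans (cong₂ _+_ e e') (eq₂ ℓ u β g z c₁)))

  g≤t : g ≤ t
  g≤t = +-cancelʳ-≤ H g t (≤-trans (+-monoʳ-≤ g r₄) (≤-reflexive (trans (+-comm g _) (sym tH))))

  ag : a + g ≡ t
  ag = m∸n+n≡m g≤t

  aH : a + H ≡ ℓ + c₁ + 1
  aH = +-cancelʳ-≡ g _ _ (trans (trans (+-assoc a H g) (trans (cong (a +_) (+-comm H g)) (sym (+-assoc a g H)))) (trans (cong (_+ H) ag) tH))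

  q1 : ℓ ≤ suc H + κ
  q1 = m≤n+m∸n ℓ (suc H)

  q4 : β + u ≤ H + p
  q4 = +-cancelʳ-≤ β _ _ (≤-trans (≤-reflexive (eq u β)) (≤-trans r₁ (≤-reflexive (trans (cong (H +_) (+-identityʳ H)) (trans (cong (H +_) (sym q2)) (sym (+-assoc H p β)))))))
    where
    eq : ∀ u β → β + u + β ≡ u + 2 * β
    eq = solve-∀

  q5 : ℓ₂ + c₁ + 1 ≤ H + a
  q5 = ≤-trans (+-monoˡ-≤ 1 (+-monoˡ-≤ c₁ (≤-trans (m≤m+n ℓ₂ β) (≤-reflexive (sym q3))))) (≤-reflexive (trans (sym aH) (+-comm a H)))

  q6 : z ≤ suc H
  q6 = +-cancelʳ-≤ H _ _ (≤-trans (≤-reflexive (trans zH (cong (λ x → u + x + 1) χ≡))) (≤-trans (+-monoˡ-≤ 1 r₁) (≤-reflexive (eq H))))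
    where
    eq : ∀ H → 2 * H + 1 ≡ suc H + H
    eq = solve-∀

  q7 : a ≤ suc H
  q7 = +-cancelʳ-≤ H _ _ (≤-trans (≤-reflexive aH) (≤-trans (+-monoˡ-≤ 1 (≤-trans (m≤m+n (ℓ + c₁) β) r₅)) (≤-reflexive (eq H))))
    where
    eq : ∀ H → 2 * H + 1 ≡ suc H + H
    eq = solve-∀

  q8 : κ ≤ suc H
  q8 = m≤n+o⇒m∸n≤o ℓ (suc H) (≤-trans (≤-trans (m≤m+n ℓ (c₁ + β)) (≤-trans (≤-reflexive (sym (+-assoc ℓ c₁ β))) r₅)) (≤-trans (m≤m+n _ 2) (≤-reflexive (eq H))))
    where
    eq : ∀ H → 2 * H + 2 ≡ suc H + suc H
    eq = solve-∀

  slack : ∀ x → x ≤ χ + 1 → N + x ≤ H + ℓ + z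
  slack x h = go ℓ u N z N≡ zH
    where
    eq : ∀ ℓ u H z χ x → ℓ + u + x + (χ + 1 + (z + H)) + 0 ≡ H + ℓ + z + (x + (u + χ + 1))
    eq = solve-∀
    go : ∀ ℓ u N z → ℓ + u ≡ N → z + H ≡ u + χ + 1 → N + x ≤ H + ℓ + z
    go ℓ u N z refl e = lin 0 (+-mono-≤ h (≤-reflexive (sym e))) (eq ℓ u H z χ x)

  q9 : N + c₂ ≤ H + ℓ + z
  q9 = slack c₂ (≤-trans c₂≤χ (m≤m+n χ 1))

  q10 : N + c″ ≤ H + ℓ + z
  q10 with ≤-total p (suc z)
  ... | inj₂ h = slack c″ (≤-trans (≤-reflexive (m≤n⇒m∸n≡0 h)) z≤n)
  ... | inj₁ h = +-cancelʳ-≤ p _ _ (≤-trans (≤-reflexive (trans (+-assoc N c″ p) (cong₂ _+_ (sym N≡) (m∸n+n≡m h))))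
      (≤-trans (≤-reflexive (eq₁ ℓ u z)) (≤-trans (+-monoʳ-≤ (ℓ + z) (+-cancelʳ-≤ β (u + 1) (H + p) (≤-trans r₂ (≤-reflexive (trans (cong (H +_) (trans (+-identityʳ H) (sym q2))) (sym (+-assoc H p β))))))) (≤-reflexive (eq₂ ℓ z H p)))))
    where
    eq₁ : ∀ ℓ u z → ℓ + u + suc z ≡ ℓ + z + (u + 1)
    eq₁ = solve-∀
    eq₂ : ∀ ℓ z H p → ℓ + z + (H + p) ≡ H + ℓ + z + p
    eq₂ = solve-∀

  q11 : N ≤ suc (H + ℓ + p)
  q11 = ≤-trans (≤-reflexive (sym N≡)) (≤-trans (+-monoʳ-≤ ℓ (≤-trans (m≤n+m u β) q4)) (≤-trans (≤-reflexive (eq ℓ H p)) (n≤1+n _)))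
    where
    eq : ∀ ℓ H p → ℓ + (H + p) ≡ H + ℓ + p
    eq = solve-∀

  q12 : suc z ≤ p + c″
  q12 = m≤n+m∸n (suc z) p

  -- The last κ edges of L₁ may meet 2κ edges of L₂, and κ further ones are wanted for A₂.
  q14 : κ + 2 * κ ≤ ℓ₂
  q14 with ≤-total ℓ (suc H)
  ... | inj₁ h = subst (λ x → x + 2 * x ≤ ℓ₂) (sym (m≤n⇒m∸n≡0 h)) z≤n
  ... | inj₂ h = go ℓ κ (m∸n+n≡m h) q3 r₆
    where
    eq : ∀ ℓ₂ β κ H → κ + 2 * κ + (3 + 3 * H + 3 * (ℓ₂ + β)) + 0 ≡ ℓ₂ + (2 * (ℓ₂ + β) + β + 3 * (κ + suc H))
    eq = solve-∀
    go : ∀ ℓ κ → κ + suc H ≡ ℓ → ℓ ≡ ℓ₂ + β → 2 * ℓ + β ≤ 3 + 3 * H → κ + 2 * κ ≤ ℓ₂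
    go ℓ κ e refl h = lin 0 (+-mono-≤ h (≤-reflexive (cong (3 *_) e))) (eq ℓ₂ β κ H)

  q15 : a + κ ≤ ℓ₂
  q15 with ≤-total ℓ (suc H)
  ... | inj₁ h = subst (λ x → a + x ≤ ℓ₂) (sym (m≤n⇒m∸n≡0 h)) (≤-trans (≤-reflexive (+-identityʳ a)) (go ℓ a q3 aH))
    where
    eq : ∀ ℓ₂ β a H c₁ → a + (ℓ₂ + β + c₁ + 1 + H) + 0 ≡ ℓ₂ + (a + H + (c₁ + 1 + β))
    eq = solve-∀
    go : ∀ ℓ a → ℓ ≡ ℓ₂ + β → a + H ≡ ℓ + c₁ + 1 → a ≤ ℓ₂
    go ℓ a refl e = lin 0 (+-mono-≤ (≤-reflexive e) r₇) (eq ℓ₂ β a H c₁)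
  ... | inj₂ h = go ℓ a κ (m∸n+n≡m h) q3 aH r₅
    where
    eq : ∀ ℓ₂ β a κ H c₁ → a + κ + (ℓ₂ + β + c₁ + 1 + (ℓ₂ + β) + 2 * H) + 0 ≡ ℓ₂ + (a + H + (κ + suc H) + (ℓ₂ + β + c₁ + β))
    eq = solve-∀
    go : ∀ ℓ a κ → κ + suc H ≡ ℓ → ℓ ≡ ℓ₂ + β → a + H ≡ ℓ + c₁ + 1 → ℓ + c₁ + β ≤ 2 * H → a + κ ≤ ℓ₂
    go ℓ a κ e refl e' h = lin 0 (+-mono-≤ (+-mono-≤ (≤-reflexive e') (≤-reflexive e)) h) (eq ℓ₂ β a κ H c₁)

-- Cubic class 1 graphs: the three orders

module CubicOrder {n} (G : Graph n) (reg : Regular 3 G) (c : Fin (m G) → Fin 3) (proper : Proper G c) (lE : Fin (m G) → Bool) (H : ℕ) where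
  open CubicLayout G reg c proper lE

  module Build (χ≤8 : χ ≤ 8) (mix≤ : mix + 2 * χ + 2 ≤ 2 * H) (lo≤ : 2 * u ≤ 3 * ℓ + 8) (hi≤ : 3 * ℓ ≤ 2 * u + 20)
               (H≤ : 10 * H ≤ 3 * N + 60) (≤H : 3 * N + 51 ≤ 10 * H) (big : 91 ≤ N) where
    open CubicNumbers ℓ u ℓ₂ u₂ χ mix (cnt r0 M₂) (cnt t0 M₂) (cnt t2 M₂) c₁ c₂ N H N≡ N₁ eqχ eq-mix eq-t eq-t2 c₁≤χ c₂≤χ χ≤8 mix≤ lo≤ hi≤ H≤ ≤H big

    -- The classes are laid out as L₁ C₁ Z₁, A₂ B₂ U₂ and A₃ X₃ Z₃, with U₁ split into C₁ and Z₁ and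
    -- L₂ into A₂ and B₂. No edge of U₁ meets L₂, none of U₂ meets A₃ and none of Z₃ meets L₁. X₃
    -- opens with edges D₀ that do not meet U₂ and closes with edges D₂ that do not meet L₁.
    L₁ U₁ L₂ U₂ T0 Rest R0 Mid A₃ D₀ Z₃ D₂ X₃ : List E
    L₁ = filterᵇ lE M₀
    U₁ = filterᵇ (not ∘ lE) M₀
    L₂ = filterᵇ gE M₁
    U₂ = filterᵇ (not ∘ gE) M₁
    T0 = filterᵇ t0 M₂
    Rest = filterᵇ (not ∘ t0) M₂
    R0 = filterᵇ r0 Rest
    Mid = filterᵇ (not ∘ r0) Rest
    A₃ = take a T0
    D₀ = drop a T0
    Z₃ = take z R0
    D₂ = drop z R0
    X₃ = D₀ ++ Mid ++ D₂

    len-L₁ : length L₁ ≡ ℓ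
    len-L₁ = length-fil lE M₀
    len-T0 : length T0 ≡ a + g
    len-T0 = trans (length-fil t0 M₂) (sym ag)

    r0⇒¬t0 : ∀ f → r0 f ≡ true → not (t0 f) ≡ true
    r0⇒¬t0 f h = aux (k (lo f)) (k (hi f)) (r0⇒t2 f h)
      where
      aux : ∀ x y → x ∧ y ≡ true → not (not x ∧ not y) ≡ true
      aux true true _ = refl

    len-R0 : length R0 ≡ z + g
    len-R0 = trans (length-fil r0 Rest) (trans (cnt-fil r0 (not ∘ t0) M₂) (trans (Σl-cong M₂ (λ f _ → cong b2n (aux (not (t0 f)) (r0 f) (r0⇒¬t0 f))))
      (trans (sym gz) (+-comm g z))))
      where
      aux : ∀ x y → (y ≡ true → x ≡ true) → x ∧ y ≡ y
      aux true y h = refl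
      aux false true h = h refl
      aux false false h = refl

    len-A₃ : length A₃ ≡ a
    len-A₃ = length-take≤ a T0 (≤-trans (m≤m+n a g) (≤-reflexive (sym len-T0)))
    len-D₀ : length D₀ ≡ g
    len-D₀ = length-drop≤ a T0 len-T0
    len-Z₃ : length Z₃ ≡ z
    len-Z₃ = length-take≤ z R0 (≤-trans (m≤m+n z g) (≤-reflexive (sym len-R0)))
    len-D₂ : length D₂ ≡ g
    len-D₂ = length-drop≤ z R0 len-R0

    T0⁻ : ∀ {f} → f ∈ T0 → c f ≡ i₂ × t0 f ≡ true
    T0⁻ h = cls⁻ (proj₁ (∈-fil⁻ t0 M₂ h)) , proj₂ (∈-fil⁻ t0 M₂ h)
    Rest⁻ : ∀ {f} → f ∈ Rest → f ∈ M₂ × t0 f ≡ false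
    Rest⁻ h = proj₁ (∈-fil⁻ _ M₂ h) , not-true (proj₂ (∈-fil⁻ _ M₂ h))
    R0⁻ : ∀ {f} → f ∈ R0 → r0 f ≡ true
    R0⁻ h = proj₂ (∈-fil⁻ r0 Rest h)

    X₃↭ : X₃ ++ Z₃ ↭ D₀ ++ Rest
    X₃↭ = ptrans (↭-reflexive (++-assoc D₀ (Mid ++ D₂) Z₃)) (++⁺ˡ D₀ (ptrans (↭-reflexive (++-assoc Mid D₂ Z₃))
      (ptrans (++⁺ˡ Mid (ptrans (↭-++-comm D₂ Z₃) (↭-reflexive (take++drop≡id z R0)))) (ptrans (↭-++-comm Mid R0) (fil-↭ r0 Rest)))))

    W₂↭ : A₃ ++ X₃ ++ Z₃ ↭ M₂
    W₂↭ = ptrans (++⁺ˡ A₃ X₃↭) (ptrans (↭-reflexive (trans (sym (++-assoc A₃ D₀ Rest)) (cong (_++ Rest) (take++drop≡id a T0)))) (fil-↭ t0 M₂))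

    len-X₃ : a + (length X₃ + z) ≡ N
    len-X₃ = trans (cong₂ _+_ (sym len-A₃) (trans (cong (length X₃ +_) (sym len-Z₃)) (sym (length-++ X₃)))) (trans (sym (length-++ A₃)) (trans (↭-length W₂↭) (size-eq i₂ i₀)))

    t-nb : ∀ f → cnt (nb f) U₂ ≤ sumE k f
    t-nb f = nb-count i₁ (not ∘ gE) f
    r-nb : ∀ f → cnt (nb f) L₁ ≤ sumE l f
    r-nb f = nb-count i₀ lE f

    Σ-Mid : ∀ (w v : E → ℕ) → (∀ f → r0 f ≡ false → t0 f ≡ false → w f ≤ v f) → Σl w Mid ≤ Σl v M₂
    Σ-Mid w v h = ≤-trans (Σl-mono Mid (λ f r → h f (not-true (proj₂ (∈-fil⁻ _ Rest r))) (proj₂ (Rest⁻ (proj₁ (∈-fil⁻ _ Rest r))))))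
      (≤-trans (≤-reflexive (Σl-fil v _ Rest)) (≤-trans (Σl-mono Rest (λ f _ → ite (not (r0 f)) (v f))) (≤-trans (≤-reflexive (Σl-fil v _ M₂)) (Σl-mono M₂ (λ f _ → ite (not (t0 f)) (v f))))))
      where
      ite : ∀ b x → (if b then x else 0) ≤ x
      ite true x = ≤-refl
      ite false x = z≤n

    -- The g edges of D₀ earn g units and the g edges of D₂ spend at most one unit each beyond their
    -- own. An edge of `Mid` with two neighbours in U₂ satisfies `t2` but not `r0`, so there are at
    -- most c₁ of them.
    slowU : Slow nb c₁ X₃ U₂
    slowU = slow-free nb c₁ D₀ (Mid ++ D₂) U₂ free (slow-Σ nb _ (Mid ++ D₂) U₂ (≤-trans (≤-reflexive (Σl-++ _ Mid D₂))
      (≤-trans (+-mono-≤ (Σ-Mid _ _ mid) (≤-trans (Σl-bound _ 1 D₂ (λ f _ → ∸-monoˡ-≤ 1 (≤-trans (t-nb f) (sum≤2 k f)))) (≤-reflexive (trans (*-identityˡ _) (trans len-D₂ (sym len-D₀))))))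
        (≤-reflexive (+-comm c₁ _)))))
      where
      sum≤2 : ∀ p f → sumE p f ≤ 2
      sum≤2 p f = +-mono-≤ (b2n≤1 (p (lo f))) (b2n≤1 (p (hi f)))
      free : ∀ f → f ∈ D₀ → cnt (nb f) U₂ ≡ 0
      free f h = n≤0⇒n≡0 (≤-trans (t-nb f) (aux (k (lo f)) (k (hi f)) (proj₂ (T0⁻ (∈-drop a T0 h)))))
        where
        aux : ∀ x y → not x ∧ not y ≡ true → b2n x + b2n y ≤ 0
        aux false false _ = z≤n
      mid : ∀ f → r0 f ≡ false → t0 f ≡ false → cnt (nb f) U₂ ∸ 1 ≤ b2n (t2 f ∧ not (r0 f))
      mid f e _ = ≤-trans (∸-monoˡ-≤ 1 (t-nb f)) (≤-trans (aux (k (lo f)) (k (hi f))) (≤-reflexive (cong b2n (sym (aux' (t2 f) e)))))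
        where
        aux : ∀ x y → (b2n x + b2n y) ∸ 1 ≤ b2n (x ∧ y)
        aux true true = ≤-refl
        aux true false = z≤n
        aux false true = z≤n
        aux false false = z≤n
        aux' : ∀ x {y} → y ≡ false → x ∧ not y ≡ x
        aux' true refl = refl
        aux' false refl = refl

    revX : reverse X₃ ≡ reverse D₂ ++ (reverse Mid ++ reverse D₀)
    revX = trans (reverse-++ D₀ (Mid ++ D₂)) (trans (cong (_++ reverse D₀) (reverse-++ Mid D₂)) (++-assoc (reverse D₂) _ _))

    -- The mirror image of `slowU`: read backwards, D₂ earns what D₀ spends, and the edges of `Mid`
    -- with two neighbours in L₁ satisfy `r2` but not `t0`.
    slowL : Slow nb c₂ (reverse X₃) L₁
    slowL = subst (λ w → Slow nb c₂ w L₁) (sym revX) (slow-free nb c₂ (reverse D₂) _ L₁ free (slow-Σ nb _ (reverse Mid ++ reverse D₀) L₁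
      (≤-trans (≤-reflexive (trans (Σl-++ _ (reverse Mid) _) (cong₂ _+_ (Σl-↭ _ (↭-reverse Mid)) (Σl-↭ _ (↭-reverse D₀)))))
      (≤-trans (+-mono-≤ (Σ-Mid _ _ mid) (≤-trans (Σl-bound _ 1 D₀ (λ f _ → ∸-monoˡ-≤ 1 (≤-trans (r-nb f) (sum≤2 l f)))) (≤-reflexive (trans (*-identityˡ _)
        (trans len-D₀ (trans (sym len-D₂) (sym (length-reverse D₂))))))))
        (≤-reflexive (+-comm c₂ _))))))
      where
      sum≤2 : ∀ p f → sumE p f ≤ 2
      sum≤2 p f = +-mono-≤ (b2n≤1 (p (lo f))) (b2n≤1 (p (hi f)))
      free : ∀ f → f ∈ reverse D₂ → cnt (nb f) L₁ ≡ 0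
      free f h = n≤0⇒n≡0 (≤-trans (r-nb f) (aux (l (lo f)) (l (hi f)) (R0⁻ (∈-drop z R0 (∈-resp-↭ (↭-reverse D₂) h)))))
        where
        aux : ∀ x y → not x ∧ not y ≡ true → b2n x + b2n y ≤ 0
        aux false false _ = z≤n
      mid : ∀ f → r0 f ≡ false → t0 f ≡ false → cnt (nb f) L₁ ∸ 1 ≤ b2n (r2 f ∧ not (t0 f))
      mid f _ e = ≤-trans (∸-monoˡ-≤ 1 (r-nb f)) (≤-trans (aux (l (lo f)) (l (hi f))) (≤-reflexive (cong b2n (sym (aux' (r2 f) e)))))
        where
        aux : ∀ x y → (b2n x + b2n y) ∸ 1 ≤ b2n (x ∧ y)
        aux true true = ≤-refl
        aux true false = z≤n
        aux false true = z≤n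
        aux false false = z≤n
        aux' : ∀ x {y} → y ≡ false → x ∧ not y ≡ x
        aux' true refl = refl
        aux' false refl = refl

    open Selection (selection i₀ i₁)

    -- C₁ has to contain every edge of U₁ that selects one of the first p edges C₂ of U₂, so that Z₁
    -- selects none of them; other edges of U₁ fill it up to exactly p.
    U₂f L₁f C₂ C₁a C₁b C₁ Z₁ Z₁f : List E
    U₂f = touch nb X₃ U₂
    L₁f = reverse (touch nb (reverse X₃) L₁)
    C₂ = take p U₂f

    inC : E → Bool
    inC e = ⌊ 1 ≤? cnt (is (φ e)) C₂ ⌋

    C₁a = filterᵇ inC U₁
    C₁b = filterᵇ (not ∘ inC) U₁
    C₁ = C₁a ++ take (p ∸ length C₁a) C₁b
    Z₁ = drop (p ∸ length C₁a) C₁b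
    Z₁f = touch nb C₂ Z₁

    U₂f↭ : U₂f ↭ U₂
    U₂f↭ = touch-↭ nb X₃ U₂
    L₁f↭ : L₁f ↭ L₁
    L₁f↭ = ptrans (↭-reverse _) (touch-↭ nb (reverse X₃) L₁)

    U₁⁻ : ∀ {e} → e ∈ U₁ → c e ≡ i₀ × lE e ≡ false
    U₁⁻ h = cls⁻ (proj₁ (∈-fil⁻ _ M₀ h)) , not-true (proj₂ (∈-fil⁻ _ M₀ h))

    U₂⁻ : ∀ {e} → e ∈ U₂ → c e ≡ i₁ × gE e ≡ false
    U₂⁻ h = cls⁻ (proj₁ (∈-fil⁻ _ M₁ h)) , not-true (proj₂ (∈-fil⁻ _ M₁ h))

    -- By `φ-inj` different edges select different edges of C₂.
    C₁a≤p : length C₁a ≤ p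
    C₁a≤p = begin
      length C₁a                                        ≡⟨ length-fil inC U₁ ⟩
      cnt inC U₁                                        ≤⟨ Σl-mono U₁ (λ e _ → aux (cnt (is (φ e)) C₂)) ⟩
      Σl (λ e → cnt (is (φ e)) C₂) U₁                   ≡⟨ Σl-swap (λ e f → b2n (is (φ e) f)) U₁ C₂ ⟩
      Σl (λ f → cnt (λ e → is (φ e) f) U₁) C₂           ≤⟨ Σl-bound _ 1 C₂ (λ f _ → cnt≤1 _ (unique-fil _ (cls-unique i₀))
                                                             (λ e e' q q' x y → φ-inj (proj₁ (U₁⁻ q)) (proj₁ (U₁⁻ q')) (sym (is-true (φ e) x)) (sym (is-true (φ e') y)))) ⟩
      1 * length C₂                                     ≡⟨ *-identityˡ _ ⟩
      length C₂                                         ≤⟨ ≤-trans (≤-reflexive (length-take p U₂f)) (m⊓n≤m p _) ⟩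
      p                                                 ∎
      where
      open ≤-Reasoning
      aux : ∀ x → b2n ⌊ 1 ≤? x ⌋ ≤ x
      aux zero = z≤n
      aux (suc x) = s≤s z≤n

    U₁-split : C₁ ++ Z₁ ↭ U₁
    U₁-split = ptrans (↭-reflexive (trans (++-assoc C₁a _ _) (cong (C₁a ++_) (take++drop≡id (p ∸ length C₁a) C₁b)))) (fil-↭ inC U₁)

    len-U₁ : length U₁ ≡ u
    len-U₁ = length-fil _ M₀

    len-C₁ : length C₁ ≡ p
    len-C₁ = trans (length-++ C₁a) (trans (cong (length C₁a +_) (length-take≤ (p ∸ length C₁a) C₁b
      (m≤n+o⇒m∸n≤o p (length C₁a) (≤-trans p≤u (≤-reflexive (trans (sym len-U₁) (trans (sym (↭-length (fil-↭ inC U₁))) (length-++ C₁a))))))))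
      (m+[n∸m]≡n C₁a≤p))

    Z₁⁻ : ∀ {e} → e ∈ Z₁ → c e ≡ i₀ × inC e ≡ false
    Z₁⁻ h = proj₁ (U₁⁻ (proj₁ (∈-fil⁻ _ U₁ (∈-drop (p ∸ length C₁a) C₁b h)))) , not-true (proj₂ (∈-fil⁻ _ U₁ (∈-drop (p ∸ length C₁a) C₁b h)))

    -- No edge of Z₁ selects into C₂, so `φ-in` leaves each edge of C₂ at most one neighbour in Z₁,
    -- and Z₁ follows C₂ without any budget.
    slowZ₁ : Slow nb 0 C₂ Z₁
    slowZ₁ = slow-Σ nb 0 C₂ Z₁ (≤-trans (Σl-bound _ 0 C₂ (λ f h → ∸-monoˡ-≤ 1 (once f h))) z≤n)
      where
      uniqueZ : Unique Z₁
      uniqueZ = unique-++ʳ C₁ (↭-unique (↭-sym U₁-split) (unique-fil _ (cls-unique i₀)))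
        where
        unique-++ʳ : ∀ xs {ys : List E} → Unique (xs ++ ys) → Unique ys
        unique-++ʳ [] u = u
        unique-++ʳ (x ∷ xs) (_ ∷ᵁ u) = unique-++ʳ xs u
      avoid : ∀ {e f} → f ∈ C₂ → e ∈ Z₁ → φ e ≢ just f
      avoid {e} {f} q h r = ⌊⌋-false (1 ≤? cnt (is (φ e)) C₂) (proj₂ (Z₁⁻ h)) (cnt-pos (is (φ e)) q
        (trans (cong (λ x → is x f) r) (⌊⌋-intro (f ≟F f) refl)))
      once : ∀ f → f ∈ C₂ → cnt (nb f) Z₁ ≤ 1
      once f h = cnt≤1 (nb f) uniqueZ (λ e e' q q' x y → φ-in (proj₁ (Z₁⁻ q)) (proj₁ (Z₁⁻ q'))
        (proj₁ (U₂⁻ (∈-resp-↭ U₂f↭ (∈-take p U₂f h)))) (adj-sym (nb⁻ x)) (adj-sym (nb⁻ y)) (avoid h q) (avoid h q'))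

    sub-deg : ∀ i (xs ys : List E) → xs ++ ys ↭ cls i → ∀ (w : E → Bool) → cnt w (cls i) ≤ 2 → cnt w xs ≤ 2
    sub-deg i xs ys q w h = ≤-trans (m≤m+n _ _) (≤-trans (≤-reflexive (trans (sym (Σl-++ _ xs ys)) (Σl-↭ _ q))) h)

    W₀-raw : C₁ ++ (Z₁ ++ L₁) ↭ M₀
    W₀-raw = ptrans (↭-reflexive (sym (++-assoc C₁ Z₁ L₁))) (ptrans (++⁺ʳ L₁ U₁-split) (ptrans (↭-++-comm U₁ L₁) (fil-↭ lE M₀)))

    W₂-raw : Z₃ ++ (A₃ ++ X₃) ↭ M₂
    W₂-raw = ptrans (↭-++-comm Z₃ (A₃ ++ X₃)) (ptrans (↭-reflexive (++-assoc A₃ X₃ Z₃)) W₂↭)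

    orderC : ∃ λ W → W ↭ C₁ × Slow nb c″ W Z₃
    orderC = greedy nb c″ C₁ Z₃ (λ e _ → sub-deg i₂ Z₃ (A₃ ++ X₃) W₂-raw (nb e) (degree≤2 e i₂)) (λ f _ → sub-deg i₀ C₁ (Z₁ ++ L₁) W₀-raw (λ e → nb e f) (degree≤2' f i₀))
      (≤-trans (≤-reflexive (cong suc len-Z₃)) (≤-trans q12 (≤-reflexive (cong (_+ c″) (sym len-C₁)))))

    -- An edge of L₁ at position at most H may meet anything in M₁. A₂ consists of edges that avoid
    -- the later part of L₁; its length κ makes the positions in B₂ large enough for the whole of
    -- L₁.
    tailL Un To A₂ B₂ : List E
    tailL = drop (suc H) L₁f
    hit : E → Bool
    hit f = ⌊ 1 ≤? cnt (λ e → nb e f) tailL ⌋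
    Un = filterᵇ (not ∘ hit) L₂
    To = filterᵇ hit L₂
    A₂ = take κ Un
    B₂ = drop κ Un ++ To

    L₂⁻ : ∀ {e} → e ∈ L₂ → c e ≡ i₁ × gE e ≡ true
    L₂⁻ h = cls⁻ (proj₁ (∈-fil⁻ gE M₁ h)) , proj₂ (∈-fil⁻ gE M₁ h)

    len-L₂ : length L₂ ≡ ℓ₂
    len-L₂ = length-fil gE M₁

    To≤ : length To ≤ 2 * κ
    To≤ = begin
      length To                                   ≡⟨ length-fil hit L₂ ⟩
      cnt hit L₂                                  ≤⟨ Σl-mono L₂ (λ f _ → aux (cnt (λ e → nb e f) tailL)) ⟩
      Σl (λ f → cnt (λ e → nb e f) tailL) L₂      ≡⟨ Σl-swap (λ f e → b2n (nb e f)) L₂ tailL ⟩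
      Σl (λ e → cnt (nb e) L₂) tailL              ≤⟨ Σl-bound _ 2 tailL (λ e _ → ≤-trans (cnt-fil≤ (nb e) gE M₁) (degree≤2 e i₁)) ⟩
      2 * length tailL                            ≡⟨ cong (2 *_) (trans (length-drop (suc H) L₁f) (cong (_∸ suc H) (trans (↭-length L₁f↭) len-L₁))) ⟩
      2 * κ                                       ∎
      where
      open ≤-Reasoning
      aux : ∀ x → b2n ⌊ 1 ≤? x ⌋ ≤ x
      aux zero = z≤n
      aux (suc x) = s≤s z≤n

    L₂-len : length To + length Un ≡ ℓ₂
    L₂-len = trans (sym (length-++ To)) (trans (↭-length (fil-↭ hit L₂)) len-L₂)

    κ≤Un : κ ≤ length Un
    κ≤Un = +-cancelˡ-≤ (2 * κ) _ _ (≤-trans (≤-trans (≤-reflexive (+-comm (2 * κ) κ)) q14) (≤-trans (≤-reflexive (sym L₂-len)) (+-monoˡ-≤ (length Un) To≤)))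

    len-A₂ : length A₂ ≡ κ
    len-A₂ = length-take≤ κ Un κ≤Un

    AB₂↭ : A₂ ++ B₂ ↭ L₂
    AB₂↭ = ptrans (↭-reflexive (trans (sym (++-assoc A₂ _ _)) (cong (_++ To) (take++drop≡id κ Un)))) (ptrans (↭-++-comm Un To) (fil-↭ hit L₂))

    len-B₂ : κ + length B₂ ≡ ℓ₂
    len-B₂ = trans (cong (_+ length B₂) (sym len-A₂)) (trans (sym (length-++ A₂)) (trans (↭-length AB₂↭) len-L₂))

    W₁-raw : B₂ ++ (A₂ ++ U₂) ↭ M₁
    W₁-raw = ptrans (↭-reflexive (sym (++-assoc B₂ A₂ U₂))) (ptrans (++⁺ʳ U₂ (ptrans (↭-++-comm B₂ A₂) AB₂↭)) (fil-↭ gE M₁))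

    orderB : ∃ λ W → W ↭ B₂ × Slow nb 1 W A₃
    orderB = greedy nb 1 B₂ A₃ (λ e _ → sub-deg i₂ A₃ (X₃ ++ Z₃) W₂↭ (nb e) (degree≤2 e i₂)) (λ f _ → sub-deg i₁ B₂ (A₂ ++ U₂) W₁-raw (λ e → nb e f) (degree≤2' f i₁))
      (≤-trans (s≤s (≤-trans (≤-reflexive len-A₃) a≤B₂)) (≤-reflexive (+-comm 1 _)))
      where
      a≤B₂ : a ≤ length B₂
      a≤B₂ = +-cancelʳ-≤ κ _ _ (≤-trans q15 (≤-reflexive (trans (sym len-B₂) (+-comm κ _))))

    C₁f Z₃f Wb B₂f A₃f : List E
    C₁f = proj₁ orderC
    Z₃f = touch nb C₁f Z₃
    Wb = proj₁ orderB
    B₂f = reverse Wb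
    A₃f = reverse (touch nb Wb A₃)

    W : Fin 3 → List E
    W Fin.zero = L₁f ++ C₁f ++ Z₁f
    W (Fin.suc Fin.zero) = A₂ ++ B₂f ++ U₂f
    W (Fin.suc (Fin.suc Fin.zero)) = A₃f ++ X₃ ++ Z₃f

    B₂f↭ : B₂f ↭ B₂
    B₂f↭ = ptrans (↭-reverse Wb) (proj₁ (proj₂ orderB))
    A₃f↭ : A₃f ↭ A₃
    A₃f↭ = ptrans (↭-reverse _) (touch-↭ nb Wb A₃)
    Z₃f↭ : Z₃f ↭ Z₃
    Z₃f↭ = touch-↭ nb C₁f Z₃
    Z₁f↭ : Z₁f ↭ Z₁
    Z₁f↭ = touch-↭ nb C₂ Z₁

    perm : ∀ i → W i ↭ cls i
    perm Fin.zero = ptrans (++⁺ L₁f↭ (++⁺ (proj₁ (proj₂ orderC)) Z₁f↭)) (ptrans (++⁺ˡ L₁ U₁-split) (fil-↭ lE M₀))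
    perm (Fin.suc Fin.zero) = ptrans (++⁺ˡ A₂ (++⁺ B₂f↭ U₂f↭)) (ptrans (↭-reflexive (sym (++-assoc A₂ B₂ U₂))) (ptrans (++⁺ʳ U₂ AB₂↭) (fil-↭ gE M₁)))
    perm (Fin.suc (Fin.suc Fin.zero)) = ptrans (++⁺ A₃f↭ (++⁺ˡ X₃ Z₃f↭)) W₂↭

-- An adjacent pair at positions q and q′ is fine when q ≤ H + q′. The letter n marks the step from
-- M₀ to M₁, m the one from M₁ to M₂ and k the one from M₂ to M₀; the inequalities cover the pairs
-- of blocks that non-adjacency does not exclude.
module CubicLinkArith (ℓ u ℓ₂ β κ b₂ p H a x₃ z N c₁ c₂ c″ : ℕ) (e₀ : κ + b₂ ≡ ℓ₂) (q3 : ℓ ≡ ℓ₂ + β) (q2 : p + β ≡ H) (xN : a + (x₃ + z) ≡ N)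
  (N≡ : ℓ + u ≡ N) (q1 : ℓ ≤ suc H + κ) (q4 : β + u ≤ H + p) (q5 : ℓ₂ + c₁ + 1 ≤ H + a) (q6 : z ≤ suc H) (q7 : a ≤ suc H) (q8 : κ ≤ suc H)
  (q9 : N + c₂ ≤ H + ℓ + z) (q10 : N + c″ ≤ H + ℓ + z) (q11 : N ≤ suc (H + ℓ + p)) where

  ℓ≡ : ℓ ≡ κ + b₂ + β
  ℓ≡ = trans q3 (cong (_+ β) (sym e₀))

  n2 : ∀ {j} q → j < ℓ → j ≤ H + (κ + q)
  n2 q h = ≤-trans (≤-pred (≤-trans h q1)) (+-monoʳ-≤ H (m≤m+n κ q))

  n3 : ∀ {j} y → j < p → ℓ + j ≤ H + (κ + (b₂ + y))
  n3 {j} y h = ≤-trans (+-monoʳ-≤ ℓ (<⇒≤ h)) (≤-trans (≤-reflexive (go p ℓ≡ q2)) (+-monoʳ-≤ H (+-monoʳ-≤ κ (m≤m+n b₂ y))))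
    where
    eq : ∀ κ b₂ β p → κ + b₂ + β + p ≡ p + β + (κ + b₂)
    eq = solve-∀
    go : ∀ {ℓ H} p → ℓ ≡ κ + b₂ + β → p + β ≡ H → ℓ + p ≡ H + (κ + b₂)
    go p refl refl = eq κ b₂ β p

  n4 : ∀ {i y} → i ≤ y + 0 → ℓ + (p + i) ≤ H + (κ + (b₂ + y))
  n4 {i} {y} h = go i y ℓ≡ q2 h
    where
    eq : ∀ κ b₂ β p i y → κ + b₂ + β + (p + i) + (y + 0) + 0 ≡ p + β + (κ + (b₂ + y)) + i
    eq = solve-∀
    go : ∀ {ℓ H} i y → ℓ ≡ κ + b₂ + β → p + β ≡ H → i ≤ y + 0 → ℓ + (p + i) ≤ H + (κ + (b₂ + y))
    go i y refl refl h = lin 0 h (eq κ b₂ β p i y)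

  n5 : ∀ {i y w} → p + w ≡ u → i < w → p ≤ y → ℓ + (p + i) ≤ H + (κ + (b₂ + y))
  n5 {i} {y} {w} e h₁ h₂ = go i y w ℓ≡ e h₁ h₂ q4
    where
    eq : ∀ κ b₂ β p i y w H → κ + b₂ + β + (p + i) + (w + y + (H + p)) + 1 ≡ H + (κ + (b₂ + y)) + (suc i + p + (β + (p + w)))
    eq = solve-∀
    go : ∀ {ℓ u} i y w → ℓ ≡ κ + b₂ + β → p + w ≡ u → i < w → p ≤ y → β + u ≤ H + p → ℓ + (p + i) ≤ H + (κ + (b₂ + y))
    go i y w refl refl h₁ h₂ h₃ = lin 1 (+-mono-≤ (+-mono-≤ h₁ h₂) h₃) (eq κ b₂ β p i y w H)

  m1 : ∀ {j} p' → j < κ → j ≤ H + p'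
  m1 p' h = ≤-trans (≤-pred (≤-trans h q8)) (m≤m+n H p')

  m2 : ∀ {q p'} → q + a ≤ b₂ + p' + 1 → κ + q ≤ H + p'
  m2 {q} {p'} h = go q p' e₀ h q5
    where
    eq : ∀ κ b₂ a q p' H c₁ → κ + q + (b₂ + p' + 1 + (H + a)) + c₁ ≡ H + p' + (q + a + (κ + b₂ + c₁ + 1))
    eq = solve-∀
    go : ∀ {ℓ₂} q p' → κ + b₂ ≡ ℓ₂ → q + a ≤ b₂ + p' + 1 → ℓ₂ + c₁ + 1 ≤ H + a → κ + q ≤ H + p'
    go q p' refl h h' = lin c₁ (+-mono-≤ h h') (eq κ b₂ a q p' H c₁)

  m3 : ∀ {q} x → q < b₂ → κ + q ≤ H + (a + x)
  m3 {q} x h = ≤-trans (≤-trans (+-monoʳ-≤ κ (<⇒≤ h)) (≤-trans (≤-reflexive e₀) (≤-trans (m≤m+n ℓ₂ (c₁ + 1)) (≤-trans (≤-reflexive (sym (+-assoc ℓ₂ c₁ 1))) q5))))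
    (≤-trans (m≤m+n (H + a) x) (≤-reflexive (+-assoc H a x)))

  m4 : ∀ {x y} → y ≤ x + c₁ → κ + (b₂ + y) ≤ H + (a + x)
  m4 {x} {y} h = go x y e₀ h q5
    where
    eq : ∀ κ b₂ a x y H c₁ → κ + (b₂ + y) + (x + c₁ + (H + a)) + 1 ≡ H + (a + x) + (y + (κ + b₂ + c₁ + 1))
    eq = solve-∀
    go : ∀ {ℓ₂} x y → κ + b₂ ≡ ℓ₂ → y ≤ x + c₁ → ℓ₂ + c₁ + 1 ≤ H + a → κ + (b₂ + y) ≤ H + (a + x)
    go x y refl h h' = lin 1 (+-mono-≤ h h') (eq κ b₂ a x y H c₁)

  m5 : ∀ {y} j → y < N → y ≤ H + (a + (x₃ + j))
  m5 {y} j h = ≤-trans (go y xN h q6) (+-monoʳ-≤ H (+-monoʳ-≤ a (m≤m+n x₃ j)))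
    where
    eq : ∀ a x₃ z y H → y + (a + (x₃ + z) + suc H) + 0 ≡ H + (a + x₃) + (suc y + z)
    eq = solve-∀
    go : ∀ {N} y → a + (x₃ + z) ≡ N → y < N → z ≤ suc H → y ≤ H + (a + x₃)
    go y refl h h' = lin 0 (+-mono-≤ h h') (eq a x₃ z y H)

  k1 : ∀ {j} p' → j < a → j ≤ H + p'
  k1 p' h = ≤-trans (≤-pred (≤-trans h q7)) (m≤m+n H p')

  k2 : ∀ {x p'} → x + ℓ ≤ x₃ + p' + c₂ → a + x ≤ H + p'
  k2 {x} {p'} h = go x p' xN h q9
    where
    eq : ∀ a x₃ z x p' H ℓ c₂ → a + x + (x₃ + p' + c₂ + (H + ℓ + z)) + 0 ≡ H + p' + (x + ℓ + (a + (x₃ + z) + c₂))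
    eq = solve-∀
    go : ∀ {N} x p' → a + (x₃ + z) ≡ N → x + ℓ ≤ x₃ + p' + c₂ → N + c₂ ≤ H + ℓ + z → a + x ≤ H + p'
    go x p' refl h h' = lin 0 (+-mono-≤ h h') (eq a x₃ z x p' H ℓ c₂)

  k3 : ∀ {x} y → x < x₃ → a + x ≤ H + (ℓ + y)
  k3 {x} y h = go x xN h (≤-trans (m≤m+n N c₂) q9)
    where
    eq : ∀ a x₃ z x y H ℓ → a + x + (x₃ + (H + ℓ + z)) + (1 + y) ≡ H + (ℓ + y) + (suc x + (a + (x₃ + z)))
    eq = solve-∀
    go : ∀ {N} x → a + (x₃ + z) ≡ N → x < x₃ → N ≤ H + ℓ + z → a + x ≤ H + (ℓ + y)
    go x refl h h' = lin (1 + y) (+-mono-≤ h h') (eq a x₃ z x y H ℓ)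

  k4 : ∀ {j y} → j ≤ y + c″ → a + (x₃ + j) ≤ H + (ℓ + y)
  k4 {j} {y} h = go j y xN h q10
    where
    eq : ∀ a x₃ z j y H ℓ c″ → a + (x₃ + j) + (y + c″ + (H + ℓ + z)) + 0 ≡ H + (ℓ + y) + (j + (a + (x₃ + z) + c″))
    eq = solve-∀
    go : ∀ {N} j y → a + (x₃ + z) ≡ N → j ≤ y + c″ → N + c″ ≤ H + ℓ + z → a + (x₃ + j) ≤ H + (ℓ + y)
    go j y refl h h' = lin 0 (+-mono-≤ h h') (eq a x₃ z j y H ℓ c″)

  k5 : ∀ {w} y → w < N → w ≤ H + (ℓ + (p + y))
  k5 y h = ≤-trans (≤-pred (≤-trans h q11)) (≤-trans (≤-reflexive (+-assoc H ℓ p)) (+-monoʳ-≤ H (+-monoʳ-≤ ℓ (m≤m+n p y))))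

-- Cubic class 1 graphs: checking the distances

module CubicFinal {n} (G : Graph n) (reg : Regular 3 G) (c : Fin (m G) → Fin 3) (proper : Proper G c) (lE : Fin (m G) → Bool) (H : ℕ) where
  open CubicOrder G reg c proper lE H
  open CubicLayout G reg c proper lE

  module Order (χ≤8 : χ ≤ 8) (mix≤ : mix + 2 * χ + 2 ≤ 2 * H) (lo≤ : 2 * u ≤ 3 * ℓ + 8) (hi≤ : 3 * ℓ ≤ 2 * u + 20)
               (H≤ : 10 * H ≤ 3 * N + 60) (≤H : 3 * N + 51 ≤ 10 * H) (big : 91 ≤ N) where
    open Build χ≤8 mix≤ lo≤ hi≤ H≤ ≤H big
    open CubicNumbers ℓ u ℓ₂ u₂ χ mix (cnt r0 M₂) (cnt t0 M₂) (cnt t2 M₂) c₁ c₂ N H N≡ N₁ eqχ eq-mix eq-t eq-t2 c₁≤χ c₂≤χ χ≤8 mix≤ lo≤ hi≤ H≤ ≤H big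
    open CubicLinkArith ℓ u ℓ₂ β κ (length B₂) p H a (length X₃) z N c₁ c₂ c″ len-B₂ q3 q2 len-X₃ N≡ q1 q4 q5 q6 q7 q8 q9 q10 q11

    len-L₁f : length L₁f ≡ ℓ
    len-L₁f = trans (↭-length L₁f↭) len-L₁
    len-C₁f : length C₁f ≡ p
    len-C₁f = trans (↭-length (proj₁ (proj₂ orderC))) len-C₁
    len-B₂f : length B₂f ≡ length B₂
    len-B₂f = ↭-length B₂f↭
    len-A₃f : length A₃f ≡ a
    len-A₃f = trans (↭-length A₃f↭) len-A₃
    len-Z₁f : p + length Z₁f ≡ u
    len-Z₁f = trans (cong₂ _+_ (sym len-C₁) (↭-length Z₁f↭)) (trans (sym (length-++ C₁)) (trans (↭-length U₁-split) len-U₁))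
    len-W : ∀ i → length (W i) ≡ N
    len-W i = trans (↭-length (perm i)) (size-eq i i₀)

    Three : List E → List E → List E → E → ℕ → Set
    Three X Y Z e q = At X q e ⊎ (∃ λ r → q ≡ length X + r × At Y r e) ⊎ (∃ λ r → q ≡ length X + (length Y + r) × At Z r e)

    three : ∀ X Y Z {e q} → At (X ++ Y ++ Z) q e → Three X Y Z e q
    three X Y Z a = by (At-++⁻ X a)
      where
      by : ∀ {e q} → At X q e ⊎ (∃ λ r → q ≡ length X + r × At (Y ++ Z) r e) → Three X Y Z e q
      by (inj₁ b) = inj₁ b
      by (inj₂ (r , refl , b)) = by₂ (At-++⁻ Y b)
        where
        by₂ : At Y r _ ⊎ (∃ λ s → r ≡ length Y + s × At Z s _) → _
        by₂ (inj₁ b) = inj₂ (inj₁ (r , refl , b))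
        by₂ (inj₂ (s , refl , b)) = inj₂ (inj₂ (s , refl , b))

    at₁ : ∀ {x y q r} → x ≡ y → q ≡ x + r → q ≡ y + r
    at₁ refl e = e
    at₂ : ∀ {x x' y y' q r} → x ≡ x' → y ≡ y' → q ≡ x + (y + r) → q ≡ x' + (y' + r)
    at₂ refl refl e = e
    le : ∀ {x x' y y'} → x ≡ x' → y ≡ y' → x' ≤ H + y' → x ≤ H + y
    le refl refl h = h

    U₁z : ∀ {e} → e ∈ C₁f ⊎ e ∈ Z₁f → c e ≡ i₀ × lE e ≡ false
    U₁z (inj₁ h) = U₁⁻ (∈-resp-↭ U₁-split (∈-++⁺ˡ (∈-resp-↭ (proj₁ (proj₂ orderC)) h)))
    U₁z (inj₂ h) = U₁⁻ (∈-resp-↭ U₁-split (∈-++⁺ʳ C₁ (∈-resp-↭ Z₁f↭ h)))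

    L₂z : ∀ {f} → f ∈ A₂ ⊎ f ∈ B₂f → gE f ≡ true
    L₂z (inj₁ h) = proj₂ (L₂⁻ (∈-resp-↭ AB₂↭ (∈-++⁺ˡ h)))
    L₂z (inj₂ h) = proj₂ (L₂⁻ (∈-resp-↭ AB₂↭ (∈-++⁺ʳ A₂ (∈-resp-↭ B₂f↭ h))))

    no₀₁ : ∀ {e f} → e ∈ C₁f ⊎ e ∈ Z₁f → f ∈ A₂ ⊎ f ∈ B₂f → ¬ Adjacent G e f
    no₀₁ h h' = apart₀₁ (proj₁ (U₁z h)) (proj₂ (U₁z h)) (L₂z h')

    not-hit : ∀ {e f} → f ∈ A₂ → e ∈ tailL → ¬ Adjacent G e f
    not-hit {e} {f} h h' adj = ⌊⌋-false (1 ≤? cnt (λ e → nb e f) tailL) (not-true (proj₂ (∈-fil⁻ _ L₂ (∈-take κ Un h)))) (cnt-pos (λ e → nb e f) h' (nb⁺ adj))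

    link₀ : ∀ {q q' e f} → Adjacent G e f → Three L₁f C₁f Z₁f e q → Three A₂ B₂f U₂f f q' → q ≤ H + q'
    link₀ {q} {q'} adj (inj₁ x) (inj₁ y) = by (q ≤? H)
      where
      by : Dec (q ≤ H) → q ≤ H + q'
      by (yes h) = ≤-trans h (m≤m+n H q')
      by (no h) = ⊥-elim (not-hit (At-∈ y) (At-drop (suc H) x (≰⇒> h)) adj)
    link₀ adj (inj₁ x) (inj₂ (inj₁ (r , e , y))) = le refl (at₁ len-A₂ e) (n2 r (subst (_ <_) len-L₁f (At-< x)))
    link₀ adj (inj₁ x) (inj₂ (inj₂ (r , e , y))) = le refl (at₁ len-A₂ e) (n2 _ (subst (_ <_) len-L₁f (At-< x)))
    link₀ adj (inj₂ (inj₁ (r , e , x))) (inj₁ y) = ⊥-elim (no₀₁ (inj₁ (At-∈ x)) (inj₁ (At-∈ y)) adj)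
    link₀ adj (inj₂ (inj₁ (r , e , x))) (inj₂ (inj₁ (r' , e' , y))) = ⊥-elim (no₀₁ (inj₁ (At-∈ x)) (inj₂ (At-∈ y)) adj)
    link₀ adj (inj₂ (inj₂ (r , e , x))) (inj₁ y) = ⊥-elim (no₀₁ (inj₂ (At-∈ x)) (inj₁ (At-∈ y)) adj)
    link₀ adj (inj₂ (inj₂ (r , e , x))) (inj₂ (inj₁ (r' , e' , y))) = ⊥-elim (no₀₁ (inj₂ (At-∈ x)) (inj₂ (At-∈ y)) adj)
    link₀ adj (inj₂ (inj₁ (r , e , x))) (inj₂ (inj₂ (r' , e' , y))) = le (at₁ len-L₁f e) (at₂ len-A₂ len-B₂f e') (n3 r' (subst (r <_) len-C₁f (At-< x)))
    link₀ adj (inj₂ (inj₂ (r , e , x))) (inj₂ (inj₂ (r' , e' , y))) = le (at₂ len-L₁f len-C₁f e) (at₂ len-A₂ len-B₂f e') (by (r' <? p))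
      where
      -- Within C₂ the order of Z₁ follows that of U₂; beyond C₂ the position of f alone is large
      -- enough.
      by : Dec (r' < p) → ℓ + (p + r) ≤ H + (κ + (length B₂ + r'))
      by (yes h) = n4 (touch-late nb 0 C₂ Z₁ slowZ₁ (At-take p y h) x (nb⁺ (adj-sym adj)))
      by (no h) = n5 len-Z₁f (At-< x) (≮⇒≥ h)

    no₁₂ : ∀ {e f} → e ∈ U₂f → f ∈ A₃f → ¬ Adjacent G e f
    no₁₂ h h' = apart₁₂ (proj₁ (U₂⁻ (∈-resp-↭ U₂f↭ h))) (proj₂ (U₂⁻ (∈-resp-↭ U₂f↭ h))) (proj₂ (T0⁻ (∈-take a T0 (∈-resp-↭ A₃f↭ h'))))

    link₁ : ∀ {q q' e f} → Adjacent G e f → q < N → Three A₂ B₂f U₂f e q → Three A₃f X₃ Z₃f f q' → q ≤ H + q'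
    link₁ {q' = q'} adj l (inj₁ x) _ = m1 q' (subst (_ <_) len-A₂ (At-< x))
    link₁ {q' = q'} adj l (inj₂ (inj₁ (r , e , x))) (inj₁ y) = le (at₁ len-A₂ e) refl
      (m2 (subst₂ (λ s t → r + s ≤ t + q' + 1) len-A₃ (↭-length (proj₁ (proj₂ orderB))) (rev-late nb 1 Wb A₃ (proj₂ (proj₂ orderB)) x y (nb⁺ adj))))
    link₁ adj l (inj₂ (inj₁ (r , e , x))) (inj₂ (inj₁ (r' , e' , y))) = le (at₁ len-A₂ e) (at₁ len-A₃f e') (m3 r' (subst (r <_) len-B₂f (At-< x)))
    link₁ adj l (inj₂ (inj₁ (r , e , x))) (inj₂ (inj₂ (r' , e' , y))) = le (at₁ len-A₂ e) (at₁ len-A₃f e') (m3 _ (subst (r <_) len-B₂f (At-< x)))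
    link₁ adj l (inj₂ (inj₂ (r , e , x))) (inj₁ y) = ⊥-elim (no₁₂ (At-∈ x) (At-∈ y) adj)
    link₁ adj l (inj₂ (inj₂ (r , e , x))) (inj₂ (inj₁ (r' , e' , y))) = le (at₂ len-A₂ len-B₂f e) (at₁ len-A₃f e')
      (m4 (touch-late nb c₁ X₃ U₂ slowU y x (nb⁺ (adj-sym adj))))
    link₁ adj l (inj₂ (inj₂ (r , e , x))) (inj₂ (inj₂ (r' , e' , y))) = le refl (at₁ len-A₃f e') (m5 r' l)

    no₂₀ : ∀ {e f} → e ∈ Z₃f → f ∈ L₁f → ¬ Adjacent G e f
    no₂₀ h h' = apart₂₀ (cls⁻ (proj₁ (∈-fil⁻ lE M₀ (∈-resp-↭ L₁f↭ h')))) (proj₂ (∈-fil⁻ lE M₀ (∈-resp-↭ L₁f↭ h'))) (R0⁻ (∈-take z R0 (∈-resp-↭ Z₃f↭ h)))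

    link₂ : ∀ {q q' e f} → Adjacent G e f → q < N → Three A₃f X₃ Z₃f e q → Three L₁f C₁f Z₁f f q' → q ≤ H + q'
    link₂ {q' = q'} adj l (inj₁ x) _ = k1 q' (subst (_ <_) len-A₃f (At-< x))
    link₂ {q' = q'} {e = e} adj l (inj₂ (inj₁ (r , e' , x))) (inj₁ y) = le (at₁ len-A₃f e') refl
      (k2 (subst₂ (λ s t → r + s ≤ t + q' + c₂) len-L₁ (length-reverse X₃)
        (rev-late nb c₂ (reverse X₃) L₁ slowL (subst (λ w → At w r e) (sym (reverse-involutive X₃)) x) y (nb⁺ adj))))
    link₂ adj l (inj₂ (inj₁ (r , e , x))) (inj₂ (inj₁ (r' , e' , y))) = le (at₁ len-A₃f e) (at₁ len-L₁f e') (k3 r' (At-< x))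
    link₂ adj l (inj₂ (inj₁ (r , e , x))) (inj₂ (inj₂ (r' , e' , y))) = le (at₁ len-A₃f e) (at₁ len-L₁f e') (k3 _ (At-< x))
    link₂ adj l (inj₂ (inj₂ (r , e , x))) (inj₁ y) = ⊥-elim (no₂₀ (At-∈ x) (At-∈ y) adj)
    link₂ adj l (inj₂ (inj₂ (r , e , x))) (inj₂ (inj₁ (r' , e' , y))) = le (at₁ len-A₃f e) (at₁ len-L₁f e')
      (k4 (touch-late nb c″ C₁f Z₃ (proj₂ (proj₂ orderC)) y x (nb⁺ (adj-sym adj))))
    link₂ adj l (inj₂ (inj₂ (r , e , x))) (inj₂ (inj₂ (r' , e' , y))) = le refl (at₂ len-L₁f len-C₁f e') (k5 r' l)

    H≤N : H ≤ N
    H≤N = ≤-trans r₃ (≤-trans (m≤n+m u ℓ) (≤-reflexive N≡))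

    toS : ∀ {w q q'} → w ≡ N → q ≤ H + q' → q + (N ∸ H) ≤ w + q'
    toS {w} {q} {q'} refl h = ≤-trans (+-monoˡ-≤ (N ∸ H) h) (≤-reflexive (trans (eq H q' (N ∸ H)) (cong (_+ q') (m∸n+n≡m H≤N))))
      where
      eq : ∀ H q' S → H + q' + S ≡ S + H + q'
      eq = solve-∀

    link : ∀ i {q q' e f} → At (W i) q e → At (W (nxt i)) q' f → Adjacent G e f → q + (N ∸ H) ≤ length (W i) + q'
    link Fin.zero x y adj = toS (len-W Fin.zero) (link₀ adj (three L₁f C₁f Z₁f x) (three A₂ B₂f U₂f y))
    link (Fin.suc Fin.zero) x y adj = toS (len-W i₁) (link₁ adj (subst (_ <_) (len-W i₁) (At-< x)) (three A₂ B₂f U₂f x) (three A₃f X₃ Z₃f y))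
    link (Fin.suc (Fin.suc Fin.zero)) x y adj = toS (len-W i₂) (link₂ adj (subst (_ <_) (len-W i₂) (At-< x)) (three A₃f X₃ Z₃f x) (three L₁f C₁f Z₁f y))

    abstract
      ordering : Σ (Ordering G) λ o → Good G o (N ∸ H)
      ordering = Scheme.arrange G c proper (N ∸ H) W perm (λ i → ≤-trans (m∸n≤m N H) (≤-reflexive (sym (len-W i)))) link

-- Cubic class 1 graphs: choice of the bipartition

label : Bool → Bool → Bool → Bool → Fin 5
label true  _     _     _     = Fin.zero
label false true  _     _     = Fin.suc Fin.zero
label false false true  _     = Fin.suc (Fin.suc Fin.zero)
label false false false true  = Fin.suc (Fin.suc (Fin.suc Fin.zero))
label false false false false = Fin.suc (Fin.suc (Fin.suc (Fin.suc Fin.zero)))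

twoOf : Fin 5 × Fin 5 → Fin 5 → Bool
twoOf (p , q) x = ⌊ x ≟F p ⌋ ∨ ⌊ x ≟F q ⌋

pairs : List (Fin 5 × Fin 5)
pairs = filter (λ (p , q) → toℕ p <? toℕ q) (Data.List.cartesianProduct (allFin 5) (allFin 5))

pairs-< : ∀ {p q} → (p , q) ∈ pairs → p ≢ q
pairs-< h refl = <-irrefl refl (proj₂ (∈-filter⁻ (λ (p , q) → toℕ p <? toℕ q) {xs = Data.List.cartesianProduct (allFin 5) (allFin 5)} h))

-- A pair that splits two different labels has one of them and one of the three other labels, so
-- there are 2 · 3 of them. The 25 cases are evaluated.
separated : ∀ x y → Σl (λ S → b2n (xor (twoOf S x) (twoOf S y))) pairs ≤ 6 * b2n (not ⌊ x ≟F y ⌋)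
separated = toWitness {a? = all?F λ x → all?F λ y → _ ≤? _} tt

∈-take-mono : ∀ {A : Set} {x : A} {i j} xs → i ≤ j → x ∈ take i xs → x ∈ take j xs
∈-take-mono (y ∷ xs) (s≤s h) (here e)  = here e
∈-take-mono (y ∷ xs) (s≤s h) (there r) = there (∈-take-mono xs h r)

unique-split : ∀ {A : Set} (xs : List A) {ys x} → Unique (xs ++ ys) → x ∈ xs → x ∈ ys → ⊥
unique-split (z ∷ xs) (a ∷ᵁ u) (here refl) j = All.lookup a (∈-++⁺ʳ xs j) refl
unique-split (z ∷ xs) (a ∷ᵁ u) (there i)   j = unique-split xs u i j

module CubicChoice {n} (G : Graph n) (reg : Regular 3 G) (c : Fin (m G) → Fin 3) (proper : Proper G c) where
  open Perfect G reg c proper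

  M₀ M₁ M₂ : List E
  M₀ = cls Fin.zero
  M₁ = cls (Fin.suc Fin.zero)
  M₂ = cls (Fin.suc (Fin.suc Fin.zero))
  N = length M₀

  module L = CubicLayout G reg c proper

  order : ∃ λ O → O ↭ M₀ × Slow nb 1 O M₁
  order = greedy nb 1 M₀ M₁ (λ e _ → degree≤2 e (Fin.suc Fin.zero)) (λ f _ → degree≤2' f Fin.zero)
    (≤-reflexive (trans (cong suc (size-eq (Fin.suc Fin.zero) Fin.zero)) (+-comm 1 N)))

  O : List E
  O = proj₁ order
  O↭ : O ↭ M₀
  O↭ = proj₁ (proj₂ order)

  mem : ℕ → E → Bool
  mem j e = ⌊ 1 ≤? cnt (λ x → ⌊ x ≟F e ⌋) (take j O) ⌋

  mem⁺ : ∀ {j e} → e ∈ take j O → mem j e ≡ true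
  mem⁺ {j} {e} h = ⌊⌋-intro (1 ≤? _) (cnt-pos _ h (⌊⌋-intro (e ≟F e) refl))

  mem⁻ : ∀ {j e} → mem j e ≡ true → e ∈ take j O
  mem⁻ {j} {e} h = by (cnt-witness _ (take j O) (⌊⌋-true (1 ≤? _) h))
    where
    by : (∃ λ x → x ∈ take j O × ⌊ x ≟F e ⌋ ≡ true) → e ∈ take j O
    by (x , i , r) = subst (_∈ take j O) (⌊⌋-true (x ≟F e) r) i

  mem-mono : ∀ {i j e} → i ≤ j → mem i e ≡ true → mem j e ≡ true
  mem-mono {i} {j} h r = mem⁺ {j} (∈-take-mono O h (mem⁻ {i} r))

  cnt-mem : ∀ j → j ≤ N → cnt (mem j) M₀ ≡ j
  cnt-mem j h = trans (sym (Σl-↭ _ O↭)) (trans (cong (cnt (mem j)) (sym (take++drop≡id j O))) (trans (Σl-++ _ (take j O) (drop j O))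
    (trans (cong₂ _+_ (trans (Σl-cong (take j O) (λ e r → cong b2n (mem⁺ {j} r))) (trans (Σl-const 1 (take j O)) (*-identityˡ _)))
       (cnt-zero (mem j) (drop j O) (λ e r → ≢true (λ t → unique-split (take j O)
         (subst Unique (sym (take++drop≡id j O)) (↭-unique (↭-sym O↭) (cls-unique Fin.zero))) (mem⁻ {j} t) r))))
    (trans (+-identityʳ _) (length-take≤ j O (≤-trans h (≤-reflexive (sym (↭-length O↭)))))))))

  -- The first j edges of O meet at most j + 1 edges of M₁ by slowness, namely those inside the
  -- segment and those crossing its boundary: ℓ₂ + χ ≤ j + 1. Together with 2j = 2ℓ₂ + χ this gives
  -- χ ≤ 2.
  boundary : ∀ j → j ≤ N → L.χ (mem j) ≤ 2
  boundary j h = lem _ _ (trans (sym (cong (2 *_) (cnt-mem j h))) (L.eqχ (mem j))) (begin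
      L.ℓ₂ (mem j) + L.χ (mem j)                     ≡⟨ sym (Σl-+ _ _ M₁) ⟩
      Σl (λ f → b2n (L.gE (mem j) f) + b2n (L.cross (mem j) f)) M₁ ≤⟨ Σl-mono M₁ (λ f r → touched f r) ⟩
      cnt (λ f → ⌊ 1 ≤? cnt (λ x → nb x f) (take j O) ⌋) M₁        ≤⟨ slow-touched nb 1 j O M₁ (proj₂ (proj₂ order)) ⟩
      j + 1                                           ∎)
    where
    open ≤-Reasoning
    eq : ∀ a b j → b + (2 * (j + 1) + (2 * a + b)) + 0 ≡ 2 + (2 * (a + b) + 2 * j)
    eq = solve-∀
    lem : ∀ a b → 2 * j ≡ 2 * a + b → a + b ≤ j + 1 → b ≤ 2
    lem a b e h = lin 0 (+-mono-≤ (*-monoʳ-≤ 2 h) (≤-reflexive e)) (eq a b j)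
    hit : ∀ f v → f ∈ M₁ → Incident G v f → mem j (at Fin.zero v) ≡ true → 1 ≤ cnt (λ x → nb x f) (take j O)
    hit f v r p t = cnt-pos (λ x → nb x f) (mem⁻ {j} t) (nb⁺ ((λ q → differ (trans (sym (at-cls Fin.zero v)) (trans (cong c q) (cls⁻ r)))) , v , at-inc Fin.zero v , p))
      where
      differ : Fin.zero {2} ≢ Fin.suc Fin.zero
      differ ()
    touched : ∀ f → f ∈ M₁ → b2n (L.gE (mem j) f) + b2n (L.cross (mem j) f) ≤ b2n ⌊ 1 ≤? cnt (λ x → nb x f) (take j O) ⌋
    touched f r = by _ _ refl refl
      where
      ok : 1 ≤ cnt (λ x → nb x f) (take j O) → 1 ≤ b2n ⌊ 1 ≤? cnt (λ x → nb x f) (take j O) ⌋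
      ok h = ≤-reflexive (cong b2n (sym (⌊⌋-intro (1 ≤? _) h)))
      by : ∀ a b → mem j (at Fin.zero (lo f)) ≡ a → mem j (at Fin.zero (hi f)) ≡ b → b2n (a ∧ b) + b2n (xor a b) ≤ b2n ⌊ 1 ≤? cnt (λ x → nb x f) (take j O) ⌋
      by false false p q = z≤n
      by true true p q = ok (hit f _ r (inj₁ refl) p)
      by true false p q = ok (hit f _ r (inj₁ refl) p)
      by false true p q = ok (hit f _ r (inj₂ refl) q)

  w : ℕ
  w = N / 5

  5w≤N : 5 * w ≤ N
  5w≤N = ≤-trans (≤-reflexive (*-comm 5 w)) (m/n*n≤m N 5)

  N≤5w : N ≤ 5 * w + 4
  N≤5w = ≤-trans (≤-reflexive (trans (m≡m%n+[m/n]*n N 5) (trans (+-comm (N % 5) _) (cong (_+ N % 5) (*-comm w 5))))) (+-monoʳ-≤ (5 * w) (≤-pred (m%n<n N 5)))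

  bw≤N : ∀ b → b ≤ 5 → b * w ≤ N
  bw≤N b h = ≤-trans (*-monoˡ-≤ w h) 5w≤N

  X : ℕ → E → Bool
  X b = mem (b * w)

  -- Five consecutive segments of O, told apart by nested initial segments; the last one also has
  -- the at most four edges that the division of N by 5 leaves over.
  lab : E → Fin 5
  lab e = label (X 1 e) (X 2 e) (X 3 e) (X 4 e)

  size : Fin 5 → ℕ
  size p = cnt (λ e → ⌊ lab e ≟F p ⌋) M₀

  nested : ∀ b e → X b e ≡ true → X (suc b) e ≡ true
  nested b e = mem-mono {b * w} {suc b * w} (m≤n+m (b * w) w)

  cnt-X : ∀ b → b ≤ 5 → cnt (X b) M₀ ≡ b * w
  cnt-X b h = cnt-mem (b * w) (bw≤N b h)

  stack : ∀ p (q r : E → Bool) → (∀ e → b2n (q e) + b2n ⌊ lab e ≟F p ⌋ ≡ b2n (r e)) → cnt q M₀ + size p ≡ cnt r M₀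
  stack p q r h = trans (sym (Σl-+ _ _ M₀)) (Σl-cong M₀ (λ e _ → h e))

  size-low : ∀ p → toℕ p < 4 → size p ≡ w
  size-low p h = +-cancelˡ-≡ (toℕ p * w) _ _ (trans (by p h) (+-comm w _))
    where
    use : ∀ b p → b ≤ 4 → (∀ e → b2n (X b e) + b2n ⌊ lab e ≟F p ⌋ ≡ b2n (X (suc b) e)) → b * w + size p ≡ suc b * w
    use b p l h = trans (cong (_+ size p) (sym (cnt-X b (m≤n⇒m≤1+n l)))) (trans (stack p _ _ h) (cnt-X (suc b) (s≤s l)))
    by : ∀ p → toℕ p < 4 → toℕ p * w + size p ≡ suc (toℕ p) * w
    by Fin.zero _ = use 0 Fin.zero z≤n (λ e → aux (X 1 e) (X 2 e) (X 3 e) (X 4 e))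
      where
      aux : ∀ a b c d → b2n ⌊ label a b c d ≟F Fin.zero ⌋ ≡ b2n a
      aux true b c d = refl
      aux false true c d = refl
      aux false false true d = refl
      aux false false false true = refl
      aux false false false false = refl
    by (Fin.suc Fin.zero) _ = use 1 _ (s≤s z≤n) (λ e → aux (X 1 e) (X 2 e) (X 3 e) (X 4 e) (nested 1 e))
      where
      aux : ∀ a b c d → (a ≡ true → b ≡ true) → b2n a + b2n ⌊ label a b c d ≟F Fin.suc Fin.zero ⌋ ≡ b2n b
      aux true true c d h = refl
      aux true false c d h = case h refl of λ ()
      aux false true c d h = refl
      aux false false true d h = refl
      aux false false false true h = refl
      aux false false false false h = refl
    by (Fin.suc (Fin.suc Fin.zero)) _ = use 2 _ (s≤s (s≤s z≤n)) (λ e → aux (X 1 e) (X 2 e) (X 3 e) (X 4 e) (nested 1 e) (nested 2 e))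
      where
      aux : ∀ a b c d → (a ≡ true → b ≡ true) → (b ≡ true → c ≡ true) → b2n b + b2n ⌊ label a b c d ≟F Fin.suc (Fin.suc Fin.zero) ⌋ ≡ b2n c
      aux true false c d h h' = case h refl of λ ()
      aux a true false d h h' = case h' refl of λ ()
      aux true true true d h h' = refl
      aux false true true d h h' = refl
      aux false false true d h h' = refl
      aux false false false true h h' = refl
      aux false false false false h h' = refl
    by (Fin.suc (Fin.suc (Fin.suc Fin.zero))) _ = use 3 _ (s≤s (s≤s (s≤s z≤n))) (λ e → aux (X 1 e) (X 2 e) (X 3 e) (X 4 e) (nested 1 e) (nested 2 e) (nested 3 e))
      where
      aux : ∀ a b c d → (a ≡ true → b ≡ true) → (b ≡ true → c ≡ true) → (c ≡ true → d ≡ true) →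
            b2n c + b2n ⌊ label a b c d ≟F Fin.suc (Fin.suc (Fin.suc Fin.zero)) ⌋ ≡ b2n d
      aux true false c d h h' h″ = case h refl of λ ()
      aux a true false d h h' h″ = case h' refl of λ ()
      aux a b true false h h' h″ = case h″ refl of λ ()
      aux true true true true h h' h″ = refl
      aux false true true true h h' h″ = refl
      aux false false true true h h' h″ = refl
      aux false false false true h h' h″ = refl
      aux false false false false h h' h″ = refl
    by (Fin.suc (Fin.suc (Fin.suc (Fin.suc Fin.zero)))) (s≤s (s≤s (s≤s (s≤s ()))))

  last : Fin 5
  last = Fin.suc (Fin.suc (Fin.suc (Fin.suc Fin.zero)))

  size-last : 4 * w + size last ≡ N
  size-last = trans (cong (_+ size last) (sym (cnt-X 4 (s≤s (s≤s (s≤s (s≤s z≤n))))))) (trans (stack last (X 4) (λ _ → true)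
      (λ e → aux (X 1 e) (X 2 e) (X 3 e) (X 4 e) (nested 1 e) (nested 2 e) (nested 3 e))) (trans (Σl-const 1 M₀) (*-identityˡ _)))
    where
    aux : ∀ a b c d → (a ≡ true → b ≡ true) → (b ≡ true → c ≡ true) → (c ≡ true → d ≡ true) → b2n d + b2n ⌊ label a b c d ≟F last ⌋ ≡ 1
    aux true false c d h h' h″ = case h refl of λ ()
    aux a true false d h h' h″ = case h' refl of λ ()
    aux a b true false h h' h″ = case h″ refl of λ ()
    aux true true true true h h' h″ = refl
    aux false true true true h h' h″ = refl
    aux false false true true h h' h″ = refl
    aux false false false true h h' h″ = refl
    aux false false false false h h' h″ = refl

  is-last : ∀ p → ¬ toℕ p < 4 → p ≡ last
  is-last p h = toℕ-injective (≤-antisym (≤-pred (toℕ<n p)) (≮⇒≥ h))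

  w≤size : ∀ p → w ≤ size p
  w≤size p = by (toℕ p <? 4)
    where
    at-last : w ≤ size last
    at-last = +-cancelˡ-≤ (4 * w) _ _ (≤-trans (≤-reflexive (+-comm (4 * w) w)) (≤-trans 5w≤N (≤-reflexive (sym size-last))))
    by : Dec (toℕ p < 4) → w ≤ size p
    by (yes h) = ≤-reflexive (sym (size-low p h))
    by (no h) = subst (λ z → w ≤ size z) (sym (is-last p h)) at-last

  size≤ : ∀ p → size p ≤ w + 4
  size≤ p = by (toℕ p <? 4)
    where
    eq : ∀ w → 5 * w + 4 ≡ 4 * w + (w + 4)
    eq = solve-∀
    at-last : size last ≤ w + 4
    at-last = +-cancelˡ-≤ (4 * w) _ _ (≤-trans (≤-reflexive size-last) (≤-trans N≤5w (≤-reflexive (eq w))))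
    by : Dec (toℕ p < 4) → size p ≤ w + 4
    by (yes h) = ≤-trans (≤-reflexive (size-low p h)) (m≤m+n w 4)
    by (no h) = subst (λ z → size z ≤ w + 4) (sym (is-last p h)) at-last

  size-pair≤ : ∀ p q → p ≢ q → size p + size q ≤ 2 * w + 4
  size-pair≤ p q ne = by (toℕ p <? 4) (toℕ q <? 4)
    where
    eq₁ : ∀ w → w + (w + 4) ≡ 2 * w + 4
    eq₁ = solve-∀
    eq₂ : ∀ w → w + 4 + w ≡ 2 * w + 4
    eq₂ = solve-∀
    by : Dec (toℕ p < 4) → Dec (toℕ q < 4) → size p + size q ≤ 2 * w + 4
    by (yes h) _ = ≤-trans (+-mono-≤ (≤-reflexive (size-low p h)) (size≤ q)) (≤-reflexive (eq₁ w))
    by (no _) (yes h) = ≤-trans (+-mono-≤ (size≤ p) (≤-reflexive (size-low q h))) (≤-reflexive (eq₂ w))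
    by (no h) (no h') = ⊥-elim (ne (trans (is-last p h) (sym (is-last q h'))))

  side : Fin 5 × Fin 5 → E → Bool
  side S e = twoOf S (lab e)

  side-size : ∀ p q → p ≢ q → cnt (side (p , q)) M₀ ≡ size p + size q
  side-size p q ne = trans (Σl-cong M₀ (λ e _ → aux e (lab e ≟F p) (lab e ≟F q))) (Σl-+ _ _ M₀)
    where
    aux : ∀ e (d : Dec (lab e ≡ p)) (d' : Dec (lab e ≡ q)) → b2n (⌊ d ⌋ ∨ ⌊ d' ⌋) ≡ b2n ⌊ d ⌋ + b2n ⌊ d' ⌋
    aux e (yes r) (yes s) = ⊥-elim (ne (trans (sym r) s))
    aux e (yes _) (no _) = refl
    aux e (no _) (yes _) = refl
    aux e (no _) (no _) = refl

  labelsDiffer : E → Bool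
  labelsDiffer f = not ⌊ lab (at Fin.zero (lo f)) ≟F lab (at Fin.zero (hi f)) ⌋

  label-cross : ∀ f → b2n (labelsDiffer f) ≤ b2n (L.cross (X 1) f) + (b2n (L.cross (X 2) f) + (b2n (L.cross (X 3) f) + b2n (L.cross (X 4) f)))
  label-cross f = by (X 1 x) (X 1 y) (X 2 x) (X 2 y) (X 3 x) (X 3 y) (X 4 x) (X 4 y)
    where
    x = at Fin.zero (lo f)
    y = at Fin.zero (hi f)
    one : ∀ {a} {b : Bool} → 1 ≤ a → b2n b ≤ a
    one {b = b} h = ≤-trans (b2n≤1 b) h
    diag : ∀ (x : Fin 5) → b2n (not ⌊ x ≟F x ⌋) ≤ 0
    diag x = ≤-reflexive (cong (b2n ∘ not) (⌊⌋-intro (x ≟F x) refl))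
    eqn : ∀ a a' r → (a ≡ a' → r) → (1 ≤ b2n (xor a a') → r) → r
    eqn true true r h k = h refl
    eqn true false r h k = k ≤-refl
    eqn false true r h k = k ≤-refl
    eqn false false r h k = h refl
    by : ∀ a a' b b' c c' d d' → b2n (not ⌊ label a b c d ≟F label a' b' c' d' ⌋) ≤ b2n (xor a a') + (b2n (xor b b') + (b2n (xor c c') + b2n (xor d d')))
    by a a' b b' c c' d d' =
      eqn a a' _ (λ { refl → eqn b b' _ (λ { refl → eqn c c' _ (λ { refl → eqn d d' _ (λ { refl → ≤-trans (diag (label a b c d)) z≤n })
        (λ h → one (≤-trans h (≤-trans (m≤n+m _ (b2n (xor c c))) (≤-trans (m≤n+m _ (b2n (xor b b))) (m≤n+m _ (b2n (xor a a))))))) })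
        (λ h → one (≤-trans h (≤-trans (m≤m+n _ (b2n (xor d d'))) (≤-trans (m≤n+m _ (b2n (xor b b))) (m≤n+m _ (b2n (xor a a))))))) })
        (λ h → one (≤-trans h (≤-trans (m≤m+n _ (b2n (xor c c') + b2n (xor d d'))) (m≤n+m _ (b2n (xor a a)))))) })
        (λ h → one (≤-trans h (m≤m+n _ _)))

  -- An edge of M₁ between different segments crosses one of the four inner boundaries, and each of
  -- these is crossed at most twice.
  few-differ : cnt labelsDiffer M₁ ≤ 8
  few-differ = ≤-trans (Σl-mono M₁ (λ f _ → label-cross f)) (≤-trans (≤-reflexive (trans (Σl-+ _ _ M₁) (cong (L.χ (X 1) +_) (trans (Σl-+ _ _ M₁) (cong (L.χ (X 2) +_) (Σl-+ _ _ M₁))))))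
    (+-mono-≤ (b 1 (s≤s z≤n)) (+-mono-≤ (b 2 (s≤s (s≤s z≤n))) (+-mono-≤ (b 3 (s≤s (s≤s (s≤s z≤n)))) (b 4 (s≤s (s≤s (s≤s (s≤s z≤n)))))))))
    where
    b : ∀ b → b ≤ 5 → L.χ (X b) ≤ 2
    b b h = boundary (b * w) (bw≤N b h)

  χ≤8 : ∀ S → L.χ (side S) ≤ 8
  χ≤8 S = ≤-trans (cnt-mono (L.cross (side S)) labelsDiffer M₁ (λ f _ → aux f)) few-differ
    where
    aux : ∀ f → L.cross (side S) f ≡ true → labelsDiffer f ≡ true
    aux f h = not-false (⌊⌋-no (lab (at Fin.zero (lo f)) ≟F lab (at Fin.zero (hi f))) (λ e → same (twoOf S (lab (at Fin.zero (hi f)))) (trans (sym (cong (λ z → xor (twoOf S z) (twoOf S (lab (at Fin.zero (hi f))))) e)) h)))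
      where
      same : ∀ b → xor b b ≡ true → ⊥
      same true ()
      same false ()

  average : ∀ es → Σl (λ S → cnt (L.cross (side S)) es) pairs ≤ 6 * cnt labelsDiffer es
  average es = ≤-trans (≤-reflexive (Σl-swap (λ S f → b2n (L.cross (side S) f)) pairs es))
    (≤-trans (Σl-mono es (λ f _ → separated (lab (at Fin.zero (lo f))) (lab (at Fin.zero (hi f))))) (≤-reflexive (Σl-* 6 _ es)))

  -- Every edge between different segments is separated by at most 6 pairs. At most N such edges lie
  -- in M₂ and at most 8 in M₁, the latter with weight 2, which gives the term 96.
  sum≤ : Σl (λ S → L.mix (side S) + 2 * L.χ (side S)) pairs ≤ 6 * N + 96
  sum≤ = ≤-trans (≤-reflexive (trans (Σl-+ (λ S → L.mix (side S)) (λ S → 2 * L.χ (side S)) pairs) (cong (Σl (λ S → L.mix (side S)) pairs +_) (Σl-* 2 (λ S → L.χ (side S)) pairs))))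
    (+-mono-≤ (≤-trans (average M₂) (*-monoʳ-≤ 6 (≤-trans (cnt≤length labelsDiffer M₂) (≤-reflexive (size-eq _ Fin.zero)))))
      (*-monoʳ-≤ 2 (≤-trans (average M₁) (*-monoʳ-≤ 6 few-differ))))

  choose : ∃ λ S → S ∈ pairs × 10 * (L.mix (side S) + 2 * L.χ (side S)) ≤ 6 * N + 96
  choose = by (Σl-< (λ S → L.mix (side S) + 2 * L.χ (side S)) (λ _ → suc B) pairs (≤-trans (s≤s sum≤) (≤-trans over (≤-reflexive (sym (Σl-const (suc B) pairs))))))
    where
    B = (6 * N + 96) / 10
    -- `length pairs` evaluates to 10.
    over : 6 * N + 96 < suc B * length pairs
    over = ≤-trans (s≤s (≤-trans (≤-reflexive (m≡m%n+[m/n]*n (6 * N + 96) 10)) (+-monoˡ-≤ (B * 10) (≤-pred (m%n<n (6 * N + 96) 10))))) (≤-reflexive refl)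
    by : (∃ λ S → S ∈ pairs × L.mix (side S) + 2 * L.χ (side S) < suc B) → _
    by (S , i , h) = S , i , ≤-trans (*-monoʳ-≤ 10 (≤-pred h)) (≤-trans (≤-reflexive (*-comm 10 B)) (m/n*n≤m (6 * N + 96) 10))

-- With n = 2N and s = N - H, the claim 7n ≤ 20(s + 6) reads 10H ≤ 3N + 60; H is the largest such
-- number.
H-arith : ∀ N → ∃ λ H → 10 * H ≤ 3 * N + 60 × 3 * N + 51 ≤ 10 * H
H-arith N = H , ≤-trans (≤-reflexive (*-comm 10 H)) (m/n*n≤m (3 * N + 60) 10) ,
  +-cancelʳ-≤ 9 _ _ (≤-trans (≤-reflexive (+-assoc (3 * N) 51 9)) (≤-trans (≤-reflexive (m≡m%n+[m/n]*n (3 * N + 60) 10))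
    (≤-trans (+-monoˡ-≤ (H * 10) (≤-pred (m%n<n (3 * N + 60) 10))) (≤-reflexive (trans (+-comm 9 _) (cong (_+ 9) (*-comm H 10)))))))
  where H = (3 * N + 60) / 10

-- From 20H ≥ 6N + 102 and the averaged bound 6N + 96 follows mix + 2χ < 2H. The first equation
-- makes mix even, so the gap is at least 2.
mix-arith : ∀ ℓ r mix χ N u H → 2 * ℓ + 2 * r + mix ≡ 2 * N → ℓ + u ≡ N → 10 * (mix + 2 * χ) ≤ 6 * N + 96 → 3 * N + 51 ≤ 10 * H → mix + 2 * χ + 2 ≤ 2 * H
mix-arith ℓ r mix χ N u H e refl h h' = by (u ∸ r) (sym (m∸n+n≡m r≤u))
  where
  eq₀ : ∀ ℓ r mix u → 2 * r + (2 * (ℓ + u)) + mix ≡ 2 * u + (2 * ℓ + 2 * r + mix)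
  eq₀ = solve-∀
  r≤u : r ≤ u
  r≤u = *-cancelˡ-≤ 2 (lin mix (≤-reflexive e) (eq₀ ℓ r mix u))
  eq₁ : ∀ y r ℓ → 2 * (ℓ + (y + r)) ≡ 2 * ℓ + 2 * r + 2 * y
  eq₁ = solve-∀
  by : ∀ y → u ≡ y + r → mix + 2 * χ + 2 ≤ 2 * H
  by y refl = go (+-cancelˡ-≡ (2 * ℓ + 2 * r) _ _ (trans e (eq₁ y r ℓ)))
    where
    small : ∀ N → 10 * (2 * y + 2 * χ) ≤ 6 * N + 96 → 3 * N + 51 ≤ 10 * H → y + χ < H
    small N h h' = *-cancelˡ-< 10 (y + χ) H (*-cancelˡ-< 2 (10 * (y + χ)) (10 * H) (lin 5 (+-mono-≤ h (*-monoʳ-≤ 2 h')) (eq₄ y χ N H)))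
      where
      eq₄ : ∀ y χ N H → suc (2 * (10 * (y + χ))) + (6 * N + 96 + 2 * (10 * H)) + 5 ≡ 2 * (10 * H) + (10 * (2 * y + 2 * χ) + 2 * (3 * N + 51))
      eq₄ = solve-∀
    eq₅ : ∀ y χ → 2 * y + 2 * χ + 2 ≡ 2 * suc (y + χ)
    eq₅ = solve-∀
    go : mix ≡ 2 * y → mix + 2 * χ + 2 ≤ 2 * H
    go refl = ≤-trans (≤-reflexive (eq₅ y χ)) (*-monoʳ-≤ 2 (small (ℓ + (y + r)) h h'))

cubic-bound : ∀ {n} (G : Graph n) → Regular 3 G → (c : Fin (m G) → Fin 3) → Proper G c →
              ∃ λ s → 7 * n ≤ 20 * (s + 6) × Σ (Ordering G) λ o → Good G o s
cubic-bound {n} G reg c proper = by (91 ≤? N)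
  where
  open CubicChoice G reg c proper
  open Perfect G reg c proper using (perfect; class-one-bound)
  by : Dec (91 ≤ N) → ∃ λ s → 7 * n ≤ 20 * (s + 6) × Σ (Ordering G) λ o → Good G o s
  -- For N ≤ 90 the two-thirds bound is strong enough: 3 · 14N ≤ 20(2N + 9) amounts to 2N ≤ 180.
  by (no h) = go class-one-bound
    where
    eq : ∀ N s → 3 * (7 * (2 * N)) + (20 * (3 * (s + 6)) + 2 * 90) + 0 ≡ 3 * (20 * (s + 6)) + (20 * (2 * N + 9) + 2 * N)
    eq = solve-∀
    go : (∃ λ s → n + 9 ≤ 3 * (s + 6) × Σ (Ordering G) λ o → Good G o s) → _
    go (s , l , o) = s , *-cancelˡ-≤ 3 (≤-trans (≤-reflexive (cong (λ x → 3 * (7 * x)) (sym (perfect Fin.zero))))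
      (lin 0 (+-mono-≤ (*-monoʳ-≤ 20 (subst (λ x → x + 9 ≤ 3 * (s + 6)) (sym (perfect Fin.zero)) l)) (*-monoʳ-≤ 2 (≤-pred (≰⇒> h)))) (eq N s))) , o
  by (yes big) = pick choose (H-arith N)
    where
    pick : (∃ λ S → S ∈ pairs × 10 * (L.mix (side S) + 2 * L.χ (side S)) ≤ 6 * N + 96) → (∃ λ H → 10 * H ≤ 3 * N + 60 × 3 * N + 51 ≤ 10 * H) → _
    pick ((p , q) , i , h) (H , h₁ , h₂) = N ∸ H , bound , CubicFinal.Order.ordering G reg c proper (side (p , q)) H (χ≤8 (p , q))
        (mix-arith (L.ℓ (side (p , q))) (cnt (L.r0 (side (p , q))) M₂) (L.mix (side (p , q))) (L.χ (side (p , q))) N (L.u (side (p , q))) H (L.eq-mix (side (p , q))) (L.N≡ (side (p , q))) h h₂)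
        (lo-arith _ _ _ w (L.N≡ (side (p , q))) N≤5w ℓ≥) (hi-arith _ _ _ w (L.N≡ (side (p , q))) 5w≤N ℓ≤) h₁ h₂ big
      where
      ne : p ≢ q
      ne = pairs-< i
      ℓ≥ : 2 * w ≤ L.ℓ (side (p , q))
      ℓ≥ = ≤-trans (≤-trans (≤-reflexive (cong (w +_) (+-identityʳ w))) (+-mono-≤ (w≤size p) (w≤size q))) (≤-reflexive (sym (side-size p q ne)))
      ℓ≤ : L.ℓ (side (p , q)) ≤ 2 * w + 4
      ℓ≤ = ≤-trans (≤-reflexive (side-size p q ne)) (size-pair≤ p q ne)
      lo-arith : ∀ ℓ u N w → ℓ + u ≡ N → N ≤ 5 * w + 4 → 2 * w ≤ ℓ → 2 * u ≤ 3 * ℓ + 8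
      lo-arith ℓ u N w refl h h' = lin 0 (+-mono-≤ (*-monoʳ-≤ 2 h) (*-monoʳ-≤ 5 h')) (eq ℓ u w)
        where
        eq : ∀ ℓ u w → 2 * u + (2 * (5 * w + 4) + 5 * ℓ) + 0 ≡ 3 * ℓ + 8 + (2 * (ℓ + u) + 5 * (2 * w))
        eq = solve-∀
      hi-arith : ∀ ℓ u N w → ℓ + u ≡ N → 5 * w ≤ N → ℓ ≤ 2 * w + 4 → 3 * ℓ ≤ 2 * u + 20
      hi-arith ℓ u N w refl h h' = lin 0 (+-mono-≤ (*-monoʳ-≤ 2 h) (*-monoʳ-≤ 5 h')) (eq ℓ u w)
        where
        eq : ∀ ℓ u w → 3 * ℓ + (2 * (ℓ + u) + 5 * (2 * w + 4)) + 0 ≡ 2 * u + 20 + (2 * (5 * w) + 5 * ℓ)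
        eq = solve-∀
      bound : 7 * n ≤ 20 * (N ∸ H + 6)
      bound = ≤-trans (≤-reflexive (cong (7 *_) (sym (perfect Fin.zero)))) (by₂ (≤-total H N))
        where
        eq₁ : ∀ S H → 7 * (2 * (S + H)) + 2 * (3 * (S + H) + 60) + 0 ≡ 20 * (S + 6) + 2 * (10 * H)
        eq₁ = solve-∀
        go : ∀ N S → S + H ≡ N → 10 * H ≤ 3 * N + 60 → 7 * (2 * N) ≤ 20 * (S + 6)
        go N S refl h = lin 0 (*-monoʳ-≤ 2 h) (eq₁ S H)
        by₂ : H ≤ N ⊎ N ≤ H → 7 * (2 * N) ≤ 20 * (N ∸ H + 6)
        by₂ (inj₁ l) = go N (N ∸ H) (m∸n+n≡m l) h₁
        by₂ (inj₂ l) = ⊥-elim (1+n≰n (≤-trans big (*-cancelˡ-≤ 7 (≤-trans (+-cancelˡ-≤ (3 * N) _ _ (≤-trans (≤-trans (≤-reflexive (eq₃ N)) (*-monoʳ-≤ 10 l)) h₁)) (m≤m+n 60 570)))))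
          where
          eq₃ : ∀ N → 3 * N + 7 * N ≡ 10 * N
          eq₃ = solve-∀

-- Existence of the extrema by finite search

abstract
  funs : ∀ {B : Set} a → List B → List (Fin a → B)
  funs zero    bs = (λ ()) ∷ []
  funs (suc a) bs = Data.List.cartesianProductWith (λ b f → λ { Fin.zero → b ; (Fin.suc i) → f i }) bs (funs a bs)

  -- The list is complete only up to pointwise equality; `good-≗` and `~-cms` therefore carry the
  -- relevant properties across it.
  funs-complete : ∀ {B : Set} a (bs : List B) (f : Fin a → B) → (∀ i → f i ∈ bs) → ∃ λ g → g ∈ funs a bs × ∀ i → g i ≡ f i
  funs-complete zero    bs f h = _ , here refl , λ ()
  funs-complete (suc a) bs f h with funs-complete a bs (f ∘ Fin.suc) (h ∘ Fin.suc)
  ... | g , i , e = _ , ∈-cartesianProductWith⁺ _ (h Fin.zero) i , λ { Fin.zero → refl ; (Fin.suc j) → e j }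

abstract
  select : ∀ {A : Set} {P : A → Set} → (∀ x → Dec (P x)) → List A → List (Σ A P)
  select P? [] = []
  select P? (x ∷ xs) with P? x
  ... | yes p = (x , p) ∷ select P? xs
  ... | no _  = select P? xs

  select-complete : ∀ {A : Set} {P : A → Set} (P? : ∀ x → Dec (P x)) {x} xs → x ∈ xs → P x → ∃ λ p → (x , p) ∈ select P? xs
  select-complete P? (x ∷ xs) (here refl) px with P? x
  ... | yes p = p , here refl
  ... | no ¬p = ⊥-elim (¬p px)
  select-complete P? (y ∷ xs) (there i) px with P? y | select-complete P? xs i px
  ... | yes _ | p , j = p , there j
  ... | no _  | p , j = p , j

argmax : ∀ {A : Set} (f : A → ℕ) {x} xs → x ∈ xs → ∃ λ y → y ∈ xs × ∀ z → z ∈ xs → f z ≤ f y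
argmax f (x ∷ []) i = x , here refl , λ { z (here refl) → ≤-refl }
argmax f (x ∷ y ∷ xs) i with argmax f (y ∷ xs) (here refl)
... | w , j , h with ≤-total (f x) (f w)
...   | inj₁ l = w , there j , λ { z (here refl) → l ; z (there k) → h z k }
...   | inj₂ l = x , here refl , λ { z (here refl) → ≤-refl ; z (there k) → ≤-trans (h z k) l }

argmin : ∀ {A : Set} (f : A → ℕ) {x} xs → x ∈ xs → ∃ λ y → y ∈ xs × ∀ z → z ∈ xs → f y ≤ f z
argmin f (x ∷ []) i = x , here refl , λ { z (here refl) → ≤-refl }
argmin f (x ∷ y ∷ xs) i with argmin f (y ∷ xs) (here refl)
... | w , j , h with ≤-total (f x) (f w)
...   | inj₂ l = w , there j , λ { z (here refl) → l ; z (there k) → h z k }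
...   | inj₁ l = x , here refl , λ { z (here refl) → ≤-refl ; z (there k) → ≤-trans l (h z k) }

largest : ∀ {P : ℕ → Set} → (∀ s → Dec (P s)) → P 1 → ∀ b → 1 ≤ b →
          ∃ λ s → 1 ≤ s × s ≤ b × P s × (∀ t → 1 ≤ t → t ≤ b → P t → t ≤ s)
largest {P} P? p₁ (suc b) _ = go b
  where
  go : ∀ b → ∃ λ s → 1 ≤ s × s ≤ suc b × P s × (∀ t → 1 ≤ t → t ≤ suc b → P t → t ≤ s)
  go zero = 1 , ≤-refl , ≤-refl , p₁ , λ t _ h _ → h
  go (suc b) with P? (suc (suc b)) | go b
  ... | yes p | _ = suc (suc b) , s≤s z≤n , ≤-refl , p , λ t _ h _ → h
  ... | no ¬p | s , h₁ , h₂ , p , top = s , h₁ , m≤n⇒m≤1+n h₂ , p , bound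
    where
    bound : ∀ t → 1 ≤ t → t ≤ suc (suc b) → P t → t ≤ s
    bound t l h q with m≤n⇒m<n∨m≡n h
    ... | inj₁ l'   = top t l (≤-pred l') q
    ... | inj₂ refl = ⊥-elim (¬p q)

module CmsOf {n} (G : Graph n) (1≤m : 1 ≤ m G) where
  open Edges G

  abstract
    good? : ∀ (ℓ : Ordering G) s → Dec (Good G ℓ s)
    good? ℓ s = all?F λ e → all?F λ e' → adjacent? e e' →-dec (s ≤? sdist G ℓ e e')

  fwd≥1 : ∀ M i j → 1 ≤ M → 1 ≤ fwd M i j
  fwd≥1 (suc M) i j _ = s≤s z≤n

  good₁ : ∀ ℓ → Good G ℓ 1
  good₁ ℓ e e' _ = ⊓-glb (fwd≥1 (m G) _ _ 1≤m) (fwd≥1 (m G) _ _ 1≤m)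

  abstract
    cmsOrd : ∀ ℓ → ∃ (IsCmsOrd G ℓ)
    cmsOrd ℓ = largest (good? ℓ) (good₁ ℓ) (m G) 1≤m

  Inj : (Fin (m G) → Fin (m G)) → Set
  Inj f = ∀ i j → f i ≡ f j → i ≡ j

  abstract
    inj? : ∀ f → Dec (Inj f)
    inj? f = all?F λ i → all?F λ j → (f i ≟F f j) →-dec (i ≟F j)

  orderings : List (Σ (Fin (m G) → Fin (m G)) Inj)
  orderings = select inj? (funs (m G) (allFin (m G)))

  toOrd : Σ (Fin (m G) → Fin (m G)) Inj → Ordering G
  toOrd (f , i) = f , inj⇒surj f (λ {x} {y} → i x y)

  listed : ∀ (ℓ : Ordering G) → ∃ λ o → o ∈ orderings × ∀ e → proj₁ (toOrd o) e ≡ proj₁ ℓ e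
  listed (f , inj , _) = by (funs-complete (m G) (allFin (m G)) f (λ i → ∈-allFin (f i)))
    where
    by : (∃ λ g → g ∈ funs (m G) (allFin (m G)) × ∀ i → g i ≡ f i) → ∃ λ o → o ∈ orderings × ∀ e → proj₁ (toOrd o) e ≡ f e
    by (g , i , e) = by₂ (select-complete inj? (funs (m G) (allFin (m G))) i (λ x y h → inj (trans (sym (e x)) (trans h (e y)))))
      where
      by₂ : (∃ λ p → (g , p) ∈ orderings) → ∃ λ o → o ∈ orderings × ∀ e → proj₁ (toOrd o) e ≡ f e
      by₂ (p , j) = (g , p) , j , e

  good-≗ : ∀ (ℓ ℓ' : Ordering G) → (∀ e → proj₁ ℓ e ≡ proj₁ ℓ' e) → ∀ s → Good G ℓ' s → Good G ℓ s
  good-≗ ℓ ℓ' h s gd e e' adj = subst₂ (λ a b → s ≤ fwd (m G) (toℕ a) (toℕ b) ⊓ fwd (m G) (toℕ b) (toℕ a)) (sym (h e)) (sym (h e')) (gd e e' adj)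

  best : ∃ λ o → o ∈ orderings × ∀ o' → o' ∈ orderings → proj₁ (cmsOrd (toOrd o')) ≤ proj₁ (cmsOrd (toOrd o))
  best = argmax (λ o → proj₁ (cmsOrd (toOrd o))) orderings (proj₁ (proj₂ (listed (id , inj⇒surj id id))))

  cms : ∃ (IsCmsGraph G)
  cms = proj₁ (cmsOrd (toOrd (proj₁ best))) , (toOrd (proj₁ best) , proj₂ (cmsOrd (toOrd (proj₁ best)))) , bound
    where
    bound : ∀ ℓ s → IsCmsOrd G ℓ s → s ≤ proj₁ (cmsOrd (toOrd (proj₁ best)))
    bound ℓ s (h₁ , h₂ , gd , _) = by (listed ℓ)
      where
      by : (∃ λ o → o ∈ orderings × ∀ e → proj₁ (toOrd o) e ≡ proj₁ ℓ e) → s ≤ proj₁ (cmsOrd (toOrd (proj₁ best)))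
      by (o , i , e) = ≤-trans (proj₂ (proj₂ (proj₂ (proj₂ (cmsOrd (toOrd o))))) s h₁ h₂ (good-≗ (toOrd o) ℓ e s gd)) (proj₂ (proj₂ best) o i)

cms-unique : ∀ {n} (G : Graph n) c c' → IsCmsGraph G c → IsCmsGraph G c' → c ≤ c'
cms-unique G c c' ((ℓ , o) , _) (_ , top) = top ℓ c o

cms-≥ : ∀ {n} (G : Graph n) → 1 ≤ m G → ∀ c s → IsCmsGraph G c → s ≤ m G → (ℓ : Ordering G) → Good G ℓ s → s ≤ c
cms-≥ G 1≤m c zero _ _ _ _ = z≤n
cms-≥ G 1≤m c (suc s) (_ , top) h ℓ gd with CmsOf.cmsOrd G 1≤m ℓ
... | t , q@(_ , _ , _ , max) = ≤-trans (max (suc s) (s≤s z≤n) h gd) (top ℓ t q)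

-- Graphs on Fin n with equal edge functions; without function extensionality they need not be equal.
data _~_ {n} : Graph n → Graph n → Set where
  sim : ∀ {M} {ed ed' : Fin M → Fin n × Fin n} {o o'} {i : Injective _≡_ _≡_ ed} {i' : Injective _≡_ _≡_ ed'} → (∀ e → ed e ≡ ed' e) →
        record { m = M ; edge = ed ; ordered = o ; edgeInj = i } ~ record { m = M ; edge = ed' ; ordered = o' ; edgeInj = i' }

~-cms : ∀ {n} {G G' : Graph n} → G ~ G' → ∀ c → IsCmsGraph G c → IsCmsGraph G' c
~-cms {n} (sim {M} {ed} {ed'} {o} {o'} {i} {i'} h) c ((ℓ , q) , top) = (ℓ , ord {ed} {ed'} {o} {o'} {i} {i'} h ℓ c q) , λ ℓ s q → top ℓ s (ord {ed'} {ed} {o'} {o} {i'} {i} (λ e → sym (h e)) ℓ s q)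
  where
  G₁ : (ed : Fin M → Fin n × Fin n) → (∀ e → toℕ (proj₁ (ed e)) < toℕ (proj₂ (ed e))) → Injective _≡_ _≡_ ed → Graph n
  G₁ ed o i = record { m = M ; edge = ed ; ordered = o ; edgeInj = i }
  adj : ∀ {ed ed' o o'} {i : Injective _≡_ _≡_ ed} {i' : Injective _≡_ _≡_ ed'} → (∀ e → ed e ≡ ed' e) → ∀ {e f} → Adjacent (G₁ ed' o' i') e f → Adjacent (G₁ ed o i) e f
  adj h {e} {f} (ne , v , p , q) = ne , v , subst (λ x → proj₁ x ≡ v ⊎ proj₂ x ≡ v) (sym (h e)) p , subst (λ x → proj₁ x ≡ v ⊎ proj₂ x ≡ v) (sym (h f)) q
  ord : ∀ {ed ed' o o'} {i : Injective _≡_ _≡_ ed} {i' : Injective _≡_ _≡_ ed'} → (∀ e → ed e ≡ ed' e) → ∀ ℓ s → IsCmsOrd (G₁ ed o i) ℓ s → IsCmsOrd (G₁ ed' o' i') ℓ s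
  ord {ed} {ed'} {o} {o'} {i} {i'} h ℓ s (a , b , gd , max) = a , b , (λ e f A → gd e f (adj {ed} {ed'} {o} {o'} {i} {i'} h A)) ,
    λ t l l' gd' → max t l l' (λ e f A → gd' e f (adj {ed'} {ed} {o'} {o} {i'} {i} (λ e → sym (h e)) A))

~-regular : ∀ {n k} {G G' : Graph n} → G ~ G' → Regular k G → Regular k G'
~-regular {G = G} {G'} (sim h) reg v = trans (trans (Counting.degree-cnt G' v) (trans (Σl-cong (allFin _)
  (λ e _ → cong (λ x → b2n ⌊ (proj₁ x ≟F v) ⊎-dec (proj₂ x ≟F v) ⌋) (sym (h e)))) (sym (Counting.degree-cnt G v)))) (reg v)

module Search (n k : ℕ) where

  WellFormed : ∀ {M} → (Fin M → Fin n × Fin n) → Set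
  WellFormed ed = (∀ e → toℕ (proj₁ (ed e)) < toℕ (proj₂ (ed e))) × (∀ e f → ed e ≡ ed f → e ≡ f)

  abstract
    wellFormed? : ∀ {M} (ed : Fin M → Fin n × Fin n) → Dec (WellFormed ed)
    wellFormed? ed = all?F (λ e → toℕ (proj₁ (ed e)) <? toℕ (proj₂ (ed e))) ×-dec
                     all?F (λ e → all?F λ f → ≡-dec _≟F_ _≟F_ (ed e) (ed f) →-dec (e ≟F f))

  toGraph : ∀ {M} → Σ (Fin M → Fin n × Fin n) WellFormed → Graph n
  toGraph {M} (ed , o , i) = record { m = M ; edge = ed ; ordered = o ; edgeInj = λ {x} {y} → i x y }

  abstract
    regular? : ∀ (G : Graph n) → Dec (Regular k G)
    regular? G = all?F λ v → degree G v ≟ k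

  edgeFuns : ∀ M → List (Fin M → Fin n × Fin n)
  edgeFuns M = funs M (Data.List.cartesianProduct (allFin n) (allFin n))

  graphs : ∀ M → List (Σ (Graph n) (Regular k))
  graphs M = select regular? (map toGraph (select wellFormed? (edgeFuns M)))

  listed : ∀ M (G : Graph n) → m G ≡ M → Regular k G → ∃ λ H → H ∈ graphs M × G ~ proj₁ H
  listed M G refl reg = by (funs-complete M _ (edge G) (λ e → ∈-cartesianProduct⁺ (∈-allFin _) (∈-allFin _)))
    where
    by : (∃ λ g → g ∈ edgeFuns M × ∀ e → g e ≡ edge G e) → ∃ λ H → H ∈ graphs M × G ~ proj₁ H
    by (g , j , h) = by₂ (select-complete wellFormed? (edgeFuns M) j
        ((λ e → subst (λ x → toℕ (proj₁ x) < toℕ (proj₂ x)) (sym (h e)) (ordered G e)) , λ e f q → edgeInj G (trans (sym (h e)) (trans q (h f)))))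
      where
      by₂ : (∃ λ w → (g , w) ∈ select wellFormed? (edgeFuns M)) → ∃ λ H → H ∈ graphs M × G ~ proj₁ H
      by₂ (w , j') = by₃ (select-complete regular? (map toGraph (select wellFormed? (edgeFuns M))) (∈-map⁺ toGraph j')
          (~-regular {k = k} {G = G} {G' = toGraph (g , w)} similar reg))
        where
        similar : G ~ toGraph (g , w)
        similar = sim (λ e → sym (h e))
        by₃ : (∃ λ r → (toGraph (g , w) , r) ∈ graphs M) → ∃ λ H → H ∈ graphs M × G ~ proj₁ H
        by₃ (r , j″) = (toGraph (g , w) , r) , j″ , similar

  -- Regularity fixes the number of edges, so one finite list contains all competitors up to `_~_`.
  exists : ∀ M → 1 ≤ M → (∀ G → Regular k G → m G ≡ M) → (G : Graph n) → Regular k G → ∃ (IsCmsNK n k)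
  exists M 1≤M size G reg = by (argmin cms (graphs M) (proj₁ (proj₂ (listed M G (size G reg) reg))))
    where
    1≤ : ∀ (H : Σ (Graph n) (Regular k)) → 1 ≤ m (proj₁ H)
    1≤ (H , r) = subst (1 ≤_) (sym (size H r)) 1≤M
    cms : Σ (Graph n) (Regular k) → ℕ
    cms H = proj₁ (CmsOf.cms (proj₁ H) (1≤ H))
    by : (∃ λ H → H ∈ graphs M × ∀ H' → H' ∈ graphs M → cms H ≤ cms H') → ∃ (IsCmsNK n k)
    by (H , _ , least) = cms H , (proj₁ H , proj₂ H , proj₂ (CmsOf.cms (proj₁ H) (1≤ H))) , minimal
      where
      minimal : ∀ (G : Graph n) c' → Regular k G → IsCmsGraph G c' → cms H ≤ c'
      minimal G c' r q with listed M G (size G r) r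
      ... | H' , i , s = ≤-trans (least H' i) (cms-unique (proj₁ H') _ c' (proj₂ (CmsOf.cms (proj₁ H') (1≤ H'))) (~-cms s c' q))

-- Window sums along the periodic sequence of edges

Win : (ℕ → ℕ) → ℕ → ℕ → ℕ
Win f x zero    = 0
Win f x (suc L) = f x + Win f (suc x) L

Win-++ : ∀ f x a b → Win f x (a + b) ≡ Win f x a + Win f (x + a) b
Win-++ f x zero    b = cong (λ y → Win f y b) (sym (+-identityʳ x))
Win-++ f x (suc a) b = trans (cong (f x +_) (trans (Win-++ f (suc x) a b) (cong (λ y → Win f (suc x) a + Win f y b) (sym (+-suc x a)))))
  (sym (+-assoc (f x) _ _))

Win-last : ∀ f x L → Win f x (suc L) ≡ Win f x L + f (x + L)
Win-last f x L = trans (cong (Win f x) (sym (+-comm L 1))) (trans (Win-++ f x L 1) (cong (Win f x L +_) (+-identityʳ _)))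

Win-mono : ∀ {f g} x L → (∀ t → f t ≤ g t) → Win f x L ≤ Win g x L
Win-mono x zero    h = z≤n
Win-mono x (suc L) h = +-mono-≤ (h x) (Win-mono (suc x) L h)

Win-cong : ∀ {f g} x L → (∀ i → i < L → f (x + i) ≡ g (x + i)) → Win f x L ≡ Win g x L
Win-cong x zero h = refl
Win-cong {f} {g} x (suc L) h = cong₂ _+_ (subst (λ y → f y ≡ g y) (+-identityʳ x) (h 0 (s≤s z≤n)))
  (Win-cong (suc x) L (λ i l → subst (λ y → f y ≡ g y) (+-suc x i) (h (suc i) (s≤s l))))

Win-≤ : ∀ f x {a b} → a ≤ b → Win f x a ≤ Win f x b
Win-≤ f x {a} {b} h = ≤-trans (m≤m+n _ _) (≤-reflexive (trans (sym (Win-++ f x a (b ∸ a))) (cong (Win f x) (m+[n∸m]≡n h))))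

Win-period : ∀ f p → (∀ t → f (t + p) ≡ f t) → ∀ x → Win f x p ≡ Win f 0 p
Win-period f p h zero    = refl
Win-period f p h (suc x) = trans (+-cancelˡ-≡ (f x) _ _ (trans (Win-last f x p) (trans (cong (Win f x p +_) (h x)) (+-comm _ (f x))))) (Win-period f p h x)

Win-shift : ∀ f c x L → Win (λ t → f (c + t)) x L ≡ Win f (c + x) L
Win-shift f c x zero    = refl
Win-shift f c x (suc L) = cong (f (c + x) +_) (trans (Win-shift f c (suc x) L) (cong (λ y → Win f y L) (+-suc c x)))

Win-Σl : ∀ {A : Set} (f : A → ℕ → ℕ) x L vs → Σl (λ v → Win (f v) x L) vs ≡ Win (λ t → Σl (λ v → f v t) vs) x L
Win-Σl f x zero    vs = trans (Σl-const 0 vs) refl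
Win-Σl f x (suc L) vs = trans (Σl-+ _ _ vs) (cong (Σl (λ v → f v x) vs +_) (Win-Σl f (suc x) L vs))

Win-const : ∀ c x L → Win (λ _ → c) x L ≡ c * L
Win-const c x zero = sym (*-zeroʳ c)
Win-const c x (suc L) = trans (cong (c +_) (Win-const c (suc x) L)) (sym (*-suc c L))

Win-* : ∀ c f x L → Win (λ t → c * f t) x L ≡ c * Win f x L
Win-* c f x zero = sym (*-zeroʳ c)
Win-* c f x (suc L) = trans (cong (c * f x +_) (Win-* c f (suc x) L)) (sym (*-distribˡ-+ c (f x) _))

Win-+ : ∀ f g x L → Win (λ t → f t + g t) x L ≡ Win f x L + Win g x L
Win-+ f g x zero = refl
Win-+ f g x (suc L) rewrite Win-+ f g (suc x) L = lem (f x) (g x) (Win f (suc x) L) (Win g (suc x) L)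
  where
  lem : ∀ a b c d → a + b + (c + d) ≡ a + c + (b + d)
  lem = solve-∀

Win-blocks : ∀ f h s → (∀ x → Win f x s ≤ h) → ∀ x j → Win f x (j * s) ≤ j * h
Win-blocks f h s b x zero    = z≤n
Win-blocks f h s b x (suc j) = ≤-trans (≤-reflexive (Win-++ f x s (j * s))) (+-mono-≤ (b x) (Win-blocks f h s b (x + s) j))

Win-allFin : ∀ f n → Σl (λ i → f (toℕ i)) (allFin n) ≡ Win f 0 n
Win-allFin f n = go f n id
  where
  tab : ∀ {A : Set} (g : A → ℕ) n (h : Fin n → A) → Σl g (Data.List.tabulate h) ≡ Σl (g ∘ h) (allFin n)
  tab g zero h = refl
  tab g (suc n) h = cong (g (h Fin.zero) +_) (trans (tab g n (h ∘ Fin.suc)) (sym (tab (g ∘ h) n Fin.suc)))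
  go : ∀ f n (h : Fin n → Fin n) → Σl (λ i → f (toℕ i)) (allFin n) ≡ Win f 0 n
  go f zero h = refl
  go f (suc n) h = cong (f 0 +_) (trans (tab (λ i → f (toℕ i)) n Fin.suc) (trans (go (f ∘ suc) n id) (Win-shift f 1 0 n)))

b2n-pos : ∀ {b} → 1 ≤ b2n b → b ≡ true
b2n-pos {true} _ = refl

module _ (p : ℕ → Bool) where
  private
    f : ℕ → ℕ
    f t = b2n (p t)

  Win-zero : ∀ x L → (∀ i → i < L → p (x + i) ≡ false) → Win f x L ≡ 0
  Win-zero x L h = trans (Win-cong {g = λ _ → 0} x L (λ i l → cong b2n (h i l))) (Win-const 0 x L)

  Win≤1 : ∀ x L → (∀ t d → d < L → 1 ≤ d → p t ≡ true → p (t + d) ≡ true → ⊥) → Win f x L ≤ 1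
  Win≤1 x zero h = z≤n
  Win≤1 x (suc L) h with p x in eq
  ... | false = Win≤1 (suc x) L (λ t d l → h t d (m≤n⇒m≤1+n l))
  ... | true  = s≤s (≤-reflexive (Win-zero (suc x) L (λ i l → ≢true (λ q → h x (suc i) (s≤s l) (s≤s z≤n) eq (subst (λ y → p y ≡ true) (sym (+-suc x i)) q)))))

  -- Serves to cut time at the edges inside a part; q = 0 gives the first of them.
  Win-nth : ∀ x L q → q < Win f x L → ∃ λ a → a < L × Win f x a ≡ q × p (x + a) ≡ true
  Win-nth x (suc L) q h with p x in eq
  Win-nth x (suc L) zero h | true = 0 , s≤s z≤n , refl , subst (λ y → p y ≡ true) (sym (+-identityʳ x)) eq
  Win-nth x (suc L) (suc q) h | true with Win-nth (suc x) L q (≤-pred h)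
  ... | a , l , e , r = suc a , s≤s l , trans (cong (λ b → b2n b + Win f (suc x) a) eq) (cong suc e) , subst (λ y → p y ≡ true) (sym (+-suc x a)) r
  Win-nth x (suc L) q h | false with Win-nth (suc x) L q h
  ... | a , l , e , r = suc a , s≤s l , trans (cong (λ b → b2n b + Win f (suc x) a) eq) e , subst (λ y → p y ≡ true) (sym (+-suc x a)) r

Σl-pick : ∀ {A : Set} (f : A → ℕ) {x xs} → Unique xs → x ∈ xs → (∀ y → y ≢ x → f y ≡ 0) → Σl f xs ≡ f x
Σl-pick f {x} {y ∷ ys} (a ∷ᵁ u) (here refl) h = trans (cong (f y +_) (rest ys (λ z i → h z (λ e → All.lookup a i (sym e))))) (+-identityʳ (f y))
  where
  rest : ∀ ys → (∀ z → z ∈ ys → f z ≡ 0) → Σl f ys ≡ 0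
  rest ys h = trans (Σl-cong ys h) (Σl-const 0 ys)
Σl-pick f (a ∷ᵁ u) (there i) h = cong₂ _+_ (h _ (λ e → All.lookup a i e)) (Σl-pick f u i h)

fwd-≤ : ∀ M .{{_ : NonZero M}} t d → 1 ≤ d → fwd M (t % M) ((t + d) % M) ≤ d
fwd-≤ (suc M) t (suc d) _ = s≤s (begin
    ((t + suc d) % suc M + suc M ∸ suc a) % suc M          ≡⟨ cong (_% suc M) (+-∸-assoc ((t + suc d) % suc M) (m%n<n t (suc M))) ⟩
    ((t + suc d) % suc M + (M ∸ a)) % suc M                ≡⟨ cong (λ z → (z + (M ∸ a)) % suc M) (mod t (suc d)) ⟩
    ((a + suc d) % suc M + (M ∸ a)) % suc M                ≡⟨ sym (mod (a + suc d) (M ∸ a)) ⟩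
    (a + suc d + (M ∸ a)) % suc M                          ≡⟨ cong (_% suc M) (lem a d (M ∸ a)) ⟩
    (d + suc (a + (M ∸ a))) % suc M                        ≡⟨ cong (λ z → (d + suc z) % suc M) (m+[n∸m]≡n (≤-pred (m%n<n t (suc M)))) ⟩
    (d + suc M) % suc M                                    ≡⟨ [m+n]%n≡m%n d (suc M) ⟩
    d % suc M                                              ≤⟨ m%n≤m d (suc M) ⟩
    d                                                      ∎)
  where
  open ≤-Reasoning
  a = t % suc M
  mod : ∀ x y → (x + y) % suc M ≡ (x % suc M + y) % suc M
  mod x y = trans (%-distribˡ-+ x y (suc M)) (trans (cong (λ z → (z + y % suc M) % suc M) (sym (m%n%n≡m%n x (suc M)))) (sym (%-distribˡ-+ (x % suc M) y (suc M))))
  lem : ∀ a d b → a + suc d + b ≡ d + suc (a + b)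
  lem = solve-∀

-- This value at equal positions is what lets `distinct` show that an edge does not recur in fewer
-- than m steps.
fwd-refl : ∀ M i → i < M → fwd M i i ≡ M
fwd-refl (suc M) i l = cong suc (trans (cong (λ z → z % suc M) (trans (cong (_∸ suc i) (+-suc i M)) (m+n∸m≡n i M))) (m≤n⇒m%n≡m ≤-refl))

module Periodic {n} (G : Graph n) .{{_ : NonZero (m G)}} (ℓ : Ordering G) where
  open Counting G public

  position : E → ℕ
  position e = toℕ (proj₁ ℓ e)

  slot : ℕ → Fin (m G)
  slot t = fromℕ< (m%n<n t (m G))

  at : Fin (m G) → E
  at i = proj₁ (proj₂ (proj₂ ℓ) i)

  ℓ-at : ∀ i → proj₁ ℓ (at i) ≡ i
  ℓ-at i = proj₂ (proj₂ (proj₂ ℓ) i) refl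

  edgeAtTime : ℕ → E
  edgeAtTime t = at (slot t)

  position-edge : ∀ t → position (edgeAtTime t) ≡ t % m G
  position-edge t = trans (cong toℕ (ℓ-at (slot t))) (toℕ-fromℕ< _)

  periodic : ∀ t → edgeAtTime (t + m G) ≡ edgeAtTime t
  periodic t = cong at (toℕ-injective (trans (toℕ-fromℕ< _) (trans ([m+n]%n≡m%n t (m G)) (sym (toℕ-fromℕ< _)))))

  dist-≤ : ∀ t d → 1 ≤ d → dist G ℓ (edgeAtTime t) (edgeAtTime (t + d)) ≤ d
  dist-≤ t d h = subst₂ (λ a b → fwd (m G) a b ≤ d) (sym (position-edge t)) (sym (position-edge (t + d))) (fwd-≤ (m G) t d h)

  distinct : ∀ t d → 1 ≤ d → d < m G → edgeAtTime t ≢ edgeAtTime (t + d)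
  distinct t d h l e = <⇒≱ l (≤-trans (≤-reflexive (sym (fwd-refl (m G) _ (toℕ<n (proj₁ ℓ (edgeAtTime t))))))
    (subst (λ f → dist G ℓ (edgeAtTime t) f ≤ d) (sym e) (dist-≤ t d h)))

  over : (E → ℕ) → ℕ → ℕ → ℕ
  over f = Win (f ∘ edgeAtTime)

  over-all : ∀ f x → over f x (m G) ≡ Σl f Es
  over-all f x = trans (Win-period (f ∘ edgeAtTime) (m G) (λ t → cong f (periodic t)) x) (trans (sym (Win-allFin _ (m G)))
      (trans (Σl-cong Es (λ i _ → trans (cong (f ∘ at) (slot-toℕ i)) (sym (row i))))
      (trans (Σl-swap (λ i e → pick i e (proj₁ ℓ e ≟F i)) Es Es) (Σl-cong Es (λ e _ → column e)))))
    where
    slot-toℕ : ∀ i → slot (toℕ i) ≡ i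
    slot-toℕ i = toℕ-injective (trans (toℕ-fromℕ< _) (m<n⇒m%n≡m (toℕ<n i)))
    pick : ∀ i e → Dec (proj₁ ℓ e ≡ i) → ℕ
    pick i e d = if ⌊ d ⌋ then f e else 0
    hit : ∀ i e (d : Dec (proj₁ ℓ e ≡ i)) → proj₁ ℓ e ≡ i → pick i e d ≡ f e
    hit i e (yes _) _ = refl
    hit i e (no ne) p = ⊥-elim (ne p)
    miss : ∀ i e (d : Dec (proj₁ ℓ e ≡ i)) → proj₁ ℓ e ≢ i → pick i e d ≡ 0
    miss i e (yes p) ne = ⊥-elim (ne p)
    miss i e (no _) _ = refl
    row : ∀ i → Σl (λ e → pick i e (proj₁ ℓ e ≟F i)) Es ≡ f (at i)
    row i = trans (Σl-pick _ (allFin⁺ (m G)) (∈-allFin (at i)) (λ e ne → miss i e _ (λ r → ne (proj₁ (proj₂ ℓ) (trans r (sym (ℓ-at i)))))))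
      (hit i (at i) _ (ℓ-at i))
    column : ∀ e → Σl (λ i → pick i e (proj₁ ℓ e ≟F i)) Es ≡ f e
    column e = trans (Σl-pick _ (allFin⁺ (m G)) (∈-allFin (proj₁ ℓ e)) (λ i ne → miss i e _ (λ r → ne (sym r)))) (hit _ e _ refl)

  module Windows (s : ℕ) (s≤m : s ≤ m G) (good : Good G ℓ s) where

    apart : ∀ v t d → 1 ≤ d → d < s → inc v (edgeAtTime t) ≡ true → inc v (edgeAtTime (t + d)) ≡ true → ⊥
    apart v t d h l p q = <⇒≱ l (≤-trans (good _ _ (distinct t d h (≤-trans l s≤m) , v , ⌊⌋-true (incident? v _) p , ⌊⌋-true (incident? v _) q))
      (≤-trans (m⊓n≤m _ _) (dist-≤ t d h)))

    once : ∀ (p : E → Bool) v x → (∀ e → p e ≡ true → inc v e ≡ true) → over (b2n ∘ p) x s ≤ 1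
    once p v x h = Win≤1 (p ∘ edgeAtTime) x s (λ t d l r a b → apart v t d r l (h _ a) (h _ b))

halve : ∀ a b → 2 * a ≤ suc (2 * b) → a ≤ b
halve a b h = ≮⇒≥ (λ l → 1+n≰n (≤-trans (≤-trans (≤-reflexive (lem b)) (*-monoʳ-≤ 2 l)) h))
  where
  lem : ∀ b → suc (suc (2 * b)) ≡ 2 * suc b
  lem = solve-∀

-- Upper bounds from a dense part

module Gadget {n} (G : Graph n) (S : Fin n → Bool) where
  open Counting G public

  VS : List (Fin n)
  VS = filterᵇ S V

  inside crossing : E → Bool
  inside e = S (lo e) ∧ S (hi e)
  crossing e = S (lo e) ∧ not (S (hi e)) ∨ not (S (lo e)) ∧ S (hi e)

  insideAt : Fin n → E → Bool
  insideAt v e = inside e ∧ inc v e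

  inside-S : ∀ {e v} → inside e ≡ true → Incident G v e → S v ≡ true
  inside-S h (inj₁ refl) = proj₁ (∧-true h)
  inside-S {e} h (inj₂ refl) = proj₂ (∧-true {S (lo e)} h)

  size : ℕ
  size = Σl (b2n ∘ inside) Es

  private
    cnt-end : ∀ a → cnt (λ v → S v ∧ ⌊ a ≟F v ⌋) V ≡ b2n (S a)
    cnt-end a = trans (Σl-pick _ (allFin⁺ n) (∈-allFin a) (λ y ne → cong b2n (≢true (λ r → ne (sym (⌊⌋-true (a ≟F y) (proj₂ (∧-true {S y} r))))))))
      (cong b2n (trans (cong (S a ∧_) (⌊⌋-intro (a ≟F a) refl)) (Data.Bool.Properties.∧-identityʳ (S a))))

  ends-inside : ∀ e → cnt (λ v → inc v e) VS ≡ b2n (S (lo e)) + b2n (S (hi e))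
  ends-inside e = trans (cnt-fil (λ v → inc v e) S V) (trans (Σl-cong V (λ v _ → aux v (S v) (lo e ≟F v) (hi e ≟F v)))
    (trans (Σl-+ _ _ V) (cong₂ _+_ (cnt-end (lo e)) (cnt-end (hi e)))))
    where
    aux : ∀ v b (p : Dec (lo e ≡ v)) (q : Dec (hi e ≡ v)) → b2n (b ∧ ⌊ p ⊎-dec q ⌋) ≡ b2n (b ∧ ⌊ p ⌋) + b2n (b ∧ ⌊ q ⌋)
    aux v false p q = refl
    aux v true (yes p) (yes q) = ⊥-elim (lo≢hi e (trans p (sym q)))
    aux v true (yes p) (no q)  = refl
    aux v true (no p)  (yes q) = refl
    aux v true (no p)  (no q)  = refl

  two-inside : ∀ e → cnt (λ v → insideAt v e) VS ≡ 2 * b2n (inside e)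
  two-inside e = by (S (lo e)) (S (hi e)) refl refl
    where
    by : ∀ a b → S (lo e) ≡ a → S (hi e) ≡ b → cnt (λ v → (a ∧ b) ∧ inc v e) VS ≡ 2 * b2n (a ∧ b)
    by true true p q = trans (ends-inside e) (cong₂ (λ a b → b2n a + b2n b) p q)
    by true false p q = cnt-zero _ VS (λ _ _ → refl)
    by false b p q = cnt-zero _ VS (λ _ _ → refl)

  degree-sum : ∀ {k} → Regular k G → k * length VS ≡ 2 * size + cnt crossing Es
  degree-sum {k} reg = trans (sym (Σl-const k VS)) (trans (Σl-cong VS (λ v _ → trans (sym (reg v)) (degree-cnt v)))
    (trans (Σl-swap (λ v e → b2n (inc v e)) VS Es) (trans (Σl-cong Es (λ e _ → trans (ends-inside e) (aux (S (lo e)) (S (hi e)))))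
    (trans (Σl-+ _ _ Es) (cong (_+ cnt crossing Es) (Σl-* 2 (b2n ∘ inside) Es))))))
    where
    aux : ∀ a b → b2n a + b2n b ≡ 2 * b2n (a ∧ b) + b2n (a ∧ not b ∨ not a ∧ b)
    aux true true = refl
    aux true false = refl
    aux false true = refl
    aux false false = refl

  module Timed .{{_ : NonZero (m G)}} (ℓ : Ordering G) (s : ℕ) (s≤m : s ≤ m G) (good : Good G ℓ s) where
    open Periodic G ℓ using (edgeAtTime; over; over-all; distinct)
    open Periodic.Windows G ℓ s s≤m good

    c : ℕ → ℕ → ℕ
    c = over (b2n ∘ inside)

    cAt : Fin n → ℕ → ℕ → ℕ
    cAt v = over (b2n ∘ insideAt v)

    cAt≤1 : ∀ v x → cAt v x s ≤ 1
    cAt≤1 v x = once (insideAt v) v x (λ e h → proj₂ (∧-true {inside e} h))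

    cAt≤c : ∀ v x L → cAt v x L ≤ c x L
    cAt≤c v x L = Win-mono x L (λ t → b2n-mono (λ h → proj₁ (∧-true {inside (edgeAtTime t)} h)))

    cAt-sum : ∀ x L → Σl (λ v → cAt v x L) VS ≡ 2 * c x L
    cAt-sum x L = trans (Win-Σl (λ v t → b2n (insideAt v (edgeAtTime t))) x L VS)
      (trans (Win-cong x L (λ i _ → two-inside (edgeAtTime (x + i)))) (Win-* 2 _ x L))

    c-bound : ∀ x → 2 * c x s ≤ length VS
    c-bound x = ≤-trans (≤-reflexive (sym (cAt-sum x s))) (≤-trans (Σl-bound _ 1 VS (λ v _ → cAt≤1 v x)) (≤-reflexive (*-identityˡ _)))

    inside-time : 1 ≤ size → ∀ x → ∃ λ t → inside (edgeAtTime t) ≡ true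
    inside-time h x with Win-nth (inside ∘ edgeAtTime) x (m G) 0 (subst (0 <_) (sym (over-all _ x)) h)
    ... | a , _ , _ , p = x + a , p

    -- A window of s - 1 edges misses at most the r inside edges that the other r full windows of a period can hold.
    short-window : ∀ h r → (∀ x → c x s ≤ h) → ∀ s' → s ≡ suc s' → m G < suc r * s → ∀ x → size ≤ c x s' + r * h
    short-window h r b s' refl l x = begin
      size                        ≡⟨ sym (over-all _ x) ⟩
      c x (m G)                   ≤⟨ Win-≤ _ x (≤-pred l) ⟩
      c x (s' + r * s)            ≡⟨ Win-++ _ x s' (r * s) ⟩
      c x s' + c (x + s') (r * s) ≤⟨ +-monoʳ-≤ (c x s') (Win-blocks _ h s b (x + s') r) ⟩
      c x s' + r * h              ∎
      where open ≤-Reasoning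

    -- S spans a complete graph, and a window of s edges has at most h of its edges. If m < (2h +
    -- 1)s, then `short-window` leaves at least h of them in every window of s - 1 edges, and a
    -- window that starts with an inside edge would have h + 1.
    complete-bound : ∀ h → 1 ≤ h → length VS ≡ suc (2 * h) → size ≡ h * suc (2 * h) → suc (2 * h) * s ≤ m G
    complete-bound h 1≤h vs N = ≮⇒≥ (λ l → clash s refl l)
      where
      b : ∀ x → c x s ≤ h
      b x = halve _ h (subst (2 * c x s ≤_) vs (c-bound x))
      clash : ∀ s₁ → s ≡ s₁ → m G < suc (2 * h) * s₁ → ⊥
      clash zero e l = n≮0 (subst (m G <_) (*-zeroʳ (suc (2 * h))) l)
      clash (suc s') e l = go (inside-time (subst (1 ≤_) (sym N) (*-mono-≤ 1≤h (s≤s z≤n))) 0)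
        where
        full : ∀ x → h ≤ c x s'
        full x = +-cancelʳ-≤ (2 * h * h) h (c x s') (≤-trans (≤-reflexive (trans (lem h) (sym N)))
          (short-window h (2 * h) b s' e (subst (λ z → m G < suc (2 * h) * z) (sym e) l) x))
          where
          lem : ∀ h → h + 2 * h * h ≡ h * suc (2 * h)
          lem = solve-∀
        go : (∃ λ t → inside (edgeAtTime t) ≡ true) → ⊥
        go (t , p) = 1+n≰n (≤-trans (s≤s (full (suc t))) (≤-trans (≤-reflexive (trans (cong (λ b → b2n b + c (suc t) s') (sym p)) (cong (c t) (sym e)))) (b t)))

-- In the application k = 2g + 1, S has k + 2 vertices, and a bridge at u is the only edge that
-- leaves S. `few` and `many` describe what happens if the bound fails. Unlike for a complete part
-- they do not clash at once; the contradiction comes from counting the edges at u.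
module DeficientGadget {n} (G : Graph n) (S : Fin n → Bool) (u : Fin n) (Su : S u ≡ true) .{{_ : NonZero (m G)}}
    (ℓ : Ordering G) (s' : ℕ) (s≤m : suc s' ≤ m G) (good : Good G ℓ (suc s')) (g : ℕ)
    (vs : length (Gadget.VS G S) ≡ suc (2 * suc g)) (few : ∀ x → Gadget.Timed.c G S ℓ (suc s') s≤m good x (suc s') ≤ suc g)
    (many : ∀ x → g ≤ Gadget.Timed.c G S ℓ (suc s') s≤m good x s') where
  open Gadget G S
  open Timed ℓ (suc s') s≤m good
  open Periodic G ℓ using (edgeAtTime; over; over-all; distinct)

  private
    s = suc s'
    isInside : ℕ → Bool
    isInside t = inside (edgeAtTime t)

  starting : ∀ x → isInside x ≡ true → c x s ≡ suc g
  starting x p = ≤-antisym (few x) (≤-trans (s≤s (many (suc x))) (≤-reflexive (cong (λ b → b2n b + c (suc x) s') (sym p))))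

  ending : ∀ x → isInside (x + s') ≡ true → c x s ≡ suc g
  ending x p = ≤-antisym (few x) (≤-trans (≤-trans (≤-reflexive (+-comm 1 g)) (+-mono-≤ (many x) (≤-reflexive (cong b2n (sym p)))))
    (≤-reflexive (sym (Win-last (b2n ∘ isInside) x s'))))

  others : List (Fin n)
  others = filterᵇ (λ v → not ⌊ v ≟F u ⌋) VS

  others⁺ : ∀ {v} → S v ≡ true → v ≢ u → v ∈ others
  others⁺ {v} p ne = ∈-fil⁺ (λ v → not ⌊ v ≟F u ⌋) (∈-fil⁺ S (∈-allFin v) p) (not-false (⌊⌋-no (v ≟F u) ne))

  VS-split : ∀ (f : Fin n → ℕ) → Σl f VS ≡ f u + Σl f others
  VS-split f = sym (trans (cong₂ _+_ (sym head) (Σl-fil f _ VS)) (trans (sym (Σl-+ _ _ VS)) (Σl-cong VS (λ v _ → aux v (v ≟F u)))))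
    where
    aux : ∀ v (d : Dec (v ≡ u)) → (if ⌊ d ⌋ then f v else 0) + (if not ⌊ d ⌋ then f v else 0) ≡ f v
    aux v (yes _) = +-identityʳ _
    aux v (no _)  = refl
    head : Σl (λ v → if ⌊ v ≟F u ⌋ then f v else 0) VS ≡ f u
    head = trans (Σl-pick _ (unique-fil S (allFin⁺ n)) (∈-fil⁺ S (∈-allFin u) Su) (λ v ne → cong (λ b → if b then f v else 0) (⌊⌋-no (v ≟F u) ne)))
      (cong (λ b → if b then f u else 0) (⌊⌋-intro (u ≟F u) refl))

  -- A window with g + 1 inside edges that avoids u is a perfect matching of the rest of S.
  covers : ∀ x → c x s ≡ suc g → cAt u x s ≡ 0 → ∀ v → S v ≡ true → v ≢ u → cAt v x s ≡ 1
  covers x full avoid v p ne = Σl-ones (λ v → cAt v x s) others (λ v _ → cAt≤1 v x) total v (others⁺ p ne)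
    where
    total : Σl (λ v → cAt v x s) others ≡ length others
    total = trans (cong (_+ Σl (λ v → cAt v x s) others) (sym avoid)) (trans (sym (VS-split (λ v → cAt v x s)))
      (trans (cAt-sum x s) (trans (cong (2 *_) full) (suc-injective (trans (sym vs) ones)))))
      where
      ones : length VS ≡ suc (length others)
      ones = trans (sym (trans (Σl-const 1 VS) (*-identityˡ _))) (trans (VS-split (λ _ → 1)) (cong suc (trans (Σl-const 1 others) (*-identityˡ _))))

  -- The block has g + 2 inside edges. The window of s edges at its start misses only the last of
  -- them, the one at its end only the first. If u is avoided, both windows match the other 2g + 2
  -- vertices of S perfectly, so the first and the last edge have the same ends; but they are
  -- different edges.
  block-meets-u : ∀ x L → isInside x ≡ true → isInside (x + L) ≡ true → c x L ≡ suc g → L < m G → 1 ≤ L → 1 ≤ cAt u x (suc L)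
  block-meets-u x L p q e L<m 1≤L = ≮⇒≥ (λ l → clash (≤-antisym (≤-pred l) z≤n))
    where
    c-suc : c x (suc L) ≡ suc (suc g)
    c-suc = trans (Win-last (b2n ∘ isInside) x L) (trans (cong₂ _+_ e (cong b2n q)) (+-comm (suc g) 1))
    s≤L : s ≤ L
    s≤L = ≮⇒≥ (λ l → 1+n≰n (≤-trans (≤-reflexive (sym c-suc)) (≤-trans (Win-≤ _ x l) (few x))))
    d = L ∸ s
    front : s + suc d ≡ suc L
    front = trans (+-suc s d) (cong suc (m+[n∸m]≡n s≤L))
    back : suc d + s ≡ suc L
    back = trans (+-comm (suc d) s) front
    last : x + suc d + s' ≡ x + L
    last = trans (+-assoc x (suc d) s') (cong (x +_) (trans (sym (+-suc d s')) (trans (+-comm d s) (m+[n∸m]≡n s≤L))))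
    split₁ : ∀ (f : E → ℕ) → over f x (suc L) ≡ over f x s + over f (x + s) (suc d)
    split₁ f = trans (cong (over f x) (sym front)) (Win-++ _ x s (suc d))
    split₂ : ∀ (f : E → ℕ) → over f x (suc L) ≡ over f x (suc d) + over f (x + suc d) s
    split₂ f = trans (cong (over f x) (sym back)) (Win-++ _ x (suc d) s)
    first-full : c x s ≡ suc g
    first-full = starting x p
    last-full : c (x + suc d) s ≡ suc g
    last-full = ending (x + suc d) (subst (λ t → isInside t ≡ true) (sym last) q)
    only-x : c (suc x) d ≡ 0
    only-x = suc-injective (trans (cong (λ b → b2n b + c (suc x) d) (sym p))
      (+-cancelʳ-≡ (suc g) (c x (suc d)) 1 (trans (cong (c x (suc d) +_) (sym last-full)) (trans (sym (split₂ (b2n ∘ inside))) c-suc))))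
    end : x + s + d ≡ x + L
    end = trans (+-assoc x s d) (cong (x +_) (m+[n∸m]≡n s≤L))
    only-end : c (x + s) d ≡ 0
    only-end = +-cancelʳ-≡ 1 (c (x + s) d) 0 (trans (trans (cong (λ b → c (x + s) d + b2n b) (sym (trans (cong isInside end) q))) (sym (Win-last (b2n ∘ isInside) (x + s) d)))
      (+-cancelˡ-≡ (suc g) (c (x + s) (suc d)) 1 (trans (cong (_+ c (x + s) (suc d)) (sym first-full)) (trans (sym (split₁ (b2n ∘ inside))) (trans c-suc (+-comm 1 (suc g)))))))
    none : ∀ v y L → c y L ≡ 0 → cAt v y L ≡ 0
    none v y L h = ≤-antisym (≤-trans (cAt≤c v y L) (≤-reflexive h)) z≤n
    clash : cAt u x (suc L) ≡ 0 → ⊥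
    clash avoid = distinct x L 1≤L L<m (same-ends (lo≢hi (edgeAtTime x)) (inj₁ refl) (inj₂ refl) (moves (inj₁ refl)) (moves (inj₂ refl)))
      where
      same : ∀ v → S v ≡ true → v ≢ u → insideAt v (edgeAtTime x) ≡ true → insideAt v (edgeAtTime (x + L)) ≡ true
      same v Sv ne r = b2n-pos (≤-reflexive (begin
          1                                             ≡⟨ cong b2n (sym r) ⟩
          b2n (insideAt v (edgeAtTime x))                ≡⟨ sym (+-identityʳ _) ⟩
          b2n (insideAt v (edgeAtTime x)) + 0            ≡⟨ cong (b2n (insideAt v (edgeAtTime x)) +_) (sym (none v (suc x) d only-x)) ⟩
          cAt v x (suc d)                               ≡⟨ +-cancelʳ-≡ 1 _ _ balance-d ⟩
          cAt v (x + s) (suc d)                         ≡⟨ Win-last (b2n ∘ insideAt v ∘ edgeAtTime) (x + s) d ⟩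
          cAt v (x + s) d + b2n (insideAt v (edgeAtTime (x + s + d))) ≡⟨ cong₂ (λ a t → a + b2n (insideAt v (edgeAtTime t))) (none v (x + s) d only-end) end ⟩
          b2n (insideAt v (edgeAtTime (x + L)))          ∎))
        where
        open ≡-Reasoning
        part : ∀ {a b} → a + b ≡ 0 → a ≡ 0 × b ≡ 0
        part {zero} h = refl , h
        balance-d : cAt v x (suc d) + 1 ≡ cAt v (x + s) (suc d) + 1
        balance-d = begin
          cAt v x (suc d) + 1                     ≡⟨ cong (cAt v x (suc d) +_) (sym (covers (x + suc d) last-full (proj₂ (part {cAt u x (suc d)} (trans (sym (split₂ (b2n ∘ insideAt u))) avoid))) v Sv ne)) ⟩
          cAt v x (suc d) + cAt v (x + suc d) s   ≡⟨ trans (sym (split₂ (b2n ∘ insideAt v))) (split₁ (b2n ∘ insideAt v)) ⟩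
          cAt v x s + cAt v (x + s) (suc d)       ≡⟨ cong (_+ cAt v (x + s) (suc d)) (covers x first-full (proj₁ (part {cAt u x s} (trans (sym (split₁ (b2n ∘ insideAt u))) avoid))) v Sv ne) ⟩
          1 + cAt v (x + s) (suc d)               ≡⟨ +-comm 1 _ ⟩
          cAt v (x + s) (suc d) + 1               ∎
      moves : ∀ {v} → Incident G v (edgeAtTime x) → Incident G v (edgeAtTime (x + L))
      moves {v} i = ⌊⌋-true (incident? v _) (proj₂ (∧-true {inside (edgeAtTime (x + L))} (same v (inside-S {edgeAtTime x} p i) avoids r)))
        where
        r : insideAt v (edgeAtTime x) ≡ true
        r = ∧-intro p (⌊⌋-intro (incident? v _) i)
        avoids : v ≢ u
        avoids refl = 1+n≰n (≤-trans (≤-trans (≤-reflexive (cong b2n (sym r))) (m≤m+n _ _)) (≤-reflexive avoid))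

  -- Disjoint blocks of g + 2 inside edges are cut off one after another, and each of them uses up
  -- an inside edge at u.
  blocks-meet-u : ∀ b x L → b * suc (suc g) ≤ c x L → L ≤ m G → b ≤ cAt u x L
  blocks-meet-u zero x L h l = z≤n
  blocks-meet-u (suc b) x L h l = go (Win-nth isInside x L 0 (≤-trans (s≤s z≤n) h))
    where
    go : (∃ λ a → a < L × c x a ≡ 0 × isInside (x + a) ≡ true) → suc b ≤ cAt u x L
    go (a , a<L , e , p) = go' (Win-nth isInside (x + a) (L ∸ a) (suc g) (≤-trans (m≤m+n (suc (suc g)) (b * suc (suc g))) (≤-trans h (≤-reflexive rest))))
      where
      L≡ : a + (L ∸ a) ≡ L
      L≡ = m+[n∸m]≡n (<⇒≤ a<L)
      rest : c x L ≡ c (x + a) (L ∸ a)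
      rest = trans (cong (c x) (sym L≡)) (trans (Win-++ _ x a (L ∸ a)) (cong (_+ c (x + a) (L ∸ a)) e))
      go' : (∃ λ z → z < L ∸ a × c (x + a) z ≡ suc g × isInside (x + a + z) ≡ true) → suc b ≤ cAt u x L
      go' (zero , _ , () , _)
      go' (suc z , z< , e' , q) = begin
          1 + b                                                                ≤⟨ +-mono-≤ (block-meets-u (x + a) (suc z) p q e' z<m (s≤s z≤n))
                                                                                  (blocks-meet-u b (x + a + suc (suc z)) w enough (≤-trans (m∸n≤m _ (suc (suc z))) (≤-trans (m∸n≤m L a) l))) ⟩
          cAt u (x + a) (suc (suc z)) + cAt u (x + a + suc (suc z)) w          ≡⟨ sym (Win-++ _ (x + a) (suc (suc z)) w) ⟩
          cAt u (x + a) (suc (suc z) + w)                                      ≡⟨ cong (cAt u (x + a)) w≡ ⟩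
          cAt u (x + a) (L ∸ a)                                                ≤⟨ m≤n+m _ (cAt u x a) ⟩
          cAt u x a + cAt u (x + a) (L ∸ a)                                    ≡⟨ sym (Win-++ _ x a (L ∸ a)) ⟩
          cAt u x (a + (L ∸ a))                                                ≡⟨ cong (cAt u x) L≡ ⟩
          cAt u x L                                                            ∎
        where
        open ≤-Reasoning
        w = L ∸ a ∸ suc (suc z)
        w≡ : suc (suc z) + w ≡ L ∸ a
        w≡ = m+[n∸m]≡n z<
        z<m : suc z < m G
        z<m = ≤-trans z< (≤-trans (m∸n≤m L a) l)
        c-block : c (x + a) (suc (suc z)) ≡ suc (suc g)
        c-block = trans (Win-last (b2n ∘ isInside) (x + a) (suc z)) (trans (cong₂ _+_ e' (cong b2n q)) (+-comm (suc g) 1))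
        enough : b * suc (suc g) ≤ c (x + a + suc (suc z)) w
        enough = +-cancelˡ-≤ (suc (suc g)) _ _ (≤-trans h (≤-reflexive (trans rest (trans (cong (c (x + a)) (sym w≡))
          (trans (Win-++ _ (x + a) (suc (suc z)) w) (cong (_+ c (x + a + suc (suc z)) w) c-block))))))

  -- Right after an inside edge at u, the other 2g(g + 2) inside edges of the period form 2g blocks.
  -- They give 2g further edges at u, one too many.
  impossible : 1 ≤ g → size ≡ suc (2 * g * suc (suc g)) → Σl (b2n ∘ insideAt u) Es ≡ 2 * g → ⊥
  impossible 1≤g N U = go (Win-nth (insideAt u ∘ edgeAtTime) 0 (m G) 0 (subst (0 <_) (sym (trans (over-all _ 0) U)) (≤-trans 1≤g (m≤m+n g (g + 0)))))
    where
    M≡ : suc (m G ∸ 1) ≡ m G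
    M≡ = m+[n∸m]≡n (≤-trans (s≤s z≤n) s≤m)
    go : (∃ λ a → a < m G × cAt u 0 a ≡ 0 × insideAt u (edgeAtTime a) ≡ true) → ⊥
    go (a , _ , _ , p) = 1+n≰n (≤-trans (s≤s (blocks-meet-u (2 * g) (suc a) (m G ∸ 1) enough (m∸n≤m (m G) 1))) (≤-reflexive (begin
        suc (cAt u (suc a) (m G ∸ 1))   ≡⟨ cong (λ b → b2n b + cAt u (suc a) (m G ∸ 1)) (sym p) ⟩
        cAt u a (suc (m G ∸ 1))         ≡⟨ cong (cAt u a) M≡ ⟩
        cAt u a (m G)                   ≡⟨ over-all _ a ⟩
        Σl (b2n ∘ insideAt u) Es        ≡⟨ U ⟩
        2 * g                           ∎)))
      where
      open ≡-Reasoning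
      enough : 2 * g * suc (suc g) ≤ c (suc a) (m G ∸ 1)
      enough = ≤-pred (≤-reflexive (sym (trans (cong (λ b → b2n b + c (suc a) (m G ∸ 1)) (sym (proj₁ (∧-true p)))) (trans (cong (c a) M≡) (trans (over-all _ a) N)))))

module _ {n} (G : Graph n) (S : Fin n → Bool) .{{_ : NonZero (m G)}} (ℓ : Ordering G) where
  open Gadget G S

  -- If m < 2(g + 1)s, then beside a window of s - 1 edges there are at most 2g + 1 full windows
  -- with at most g + 1 inside edges each, which leaves 2g(g + 2) + 1 - (2g + 1)(g + 1) = g for the
  -- short one.
  deficient-bound : ∀ s (s≤m : s ≤ m G) (good : Good G ℓ s) u → S u ≡ true → ∀ g → 1 ≤ g → length VS ≡ suc (2 * suc g) →
                    size ≡ suc (2 * g * suc (suc g)) → Σl (b2n ∘ insideAt u) Es ≡ 2 * g → 2 * suc g * s ≤ m G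
  deficient-bound zero s≤m good u Su g 1≤g vs N U = ≤-trans (≤-reflexive (*-zeroʳ (2 * suc g))) z≤n
  deficient-bound (suc s') s≤m good u Su g 1≤g vs N U = ≮⇒≥ (λ l → DeficientGadget.impossible G S u Su ℓ s' s≤m good g vs few (many l) 1≤g N U)
    where
    open Timed ℓ (suc s') s≤m good
    few : ∀ x → c x (suc s') ≤ suc g
    few x = halve _ (suc g) (subst (2 * c x (suc s') ≤_) vs (c-bound x))
    many : m G < 2 * suc g * suc s' → ∀ x → g ≤ c x s'
    many l x = +-cancelʳ-≤ (suc (g + (g + 0)) * suc g) g (c x s') (≤-trans (≤-reflexive (trans (lem g) (sym N)))
      (short-window (suc g) (suc (g + (g + 0))) few s' refl (subst (λ z → m G < z * suc s') (lem' g) l) x))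
      where
      lem : ∀ g → g + suc (g + (g + 0)) * suc g ≡ suc (2 * g * suc (suc g))
      lem = solve-∀
      lem' : ∀ g → 2 * suc g ≡ suc (suc (g + (g + 0)))
      lem' = solve-∀

-- Construction of the extremal graphs

at-injective : ∀ {A : Set} {xs : List A} → Unique xs → ∀ i j → Data.List.lookup xs i ≡ Data.List.lookup xs j → i ≡ j
at-injective (a ∷ᵁ u) Fin.zero    Fin.zero    e = refl
at-injective (a ∷ᵁ u) Fin.zero    (Fin.suc j) e = ⊥-elim (All.lookup a (∈-lookup j) e)
at-injective (a ∷ᵁ u) (Fin.suc i) Fin.zero    e = ⊥-elim (All.lookup a (∈-lookup i) (sym e))
at-injective (a ∷ᵁ u) (Fin.suc i) (Fin.suc j) e = cong Fin.suc (at-injective u i j e)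

Σl-map : ∀ {A B : Set} (f : B → ℕ) (g : A → B) xs → Σl f (map g xs) ≡ Σl (f ∘ g) xs
Σl-map f g []       = refl
Σl-map f g (x ∷ xs) = cong (f (g x) +_) (Σl-map f g xs)

Σl-lookup : ∀ {A : Set} (f : A → ℕ) xs → Σl (f ∘ Data.List.lookup xs) (allFin (length xs)) ≡ Σl f xs
Σl-lookup f xs = trans (sym (Σl-map f (Data.List.lookup xs) (allFin (length xs)))) (cong (Σl f) (trans (map-tabulate id (Data.List.lookup xs)) (tabulate-lookup xs)))

Σl-pairs : ∀ {A B : Set} (f : A × B → ℕ) xs ys → Σl f (Data.List.cartesianProduct xs ys) ≡ Σl (λ x → Σl (λ y → f (x , y)) ys) xs
Σl-pairs f []       ys = refl
Σl-pairs f (x ∷ xs) ys = trans (Σl-++ f (map (x ,_) ys) _) (cong₂ _+_ (Σl-map f (x ,_) ys) (Σl-pairs f xs ys))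

module FromAdjacency {n} (adj : Fin n → Fin n → Bool) (adj-sym : ∀ a b → adj a b ≡ adj b a) (irr : ∀ a → adj a a ≡ false) where

  isEdge : Fin n × Fin n → Bool
  isEdge (a , b) = ⌊ toℕ a <? toℕ b ⌋ ∧ adj a b

  edgePairs : List (Fin n × Fin n)
  edgePairs = filterᵇ isEdge (Data.List.cartesianProduct (allFin n) (allFin n))

  lookup-isEdge : ∀ e → isEdge (Data.List.lookup edgePairs e) ≡ true
  lookup-isEdge e = proj₂ (∈-fil⁻ isEdge (Data.List.cartesianProduct (allFin n) (allFin n)) (∈-lookup e))

  graph : Graph n
  graph = record
    { m       = length edgePairs
    ; edge    = Data.List.lookup edgePairs
    ; ordered = λ e → ⌊⌋-true (_ <? _) (proj₁ (∧-true (lookup-isEdge e)))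
    ; edgeInj = λ {x} {y} → at-injective (unique-fil isEdge (cartesianProduct⁺ (allFin⁺ n) (allFin⁺ n))) x y
    }

  joined : ∀ e → adj (proj₁ (edge graph e)) (proj₂ (edge graph e)) ≡ true
  joined e = proj₂ (∧-true {⌊ toℕ (proj₁ (edge graph e)) <? toℕ (proj₂ (edge graph e)) ⌋} (lookup-isEdge e))

  degree-adj : ∀ v → degree graph v ≡ cnt (adj v) (allFin n)
  degree-adj v = trans (Counting.degree-cnt graph v) (trans (Σl-lookup (b2n ∘ ends) edgePairs)
    (trans (Σl-fil (b2n ∘ ends) isEdge (Data.List.cartesianProduct (allFin n) (allFin n)))
    (trans (Σl-pairs _ (allFin n) (allFin n))
    (trans (Σl-cong (allFin n) (λ a _ → trans (Σl-cong (allFin n) (λ b _ → split a b (toℕ a <? toℕ b) (a ≟F v) (b ≟F v))) (Σl-+ (up a) (down a) (allFin n))))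
    (trans (Σl-+ (λ a → Σl (up a) (allFin n)) (λ a → Σl (down a) (allFin n)) (allFin n))
    (trans (cong₂ _+_
        (trans (Σl-pick _ (allFin⁺ n) (∈-allFin v) (λ a ne → trans (Σl-cong (allFin n) (λ b _ → cong b2n (off ne _))) (trans (Σl-const 0 (allFin n)) refl))) refl)
        (trans (Σl-swap down (allFin n) (allFin n)) (Σl-pick _ (allFin⁺ n) (∈-allFin v)
          (λ b ne → trans (Σl-cong (allFin n) (λ a _ → cong b2n (off ne _))) (trans (Σl-const 0 (allFin n)) refl)))))
    (trans (sym (Σl-+ _ _ (allFin n))) (Σl-cong (allFin n) (λ b _ → merge b (<-cmp (toℕ v) (toℕ b)))))))))))
    where
    ends : Fin n × Fin n → Bool
    ends (a , b) = ⌊ (a ≟F v) ⊎-dec (b ≟F v) ⌋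
    up down : Fin n → Fin n → ℕ
    up a b = b2n (⌊ a ≟F v ⌋ ∧ isEdge (a , b))
    down a b = b2n (⌊ b ≟F v ⌋ ∧ isEdge (a , b))
    off : ∀ {a} → a ≢ v → ∀ x → ⌊ a ≟F v ⌋ ∧ x ≡ false
    off {a} ne x = cong (_∧ x) (⌊⌋-no (a ≟F v) ne)
    split : ∀ a b (d : Dec (toℕ a < toℕ b)) (p : Dec (a ≡ v)) (q : Dec (b ≡ v)) →
            (if ⌊ d ⌋ ∧ adj a b then b2n ⌊ p ⊎-dec q ⌋ else 0) ≡ b2n (⌊ p ⌋ ∧ (⌊ d ⌋ ∧ adj a b)) + b2n (⌊ q ⌋ ∧ (⌊ d ⌋ ∧ adj a b))
    split a b (no _)  (yes _) (yes _) = refl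
    split a b (no _)  (yes _) (no _)  = refl
    split a b (no _)  (no _)  (yes _) = refl
    split a b (no _)  (no _)  (no _)  = refl
    split a b (yes l) (yes p) (yes q) = ⊥-elim (<-irrefl (cong toℕ (trans p (sym q))) l)
    split a b (yes l) (yes p) (no q)  = aux (adj a b)
      where
      aux : ∀ x → (if x then 1 else 0) ≡ b2n x + 0
      aux true = refl
      aux false = refl
    split a b (yes l) (no p)  (yes q) = aux (adj a b)
      where
      aux : ∀ x → (if x then 1 else 0) ≡ b2n x
      aux true = refl
      aux false = refl
    split a b (yes l) (no p)  (no q)  = aux (adj a b)
      where
      aux : ∀ x → (if x then 0 else 0) ≡ 0
      aux true = refl
      aux false = refl
    same : ⌊ v ≟F v ⌋ ≡ true
    same = ⌊⌋-intro (v ≟F v) refl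
    merge : ∀ b → Tri (toℕ v < toℕ b) (toℕ v ≡ toℕ b) (toℕ b < toℕ v) → up v b + down b v ≡ b2n (adj v b)
    merge b (tri< l _ g) rewrite same | ⌊⌋-intro (toℕ v <? toℕ b) l | ⌊⌋-no (toℕ b <? toℕ v) g = +-identityʳ _
    merge b (tri≈ l e g) rewrite same | ⌊⌋-no (toℕ v <? toℕ b) l | ⌊⌋-no (toℕ b <? toℕ v) g | toℕ-injective e = cong b2n (sym (irr b))
    merge b (tri> l _ g) rewrite same | ⌊⌋-no (toℕ v <? toℕ b) l | ⌊⌋-intro (toℕ b <? toℕ v) g = cong b2n (adj-sym b v)

Win≡1 : ∀ (p : ℕ → Bool) L {c} → c < L → p c ≡ true → (∀ b → b < L → p b ≡ true → b ≡ c) → Win (b2n ∘ p) 0 L ≡ 1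
Win≡1 p L {c} l e h = trans (sym (Win-allFin (b2n ∘ p) L)) (cnt≡1 (p ∘ toℕ) (allFin⁺ L) (∈-allFin (fromℕ< l))
  (trans (cong p (toℕ-fromℕ< l)) e) (λ y _ r → toℕ-injective (trans (h (toℕ y) (toℕ<n y) r) (sym (toℕ-fromℕ< l)))))

Win-full : ∀ (p : ℕ → Bool) x L → (∀ i → i < L → p (x + i) ≡ true) → Win (b2n ∘ p) x L ≡ L
Win-full p x L h = trans (Win-cong {g = λ _ → 1} x L (λ i l → cong b2n (h i l))) (trans (Win-const 1 x L) (*-identityˡ L))

bool-iff : ∀ {a b} → (a ≡ true → b ≡ true) → (b ≡ true → a ≡ true) → a ≡ b
bool-iff {true} {true} f g = refl
bool-iff {false} {false} f g = refl
bool-iff {true} {false} f g = sym (f refl)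
bool-iff {false} {true} f g = g refl

-- For d = |a - b| on a cycle of p vertices this says that the cyclic distance is between 1 and h,
-- which defines a circulant graph; for p = 2h + 1 it is complete.
near : ℕ → ℕ → ℕ → Bool
near p h d = ⌊ 1 ≤? d ⌋ ∧ (⌊ d ≤? h ⌋ ∨ ⌊ p ≤? d + h ⌋)

near⁻ : ∀ {p h d} → near p h d ≡ true → 1 ≤ d × (d ≤ h ⊎ p ≤ d + h)
near⁻ {p} {h} {d} e = ⌊⌋-true (1 ≤? d) (proj₁ (∧-true e)) , Data.Sum.map (⌊⌋-true (d ≤? h)) (⌊⌋-true (p ≤? d + h)) (∨-true (proj₂ (∧-true {⌊ 1 ≤? d ⌋} e)))

near⁺ : ∀ {p h d} → 1 ≤ d → d ≤ h ⊎ p ≤ d + h → near p h d ≡ true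
near⁺ {p} {h} {d} l (inj₁ r) = ∧-intro (⌊⌋-intro (1 ≤? d) l) (cong (_∨ ⌊ p ≤? d + h ⌋) (⌊⌋-intro (d ≤? h) r))
near⁺ {p} {h} {d} l (inj₂ r) = ∧-intro (⌊⌋-intro (1 ≤? d) l) (trans (cong (⌊ d ≤? h ⌋ ∨_) (⌊⌋-intro (p ≤? d + h) r)) (Data.Bool.Properties.∨-zeroʳ _))

near-flip : ∀ p h d → 1 ≤ d → d < p → near p h (p ∸ d) ≡ near p h d
near-flip p h d 1≤d d<p = bool-iff (λ e → near⁺ 1≤d (there⁻ (proj₂ (near⁻ {p} {h} e)))) (λ e → near⁺ (m<n⇒0<n∸m d<p) (back (proj₂ (near⁻ {p} {h} e))))
  where
  there⁻ : p ∸ d ≤ h ⊎ p ≤ p ∸ d + h → d ≤ h ⊎ p ≤ d + h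
  there⁻ (inj₁ l) = inj₂ (≤-trans (≤-reflexive (sym (m+[n∸m]≡n (<⇒≤ d<p)))) (+-monoʳ-≤ d l))
  there⁻ (inj₂ l) = inj₁ (+-cancelˡ-≤ (p ∸ d) d h (≤-trans (≤-reflexive (m∸n+n≡m (<⇒≤ d<p))) l))
  back : d ≤ h ⊎ p ≤ d + h → p ∸ d ≤ h ⊎ p ≤ p ∸ d + h
  back (inj₁ l) = inj₂ (≤-trans (≤-reflexive (sym (m∸n+n≡m (<⇒≤ d<p)))) (+-monoʳ-≤ (p ∸ d) l))
  back (inj₂ l) = inj₁ (+-cancelˡ-≤ d (p ∸ d) h (≤-trans (≤-reflexive (m+[n∸m]≡n (<⇒≤ d<p))) l))

near-count : ∀ p h → 2 * h < p → Win (b2n ∘ near p h) 0 p ≡ 2 * h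
near-count p h l = begin
    Win f 0 p                                                        ≡⟨ cong (Win f 0) (sym p≡) ⟩
    Win f 1 (h + (r + h))                                            ≡⟨ Win-++ f 1 h (r + h) ⟩
    Win f 1 h + Win f (1 + h) (r + h)                                ≡⟨ cong (Win f 1 h +_) (Win-++ f (1 + h) r h) ⟩
    Win f 1 h + (Win f (1 + h) r + Win f (1 + h + r) h)              ≡⟨ cong₂ _+_ low (cong₂ _+_ mid high) ⟩
    h + (0 + h)                                                      ≡⟨ cong (h +_) (sym (+-identityʳ h)) ⟩
    2 * h                                                            ∎
  where
  open ≡-Reasoning
  f = b2n ∘ near p h
  r = p ∸ suc (2 * h)
  lem : ∀ h r → suc (h + (r + h)) ≡ suc (2 * h) + r
  lem = solve-∀
  p≡ : suc (h + (r + h)) ≡ p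
  p≡ = trans (lem h r) (m+[n∸m]≡n l)
  low : Win f 1 h ≡ h
  low = Win-full (near p h) 1 h (λ i i<h → near⁺ (s≤s z≤n) (inj₁ i<h))
  mid : Win f (1 + h) r ≡ 0
  mid = Win-zero (near p h) (1 + h) r (λ i i<r → ≢true (λ e → no-way i i<r (proj₂ (near⁻ {p} {h} e))))
    where
    no-way : ∀ i → i < r → suc h + i ≤ h ⊎ p ≤ suc h + i + h → ⊥
    no-way i i<r (inj₁ q) = 1+n≰n (≤-trans (m≤m+n (suc h) i) q)
    no-way i i<r (inj₂ q) = <⇒≱ (subst (suc h + i + h <_) (trans (lem' h r) p≡) (+-monoˡ-< h (+-monoʳ-< (suc h) i<r))) q
      where
      lem' : ∀ h r → suc h + r + h ≡ suc (h + (r + h))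
      lem' = solve-∀
  high : Win f (1 + h + r) h ≡ h
  high = Win-full (near p h) (1 + h + r) h (λ i i<h → near⁺ (s≤s z≤n) (inj₂ (≤-trans (≤-reflexive (trans (sym p≡) (lem' h r))) (+-monoˡ-≤ h (m≤m+n (suc h + r) i)))))
    where
    lem' : ∀ h r → suc (h + (r + h)) ≡ suc h + r + h
    lem' = solve-∀

circ : ℕ → ℕ → ℕ → ℕ → Bool
circ p h a b = near p h ∣ a - b ∣

-- A rotation takes a to 0: reading the neighbours of a from a onwards modulo p gives those of 0,
-- where `near-flip` accounts for the vertices below a.
circ-degree : ∀ p h a → a < p → 2 * h < p → Win (b2n ∘ circ p h a) 0 p ≡ 2 * h
circ-degree p@(suc _) h a a<p l = trans (Win-cong 0 p (λ b b<p → cong b2n (turn b b<p (<-cmp b a))))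
  (trans (Win-shift G (p ∸ a) 0 p) (trans (Win-period G p (λ t → cong (b2n ∘ near p h) ([m+n]%n≡m%n t p)) (p ∸ a + 0))
  (trans (Win-cong 0 p (λ t t<p → cong (b2n ∘ near p h) (m<n⇒m%n≡m t<p))) (near-count p h l))))
  where
  G : ℕ → ℕ
  G t = b2n (near p h (t % p))
  turn : ∀ b → b < p → Tri (b < a) (b ≡ a) (a < b) → circ p h a b ≡ near p h ((p ∸ a + b) % p)
  forward : ∀ b → b < p → a ≤ b → circ p h a b ≡ near p h ((p ∸ a + b) % p)
  forward b b<p l = cong (near p h) (trans (m≤n⇒∣m-n∣≡n∸m l) (sym (trans (cong (_% p)
    (trans (sym (+-∸-comm b (<⇒≤ a<p))) (trans (cong (_∸ a) (+-comm p b)) (+-∸-comm p l)))) (trans ([m+n]%n≡m%n (b ∸ a) p) (m<n⇒m%n≡m (≤-trans (s≤s (m∸n≤m b a)) b<p))))))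
  turn b b<p (tri≈ _ e _) = forward b b<p (≤-reflexive (sym e))
  turn b b<p (tri> _ _ l) = forward b b<p (<⇒≤ l)
  turn b b<p (tri< l _ _) = trans (cong (near p h) (m≤n⇒∣n-m∣≡n∸m (<⇒≤ l))) (trans (sym (near-flip p h (a ∸ b) (m<n⇒0<n∸m l) (≤-trans (s≤s (m∸n≤m a b)) a<p)))
    (cong (near p h) (trans e (sym (m<n⇒m%n≡m (subst (_< p) e (∸-monoʳ-< (m<n⇒0<n∸m l) (≤-trans (m∸n≤m a b) (<⇒≤ a<p)))))))))
    where
    e : p ∸ (a ∸ b) ≡ p ∸ a + b
    e = +-cancelʳ-≡ (a ∸ b) _ _ (trans (m∸n+n≡m (≤-trans (m∸n≤m a b) (<⇒≤ a<p))) (sym (trans (+-assoc (p ∸ a) b (a ∸ b))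
      (trans (cong (p ∸ a +_) (m+[n∸m]≡n (<⇒≤ l))) (m∸n+n≡m (<⇒≤ a<p))))))

b2n-∨ : ∀ {a b} → (a ≡ true → b ≡ true → ⊥) → b2n (a ∨ b) ≡ b2n a + b2n b
b2n-∨ {true} {true} h = ⊥-elim (h refl refl)
b2n-∨ {true} {false} h = refl
b2n-∨ {false} h = refl

-- On the vertices 0, ..., 2q this is a matching that misses only 2q. It joins vertices at distance
-- q, so for h < q it is disjoint from the circulant and raises every other degree by one.
halfway : ℕ → ℕ → ℕ → Bool
halfway q a b = (⌊ b ≟ a + q ⌋ ∧ ⌊ a <? q ⌋) ∨ (⌊ a ≟ b + q ⌋ ∧ ⌊ b <? q ⌋)

halfway⁻ : ∀ {q a b} → halfway q a b ≡ true → (b ≡ a + q × a < q) ⊎ (a ≡ b + q × b < q)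
halfway⁻ {q} {a} {b} e = Data.Sum.map (λ r → ⌊⌋-true (b ≟ a + q) (proj₁ (∧-true r)) , ⌊⌋-true (a <? q) (proj₂ (∧-true {⌊ b ≟ a + q ⌋} r)))
  (λ r → ⌊⌋-true (a ≟ b + q) (proj₁ (∧-true r)) , ⌊⌋-true (b <? q) (proj₂ (∧-true {⌊ a ≟ b + q ⌋} r))) (∨-true {⌊ b ≟ a + q ⌋ ∧ ⌊ a <? q ⌋} e)

halfway⁺ : ∀ {q a b} → (b ≡ a + q × a < q) ⊎ (a ≡ b + q × b < q) → halfway q a b ≡ true
halfway⁺ {q} {a} {b} (inj₁ (e , l)) = cong (_∨ (⌊ a ≟ b + q ⌋ ∧ ⌊ b <? q ⌋)) (∧-intro (⌊⌋-intro (b ≟ a + q) e) (⌊⌋-intro (a <? q) l))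
halfway⁺ {q} {a} {b} (inj₂ (e , l)) = trans (cong (⌊ b ≟ a + q ⌋ ∧ ⌊ a <? q ⌋ ∨_) (∧-intro (⌊⌋-intro (a ≟ b + q) e) (⌊⌋-intro (b <? q) l))) (Data.Bool.Properties.∨-zeroʳ _)

halfway-degree : ∀ q a → a < suc (q + q) → Win (b2n ∘ halfway q a) 0 (suc (q + q)) + b2n ⌊ suc a ≟ suc (q + q) ⌋ ≡ 1
halfway-degree q a a<p = by (a <? q) (a ≟ q + q)
  where
  p = suc (q + q)
  by : Dec (a < q) → Dec (a ≡ q + q) → Win (b2n ∘ halfway q a) 0 p + b2n ⌊ suc a ≟ p ⌋ ≡ 1
  by (yes l) _ = cong₂ _+_ (Win≡1 (halfway q a) p {a + q} (s≤s (+-monoˡ-≤ q (<⇒≤ l))) (halfway⁺ (inj₁ (refl , l))) unique) (cong b2n (⌊⌋-no (suc a ≟ p) (λ e → <⇒≱ l (≤-trans (m≤m+n q q) (≤-reflexive (sym (suc-injective e)))))))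
    where
    unique : ∀ b → b < p → halfway q a b ≡ true → b ≡ a + q
    unique b _ r with halfway⁻ {q} {a} {b} r
    ... | inj₁ (e , _) = e
    ... | inj₂ (e , _) = ⊥-elim (<⇒≱ l (≤-trans (m≤n+m q b) (≤-reflexive (sym e))))
  by (no g) (yes e) = cong₂ _+_ (Win-zero (halfway q a) 0 p (λ b _ → ≢true (λ r → none b (halfway⁻ {q} {a} {b} r)))) (cong b2n (⌊⌋-intro (suc a ≟ p) (cong suc e)))
    where
    none : ∀ b → (b ≡ a + q × a < q) ⊎ (a ≡ b + q × b < q) → ⊥
    none b (inj₁ (_ , l)) = g l
    none b (inj₂ (r , l)) = <-irrefl (+-cancelʳ-≡ q b q (trans (sym r) e)) l
  by (no g) (no ne) = cong₂ _+_ (Win≡1 (halfway q a) p {a ∸ q} (≤-trans (s≤s (m∸n≤m a q)) a<p) (halfway⁺ (inj₂ (sym (m∸n+n≡m (≮⇒≥ g)) , small))) unique)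
      (cong b2n (⌊⌋-no (suc a ≟ p) (λ e → ne (suc-injective e))))
    where
    small : a ∸ q < q
    small = +-cancelʳ-< q _ _ (subst (_< q + q) (sym (m∸n+n≡m (≮⇒≥ g))) (≤∧≢⇒< (≤-pred a<p) ne))
    unique : ∀ b → b < p → halfway q a b ≡ true → b ≡ a ∸ q
    unique b _ r with halfway⁻ {q} {a} {b} r
    ... | inj₁ (_ , l) = ⊥-elim (g l)
    ... | inj₂ (e , _) = sym (trans (cong (_∸ q) e) (m+n∸n≡m b q))

part : Bool → ℕ → ℕ → ℕ → ℕ → ℕ → Bool
part o p h q a b = circ p h a b ∨ (o ∧ halfway q a b)

part-sym : ∀ o p h q a b → part o p h q a b ≡ part o p h q b a
part-sym o p h q a b = cong₂ (λ x y → x ∨ (o ∧ y)) (cong (near p h) (∣-∣-comm a b)) (Data.Bool.Properties.∨-comm (⌊ b ≟ a + q ⌋ ∧ ⌊ a <? q ⌋) _)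

part-irr : ∀ o p h q → 1 ≤ q → ∀ a → part o p h q a a ≡ false
part-irr o p h q 1≤q a = ≢true (λ e → by (∨-true {circ p h a a} e))
  where
  off : a ≡ a + q → ⊥
  off e = <-irrefl e (≤-trans (≤-reflexive (+-comm 1 a)) (+-monoʳ-≤ a 1≤q))
  by : circ p h a a ≡ true ⊎ o ∧ halfway q a a ≡ true → ⊥
  by (inj₁ e) = case subst (1 ≤_) (∣n-n∣≡0 a) (proj₁ (near⁻ {p} {h} e)) of λ ()
  by (inj₂ e) with halfway⁻ {q} {a} {a} (proj₂ (∧-true {o} e))
  ... | inj₁ (r , _) = off r
  ... | inj₂ (r , _) = off r

-- For odd degree the last vertex lacks one edge; the second summand records this, and the bridge in
-- `Glue` makes up for it.
part-degree : ∀ o p h q → 2 * h < p → (o ≡ true → p ≡ suc (q + q) × h < q) → ∀ a → a < p →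
              Win (b2n ∘ part o p h q a) 0 p + b2n (o ∧ ⌊ suc a ≟ p ⌋) ≡ 2 * h + b2n o
part-degree false p h q l _ a a<p = cong (_+ 0) (trans (Win-cong 0 p (λ b _ → cong b2n (Data.Bool.Properties.∨-identityʳ (circ p h a b)))) (circ-degree p h a a<p l))
part-degree true p h q l odd a a<p = by (odd refl)
  where
  by : p ≡ suc (q + q) × h < q → Win (b2n ∘ part true p h q a) 0 p + b2n ⌊ suc a ≟ p ⌋ ≡ 2 * h + 1
  by (e , h<q) = trans (cong (_+ b2n ⌊ suc a ≟ p ⌋) (trans (Win-cong 0 p (λ b _ → b2n-∨ {circ p h a b} {halfway q a b} (λ x y → disjoint b (near⁻ {p} {h} x) (halfway⁻ {q} {a} {b} y))))
      (trans (Win-+ (b2n ∘ circ p h a) (b2n ∘ halfway q a) 0 p) (cong (_+ Win (b2n ∘ halfway q a) 0 p) (circ-degree p h a a<p l)))))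
      (trans (+-assoc (2 * h) _ _) (cong (2 * h +_) (subst (λ p → Win (b2n ∘ halfway q a) 0 p + b2n ⌊ suc a ≟ p ⌋ ≡ 1) (sym e) (halfway-degree q a (subst (a <_) e a<p)))))
    where
    far : ∀ {d} → d ≡ q → d ≤ h ⊎ p ≤ d + h → ⊥
    far refl (inj₁ r) = <⇒≱ h<q r
    far refl (inj₂ r) = <⇒≱ (≤-trans (+-monoʳ-< q h<q) (m≤n⇒m≤1+n ≤-refl)) (subst (_≤ q + h) e r)
    disjoint : ∀ b → 1 ≤ ∣ a - b ∣ × (∣ a - b ∣ ≤ h ⊎ p ≤ ∣ a - b ∣ + h) → (b ≡ a + q × a < q) ⊎ (a ≡ b + q × b < q) → ⊥
    disjoint b (_ , r) (inj₁ (refl , _)) = far (∣m-m+n∣≡n a q) r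
    disjoint b (_ , r) (inj₂ (refl , _)) = far (trans (∣-∣-comm (b + q) b) (∣m-m+n∣≡n b q)) r

-- Two parts on p₁ and p₂ vertices; for odd degree (o = true) their deficient last vertices are joined by a bridge.
module Glue (o : Bool) (h p₁ p₂ q₁ q₂ : ℕ) (1≤q₁ : 1 ≤ q₁) (1≤q₂ : 1 ≤ q₂) (l₁ : 2 * h < p₁) (l₂ : 2 * h < p₂)
    (odd₁ : o ≡ true → p₁ ≡ suc (q₁ + q₁) × h < q₁) (odd₂ : o ≡ true → p₂ ≡ suc (q₂ + q₂) × h < q₂) where

  first : ℕ → Bool
  first a = ⌊ a <? p₁ ⌋

  bridge : ℕ → ℕ → Bool
  bridge a b = (o ∧ ⌊ suc a ≟ p₁ ⌋) ∧ ⌊ suc b ≟ p₁ + p₂ ⌋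

  joins : Bool → Bool → ℕ → ℕ → Bool
  joins true  true  a b = part o p₁ h q₁ a b
  joins true  false a b = bridge a b
  joins false true  a b = bridge b a
  joins false false a b = part o p₂ h q₂ (a ∸ p₁) (b ∸ p₁)

  adjℕ : ℕ → ℕ → Bool
  adjℕ a b = joins (first a) (first b) a b

  joins-sym : ∀ x y a b → joins x y a b ≡ joins y x b a
  joins-sym true  true  a b = part-sym o p₁ h q₁ a b
  joins-sym true  false a b = refl
  joins-sym false true  a b = refl
  joins-sym false false a b = part-sym o p₂ h q₂ (a ∸ p₁) (b ∸ p₁)

  joins-irr : ∀ x a → joins x x a a ≡ false
  joins-irr true  a = part-irr o p₁ h q₁ 1≤q₁ a
  joins-irr false a = part-irr o p₂ h q₂ 1≤q₂ (a ∸ p₁)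

  open FromAdjacency {p₁ + p₂} (λ a b → adjℕ (toℕ a) (toℕ b)) (λ a b → joins-sym (first (toℕ a)) (first (toℕ b)) (toℕ a) (toℕ b)) (λ a → joins-irr (first (toℕ a)) (toℕ a)) public

  private
    low : ∀ {t} → t < p₁ → first t ≡ true
    low {t} l = ⌊⌋-intro (t <? p₁) l
    high : ∀ t → first (p₁ + t) ≡ false
    high t = ⌊⌋-no (p₁ + t <? p₁) (m+n≮m p₁ t)

  degree-first : ∀ a → a < p₁ → Win (b2n ∘ adjℕ a) 0 (p₁ + p₂) ≡ 2 * h + b2n o
  degree-first a l = trans (Win-++ _ 0 p₁ p₂) (trans (cong₂ _+_ 
      (Win-cong {g = b2n ∘ part o p₁ h q₁ a} 0 p₁ (λ i i<p → cong₂ (λ x y → b2n (joins x y a i)) (low l) (low i<p)))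
      (trans (Win-cong {g = b2n ∘ bridge a} p₁ p₂ (λ i _ → cong₂ (λ x y → b2n (joins x y a (p₁ + i))) (low l) (high i))) bridges))
      (part-degree o p₁ h q₁ l₁ odd₁ a l))
    where
    bridges : Win (b2n ∘ bridge a) p₁ p₂ ≡ b2n (o ∧ ⌊ suc a ≟ p₁ ⌋)
    bridges = by (o ∧ ⌊ suc a ≟ p₁ ⌋)
      where
      M≡ : suc (p₂ ∸ 1) ≡ p₂
      M≡ = m+[n∸m]≡n (≤-trans (s≤s z≤n) l₂)
      by : ∀ x → Win (λ b → b2n (x ∧ ⌊ suc b ≟ p₁ + p₂ ⌋)) p₁ p₂ ≡ b2n x
      by false = Win-zero (λ _ → false) p₁ p₂ (λ _ _ → refl)
      by true = trans (cong (λ z → Win (λ b → b2n ⌊ suc b ≟ p₁ + p₂ ⌋) z p₂) (sym (+-identityʳ p₁))) (trans (sym (Win-shift (λ b → b2n ⌊ suc b ≟ p₁ + p₂ ⌋) p₁ 0 p₂))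
        (Win≡1 (λ b → ⌊ suc (p₁ + b) ≟ p₁ + p₂ ⌋) p₂ {p₂ ∸ 1} (≤-reflexive M≡) (⌊⌋-intro (suc (p₁ + (p₂ ∸ 1)) ≟ p₁ + p₂) (trans (sym (+-suc p₁ _)) (cong (p₁ +_) M≡)))
          (λ b _ r → suc-injective (trans (+-cancelˡ-≡ p₁ _ _ (trans (+-suc p₁ b) (⌊⌋-true (suc (p₁ + b) ≟ p₁ + p₂) r))) (sym M≡)))))

  degree-second : ∀ a → a < p₂ → Win (b2n ∘ adjℕ (p₁ + a)) 0 (p₁ + p₂) ≡ 2 * h + b2n o
  degree-second a l = trans (Win-++ _ 0 p₁ p₂) (trans (+-comm (Win (b2n ∘ adjℕ (p₁ + a)) 0 p₁) _) (trans (cong₂ _+_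
      (trans (cong (λ z → Win (b2n ∘ adjℕ (p₁ + a)) z p₂) (sym (+-identityʳ p₁))) (trans (sym (Win-shift (b2n ∘ adjℕ (p₁ + a)) p₁ 0 p₂))
        (Win-cong {g = b2n ∘ part o p₂ h q₂ a} 0 p₂ (λ i _ → trans (cong₂ (λ x y → b2n (joins x y (p₁ + a) (p₁ + i))) (high a) (high i))
          (cong₂ (λ x y → b2n (part o p₂ h q₂ x y)) (m+n∸m≡n p₁ a) (m+n∸m≡n p₁ i))))))
      (trans (Win-cong {g = λ b → b2n (bridge b (p₁ + a))} 0 p₁ (λ i i<p → cong₂ (λ x y → b2n (joins x y (p₁ + a) i)) (high a) (low i<p))) bridges))
      (part-degree o p₂ h q₂ l₂ odd₂ a l)))
    where
    M≡ : suc (p₁ ∸ 1) ≡ p₁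
    M≡ = m+[n∸m]≡n (≤-trans (s≤s z≤n) l₁)
    ends : ⌊ suc (p₁ + a) ≟ p₁ + p₂ ⌋ ≡ ⌊ suc a ≟ p₂ ⌋
    ends = bool-iff (λ r → ⌊⌋-intro (suc a ≟ p₂) (+-cancelˡ-≡ p₁ _ _ (trans (+-suc p₁ a) (⌊⌋-true (suc (p₁ + a) ≟ p₁ + p₂) r))))
                    (λ r → ⌊⌋-intro (suc (p₁ + a) ≟ p₁ + p₂) (trans (sym (+-suc p₁ a)) (cong (p₁ +_) (⌊⌋-true (suc a ≟ p₂) r))))
    bridges : Win (λ b → b2n (bridge b (p₁ + a))) 0 p₁ ≡ b2n (o ∧ ⌊ suc a ≟ p₂ ⌋)
    bridges = trans (by o ⌊ suc (p₁ + a) ≟ p₁ + p₂ ⌋) (cong (λ x → b2n (o ∧ x)) ends)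
      where
      by : ∀ o x → Win (λ b → b2n ((o ∧ ⌊ suc b ≟ p₁ ⌋) ∧ x)) 0 p₁ ≡ b2n (o ∧ x)
      by false x = Win-zero (λ _ → false) 0 p₁ (λ _ _ → refl)
      by true false = Win-zero (λ b → ⌊ suc b ≟ p₁ ⌋ ∧ false) 0 p₁ (λ b _ → Data.Bool.Properties.∧-zeroʳ _)
      by true true = Win≡1 (λ b → ⌊ suc b ≟ p₁ ⌋ ∧ true) p₁ {p₁ ∸ 1} (≤-reflexive M≡) (∧-intro (⌊⌋-intro (suc (p₁ ∸ 1) ≟ p₁) M≡) refl)
        (λ b _ r → suc-injective (trans (⌊⌋-true (suc b ≟ p₁) (proj₁ (∧-true r))) (sym M≡)))

  regular : Regular (2 * h + b2n o) graph
  regular v = trans (degree-adj v) (trans (Win-allFin (b2n ∘ adjℕ (toℕ v)) (p₁ + p₂)) (by (toℕ v <? p₁)))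
    where
    by : Dec (toℕ v < p₁) → Win (b2n ∘ adjℕ (toℕ v)) 0 (p₁ + p₂) ≡ 2 * h + b2n o
    by (yes l) = degree-first (toℕ v) l
    by (no g) = subst (λ a → Win (b2n ∘ adjℕ a) 0 (p₁ + p₂) ≡ 2 * h + b2n o) (m+[n∸m]≡n (≮⇒≥ g))
      (degree-second (toℕ v ∸ p₁) (+-cancelˡ-< p₁ _ _ (subst (_< p₁ + p₂) (sym (m+[n∸m]≡n (≮⇒≥ g))) (toℕ<n v))))

  S : Fin (p₁ + p₂) → Bool
  S v = first (toℕ v)

  size-S : length (Gadget.VS graph S) ≡ p₁
  size-S = trans (length-fil S (allFin (p₁ + p₂))) (trans (Win-allFin (b2n ∘ first) (p₁ + p₂)) (trans (Win-++ (b2n ∘ first) 0 p₁ p₂)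
    (trans (cong₂ _+_ (Win-full first 0 p₁ (λ i l → low l)) (Win-zero first p₁ p₂ (λ i _ → high i))) (+-identityʳ p₁))))

  crossing-bridge : ∀ e → Gadget.crossing graph S e ≡ true →
    bridge (toℕ (proj₁ (edge graph e))) (toℕ (proj₂ (edge graph e))) ≡ true
  crossing-bridge e r = by (first a) (first b) refl refl (∨-true {first a ∧ not (first b)} r)
    where
    a = toℕ (proj₁ (edge graph e))
    b = toℕ (proj₂ (edge graph e))
    by : ∀ x y → first a ≡ x → first b ≡ y → x ∧ not y ≡ true ⊎ not x ∧ y ≡ true → bridge a b ≡ true
    by true true _ _ (inj₁ ())
    by true true _ _ (inj₂ ())
    by true false p q _ = trans (sym (cong₂ (λ x y → joins x y a b) p q)) (joined e)
    by false true p q _ = ⊥-elim (⌊⌋-false (a <? p₁) p (≤-trans (ordered graph e) (<⇒≤ (⌊⌋-true (b <? p₁) q))))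
    by false false _ _ (inj₁ ())
    by false false _ _ (inj₂ ())

Extremal : ℕ → ℕ → Set
Extremal k n = Σ (Graph n) λ G → Regular k G × (∀ ℓ s → s ≤ m G → Good G ℓ s → 2 * (k + 1) * s ≤ k * n)

regular-nonZero : ∀ {n k} (G : Graph n) → Regular k G → 1 ≤ k * n → NonZero (m G)
regular-nonZero G reg h = >-nonZero (*-cancelˡ-< 2 0 (m G) (subst (0 <_) (Counting.handshake G reg) h))

module _ (h p₂ : ℕ) (1≤h : 1 ≤ h) (l₂ : 2 * h < p₂) where
  private
    module D = Glue false h (suc (2 * h)) p₂ 1 1 ≤-refl ≤-refl ≤-refl l₂ (λ ()) (λ ())
    k = 2 * h + 0
    n = suc (2 * h) + p₂
    instance
      nz : NonZero (m D.graph)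
      nz = regular-nonZero D.graph D.regular (*-mono-≤ (≤-trans 1≤h (≤-trans (m≤m+n h (h + 0)) (m≤m+n _ 0))) (s≤s z≤n))

  -- The first part is complete on k + 1 = 2h + 1 vertices, and no edge leaves it, so
  -- `complete-bound` applies; 2m = kn turns its conclusion into the required form.
  extremal-even : Extremal k n
  extremal-even = D.graph , D.regular , bound
    where
    open Gadget D.graph D.S
    no-crossing : cnt crossing Es ≡ 0
    no-crossing = cnt-zero crossing Es (λ e _ → ≢true (λ r → true≢false (D.crossing-bridge e r) refl))
    N : size ≡ h * suc (2 * h)
    N = *-cancelˡ-≡ size (h * suc (2 * h)) 2 (trans (sym (trans (degree-sum D.regular) (trans (cong (2 * size +_) no-crossing) (+-identityʳ _))))
      (trans (cong (k *_) D.size-S) (lem h)))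
      where
      lem : ∀ h → (2 * h + 0) * suc (2 * h) ≡ 2 * (h * suc (2 * h))
      lem = solve-∀
    bound : ∀ ℓ s → s ≤ m D.graph → Good D.graph ℓ s → 2 * (k + 1) * s ≤ k * n
    bound ℓ s s≤m good = ≤-trans (≤-reflexive (lem h s)) (≤-trans (*-monoʳ-≤ 2 (Timed.complete-bound ℓ s s≤m good h 1≤h D.size-S N))
      (≤-reflexive (sym (handshake D.regular))))
      where
      lem : ∀ h s → 2 * (2 * h + 0 + 1) * s ≡ 2 * (suc (2 * h) * s)
      lem = solve-∀

module _ (h q₂ : ℕ) (1≤h : 1 ≤ h) (h<q₂ : h < q₂) where
  private
    q₁ p₁ p₂ k n : ℕ
    q₁ = suc h
    p₁ = suc (q₁ + q₁)
    p₂ = suc (q₂ + q₂)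
    k = 2 * h + 1
    n = p₁ + p₂
    fits : ∀ q → h < q → 2 * h < suc (q + q)
    fits q l = s≤s (≤-trans (≤-reflexive (cong (h +_) (+-identityʳ h))) (+-mono-≤ (<⇒≤ l) (<⇒≤ l)))
    module D = Glue true h p₁ p₂ q₁ q₂ (s≤s z≤n) (≤-trans (s≤s z≤n) h<q₂) (fits q₁ ≤-refl) (fits q₂ h<q₂) (λ _ → refl , ≤-refl) (λ _ → refl , h<q₂)
    instance
      nz : NonZero (m D.graph)
      nz = regular-nonZero D.graph D.regular (*-mono-≤ (m≤n+m 1 (2 * h)) (s≤s z≤n))

  -- Only the bridge can leave the first part, and by parity of the degree sum some edge does. This
  -- fixes the number of inside edges and the inside degree 2h of the end u of the bridge.
  extremal-odd : Extremal k n
  extremal-odd = D.graph , D.regular , bound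
    where
    open Gadget D.graph D.S
    u : Fin n
    u = fromℕ< {q₁ + q₁} (m≤m+n p₁ p₂)
    toℕ-u : toℕ u ≡ q₁ + q₁
    toℕ-u = toℕ-fromℕ< {q₁ + q₁} (m≤m+n p₁ p₂)
    Su : D.S u ≡ true
    Su = ⌊⌋-intro (toℕ u <? p₁) (s≤s (≤-reflexive toℕ-u))
    bridge-ends : ∀ e → crossing e ≡ true → lo e ≡ u × suc (toℕ (hi e)) ≡ n
    bridge-ends e r = toℕ-injective (suc-injective (trans (⌊⌋-true (suc (toℕ (lo e)) ≟ p₁) (proj₁ b)) (cong suc (sym toℕ-u)))) ,
        ⌊⌋-true (suc (toℕ (hi e)) ≟ n) (proj₂ b)
      where
      b : ⌊ suc (toℕ (lo e)) ≟ p₁ ⌋ ≡ true × ⌊ suc (toℕ (hi e)) ≟ n ⌋ ≡ true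
      b = ∧-true {⌊ suc (toℕ (lo e)) ≟ p₁ ⌋} (D.crossing-bridge e r)
    at-most-one : cnt crossing Es ≤ 1
    at-most-one = cnt≤1 crossing (allFin⁺ _) (λ e f _ _ r r' → edgeInj D.graph (cong₂ _,_ (trans (proj₁ (bridge-ends e r)) (sym (proj₁ (bridge-ends f r'))))
      (toℕ-injective (suc-injective (trans (proj₂ (bridge-ends e r)) (sym (proj₂ (bridge-ends f r'))))))))
    total : 2 * size + cnt crossing Es ≡ suc (2 * suc (2 * h * suc (suc h)))
    total = trans (sym (degree-sum D.regular)) (trans (cong (k *_) D.size-S) (lem h))
      where
      lem : ∀ h → (2 * h + 1) * suc (suc h + suc h) ≡ suc (2 * suc (2 * h * suc (suc h)))
      lem = solve-∀
    one : cnt crossing Es ≡ 1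
    one = by (cnt crossing Es) at-most-one total
      where
      by : ∀ x → x ≤ 1 → 2 * size + x ≡ suc (2 * suc (2 * h * suc (suc h))) → x ≡ 1
      by zero _ e = ⊥-elim (even≢odd size (suc (2 * h * suc (suc h))) (trans (sym (+-identityʳ _)) e))
      by (suc zero) _ _ = refl
      by (suc (suc x)) (s≤s ()) _
    N : size ≡ suc (2 * h * suc (suc h))
    N = *-cancelˡ-≡ size (suc (2 * h * suc (suc h))) 2 (suc-injective (trans (+-comm 1 (2 * size)) (trans (cong (2 * size +_) (sym one)) total)))
    U : Σl (b2n ∘ insideAt u) Es ≡ 2 * h
    U = +-cancelʳ-≡ 1 _ _ (trans (cong (Σl (b2n ∘ insideAt u) Es +_) (sym one)) (trans (sym (Σl-+ _ _ Es))
      (trans (Σl-cong Es (λ e _ → split e)) (trans (sym (degree-cnt u)) (D.regular u)))))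
      where
      split : ∀ e → b2n (insideAt u e) + b2n (crossing e) ≡ b2n (inc u e)
      split e = by (D.S (lo e)) (D.S (hi e)) (inc u e) refl refl refl
        where
        by : ∀ a b i → D.S (lo e) ≡ a → D.S (hi e) ≡ b → inc u e ≡ i → b2n ((a ∧ b) ∧ i) + b2n (a ∧ not b ∨ not a ∧ b) ≡ b2n i
        by true true i _ _ _ = +-identityʳ _
        by true false true _ _ _ = refl
        by false true true _ _ _ = refl
        by false false false _ _ _ = refl
        by false false true p q r = ⊥-elim (out (⌊⌋-true (incident? u e) r))
          where
          out : Incident D.graph u e → ⊥
          out (inj₁ x) = true≢false Su (trans (cong D.S (sym x)) p)
          out (inj₂ x) = true≢false Su (trans (cong D.S (sym x)) q)
        by true false false p q r = ⊥-elim (true≢false (⌊⌋-intro (incident? u e) (inj₁ (proj₁ (bridge-ends e (cong₂ (λ a b → a ∧ not b ∨ not a ∧ b) p q))))) r)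
        by false true false p q r = ⊥-elim (true≢false (⌊⌋-intro (incident? u e) (inj₁ (proj₁ (bridge-ends e (cong₂ (λ a b → a ∧ not b ∨ not a ∧ b) p q))))) r)
    bound : ∀ ℓ s → s ≤ m D.graph → Good D.graph ℓ s → 2 * (k + 1) * s ≤ k * n
    bound ℓ s s≤m good = ≤-trans (≤-reflexive (lem h s)) (≤-trans (*-monoʳ-≤ 2 (deficient-bound D.graph D.S ℓ s s≤m good u Su h 1≤h
        (trans D.size-S (lem' h)) N U)) (≤-reflexive (sym (handshake D.regular))))
      where
      lem : ∀ h s → 2 * (2 * h + 1 + 1) * s ≡ 2 * (2 * suc h * s)
      lem = solve-∀
      lem' : ∀ h → suc (suc h + suc h) ≡ suc (2 * suc h)
      lem' = solve-∀

even-or-odd : ∀ k → ∃ λ h → k ≡ 2 * h ⊎ k ≡ suc (2 * h)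
even-or-odd zero = 0 , inj₁ refl
even-or-odd (suc k) with even-or-odd k
... | h , inj₁ refl = h , inj₂ refl
... | h , inj₂ refl = suc h , inj₁ (lem h)
  where
  lem : ∀ h → suc (suc (2 * h)) ≡ 2 * suc h
  lem = solve-∀

-- For odd k = 2h + 1 the number n is even, so beside the k + 2 vertices of the first part an odd
-- number 2q + 1 remains; n ≥ 6(k + 1) makes q > h, as the second part requires.
extremal : ∀ k n → 3 ≤ k → 6 * (k + 1) ≤ n → 2 ∣ n * k → Extremal k n
extremal k n 3≤k big (divides c even) = by (even-or-odd k) (even-or-odd n)
  where
  pos : ∀ h → 3 ≤ suc (2 * h) → 1 ≤ h
  pos (suc h) _ = s≤s z≤n
  pos zero (s≤s ())
  by : (∃ λ h → k ≡ 2 * h ⊎ k ≡ suc (2 * h)) → (∃ λ ν → n ≡ 2 * ν ⊎ n ≡ suc (2 * ν)) → Extremal k n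
  by (h , inj₁ refl) _ = subst₂ Extremal (+-identityʳ _) (m+[n∸m]≡n fits) (extremal-even h (n ∸ suc (2 * h)) (pos h (m≤n⇒m≤1+n 3≤k)) room)
    where
    fits : suc (2 * h) ≤ n
    fits = ≤-trans (lin (10 * h + 5) (≤-refl {0}) (lem h)) big
      where
      lem : ∀ h → suc (2 * h) + 0 + (10 * h + 5) ≡ 6 * (2 * h + 1) + 0
      lem = solve-∀
    room : 2 * h < n ∸ suc (2 * h)
    room = +-cancelˡ-≤ (suc (2 * h)) _ _ (≤-trans (≤-trans (lin (8 * h + 4) (≤-refl {0}) (lem h)) big) (≤-reflexive (sym (m+[n∸m]≡n fits))))
      where
      lem : ∀ h → suc (2 * h) + suc (2 * h) + 0 + (8 * h + 4) ≡ 6 * (2 * h + 1) + 0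
      lem = solve-∀
  by (h , inj₂ refl) (ν , inj₂ refl) = ⊥-elim (even≢odd c (2 * ν * h + ν + h) (trans (*-comm 2 c) (trans (sym even) (lem ν h))))
    where
    lem : ∀ ν h → suc (2 * ν) * suc (2 * h) ≡ suc (2 * (2 * ν * h + ν + h))
    lem = solve-∀
  by (h , inj₂ refl) (ν , inj₁ refl) = subst₂ Extremal (+-comm (2 * h) 1) (trans (lem h (ν ∸ (h + 2))) (cong (2 *_) (m+[n∸m]≡n fits)))
      (extremal-odd h (ν ∸ (h + 2)) (pos h 3≤k) (+-cancelˡ-≤ (h + 2) _ _ (≤-trans (lin (4 * h + 3) large (lem₂ h ν)) (≤-reflexive (sym (m+[n∸m]≡n fits))))))
    where
    large : 6 * (h + 1) ≤ ν
    large = *-cancelˡ-≤ 2 (≤-trans (≤-reflexive (lem₃ h)) big)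
      where
      lem₃ : ∀ h → 2 * (6 * (h + 1)) ≡ 6 * (suc (2 * h) + 1)
      lem₃ = solve-∀
    lem : ∀ h q → suc (suc h + suc h) + suc (q + q) ≡ 2 * (h + 2 + q)
    lem = solve-∀
    fits : h + 2 ≤ ν
    fits = lin (5 * h + 4) large (lem₁ h ν)
      where
      lem₁ : ∀ h ν → h + 2 + ν + (5 * h + 4) ≡ ν + 6 * (h + 1)
      lem₁ = solve-∀
    lem₂ : ∀ h ν → h + 2 + suc h + ν + (4 * h + 3) ≡ ν + 6 * (h + 1)
    lem₂ = solve-∀

-- The bound (n - 1)/2

half-bound : ∀ {n k} (G : Graph n) → 1 ≤ n → 2 ≤ k → Regular k G → ∀ ℓ s → s ≤ m G → Good G ℓ s → suc (2 * s) ≤ n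
half-bound {n} {k} G 1≤n 2≤k reg ℓ s s≤m good = ≤∧≢⇒< (subst (_≤ n) (total 0) most) not-perfect
  where
  open Counting G
  instance
    nz : NonZero (m G)
    nz = regular-nonZero G reg (*-mono-≤ (≤-trans (s≤s z≤n) 2≤k) 1≤n)
  open Periodic G ℓ using (edgeAtTime; over; distinct)
  open Periodic.Windows G ℓ s s≤m good
  cover : Fin n → ℕ → ℕ
  cover v x = over (b2n ∘ inc v) x s
  total : ∀ x → Σl (λ v → cover v x) V ≡ 2 * s
  total x = trans (Win-Σl (λ v t → b2n (inc v (edgeAtTime t))) x s V) (trans (Win-cong {g = λ _ → 2} x s (λ i _ → ends-of (edgeAtTime (x + i)))) (Win-const 2 x s))
  cover≤1 : ∀ v x → cover v x ≤ 1
  cover≤1 v x = once (inc v) v x (λ _ h → h)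
  most : Σl (λ v → cover v 0) V ≤ n
  most = ≤-trans (Σl-bound _ 1 V (λ v _ → cover≤1 v 0)) (≤-reflexive (trans (*-identityˡ _) (length-tabulate id)))
  not-perfect : 2 * s ≢ n
  not-perfect e = distinct 0 s 1≤s s<m (same-ends (lo≢hi (edgeAtTime 0)) (inj₁ refl) (inj₂ refl) (moves (inj₁ refl)) (moves (inj₂ refl)))
    where
    1≤s : 1 ≤ s
    1≤s = *-cancelˡ-< 2 0 s (subst (0 <_) (sym e) 1≤n)
    -- From k ≥ 2 follows m ≥ n = 2s > s, so times 0 and s show different edges.
    s<m : s < m G
    s<m = *-cancelˡ-< 2 s (m G) (≤-trans (≤-trans (+-monoˡ-≤ (2 * s) 1≤n) (≤-trans (≤-reflexive (trans (cong (n +_) e) (cong (n +_) (sym (+-identityʳ n))))) (*-monoˡ-≤ n 2≤k)))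
      (≤-reflexive (handshake reg)))
    all-once : ∀ v x → cover v x ≡ 1
    all-once v x = Σl-ones (λ v → cover v x) V (λ v _ → cover≤1 v x) (trans (total x) (trans e (sym (length-tabulate id)))) v (∈-allFin v)
    moves : ∀ {v} → Incident G v (edgeAtTime 0) → Incident G v (edgeAtTime s)
    moves {v} i = ⌊⌋-true (incident? v _) (b2n-pos (≤-reflexive (trans (cong b2n (sym (⌊⌋-intro (incident? v (edgeAtTime 0)) i))) stay)))
      where
      f = b2n ∘ inc v ∘ edgeAtTime
      -- The windows at 0 and at 1 cover v equally often and differ only in the edges at times 0 and
      -- s.
      stay : f 0 ≡ f s
      stay = +-cancelʳ-≡ (Win f 1 s) _ _ (trans (trans (Win-last f 0 s) (cong (_+ f s) (trans (all-once v 0) (sym (all-once v 1))))) (+-comm (Win f 1 s) (f s)))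

-- Opened only here because +_ would make the sections (c +_) of addition on ℕ ambiguous.
open import Data.Integer using (+_)
open import Data.Rational using (ℚ; _⊔_; _-_)

-- Rational bounds and the theorem

toℚᵘ-/ : ∀ p d → Q.toℚᵘ (p Q./ suc d) ℚᵘ.≃ ℚᵘ.mkℚᵘ p d
toℚᵘ-/ p d = Q.toℚᵘ-fromℚᵘ (ℚᵘ.mkℚᵘ p d)

≤-frac : ∀ c p d → c * suc d ≤ p → ℕ→ℚ c Q.≤ frac (+ p) (suc d)
≤-frac c p d h = Q.toℚᵘ-cancel-≤ (ℚᵘ.≤-respˡ-≃ (ℚᵘ.≃-sym (toℚᵘ-/ (+ c) 0)) (ℚᵘ.≤-respʳ-≃ (ℚᵘ.≃-sym (toℚᵘ-/ (+ p) d))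
  (ℚᵘ.*≤* (subst₂ Z._≤_ (Z.pos-* c (suc d)) (trans (cong +_ (sym (*-identityʳ p))) (Z.pos-* p 1)) (Z.+≤+ h)))))

frac-* : ∀ p d n → Q.toℚᵘ (((+ p) Q./ suc d) Q.* ℕ→ℚ n) ℚᵘ.≃ ℚᵘ.mkℚᵘ (+ (p * n)) d
frac-* p d n = ℚᵘ.≃-trans (Q.toℚᵘ-homo-* ((+ p) Q./ suc d) (ℕ→ℚ n)) (ℚᵘ.≃-trans (ℚᵘ.*-cong (toℚᵘ-/ (+ p) d) (toℚᵘ-/ (+ n) 0))
  (ℚᵘ.*≡* (cong₂ Z._*_ (sym (Z.pos-* p n)) (cong +_ (sym (*-identityʳ (suc d)))))))

ℕ→ℚ-+ : ∀ c a → ℕ→ℚ c Q.+ ℕ→ℚ a ≡ ℕ→ℚ (c + a)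
ℕ→ℚ-+ c a = Q.toℚᵘ-injective (ℚᵘ.≃-trans (Q.toℚᵘ-homo-+ (ℕ→ℚ c) (ℕ→ℚ a)) (ℚᵘ.≃-trans (ℚᵘ.+-cong (toℚᵘ-/ (+ c) 0) (toℚᵘ-/ (+ a) 0))
  (ℚᵘ.≃-trans (ℚᵘ.*≡* (cong (Z._* + 1) (cong₂ Z._+_ (Z.*-identityʳ (+ c)) (Z.*-identityʳ (+ a))))) (ℚᵘ.≃-sym (toℚᵘ-/ (+ (c + a)) 0)))))

frac-minus-≤ : ∀ p d n a c → p * n ≤ (c + a) * d → frac (+ p) d Q.* ℕ→ℚ n Q.- ℕ→ℚ a Q.≤ ℕ→ℚ c
frac-minus-≤ p d n a c h = Q.≤-trans (Q.+-monoˡ-≤ (Q.- ℕ→ℚ a) (by d h)) (Q.≤-reflexive (trans (cong (Q._- ℕ→ℚ a) (sym (ℕ→ℚ-+ c a)))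
    (trans (Q.+-assoc (ℕ→ℚ c) (ℕ→ℚ a) (Q.- ℕ→ℚ a)) (trans (cong (ℕ→ℚ c Q.+_) (Q.+-inverseʳ (ℕ→ℚ a))) (Q.+-identityʳ (ℕ→ℚ c))))))
  where
  by : ∀ d → p * n ≤ (c + a) * d → frac (+ p) d Q.* ℕ→ℚ n Q.≤ ℕ→ℚ (c + a)
  -- `frac` has the value 0 at denominator 0.
  by zero _ = subst (Q._≤ ℕ→ℚ (c + a)) (sym (Q.*-zeroˡ (ℕ→ℚ n))) (Q.toℚᵘ-cancel-≤ (ℚᵘ.≤-respʳ-≃ (ℚᵘ.≃-sym (toℚᵘ-/ (+ (c + a)) 0))
    (ℚᵘ.*≤* (subst (+ 0 Z.≤_) (sym (Z.*-identityʳ (+ (c + a)))) (Z.+≤+ z≤n)))))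
  by (suc d) h = Q.toℚᵘ-cancel-≤ (ℚᵘ.≤-respˡ-≃ (ℚᵘ.≃-sym (frac-* p d n)) (ℚᵘ.≤-respʳ-≃ (ℚᵘ.≃-sym (toℚᵘ-/ (+ (c + a)) 0))
    (ℚᵘ.*≤* (subst₂ Z._≤_ (sym (Z.*-identityʳ (+ (p * n)))) (Z.pos-* (c + a) (suc d)) (Z.+≤+ h)))))

-- The witness is a times the denominator of ε; it works because the numerator of a positive ε is at
-- least 1.
constant-sublinear : ∀ a → Sublinear (λ _ → ℕ→ℚ a)
constant-sublinear a (Q.mkℚ (+ zero) b cop) (Q.*<* (Z.+<+ ()))
constant-sublinear a (Q.mkℚ (Z.-[1+ e ]) b cop) (Q.*<* ())
constant-sublinear a ε@(Q.mkℚ (+ suc e) b cop) _ = a * suc b , λ x h → subst (Q._≤ ε Q.* ℕ→ℚ x) (sym (Q.0≤p⇒∣p∣≡p nonneg))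
    (Q.toℚᵘ-cancel-≤ (ℚᵘ.≤-respˡ-≃ (ℚᵘ.≃-sym (toℚᵘ-/ (+ a) 0)) (ℚᵘ.≤-respʳ-≃ (ℚᵘ.≃-sym (ℚᵘ.≃-trans (Q.toℚᵘ-homo-* ε (ℕ→ℚ x)) (ℚᵘ.*-cong (ℚᵘ.≃-refl {ℚᵘ.mkℚᵘ (+ suc e) b}) (toℚᵘ-/ (+ x) 0))))
      (ℚᵘ.*≤* (subst₂ Z._≤_ (trans (cong (λ d → + (a * d)) (sym (*-identityʳ (suc b)))) (Z.pos-* a (suc b * 1))) (trans (cong +_ (sym (*-identityʳ (suc e * x)))) (trans (Z.pos-* (suc e * x) 1) (cong (Z._* + 1) (Z.pos-* (suc e) x))))
        (Z.+≤+ (≤-trans h (m≤m+n x (e * x)))))))))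
  where
  nonneg : ℕ→ℚ 0 Q.≤ ℕ→ℚ a
  nonneg = Q.toℚᵘ-cancel-≤ (ℚᵘ.≤-respʳ-≃ (ℚᵘ.≃-sym (toℚᵘ-/ (+ a) 0)) (ℚᵘ.*≤* (subst (+ 0 Z.≤_) (sym (Z.*-identityʳ (+ a))) (Z.+≤+ z≤n))))

half-≤ : ∀ c n → suc (2 * c) ≤ n → ℕ→ℚ c Q.≤ frac (+ n Z.- + 1) 2
half-≤ c (suc n) (s≤s h) = ≤-frac c n 1 (≤-trans (≤-reflexive (*-comm c 2)) h)

fwd-top : ∀ {n} (G : Graph n) ℓ s t → t ≤ s → Good G ℓ s → Good G ℓ t
fwd-top G ℓ s t h good e e' adj = ≤-trans h (good e e' adj)

-- A good distance above m is vacuous, and is replaced by m.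
cms-lower : ∀ {n} (G : Graph n) → 1 ≤ m G → ∀ c → IsCmsGraph G c → ∀ A B a s → A ≤ B * (s + a) → A ≤ B * (m G + a) →
            Σ (Ordering G) (λ ℓ → Good G ℓ s) → A ≤ B * (c + a)
cms-lower G 1≤m c isc A B a s h hm (ℓ , good) = by (s ≤? m G)
  where
  by : Dec (s ≤ m G) → A ≤ B * (c + a)
  by (yes l) = ≤-trans h (*-monoʳ-≤ B (+-monoˡ-≤ a (cms-≥ G 1≤m c s isc l ℓ good)))
  by (no g)  = ≤-trans hm (*-monoʳ-≤ B (+-monoˡ-≤ a (cms-≥ G 1≤m c (m G) isc ≤-refl ℓ (fwd-top G ℓ s (m G) (≰⇒≥ g) good))))

regular-lower : ∀ {n k} (G : Graph n) → 1 ≤ m G → Regular k G → ∀ c → IsCmsGraph G c → k * n ≤ 3 * suc k * (c + 6)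
regular-lower {n} {k} G 1≤m reg c isc = by (Counting.regular-bound G reg)
  where
  hs = Counting.handshake G reg
  by : (∃ λ s → 2 * m G ≤ suc k * (3 * (s + 6)) × Σ (Ordering G) λ ℓ → Good G ℓ s) → k * n ≤ 3 * suc k * (c + 6)
  by (s , h , o) = cms-lower G 1≤m c isc (k * n) (3 * suc k) 6 s (≤-trans (≤-reflexive hs) (≤-trans h (≤-reflexive (lem k s))))
    (≤-trans (≤-reflexive hs) (≤-trans (≤-trans (*-monoʳ-≤ 2 (m≤m+n (m G) 6)) (*-monoˡ-≤ (m G + 6) (m≤m+n 2 1))) (*-monoˡ-≤ (m G + 6) (*-monoʳ-≤ 3 (s≤s (z≤n {k})))))) o
    where
    lem : ∀ k s → suc k * (3 * (s + 6)) ≡ 3 * suc k * (s + 6)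
    lem = solve-∀

class-one-lower : ∀ {n k} (G : Graph n) → 1 ≤ m G → Regular (suc k) G → Class1 (suc k) G → ∀ c → IsCmsGraph G c → n ≤ 3 * (c + 6)
class-one-lower {n} {k} G 1≤m reg (col , proper) c isc = by (Counting.ClassOne.class-one-bound G reg col proper)
  where
  by : (∃ λ s → n + 9 ≤ 3 * (s + 6) × Σ (Ordering G) λ ℓ → Good G ℓ s) → n ≤ 3 * (c + 6)
  by (s , h , o) = cms-lower G 1≤m c isc n 3 6 s (≤-trans (m≤m+n n 9) h)
    (≤-trans (≤-trans (m≤m+n n (k * n)) (≤-reflexive (Counting.handshake G reg))) (≤-trans (*-monoʳ-≤ 2 (m≤m+n (m G) 6)) (*-monoˡ-≤ (m G + 6) (m≤m+n 2 1)))) o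

cubic-lower : ∀ {n} (G : Graph n) → 1 ≤ m G → Regular 3 G → Class1 3 G → ∀ c → IsCmsGraph G c → 7 * n ≤ 20 * (c + 6)
cubic-lower {n} G 1≤m reg (col , proper) c isc = by (cubic-bound G reg col proper)
  where
  by : (∃ λ s → 7 * n ≤ 20 * (s + 6) × Σ (Ordering G) λ ℓ → Good G ℓ s) → 7 * n ≤ 20 * (c + 6)
  by (s , h , o) = cms-lower G 1≤m c isc (7 * n) 20 6 s h (lin (2 * n + 14 * m G + 120) (≤-reflexive (cong (3 *_) (Counting.handshake G reg))) (lem n (m G))) o
    where
    lem : ∀ n m → 7 * n + 3 * (2 * m) + (2 * n + 14 * m + 120) ≡ 20 * (m + 6) + 3 * (3 * n)
    lem = solve-∀

∸-eq : ∀ {x y} z → x ≡ y + z → x ∸ z ≡ y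
∸-eq z refl = m+n∸n≡m _ z

-- 3 (5 k - 3) ≤ 4 (4 k - 3), with k = j + 3; the class 1 constants arise in the same way from k = j + 4.
weigh : ∀ j X Y → X ≤ 3 * Y → (5 * j + 12) * X ≤ Y * (4 * (4 * j + 9))
weigh j X Y h = ≤-trans (*-monoʳ-≤ (5 * j + 12) h) (lin (j * Y) (≤-refl {0}) (lem j Y))
  where
  lem : ∀ j Y → (5 * j + 12) * (3 * Y) + 0 + j * Y ≡ Y * (4 * (4 * j + 9)) + 0
  lem = solve-∀

module _ (k n c : ℕ) where

  regular-first : 3 ≤ k → k * n ≤ 3 * suc k * (c + 6) → k * (5 * k ∸ 3) * n ≤ (c + 6) * (4 * (k + 1) * (4 * k ∸ 3))
  regular-first 3≤k h = subst (λ k → k * n ≤ 3 * suc k * (c + 6) → k * (5 * k ∸ 3) * n ≤ (c + 6) * (4 * (k + 1) * (4 * k ∸ 3))) (m∸n+n≡m 3≤k) (by (k ∸ 3)) h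
    where
    by : ∀ j → (j + 3) * n ≤ 3 * suc (j + 3) * (c + 6) → (j + 3) * (5 * (j + 3) ∸ 3) * n ≤ (c + 6) * (4 * (j + 3 + 1) * (4 * (j + 3) ∸ 3))
    by j h = subst₂ (λ a b → (j + 3) * a * n ≤ (c + 6) * (4 * (j + 3 + 1) * b)) (sym (∸-eq {5 * (j + 3)} {5 * j + 12} 3 (l₁ j))) (sym (∸-eq {4 * (j + 3)} {4 * j + 9} 3 (l₂ j)))
      (≤-trans (≤-reflexive (l₃ j n)) (≤-trans (weigh j ((j + 3) * n) (suc (j + 3) * (c + 6)) (≤-trans h (≤-reflexive (*-assoc 3 (suc (j + 3)) (c + 6))))) (≤-reflexive (l₄ j c))))
      where
      l₁ : ∀ j → 5 * (j + 3) ≡ 5 * j + 12 + 3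
      l₁ = solve-∀
      l₂ : ∀ j → 4 * (j + 3) ≡ 4 * j + 9 + 3
      l₂ = solve-∀
      l₃ : ∀ j n → (j + 3) * (5 * j + 12) * n ≡ (5 * j + 12) * ((j + 3) * n)
      l₃ = solve-∀
      l₄ : ∀ j c → suc (j + 3) * (c + 6) * (4 * (4 * j + 9)) ≡ (c + 6) * (4 * (j + 3 + 1) * (4 * j + 9))
      l₄ = solve-∀

  regular-second : k * n ≤ 3 * suc k * (c + 6) → 31 * k * n ≤ (c + 6) * (98 * (k + 1))
  regular-second h = lin (5 * (k + 1) * (c + 6)) (*-monoʳ-≤ 31 h) (lem k n c)
    where
    lem : ∀ k n c → 31 * k * n + 31 * (3 * suc k * (c + 6)) + 5 * (k + 1) * (c + 6) ≡ (c + 6) * (98 * (k + 1)) + 31 * (k * n)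
    lem = solve-∀

  class-one-first : 4 ≤ k → n ≤ 3 * (c + 6) → (5 * k ∸ 8) * n ≤ (c + 6) * (4 * (4 * k ∸ 7))
  class-one-first 4≤k h = subst (λ k → (5 * k ∸ 8) * n ≤ (c + 6) * (4 * (4 * k ∸ 7))) (m∸n+n≡m 4≤k) (by (k ∸ 4))
    where
    by : ∀ j → (5 * (j + 4) ∸ 8) * n ≤ (c + 6) * (4 * (4 * (j + 4) ∸ 7))
    by j = subst₂ (λ a b → a * n ≤ (c + 6) * (4 * b)) (sym (∸-eq {5 * (j + 4)} {5 * j + 12} 8 (l₁ j))) (sym (∸-eq {4 * (j + 4)} {4 * j + 9} 7 (l₂ j))) (weigh j n (c + 6) h)
      where
      l₁ : ∀ j → 5 * (j + 4) ≡ 5 * j + 12 + 8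
      l₁ = solve-∀
      l₂ : ∀ j → 4 * (j + 4) ≡ 4 * j + 9 + 7
      l₂ = solve-∀

  class-one-second : n ≤ 3 * (c + 6) → 31 * n ≤ (c + 6) * 98
  class-one-second h = lin (5 * (c + 6)) (*-monoʳ-≤ 31 h) (lem n c)
    where
    lem : ∀ n c → 31 * n + 31 * (3 * (c + 6)) + 5 * (c + 6) ≡ (c + 6) * 98 + 31 * n
    lem = solve-∀

  cubic-second : 7 * n ≤ 20 * (c + 6) → 31 * n ≤ (c + 6) * 98
  cubic-second h = *-cancelˡ-≤ 7 (lin (66 * (c + 6)) (*-monoʳ-≤ 31 h) (lem n c))
    where
    lem : ∀ n c → 7 * (31 * n) + 31 * (20 * (c + 6)) + 66 * (c + 6) ≡ 7 * ((c + 6) * 98) + 31 * (7 * n)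
    lem = solve-∀

-- At k = 3 the first fraction is 7/20, exactly the constant of `cubic-bound`, and it exceeds 31/98;
-- from k = 4 on the two-thirds bound covers both.
class-one-lowers : ∀ {n k} (G : Graph n) → 3 ≤ k → 1 ≤ m G → Regular k G → Class1 k G → ∀ c → IsCmsGraph G c →
                   (5 * k ∸ 8) * n ≤ (c + 6) * (4 * (4 * k ∸ 7)) × 31 * n ≤ (c + 6) * 98
class-one-lowers {n} {suc k} G 3≤k 1≤m reg cl c isc = by (m≤n⇒m<n∨m≡n 3≤k)
  where
  by : 4 ≤ suc k ⊎ 3 ≡ suc k → (5 * suc k ∸ 8) * n ≤ (c + 6) * (4 * (4 * suc k ∸ 7)) × 31 * n ≤ (c + 6) * 98
  by (inj₁ l) = class-one-first (suc k) n c l low , class-one-second (suc k) n c low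
    where
    low = class-one-lower G 1≤m reg cl c isc
  by (inj₂ refl) = ≤-trans low (≤-reflexive (*-comm 20 (c + 6))) , cubic-second 3 n c low
    where
    low = cubic-lower G 1≤m reg cl c isc

attained-good : ∀ {n} (G : Graph n) c → IsCmsGraph G c → Σ (Ordering G) λ ℓ → c ≤ m G × Good G ℓ c
attained-good G c ((ℓ , _ , c≤m , good , _) , _) = ℓ , c≤m , good

regular-size : ∀ {n k} (G : Graph n) → Regular k G → 1 ≤ k * n → 1 ≤ m G
regular-size G reg h = >-nonZero⁻¹ _ {{regular-nonZero G reg h}}

cms-nk : ∀ k n → 3 ≤ k → 6 * (k + 1) ≤ n → 2 ∣ n * k →
         ∃ λ c → IsCmsNK n k c × k * n ≤ 3 * suc k * (c + 6) × 2 * (k + 1) * c ≤ k * n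
cms-nk k n 3≤k big even = by (extremal k n 3≤k big even)
  where
  pos : 1 ≤ k * n
  pos = *-mono-≤ {1} {k} {1} {n} (≤-trans (s≤s z≤n) 3≤k) (≤-trans (≤-trans (m≤n+m 1 k) (m≤m+n (k + 1) _)) big)
  by : Extremal k n → ∃ λ c → IsCmsNK n k c × k * n ≤ 3 * suc k * (c + 6) × 2 * (k + 1) * c ≤ k * n
  by (G₀ , reg₀ , upper) = go (Search.exists n k (m G₀) (regular-size G₀ reg₀ pos)
      (λ G reg → *-cancelˡ-≡ _ _ 2 (trans (sym (Counting.handshake G reg)) (Counting.handshake G₀ reg₀))) G₀ reg₀)
    where
    go : ∃ (IsCmsNK n k) → ∃ λ c → IsCmsNK n k c × k * n ≤ 3 * suc k * (c + 6) × 2 * (k + 1) * c ≤ k * n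
    go (c , q@((G , reg , isc) , least)) = c , q , regular-lower G (regular-size G reg pos) reg c isc , below (CmsOf.cms G₀ (regular-size G₀ reg₀ pos))
      where
      below : ∃ (IsCmsGraph G₀) → 2 * (k + 1) * c ≤ k * n
      below (c₀ , isc₀) = at-c₀ (attained-good G₀ c₀ isc₀)
        where
        at-c₀ : (Σ (Ordering G₀) λ ℓ → c₀ ≤ m G₀ × Good G₀ ℓ c₀) → 2 * (k + 1) * c ≤ k * n
        at-c₀ (ℓ , c₀≤m , good) = ≤-trans (*-monoʳ-≤ (2 * (k + 1)) (least G₀ c₀ reg₀ isc₀)) (upper ℓ c₀ c₀≤m good)

theorem1p1 : ∀ (k : ℕ) → 3 ≤ k →
    Σ (ℕ → ℚ) λ f → Sublinear f ×
    (∀ (n : ℕ) → 6 * (k + 1) ≤ n → 2 ∣ n * k →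
    (∃ λ c → IsCmsNK n k c
    × ((frac (+ (k * (5 * k ∸ 3))) (4 * (k + 1) * (4 * k ∸ 3)) Q.* ℕ→ℚ n - ℕ→ℚ 6)
    ⊔ (frac (+ (31 * k)) (98 * (k + 1)) Q.* ℕ→ℚ n - f n)) Q.≤ ℕ→ℚ c
    × ℕ→ℚ c Q.≤ frac (+ (k * n)) (2 * (k + 1)))
    × (∀ c → IsCms1NK n k c →
    ((frac (+ (5 * k ∸ 8)) (4 * (4 * k ∸ 7)) Q.* ℕ→ℚ n - ℕ→ℚ 6)
    ⊔ (frac (+ 31) 98 Q.* ℕ→ℚ n - f n)) Q.≤ ℕ→ℚ c
    × ℕ→ℚ c Q.≤ frac (+ n Z.- + 1) 2))
theorem1p1 k 3≤k = (λ _ → ℕ→ℚ 6) , constant-sublinear 6 , λ n big even → general n (cms-nk k n 3≤k big even) , class-one n big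
  where
  general : ∀ n → (∃ λ c → IsCmsNK n k c × k * n ≤ 3 * suc k * (c + 6) × 2 * (k + 1) * c ≤ k * n) →
    ∃ λ c → IsCmsNK n k c
    × ((frac (+ (k * (5 * k ∸ 3))) (4 * (k + 1) * (4 * k ∸ 3)) Q.* ℕ→ℚ n - ℕ→ℚ 6)
    ⊔ (frac (+ (31 * k)) (98 * (k + 1)) Q.* ℕ→ℚ n - ℕ→ℚ 6)) Q.≤ ℕ→ℚ c
    × ℕ→ℚ c Q.≤ frac (+ (k * n)) (2 * (k + 1))
  general n (c , isc , low , up) = c , isc ,
    Q.⊔-lub (frac-minus-≤ (k * (5 * k ∸ 3)) (4 * (k + 1) * (4 * k ∸ 3)) n 6 c (regular-first k n c 3≤k low))
            (frac-minus-≤ (31 * k) (98 * (k + 1)) n 6 c (regular-second k n c low)) ,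
    ≤-frac′ (2 * (k + 1)) (*-monoʳ-< 2 (m≤n+m 1 k)) (≤-trans (≤-reflexive (*-comm c _)) up)
    where
    ≤-frac′ : ∀ d → 0 < d → c * d ≤ k * n → ℕ→ℚ c Q.≤ frac (+ (k * n)) d
    ≤-frac′ (suc d) _ h = ≤-frac c (k * n) d h
  class-one : ∀ n → 6 * (k + 1) ≤ n → ∀ c → IsCms1NK n k c →
    ((frac (+ (5 * k ∸ 8)) (4 * (4 * k ∸ 7)) Q.* ℕ→ℚ n - ℕ→ℚ 6)
    ⊔ (frac (+ 31) 98 Q.* ℕ→ℚ n - ℕ→ℚ 6)) Q.≤ ℕ→ℚ c
    × ℕ→ℚ c Q.≤ frac (+ n Z.- + 1) 2
  class-one n big c ((G , reg , cl , isc) , _) =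
    Q.⊔-lub (frac-minus-≤ (5 * k ∸ 8) (4 * (4 * k ∸ 7)) n 6 c (proj₁ lows)) (frac-minus-≤ 31 98 n 6 c (proj₂ lows)) , half-≤ c n upper
    where
    1≤n : 1 ≤ n
    1≤n = ≤-trans (≤-trans (m≤n+m 1 k) (m≤m+n (k + 1) _)) big
    lows = class-one-lowers G 3≤k (regular-size G reg (*-mono-≤ {1} {k} {1} {n} (≤-trans (s≤s z≤n) 3≤k) 1≤n)) reg cl c isc
    upper : suc (2 * c) ≤ n
    upper = half-bound G 1≤n (≤-trans (n≤1+n 2) 3≤k) reg (proj₁ (attained-good G c isc)) c (proj₁ (proj₂ (attained-good G c isc))) (proj₂ (proj₂ (attained-good G c isc)))
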